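{- Let $p$ be a prime, let $m$ be a positive integer with $\gcd(p,m)=1$, let $k$ be a nonnegative integer, and let $n=p^km$. Then, reducing coefficients modulo $p$: (i) If $m=1$ (and $k\ge1$), then $\Psi_n(x)\equiv\left(x^2+4\right)^{\varphi(p^k)/2}$ in $\mathbb{Z}_p[x]$. (ii) If $m=2$, then $\Psi_n(x)\equiv x^{\varphi(p^k)}$ in $\mathbb{Z}_p[x]$. (iii) If $m\geq3$ and $p>2$, let $u$ be the multiplicative order of $p$ modulo $2m$ and define $\delta=u/2$ if ($p\equiv1\pmod 4$, $u$ even, and $p^{u/2}\equiv-1\pmod{2m}$) or ($p\equiv 3\pmod 4$, $u\equiv0\pmod 4$, and $p^{u/2}\equiv-1\pmod{2m}$) or ($p\equiv3\pmod4$, $u\equiv2\pmod4$, and $p^{u/2}\equiv m\pm1\pmod{2m}$); $\delta=2u$ if $p\equiv3\pmod4$ and $u$ is odd; and $\delta=u$ in all other cases. Then $\Psi_n(x)$ factors in $\mathbb{Z}_p[x]$ as a product of $\varphi(m)/\delta$ distinct irreducible monic polynomials of degree $\delta$, each raised to the $\varphi(p^k)$-th power. (iv) If $m\geq3$ and $p=2$, let $u'$ be the multiplicative order of $2$ modulo $m$ and define $\delta=u'/2$ if $u'$ is even and $2^{u'/2}\equiv-1\pmod m$, and $\delta=u'$ otherwise. Then $\Psi_n(x)$ factors in $\mathbb{Z}_2[x]$ as a product of $\varphi(m)/(2\delta)$ distinct irreducible monic polynomials of degree $\delta$, each raised to the $2\varphi(2^k)$-th power.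
   Context: $\mathbb{Z}_p$ denotes the field with $p$ elements and $\varphi$ is Euler's totient function. The Fibonacci polynomials are defined by $F_1(x)=1$, $F_2(x)=x$, and $F_n(x)=xF_{n-1}(x)+F_{n-2}(x)$ for $n\geq 3$. For $n\geq 2$, the $n$-th fibotomic polynomial $\Psi_n(x)\in\mathbb{Z}[x]$ is the product of the monic irreducible factors (in $\mathbb{Z}[x]$) of $F_n(x)$ which are not factors of $F_k(x)$ for any $k<n$; $\Psi_1(x)=1$. The quantity $\delta$ in (iii) (resp. (iv)) equals the degree over $\mathbb{Z}_p$ of the minimal polynomial of $\zeta_4(\zeta_{2m}^s+\zeta_{2m}^{ -s})$ (resp. $\zeta_m^s+\zeta_m^{ -s}$), $\gcd(s,m)=1$, where $\zeta_j$ denotes a root of the $j$-th cyclotomic polynomial in an algebraic closure of $\mathbb{Z}_p$.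
   Formalization: In (i) with p=2, k=1 the exponent φ(2)/2=1/2 is not an integer; the formula is stated for p odd or k≥2, and in the remaining case Ψ_2(x)≡x is stated instead, the square root of x^2+4 in Z_2[x]. -}

module Defs where

open import Level using (Level; _⊔_)
open import Algebra.Bundles.Raw using (RawRing)
open import Data.Bool using (Bool; true; false; if_then_else_; _∧_; _∨_; not)
open import Data.Nat as ℕ using (ℕ; zero; suc; _≤_; _<_; _≡ᵇ_)
open import Data.Nat.DivMod using (_/_; _%_)
open import Data.Nat.Coprimality using (coprime?)
open import Data.Integer as ℤ using (ℤ; +_)
import Data.Integer.Divisibility as ℤD
open import Data.List using (List; []; _∷_; length; filter; map; foldr)
open import Data.List.Base using (upTo)
open import Data.List.Relation.Unary.All using (All)
open import Data.Product using (Σ; ∃; _×_)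
open import Data.Sum using (_⊎_)
open import Data.Empty.Polymorphic using (⊥)
open import Data.Unit.Polymorphic using (⊤)
open import Relation.Nullary using (¬_)
open import Relation.Binary.PropositionalEquality using (_≡_)

-- Univariate polynomials over a raw ring, as coefficient lists
-- (constant term first).  Equality is coefficientwise w.r.t. the
-- ring's _≈_, treating missing coefficients as 0#.

module Poly {c ℓ : Level} (R : RawRing c ℓ) where
  open RawRing R

  Pol : Set c
  Pol = List Carrier

  coeff : Pol → ℕ → Carrier
  coeff []       _       = 0#
  coeff (a ∷ f)  zero    = a
  coeff (a ∷ f)  (suc i) = coeff f i

  infix 4 _≈P_
  _≈P_ : Pol → Pol → Set ℓ
  f ≈P g = ∀ i → coeff f i ≈ coeff g i

  infixl 6 _+P_
  _+P_ : Pol → Pol → Pol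
  []      +P g       = g
  (a ∷ f) +P []      = a ∷ f
  (a ∷ f) +P (b ∷ g) = (a + b) ∷ (f +P g)

  infixl 7 _*P_
  _*P_ : Pol → Pol → Pol
  []      *P g = []
  (a ∷ f) *P g = map (a *_) g +P (0# ∷ (f *P g))

  oneP : Pol
  oneP = 1# ∷ []

  X : Pol
  X = 0# ∷ 1# ∷ []

  infixr 8 _^P_
  _^P_ : Pol → ℕ → Pol
  f ^P zero  = oneP
  f ^P suc n = f *P (f ^P n)

  prodP : List Pol → Pol
  prodP = foldr _*P_ oneP

  _∣P_ : Pol → Pol → Set (c ⊔ ℓ)
  g ∣P f = Σ Pol λ h → f ≈P g *P h

  IsUnit : Pol → Set (c ⊔ ℓ)
  IsUnit f = Σ Pol λ v → f *P v ≈P oneP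

  HasDegree : Pol → ℕ → Set ℓ
  HasDegree f d = (¬ (coeff f d ≈ 0#)) × (∀ i → d < i → coeff f i ≈ 0#)

  Monic : Pol → Set ℓ
  Monic f = Σ ℕ λ d → (coeff f d ≈ 1#) × (∀ i → d < i → coeff f i ≈ 0#)

  infix 4 _∈P_
  _∈P_ : Pol → List Pol → Set ℓ
  g ∈P []      = ⊥
  g ∈P (h ∷ L) = g ≈P h ⊎ g ∈P L

  DistinctP : List Pol → Set (c ⊔ ℓ)
  DistinctP []      = ⊤
  DistinctP (h ∷ L) = (∀ g → g ∈P L → ¬ (h ≈P g)) × DistinctP L

  Irreducible : Pol → Set (c ⊔ ℓ)
  Irreducible g = (¬ (g ≈P [])) × (¬ IsUnit g)
                × (∀ a b → g ≈P a *P b → IsUnit a ⊎ IsUnit b)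

-- The coefficient rings: ℤ, and ℤ_p realised as ℤ with equality
-- "congruent modulo p" (so reduction mod p is the identity on lists).

ℤring : RawRing _ _
ℤring = record
  { Carrier = ℤ ; _≈_ = _≡_ ; _+_ = ℤ._+_ ; _*_ = ℤ._*_ ; -_ = ℤ.-_
  ; 0# = + 0 ; 1# = + 1 }

ℤmod : ℕ → RawRing _ _
ℤmod p = record
  { Carrier = ℤ ; _≈_ = λ a b → (+ p) ℤD.∣ (a ℤ.- b)
  ; _+_ = ℤ._+_ ; _*_ = ℤ._*_ ; -_ = ℤ.-_ ; 0# = + 0 ; 1# = + 1 }

module PZ = Poly ℤring
module PZp (p : ℕ) = Poly (ℤmod p)

ZPol : Set
ZPol = List ℤ

Fib : ℕ → ZPol
Fib zero          = []
Fib (suc zero)    = + 1 ∷ []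
Fib (suc (suc n)) = PZ._+P_ (PZ._*P_ PZ.X (Fib (suc n))) (Fib n)

IsFibotomic : ℕ → ZPol → Set
IsFibotomic n Ψ =
  Σ (List ZPol) λ L →
      (∀ g → (PZ._∈P_ g L) → PZ.Monic g × PZ.Irreducible g × PZ._∣P_ g (Fib n)
                           × (∀ k → 1 ≤ k → k < n → ¬ PZ._∣P_ g (Fib k)))
    × (∀ g → PZ.Monic g → PZ.Irreducible g → PZ._∣P_ g (Fib n)
                         → (∀ k → 1 ≤ k → k < n → ¬ PZ._∣P_ g (Fib k)) → PZ._∈P_ g L)
    × PZ.DistinctP L
    × PZ._≈P_ Ψ (PZ.prodP L)

φ : ℕ → ℕ
φ n = length (filter (λ j → coprime? j n) (map suc (upTo n)))

-- total remainder (x mod 0 := x; never used with 0 below)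
_mod_ : ℕ → ℕ → ℕ
x mod zero  = x
x mod suc y = x % suc y

-- total natural-number division (x / 0 := 0; never used with 0 below)
_div_ : ℕ → ℕ → ℕ
x div zero    = 0
x div suc y   = x / suc y

IsOrder : ℕ → ℕ → ℕ → Set
IsOrder a N u = 1 ≤ u × (a ℕ.^ u) mod N ≡ 1 mod N
              × (∀ v → 1 ≤ v → v < u → ¬ ((a ℕ.^ v) mod N ≡ 1 mod N))

-- δ of part (iii): p odd prime, m ≥ 3, u = order of p modulo 2m
δ-iii : ℕ → ℕ → ℕ → ℕ
δ-iii p m u =
  if (p % 4 ≡ᵇ 1) ∧ (u % 2 ≡ᵇ 0) ∧ (r ≡ᵇ M ℕ.∸ 1)
   ∨ (p % 4 ≡ᵇ 3) ∧ (u % 4 ≡ᵇ 0) ∧ (r ≡ᵇ M ℕ.∸ 1)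
   ∨ (p % 4 ≡ᵇ 3) ∧ (u % 4 ≡ᵇ 2) ∧ ((r ≡ᵇ m ℕ.+ 1) ∨ (r ≡ᵇ m ℕ.∸ 1))
  then u / 2
  else (if (p % 4 ≡ᵇ 3) ∧ (u % 2 ≡ᵇ 1) then 2 ℕ.* u else u)
  where
    M = 2 ℕ.* m
    -- residue of p^(u/2) modulo 2m (only consulted when u is even)
    r = (p ℕ.^ (u / 2)) mod M

-- δ of part (iv): m ≥ 3 odd, u' = order of 2 modulo m
δ-iv : ℕ → ℕ → ℕ
δ-iv m u' =
  if (u' % 2 ≡ᵇ 0) ∧ ((2 ℕ.^ (u' / 2)) mod m ≡ᵇ m ℕ.∸ 1)
  then u' / 2 else u'

FactorsModAs : (p : ℕ) → ZPol → (c d e : ℕ) → Set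
FactorsModAs p Ψ c d e =
  Σ (List ZPol) λ L →
      length L ≡ c
    × All (λ g → Monic g × Irreducible g × HasDegree g d) L
    × DistinctP L
    × Ψ ≈P prodP (map (λ g → g ^P e) L)
  where open PZp p

{-# OPTIONS --safe #-}
-- Over ℤ the Fibonacci polynomials factor as F_n = ∏_{d ∣ n} P_d with P_d monic, since F_n and F_d generate F_(gcd n d)
-- and F_n / F_d is congruent to n/d times a unit modulo F_d.  F_n is squarefree because (x²+4) F_n' = n L_n - x F_n and
-- L_n² = (x²+4) F_n² ± 4, hence Ψ_n = P_n.  In characteristic p, F_(pn) = F_p F_n^p, and Möbius inversion over the divisors
-- of m yields P_(p^k m) = P_m^φ(p^k) for m ≥ 2 and P_(p^k) = F_p^(p^(k-1)).
--
-- Let g be an irreducible factor of P_m modulo p.  Then g ∣ F_j if and only if m ∣ j, and the degree of g is the least d ≥ 1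
-- with x^q ≡ x modulo g, where q = p^d.  Since x^q = L_q modulo p, no extension field is needed to find this d: for odd p
-- and q = 2a + 1, the polynomial L_q - x is (x²+4) F_a F_(a+1) or L_a L_(a+1) according to the parity of a, and for p = 2
-- one has F_(q-1) F_(q+1) = (x^(q-1) - 1)².  So x^q ≡ x becomes a congruence condition on q modulo 2m (or m), whose least
-- solution d is δ.  The multiplicity of g in P_m is 1 for odd p, and 2 for p = 2 because F_(2c+1) = (F_c + F_(c+1))².

module Submission where

open import Defs
open import Level using (0ℓ)
open import Algebra.Bundles using (CommutativeRing; CommutativeMonoid)
open import Algebra.Bundles.Raw using (RawRing)
import Algebra.Properties.CommutativeSemigroup
import Algebra.Properties.CommutativeSemiring.Binomial
import Algebra.Properties.CommutativeSemiring.Exp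
import Algebra.Properties.Ring
import Algebra.Properties.Semiring.Exp
import Algebra.Properties.Semiring.Mult
import Algebra.Properties.Semiring.Sum
import Algebra.Solver.Ring
open import Algebra.Solver.Ring.AlmostCommutativeRing using (fromCommutativeRing; _-Raw-AlmostCommutative⟶_; Induced-equivalence)
open import Data.Bool using (Bool; true; false; if_then_else_; _∧_; _∨_)
open import Data.Empty using (⊥; ⊥-elim)
open import Data.Fin as Fin using (Fin)
import Data.Fin.Properties as Finₚ
open import Data.Integer as ℤ using (ℤ; +_; -[1+_])
import Data.Integer.Divisibility as ℤ∣
import Data.Integer.DivMod as ℤ÷
import Data.Integer.Properties as ℤₚ
open import Data.List as List using (List; []; _∷_; map; length)
import Data.List.Properties as Listₚ
open import Data.List.Relation.Unary.All as All using (All; []; _∷_)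
open import Data.Maybe using (just; nothing)
open import Data.Nat as ℕ using (ℕ; zero; suc; _≤_; _<_; z≤n; s≤s)
open import Data.Nat.Combinatorics using (nCn≡1; nC1≡n; nCk+nC[k+1]≡[n+1]C[k+1]) renaming (_C_ to _choose_)
open import Data.Nat.Combinatorics.Specification using (k>n⇒nCk≡0)
open import Data.Nat.Coprimality using (Coprime; coprime?; coprime-Bézout; coprime-divisor; gcd≡1⇒coprime; coprime⇒gcd≡1)
open import Data.Nat.Divisibility as ℕ∣ using () renaming (_∣_ to _∣ℕ_)
open import Data.Nat.DivMod using (_%_; _/_; m≡m%n+[m/n]*n; m%n<n; m<n⇒m%n≡m; [m+kn]%n≡m%n; m<n*o⇒m/o<n; m*n/n≡m)
open import Data.Nat.GCD as GCD using (gcd; gcd-GCD; module Bézout; gcd[m,n]∣m; gcd[m,n]∣n)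
import Data.Nat.ListAction
open import Data.Nat.Primality using (Prime; euclidsLemma; prime⇒nonTrivial; prime⇒nonZero; prime⇒irreducible)
open import Data.Nat.Primality.Factorisation using (factorise; PrimeFactorisation)
import Data.Nat.Properties as ℕₚ
import Data.Nat.Solver
open import Data.Product using (Σ; _×_; _,_; proj₁; proj₂)
open import Data.Sum using (_⊎_; inj₁; inj₂)
open import Relation.Binary.Definitions using (WeaklyDecidable; tri<; tri≈; tri>)
open import Relation.Binary.PropositionalEquality as ≡ using (_≡_; _≢_)
import Relation.Binary.Reasoning.Setoid
open import Relation.Nullary using (¬_; Dec; yes; no)

-- Commutative rings

-- Over ℤ a primitive part and a Fibonacci polynomial that are coprime over ℚ need not generate the
-- unit ideal, only an ideal containing a positive integer. Divisors are therefore kept monic: a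
-- nonzero constant can be cancelled from a divisibility by a monic polynomial, and modulo p the
-- integer stays nonzero because it divides an index prime to p. Binet's formulas need the roots α,
-- β of t² - x t - 1, adjoined formally to the polynomial ring. As α - β need not be invertible, the
-- identities are multiplied by (α - β)² = x² + 4, which lies in the base ring and is monic, hence
-- cancels after the return. Irreducible factors over ℤ are never computed. Their existence is
-- proved doubly negated, which suffices because it only serves to refute a nonconstant cofactor;
-- modulo p a finite search produces them. The degree of g is found by counting roots in the domain
-- of polynomials modulo g: the powers x^(p^i) with i below the least exponent d are distinct roots
-- of g, while every residue class is a root of Y^q - Y for q = p^d.

module RingKit (C : CommutativeRing 0ℓ 0ℓ) where
  open CommutativeRing C public
  open Algebra.Properties.Ring ring public
  open Algebra.Properties.Semiring.Exp semiring public
  open import Relation.Binary.Reasoning.Setoid setoid public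

  -- The separate clause for 1 makes `ν 1` reduce to `1#`, so that the numeral `con (+ 1)` of the
  -- ring solver denotes `1#` itself.
  ν : ℕ → Carrier
  ν zero          = 0#
  ν (suc zero)    = 1#
  ν (suc (suc n)) = 1# + ν (suc n)

  ν-suc : ∀ n → ν (suc n) ≈ 1# + ν n
  ν-suc zero    = sym (+-identityʳ 1#)
  ν-suc (suc n) = refl

  Characteristic : ℕ → Set
  Characteristic n = ν n ≈ 0#

  -- States that `α` and `β` are the two roots of t² - x t - 1, the characteristic polynomial of the
  -- Fibonacci recurrence.
  QuadraticRoots : Carrier → Carrier → Carrier → Set
  QuadraticRoots x α β = (α + β ≈ x) × (α * β ≈ - 1#)

  NoZeroDivisors : Set
  NoZeroDivisors = ∀ a b → a * b ≈ 0# → (a ≈ 0#) ⊎ (b ≈ 0#)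

  -- The canonical homomorphism from ℤ; through it the solver handles integer numerals in every
  -- commutative ring.
  ι : ℤ → Carrier
  ι (+ n)    = ν n
  ι -[1+ n ] = - ν (suc n)

  ν-+ : ∀ m n → ν (m ℕ.+ n) ≈ ν m + ν n
  ν-+ zero    n = sym (+-identityˡ _)
  ν-+ (suc m) n = begin
    ν (suc (m ℕ.+ n)) ≈⟨ ν-suc (m ℕ.+ n) ⟩
    1# + ν (m ℕ.+ n) ≈⟨ +-congˡ (ν-+ m n) ⟩
    1# + (ν m + ν n) ≈⟨ +-assoc _ _ _ ⟨
    (1# + ν m) + ν n ≈⟨ +-congʳ (ν-suc m) ⟨
    ν (suc m) + ν n ∎

  ν-* : ∀ m n → ν (m ℕ.* n) ≈ ν m * ν n
  ν-* zero    n = sym (zeroˡ _)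
  ν-* (suc m) n = begin
    ν (n ℕ.+ m ℕ.* n) ≈⟨ ν-+ n (m ℕ.* n) ⟩
    ν n + ν (m ℕ.* n) ≈⟨ +-cong (sym (*-identityˡ _)) (ν-* m n) ⟩
    1# * ν n + ν m * ν n ≈⟨ distribʳ _ _ _ ⟨
    (1# + ν m) * ν n ≈⟨ *-congʳ (ν-suc m) ⟨
    ν (suc m) * ν n ∎

  private
    cancel-suc : ∀ a b → (1# + a) - (1# + b) ≈ a - b
    cancel-suc a b = begin
      (1# + a) + - (1# + b) ≈⟨ +-congˡ (-‿+-comm 1# b) ⟨
      (1# + a) + (- 1# + - b) ≈⟨ +-congʳ (+-comm 1# a) ⟩
      (a + 1#) + (- 1# + - b) ≈⟨ +-assoc a 1# _ ⟩
      a + (1# + (- 1# + - b)) ≈⟨ +-congˡ (+-assoc 1# (- 1#) (- b)) ⟨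
      a + ((1# + - 1#) + - b) ≈⟨ +-congˡ (+-congʳ (-‿inverseʳ 1#)) ⟩
      a + (0# + - b) ≈⟨ +-congˡ (+-identityˡ _) ⟩
      a - b ∎

  ι-⊖ : ∀ m n → ι (m ℤ.⊖ n) ≈ ν m - ν n
  ι-⊖ zero    zero    = sym (-‿inverseʳ 0#)
  ι-⊖ zero    (suc n) = sym (+-identityˡ _)
  ι-⊖ (suc m) zero    = begin
    ν (suc m) ≈⟨ +-identityʳ _ ⟨
    ν (suc m) + 0# ≈⟨ +-congˡ -0#≈0# ⟨
    ν (suc m) - 0# ∎
  ι-⊖ (suc m) (suc n) = begin
    ι (suc m ℤ.⊖ suc n) ≡⟨ ≡.cong ι (ℤₚ.[1+m]⊖[1+n]≡m⊖n m n) ⟩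
    ι (m ℤ.⊖ n) ≈⟨ ι-⊖ m n ⟩
    ν m - ν n ≈⟨ cancel-suc _ _ ⟨
    (1# + ν m) - (1# + ν n) ≈⟨ +-cong (ν-suc m) (-‿cong (ν-suc n)) ⟨
    ν (suc m) - ν (suc n) ∎

  ι-neg : ∀ a → ι (ℤ.- a) ≈ - ι a
  ι-neg (+ zero)  = sym -0#≈0#
  ι-neg (+ suc n) = refl
  ι-neg -[1+ n ]  = sym (-‿involutive _)

  ι-+ : ∀ a b → ι (a ℤ.+ b) ≈ ι a + ι b
  ι-+ (+ m)    (+ n)    = ν-+ m n
  ι-+ (+ m)    -[1+ n ] = ι-⊖ m (suc n)
  ι-+ -[1+ m ] (+ n)    = trans (ι-⊖ n (suc m)) (+-comm _ _)
  ι-+ -[1+ m ] -[1+ n ] = begin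
    - ν (suc (suc (m ℕ.+ n))) ≡⟨ ≡.cong (λ k → - ν (suc k)) (ℕₚ.+-suc m n) ⟨
    - ν (suc m ℕ.+ suc n) ≈⟨ -‿cong (ν-+ (suc m) (suc n)) ⟩
    - (ν (suc m) + ν (suc n)) ≈⟨ -‿+-comm _ _ ⟨
    - ν (suc m) + - ν (suc n) ∎

  ι-* : ∀ a b → ι (a ℤ.* b) ≈ ι a * ι b
  ι-* (+ m) (+ n) = trans (reflexive (≡.cong ι (≡.sym (ℤₚ.pos-* m n)))) (ν-* m n)
  ι-* (+ m) -[1+ n ] = begin
    ι (+ m ℤ.* -[1+ n ]) ≡⟨ ≡.cong ι (ℤₚ.neg-distribʳ-* (+ m) (+ suc n)) ⟨
    ι (ℤ.- (+ m ℤ.* + suc n)) ≈⟨ ι-neg (+ m ℤ.* + suc n) ⟩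
    - ι (+ m ℤ.* + suc n) ≈⟨ -‿cong (ι-* (+ m) (+ suc n)) ⟩
    - (ν m * ν (suc n)) ≈⟨ -‿distribʳ-* _ _ ⟩
    ν m * - ν (suc n) ∎
  ι-* -[1+ m ] (+ n) = begin
    ι (-[1+ m ] ℤ.* + n) ≡⟨ ≡.cong ι (ℤₚ.neg-distribˡ-* (+ suc m) (+ n)) ⟨
    ι (ℤ.- (+ suc m ℤ.* + n)) ≈⟨ ι-neg (+ suc m ℤ.* + n) ⟩
    - ι (+ suc m ℤ.* + n) ≈⟨ -‿cong (ι-* (+ suc m) (+ n)) ⟩
    - (ν (suc m) * ν n) ≈⟨ -‿distribˡ-* _ _ ⟩
    - ν (suc m) * ν n ∎
  ι-* -[1+ m ] -[1+ n ] = begin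
    ι (+ (suc m ℕ.* suc n)) ≈⟨ ν-* (suc m) (suc n) ⟩
    ν (suc m) * ν (suc n) ≈⟨ -‿involutive _ ⟨
    - - (ν (suc m) * ν (suc n)) ≈⟨ -‿cong (-‿distribˡ-* _ _) ⟩
    - (- ν (suc m) * ν (suc n)) ≈⟨ -‿distribʳ-* _ _ ⟩
    - ν (suc m) * - ν (suc n) ∎

  private
    ℤ-morphism : ℤring -Raw-AlmostCommutative⟶ fromCommutativeRing C
    ℤ-morphism = record
      { ⟦_⟧ = ι ; +-homo = ι-+ ; *-homo = ι-* ; -‿homo = ι-neg ; 0-homo = refl ; 1-homo = refl }

    ℤ-coeff≟ : WeaklyDecidable (Induced-equivalence ℤ-morphism)
    ℤ-coeff≟ a b with a ℤ.≟ b
    ... | yes a≡b = just (reflexive (≡.cong ι a≡b))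
    ... | no  _   = nothing

  open Algebra.Solver.Ring ℤring (fromCommutativeRing C) ℤ-morphism ℤ-coeff≟ public
    using (solve; con; _:+_; _:*_; _:-_; :-_; _:^_; _:=_)

-- Polynomial rings

module PolyRing (R : CommutativeRing 0ℓ 0ℓ) where
  private module R = RingKit R
  open R using (_≈_; _+_; _*_; -_; 0#; 1#)
  open Poly R.rawRing public

  negP : Pol → Pol
  negP = map -_

  coeff-+P : ∀ f g i → coeff (f +P g) i ≈ coeff f i + coeff g i
  coeff-+P []      g       i       = R.sym (R.+-identityˡ _)
  coeff-+P (a ∷ f) []      i       = R.sym (R.+-identityʳ _)
  coeff-+P (a ∷ f) (b ∷ g) zero    = R.refl
  coeff-+P (a ∷ f) (b ∷ g) (suc i) = coeff-+P f g i

  coeff-scale : ∀ a f i → coeff (map (a *_) f) i ≈ a * coeff f i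
  coeff-scale a []      i       = R.sym (R.zeroʳ a)
  coeff-scale a (b ∷ f) zero    = R.refl
  coeff-scale a (b ∷ f) (suc i) = coeff-scale a f i

  coeff-neg : ∀ f i → coeff (negP f) i ≈ - coeff f i
  coeff-neg []      i       = R.sym R.-0#≈0#
  coeff-neg (b ∷ f) zero    = R.refl
  coeff-neg (b ∷ f) (suc i) = coeff-neg f i

  -- _≈P_ unfolds to a function type, from which Agda cannot infer the polynomials; hence this wrapper.
  infix 4 _≋_
  record _≋_ (f g : Pol) : Set where
    constructor coeffwise
    field coeff-≈ : f ≈P g
  open _≋_ public

  ≋-refl : ∀ {f} → f ≋ f
  ≋-refl = coeffwise λ i → R.refl

  ≋-sym : ∀ {f g} → f ≋ g → g ≋ f
  ≋-sym p = coeffwise λ i → R.sym (coeff-≈ p i)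

  ≋-trans : ∀ {f g h} → f ≋ g → g ≋ h → f ≋ h
  ≋-trans p q = coeffwise λ i → R.trans (coeff-≈ p i) (coeff-≈ q i)

  ∷-cong : ∀ {a b f g} → a ≈ b → f ≋ g → (a ∷ f) ≋ (b ∷ g)
  ∷-cong p q = coeffwise λ where
    zero    → p
    (suc i) → coeff-≈ q i

  tail-≋ : ∀ {a b f g} → (a ∷ f) ≋ (b ∷ g) → f ≋ g
  tail-≋ p = coeffwise λ i → coeff-≈ p (suc i)

  tail-≋[] : ∀ {a f} → (a ∷ f) ≋ [] → f ≋ []
  tail-≋[] p = coeffwise λ i → coeff-≈ p (suc i)

  +P-cong : ∀ {f f′ g g′} → f ≋ f′ → g ≋ g′ → f +P g ≋ f′ +P g′
  +P-cong {f} {f′} {g} {g′} p q = coeffwise λ i →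
    R.trans (coeff-+P f g i) (R.trans (R.+-cong (coeff-≈ p i) (coeff-≈ q i)) (R.sym (coeff-+P f′ g′ i)))

  scale-cong : ∀ {a b f g} → a ≈ b → f ≋ g → map (a *_) f ≋ map (b *_) g
  scale-cong {a} {b} {f} {g} p q = coeffwise λ i →
    R.trans (coeff-scale a f i) (R.trans (R.*-cong p (coeff-≈ q i)) (R.sym (coeff-scale b g i)))

  neg-cong : ∀ {f g} → f ≋ g → negP f ≋ negP g
  neg-cong {f} {g} p = coeffwise λ i → R.trans (coeff-neg f i) (R.trans (R.-‿cong (coeff-≈ p i)) (R.sym (coeff-neg g i)))

  +P-assoc : ∀ f g h → (f +P g) +P h ≋ f +P (g +P h)
  +P-assoc f g h = coeffwise λ i → begin
    coeff ((f +P g) +P h) i ≈⟨ coeff-+P (f +P g) h i ⟩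
    coeff (f +P g) i + coeff h i ≈⟨ R.+-congʳ (coeff-+P f g i) ⟩
    (coeff f i + coeff g i) + coeff h i ≈⟨ R.+-assoc _ _ _ ⟩
    coeff f i + (coeff g i + coeff h i) ≈⟨ R.+-congˡ (coeff-+P g h i) ⟨
    coeff f i + coeff (g +P h) i ≈⟨ coeff-+P f (g +P h) i ⟨
    coeff (f +P (g +P h)) i ∎
    where open R using (begin_; step-≈-⟩; step-≈-⟨; _∎)

  +P-comm : ∀ f g → f +P g ≋ g +P f
  +P-comm f g = coeffwise λ i → R.trans (coeff-+P f g i) (R.trans (R.+-comm _ _) (R.sym (coeff-+P g f i)))

  +P-identityʳ : ∀ f → f +P [] ≋ f
  +P-identityʳ f = coeffwise λ i → R.trans (coeff-+P f [] i) (R.+-identityʳ _)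

  +P-inverseʳ : ∀ f → f +P negP f ≋ []
  +P-inverseʳ f = coeffwise λ i → R.trans (coeff-+P f (negP f) i)
    (R.trans (R.+-congˡ (coeff-neg f i)) (R.-‿inverseʳ _))

  +P-interchange : ∀ f g h k → (f +P g) +P (h +P k) ≋ (f +P h) +P (g +P k)
  +P-interchange f g h k = coeffwise λ i → begin
    coeff ((f +P g) +P (h +P k)) i ≈⟨ coeff-+P (f +P g) (h +P k) i ⟩
    coeff (f +P g) i + coeff (h +P k) i ≈⟨ R.+-cong (coeff-+P f g i) (coeff-+P h k i) ⟩
    (coeff f i + coeff g i) + (coeff h i + coeff k i) ≈⟨ R.solve 4 (λ a b c d → (a R.:+ b) R.:+ (c R.:+ d) R.:= (a R.:+ c) R.:+ (b R.:+ d)) R.refl _ _ _ _ ⟩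
    (coeff f i + coeff h i) + (coeff g i + coeff k i) ≈⟨ R.+-cong (coeff-+P f h i) (coeff-+P g k i) ⟨
    coeff (f +P h) i + coeff (g +P k) i ≈⟨ coeff-+P (f +P h) (g +P k) i ⟨
    coeff ((f +P h) +P (g +P k)) i ∎
    where open R using (begin_; step-≈-⟩; step-≈-⟨; _∎)

  0∷-+P : ∀ f g → 0# ∷ (f +P g) ≋ (0# ∷ f) +P (0# ∷ g)
  0∷-+P f g = coeffwise λ where
    zero    → R.sym (R.+-identityˡ _)
    (suc i) → R.refl

  0∷[]≋[] : (0# ∷ []) ≋ []
  0∷[]≋[] = coeffwise λ where
    zero    → R.refl
    (suc i) → R.refl

  scale-zero : ∀ {a} f → a ≈ 0# → map (a *_) f ≋ []
  scale-zero {a} f p = coeffwise λ i → R.trans (coeff-scale a f i) (R.trans (R.*-congʳ p) (R.zeroˡ _))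

  scale-+P : ∀ a f g → map (a *_) (f +P g) ≋ map (a *_) f +P map (a *_) g
  scale-+P a f g = coeffwise λ i → begin
    coeff (map (a *_) (f +P g)) i ≈⟨ coeff-scale a (f +P g) i ⟩
    a * coeff (f +P g) i ≈⟨ R.*-congˡ (coeff-+P f g i) ⟩
    a * (coeff f i + coeff g i) ≈⟨ R.distribˡ _ _ _ ⟩
    a * coeff f i + a * coeff g i ≈⟨ R.+-cong (coeff-scale a f i) (coeff-scale a g i) ⟨
    coeff (map (a *_) f) i + coeff (map (a *_) g) i ≈⟨ coeff-+P (map (a *_) f) (map (a *_) g) i ⟨
    coeff (map (a *_) f +P map (a *_) g) i ∎
    where open R using (begin_; step-≈-⟩; step-≈-⟨; _∎)

  +-scale : ∀ a b f → map ((a + b) *_) f ≋ map (a *_) f +P map (b *_) f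
  +-scale a b f = coeffwise λ i → begin
    coeff (map ((a + b) *_) f) i ≈⟨ coeff-scale (a + b) f i ⟩
    (a + b) * coeff f i ≈⟨ R.distribʳ _ _ _ ⟩
    a * coeff f i + b * coeff f i ≈⟨ R.+-cong (coeff-scale a f i) (coeff-scale b f i) ⟨
    coeff (map (a *_) f) i + coeff (map (b *_) f) i ≈⟨ coeff-+P (map (a *_) f) (map (b *_) f) i ⟨
    coeff (map (a *_) f +P map (b *_) f) i ∎
    where open R using (begin_; step-≈-⟩; step-≈-⟨; _∎)

  *-scale : ∀ a b f → map ((a * b) *_) f ≋ map (a *_) (map (b *_) f)
  *-scale a b f = coeffwise λ i → begin
    coeff (map ((a * b) *_) f) i ≈⟨ coeff-scale (a * b) f i ⟩
    (a * b) * coeff f i ≈⟨ R.*-assoc _ _ _ ⟩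
    a * (b * coeff f i) ≈⟨ R.*-congˡ (coeff-scale b f i) ⟨
    a * coeff (map (b *_) f) i ≈⟨ coeff-scale a (map (b *_) f) i ⟨
    coeff (map (a *_) (map (b *_) f)) i ∎
    where open R using (begin_; step-≈-⟩; step-≈-⟨; _∎)

  1-scale : ∀ f → map (1# *_) f ≋ f
  1-scale f = coeffwise λ i → R.trans (coeff-scale 1# f i) (R.*-identityˡ _)

  -- A list of zeros is a zero polynomial without being `[]`, so this does not hold by computation;
  -- `*P-congʳ` needs it when the two lists have different lengths.
  *P-zeroˡ : ∀ {f} g → f ≋ [] → f *P g ≋ []
  *P-zeroˡ {[]}    g p = ≋-refl
  *P-zeroˡ {a ∷ f} g p =
    ≋-trans (+P-cong (scale-zero g (coeff-≈ p 0)) (∷-cong R.refl (*P-zeroˡ g (tail-≋[] p)))) 0∷[]≋[]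

  *P-congʳ : ∀ {f f′} g → f ≋ f′ → f *P g ≋ f′ *P g
  *P-congʳ {[]}    {f′}     g p = ≋-sym (*P-zeroˡ {f′} g (≋-sym p))
  *P-congʳ {a ∷ f} {[]}     g p = *P-zeroˡ {a ∷ f} g p
  *P-congʳ {a ∷ f} {b ∷ f′} g p =
    +P-cong (scale-cong {f = g} (coeff-≈ p 0) ≋-refl) (∷-cong R.refl (*P-congʳ g (tail-≋ p)))

  *P-congˡ : ∀ f {g g′} → g ≋ g′ → f *P g ≋ f *P g′
  *P-congˡ []      p = ≋-refl
  *P-congˡ (a ∷ f) p = +P-cong (scale-cong R.refl p) (∷-cong R.refl (*P-congˡ f p))

  *P-cong : ∀ {f f′ g g′} → f ≋ f′ → g ≋ g′ → f *P g ≋ f′ *P g′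
  *P-cong {f} {f′} {g} {g′} p q = ≋-trans (*P-congʳ {f} {f′} g p) (*P-congˡ f′ q)

  *P-distribʳ : ∀ h f g → (f +P g) *P h ≋ f *P h +P g *P h
  *P-distribʳ h []      g       = ≋-refl
  *P-distribʳ h (a ∷ f) []      = ≋-sym (+P-identityʳ _)
  *P-distribʳ h (a ∷ f) (b ∷ g) =
    ≋-trans (+P-cong (+-scale a b h) (≋-trans (∷-cong R.refl (*P-distribʳ h f g)) (0∷-+P (f *P h) (g *P h))))
             (+P-interchange (map (a *_) h) _ _ _)

  scale-*P : ∀ a f g → map (a *_) f *P g ≋ map (a *_) (f *P g)
  scale-*P a []      g = ≋-refl
  scale-*P a (b ∷ f) g =
    ≋-trans (+P-cong (*-scale a b g) (∷-cong (R.sym (R.zeroʳ a)) (scale-*P a f g)))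
             (≋-sym (scale-+P a (map (b *_) g) (0# ∷ (f *P g))))

  0∷-*P : ∀ f g → (0# ∷ f) *P g ≋ 0# ∷ (f *P g)
  0∷-*P f g = +P-cong {g = 0# ∷ (f *P g)} (scale-zero g R.refl) ≋-refl

  *P-assoc : ∀ f g h → (f *P g) *P h ≋ f *P (g *P h)
  *P-assoc []      g h = ≋-refl
  *P-assoc (a ∷ f) g h =
    ≋-trans (*P-distribʳ h (map (a *_) g) (0# ∷ (f *P g)))
      (+P-cong (scale-*P a g h) (≋-trans (0∷-*P (f *P g) h) (∷-cong R.refl (*P-assoc f g h))))

  *P-zeroʳ : ∀ f → f *P [] ≋ []
  *P-zeroʳ []      = ≋-refl
  *P-zeroʳ (a ∷ f) = ≋-trans (∷-cong R.refl (*P-zeroʳ f)) 0∷[]≋[]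

  *P-comm : ∀ f g → f *P g ≋ g *P f
  *P-comm []      g       = ≋-sym (*P-zeroʳ g)
  *P-comm (a ∷ f) g       = ≋-trans (+P-cong {map (a *_) g} ≋-refl (∷-cong R.refl (*P-comm f g))) (≋-sym (*P-∷ g))
    where
    *P-∷ : ∀ g → g *P (a ∷ f) ≋ map (a *_) g +P (0# ∷ (g *P f))
    *P-∷ []      = ≋-sym 0∷[]≋[]
    *P-∷ (b ∷ g) = ∷-cong (R.+-congʳ (R.*-comm b a))
      (≋-trans (+P-cong {map (b *_) f} ≋-refl (*P-∷ g))
        (≋-trans (≋-sym (+P-assoc (map (b *_) f) (map (a *_) g) (0# ∷ (g *P f))))
          (≋-trans (+P-cong {g = 0# ∷ (g *P f)} (+P-comm (map (b *_) f) (map (a *_) g)) ≋-refl)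
            (+P-assoc (map (a *_) g) (map (b *_) f) (0# ∷ (g *P f))))))

  *P-identityˡ : ∀ f → oneP *P f ≋ f
  *P-identityˡ f = ≋-trans (+P-cong (1-scale f) 0∷[]≋[]) (+P-identityʳ f)

  polyRing : CommutativeRing 0ℓ 0ℓ
  polyRing = record
    { Carrier = Pol ; _≈_ = _≋_ ; _+_ = _+P_ ; _*_ = _*P_ ; -_ = negP ; 0# = [] ; 1# = oneP
    ; isCommutativeRing = record
      { isRing = record
        { +-isAbelianGroup = record
          { isGroup = record
            { isMonoid = record
              { isSemigroup = record
                { isMagma = record
                  { isEquivalence = record
                    { refl  = λ {f} → ≋-refl {f}
                    ; sym   = λ {f} {g} → ≋-sym {f} {g}
                    ; trans = λ {f} {g} {h} → ≋-trans {f} {g} {h} }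
                  ; ∙-cong = λ {f} {f′} {g} {g′} → +P-cong {f} {f′} {g} {g′} }
                ; assoc = +P-assoc }
              ; identity = (λ f → ≋-refl) , +P-identityʳ }
            ; inverse = (λ f → ≋-trans (+P-comm (negP f) f) (+P-inverseʳ f)) , +P-inverseʳ
            ; ⁻¹-cong = λ {f} {g} → neg-cong {f} {g} }
          ; comm = +P-comm }
        ; *-cong = λ {f} {f′} {g} {g′} → *P-cong {f} {f′} {g} {g′}
        ; *-assoc = *P-assoc
        ; *-identity = *P-identityˡ , (λ f → ≋-trans (*P-comm f oneP) (*P-identityˡ f))
        ; distrib = (λ h f g → ≋-trans (*P-comm h (f +P g)) (≋-trans (*P-distribʳ h f g)
                       (+P-cong (*P-comm f h) (*P-comm g h)))) , *P-distribʳ }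
      ; *-comm = *P-comm } }

-- Fibonacci and Lucas sequences in a commutative ring

module Divisibility (C : CommutativeRing 0ℓ 0ℓ) where
  open RingKit C

  infix 4 _∣_
  record _∣_ (a b : Carrier) : Set where
    constructor divides
    field
      quotient : Carrier
      equality : b ≈ a * quotient

  ∣-refl : ∀ {a} → a ∣ a
  ∣-refl = divides 1# (sym (*-identityʳ _))

  ∣-resp : ∀ {a b c} → b ≈ c → a ∣ b → a ∣ c
  ∣-resp b≈c (divides q b≈aq) = divides q (trans (sym b≈c) b≈aq)

  ∣-respˡ : ∀ {a b c} → a ≈ b → a ∣ c → b ∣ c
  ∣-respˡ a≈b (divides q c≈aq) = divides q (trans c≈aq (*-congʳ a≈b))

  ∣-trans : ∀ {a b c} → a ∣ b → b ∣ c → a ∣ c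
  ∣-trans (divides q b≈aq) (divides r c≈br) = divides (q * r) (trans c≈br (trans (*-congʳ b≈aq) (*-assoc _ _ _)))

  ∣-0 : ∀ {a} → a ∣ 0#
  ∣-0 = divides 0# (sym (zeroʳ _))

  ∣-+ : ∀ {a b c} → a ∣ b → a ∣ c → a ∣ b + c
  ∣-+ (divides q b≈aq) (divides r c≈ar) = divides (q + r) (trans (+-cong b≈aq c≈ar) (sym (distribˡ _ _ _)))

  ∣-*ˡ : ∀ {a b} r → a ∣ b → a ∣ r * b
  ∣-*ˡ {a} r (divides q b≈aq) = divides (r * q) (trans (*-congˡ b≈aq) (solve 3 (λ r a q → r :* (a :* q) := a :* (r :* q)) refl r a q))

  ∣-*ʳ : ∀ {a b} r → a ∣ b → a ∣ b * r
  ∣-*ʳ r a∣b = ∣-resp (*-comm _ _) (∣-*ˡ r a∣b)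

  ∣-neg : ∀ {a b} → a ∣ b → a ∣ - b
  ∣-neg {a} {b} (divides q b≈aq) = divides (- q) (trans (-‿cong b≈aq) (-‿distribʳ-* _ _))

  ∣-sub : ∀ {a b c} → a ∣ b → a ∣ c → a ∣ b - c
  ∣-sub a∣b a∣c = ∣-+ a∣b (∣-neg a∣c)

  ∣-*-cong : ∀ {a b c d} → a ∣ b → c ∣ d → a * c ∣ b * d
  ∣-*-cong {a} {b} {c} {d} (divides q b≈aq) (divides r d≈cr) = divides (q * r) (begin
    b * d ≈⟨ *-cong b≈aq d≈cr ⟩
    (a * q) * (c * r) ≈⟨ solve 4 (λ a q c r → (a :* q) :* (c :* r) := (a :* c) :* (q :* r)) refl a q c r ⟩
    (a * c) * (q * r) ∎)

  ∣-cancel-+ʳ : ∀ {a b c} → a ∣ b + c → a ∣ c → a ∣ b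
  ∣-cancel-+ʳ {a} {b} {c} p q = ∣-resp (solve 2 (λ b c → (b :+ c) :- c := b) refl b c) (∣-sub p q)

  record IsIdeal (I : Carrier → Set) : Set where
    field
      I-resp : ∀ {a b} → a ≈ b → I a → I b
      I-0    : I 0#
      I-+    : ∀ {a b} → I a → I b → I (a + b)
      I-*    : ∀ r {a} → I a → I (r * a)

  ⟨_,_⟩ : Carrier → Carrier → Carrier → Set
  ⟨ a , b ⟩ z = Σ Carrier λ u → Σ Carrier λ v → z ≈ u * a + v * b

  ⟨,⟩-isIdeal : ∀ a b → IsIdeal ⟨ a , b ⟩
  ⟨,⟩-isIdeal a b = record
    { I-resp = λ { z≈w (u , v , z≈) → u , v , trans (sym z≈w) z≈ }
    ; I-0    = 0# , 0# , solve 2 (λ a b → con (+ 0) := con (+ 0) :* a :+ con (+ 0) :* b) refl a b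
    ; I-+    = λ { (u , v , z≈) (u′ , v′ , w≈) → u + u′ , v + v′ ,
                   trans (+-cong z≈ w≈) (solve 6 (λ u v u′ v′ a b →
                     (u :* a :+ v :* b) :+ (u′ :* a :+ v′ :* b) := (u :+ u′) :* a :+ (v :+ v′) :* b)
                     refl u v u′ v′ a b) }
    ; I-*    = λ { r (u , v , z≈) → r * u , r * v ,
                   trans (*-congˡ z≈) (solve 5 (λ r u v a b →
                     r :* (u :* a :+ v :* b) := (r :* u) :* a :+ (r :* v) :* b) refl r u v a b) }
    }

  ⟨,⟩-left : ∀ {a b} → ⟨ a , b ⟩ a
  ⟨,⟩-left {a} {b} = 1# , 0# , solve 2 (λ a b → a := con (+ 1) :* a :+ con (+ 0) :* b) refl a b

  ⟨,⟩-right : ∀ {a b} → ⟨ a , b ⟩ b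
  ⟨,⟩-right {a} {b} = 0# , 1# , solve 2 (λ a b → b := con (+ 0) :* a :+ con (+ 1) :* b) refl a b

module Fibonacci (C : CommutativeRing 0ℓ 0ℓ) (x : CommutativeRing.Carrier C) where
  open RingKit C
  open Divisibility C

  fib : ℕ → Carrier
  fib zero          = 0#
  fib (suc zero)    = 1#
  fib (suc (suc n)) = x * fib (suc n) + fib n

  -- L_n = F_(n+1) + F_(n-1), written as 2 F_(n+1) - x F_n to avoid the predecessor.
  luc : ℕ → Carrier
  luc n = ν 2 * fib (suc n) - x * fib n

  sgn : ℕ → Carrier
  sgn zero    = 1#
  sgn (suc n) = - sgn n

  -- The discriminant of t² - x t - 1.
  disc : Carrier
  disc = x * x + ν 4

  sgn² : ∀ n → sgn n * sgn n ≈ 1#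
  sgn² zero    = *-identityˡ _
  sgn² (suc n) = trans (solve 1 (λ s → (:- s) :* (:- s) := s :* s) refl (sgn n)) (sgn² n)

  fib-+-suc : ∀ m n → fib (suc (m ℕ.+ n)) ≈ fib (suc m) * fib (suc n) + fib m * fib n
  fib-+-suc zero n = solve 2 (λ a b → a := con (+ 1) :* a :+ con (+ 0) :* b) refl (fib (suc n)) (fib n)
  fib-+-suc (suc zero) n =
    solve 3 (λ x a b → x :* a :+ b := (x :* con (+ 1) :+ con (+ 0)) :* a :+ con (+ 1) :* b) refl x (fib (suc n)) (fib n)
  fib-+-suc (suc (suc m)) n = trans (+-cong (*-congˡ (fib-+-suc (suc m) n)) (fib-+-suc m n))
    (solve 5 (λ x p q a b →
        x :* ((x :* p :+ q) :* a :+ p :* b) :+ (p :* a :+ q :* b)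
        := (x :* (x :* p :+ q) :+ p) :* a :+ (x :* p :+ q) :* b)
      refl x (fib (suc m)) (fib m) (fib (suc n)) (fib n))

  -- The factor fib (suc m) - x * fib m is fib (m - 1), which this form avoids.
  fib-+ : ∀ m n → fib (m ℕ.+ n) ≈ fib m * fib (suc n) + (fib (suc m) - x * fib m) * fib n
  fib-+ zero n = solve 3 (λ x a b → b := con (+ 0) :* a :+ (con (+ 1) :- x :* con (+ 0)) :* b) refl x (fib (suc n)) (fib n)
  fib-+ (suc m) n = trans (fib-+-suc m n)
    (solve 5 (λ x p q a b → p :* a :+ q :* b := p :* a :+ ((x :* p :+ q) :- x :* p) :* b)
      refl x (fib (suc m)) (fib m) (fib (suc n)) (fib n))

  -- The quadratic form p² - x p q - q² changes sign when the recurrence replaces (p , q) by (x p +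
  -- q , p).
  cassini : ∀ n → fib (suc n) * fib (suc n) - x * (fib (suc n) * fib n) - fib n * fib n ≈ sgn n
  cassini zero = solve 1 (λ x → con (+ 1) :* con (+ 1) :- x :* (con (+ 1) :* con (+ 0)) :- con (+ 0) :* con (+ 0) := con (+ 1)) refl x
  cassini (suc n) = trans
    (solve 3 (λ x p q → (x :* p :+ q) :* (x :* p :+ q) :- x :* ((x :* p :+ q) :* p) :- p :* p
        := :- (p :* p :- x :* (p :* q) :- q :* q)) refl x (fib (suc n)) (fib n))
    (-‿cong (cassini n))

  -- Completing the square in Cassini's identity, multiplied by 4.
  luc² : ∀ n → luc n * luc n ≈ disc * (fib n * fib n) + ν 4 * sgn n
  luc² n = trans
    (solve 3 (λ x p q → (con (+ 2) :* p :- x :* q) :* (con (+ 2) :* p :- x :* q)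
        := (x :* x :+ con (+ 4)) :* (q :* q) :+ con (+ 4) :* (p :* p :- x :* (p :* q) :- q :* q))
      refl x (fib (suc n)) (fib n))
    (+-congˡ (*-congˡ (cassini n)))

  fib-double : ∀ n → fib (n ℕ.+ n) ≈ fib n * luc n
  fib-double n = trans (fib-+ n n)
    (solve 3 (λ x p q → q :* p :+ (p :- x :* q) :* q := q :* (con (+ 2) :* p :- x :* q)) refl x (fib (suc n)) (fib n))

  private
    luc-odd : ∀ a → luc (suc (a ℕ.+ a)) ≈
      ν 2 * (fib (suc (suc a)) * fib (suc a) + fib (suc a) * fib a)
        - x * (fib (suc a) * fib (suc a) + fib a * fib a)
    luc-odd a = +-cong (*-congˡ (fib-+-suc (suc a) a)) (-‿cong (*-congˡ (fib-+-suc a a)))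

  -- In terms of the roots, (α^a - β^a)(α^(a+1) - β^(a+1)) = α^(2a+1) + β^(2a+1) - (αβ)^a (α + β)
  -- with αβ = -1. The proof needs only the addition formula and Cassini's identity.
  disc-fib-fib : ∀ a → disc * (fib a * fib (suc a)) ≈ luc (suc (a ℕ.+ a)) - sgn a * x
  disc-fib-fib a = begin
    disc * (fib a * fib (suc a))
      ≈⟨ solve 3 (λ x p q → (x :* x :+ con (+ 4)) :* (q :* p)
           := (con (+ 2) :* ((x :* p :+ q) :* p :+ p :* q) :- x :* (p :* p :+ q :* q))
              :- (p :* p :- x :* (p :* q) :- q :* q) :* x) refl x (fib (suc a)) (fib a) ⟩
    _ ≈⟨ +-cong (luc-odd a) (-‿cong (*-congʳ (sym (cassini a)))) ⟨
    luc (suc (a ℕ.+ a)) - sgn a * x ∎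

  luc-luc : ∀ a → luc a * luc (suc a) ≈ luc (suc (a ℕ.+ a)) + sgn a * x
  luc-luc a = begin
    luc a * luc (suc a)
      ≈⟨ solve 3 (λ x p q → (con (+ 2) :* p :- x :* q) :* (con (+ 2) :* (x :* p :+ q) :- x :* p)
           := (con (+ 2) :* ((x :* p :+ q) :* p :+ p :* q) :- x :* (p :* p :+ q :* q))
              :+ (p :* p :- x :* (p :* q) :- q :* q) :* x) refl x (fib (suc a)) (fib a) ⟩
    _ ≈⟨ +-cong (luc-odd a) (*-congʳ (sym (cassini a))) ⟨
    luc (suc (a ℕ.+ a)) + sgn a * x ∎

  private
    -- an inverse of fib (suc d) modulo fib d
    inv : ℕ → Carrier
    inv d = sgn d * (fib (suc d) - x * fib d)

    -- Cassini's identity gives F_(d+1) (F_(d+1) - x F_d) = (-1)^d + F_d².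
    inv-fib : ∀ d → inv d * fib (suc d) ≈ 1# + fib d * (sgn d * fib d)
    inv-fib d = begin
      inv d * fib (suc d)
        ≈⟨ solve 4 (λ x p q s → (s :* (p :- x :* q)) :* p
             := s :* (p :* p :- x :* (p :* q) :- q :* q) :+ q :* (s :* q)) refl x (fib (suc d)) (fib d) (sgn d) ⟩
      sgn d * (fib (suc d) * fib (suc d) - x * (fib (suc d) * fib d) - fib d * fib d) + fib d * (sgn d * fib d)
        ≈⟨ +-congʳ (*-congˡ (cassini d)) ⟩
      sgn d * sgn d + fib d * (sgn d * fib d)
        ≈⟨ +-congʳ (sgn² d) ⟩
      1# + fib d * (sgn d * fib d) ∎

    inv-fib-^ : ∀ d k → Σ Carrier λ z → inv d ^ k * fib (suc d) ^ k ≈ 1# + fib d * z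
    inv-fib-^ d zero = 0# , solve 1 (λ f → con (+ 1) :* con (+ 1) := con (+ 1) :+ f :* con (+ 0)) refl (fib d)
    inv-fib-^ d (suc k) with inv-fib-^ d k
    ... | z , eq = (z + s + f * s * z) , (begin
      (inv d * inv d ^ k) * (fib (suc d) * fib (suc d) ^ k)
        ≈⟨ solve 4 (λ a b c e → (a :* b) :* (c :* e) := (a :* c) :* (b :* e)) refl (inv d) (inv d ^ k) (fib (suc d)) (fib (suc d) ^ k) ⟩
      (inv d * fib (suc d)) * (inv d ^ k * fib (suc d) ^ k)
        ≈⟨ *-cong (inv-fib d) eq ⟩
      (1# + f * s) * (1# + f * z)
        ≈⟨ solve 3 (λ f s z → (con (+ 1) :+ f :* s) :* (con (+ 1) :+ f :* z) := con (+ 1) :+ f :* (z :+ s :+ f :* s :* z)) refl f s z ⟩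
      1# + f * (z + s + f * s * z) ∎)
      where f = fib d
            s = sgn d * fib d

    fib-suc-multiple : ∀ d k → Σ Carrier λ z → fib (suc (k ℕ.* d)) ≈ fib (suc d) ^ k + fib d * z
    fib-suc-multiple d zero = 0# , solve 1 (λ f → con (+ 1) := con (+ 1) :+ f :* con (+ 0)) refl (fib d)
    fib-suc-multiple d (suc k) with fib-suc-multiple d k
    ... | z , eq = (fib (suc d) * z + fib (k ℕ.* d)) , (begin
      fib (suc (d ℕ.+ k ℕ.* d)) ≈⟨ fib-+-suc d (k ℕ.* d) ⟩
      fib (suc d) * fib (suc (k ℕ.* d)) + fib d * fib (k ℕ.* d) ≈⟨ +-congʳ (*-congˡ eq) ⟩
      fib (suc d) * (fib (suc d) ^ k + fib d * z) + fib d * fib (k ℕ.* d)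
        ≈⟨ solve 5 (λ p e q z w → p :* (e :+ q :* z) :+ q :* w := p :* e :+ q :* (p :* z :+ w)) refl (fib (suc d)) (fib (suc d) ^ k) (fib d) z (fib (k ℕ.* d)) ⟩
      fib (suc d) * fib (suc d) ^ k + fib d * (fib (suc d) * z + fib (k ℕ.* d)) ∎)

    -- By the addition formula the quotient c of a multiple-index term by F_d becomes F_(n+1) +
    -- (F_(d+1) - x F_d) c at the next multiple of d, where n is the present index. Modulo `fib d`
    -- each step thus multiplies c by F_(d+1) and adds one more power of it, whence the integer
    -- factor.
    fib-multiple : ∀ d k → Σ Carrier λ c → (fib (suc k ℕ.* d) ≈ fib d * c) ×
                   Σ Carrier λ h → c ≈ ν (suc k) * fib (suc d) ^ k + fib d * h
    fib-multiple d zero = 1# , trans (reflexive (≡.cong fib (ℕₚ.*-identityˡ d))) (sym (*-identityʳ _)) ,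
      0# , solve 1 (λ f → con (+ 1) := con (+ 1) :* con (+ 1) :+ f :* con (+ 0)) refl (fib d)
    fib-multiple d (suc k) =
      let c , eq , h , ceq = fib-multiple d k
          z , zeq          = fib-suc-multiple d (suc k)
      in  fib (suc n) + (p - x * q) * c
          , trans (fib-+ d n) (trans (+-congˡ (*-congˡ eq))
              (solve 4 (λ q f w c → q :* f :+ w :* (q :* c) := q :* (f :+ w :* c)) refl q (fib (suc n)) (p - x * q) c))
          , z + p * h - x * c
          , (begin
      fib (suc n) + (p - x * q) * c
        ≈⟨ +-congʳ zeq ⟩
      (p ^ suc k + q * z) + (p - x * q) * c
        ≈⟨ solve 6 (λ x e p q z c → (e :+ q :* z) :+ (p :- x :* q) :* c := e :+ p :* c :+ q :* (z :- x :* c)) refl x (p ^ suc k) p q z c ⟩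
      p ^ suc k + p * c + q * (z - x * c)
        ≈⟨ +-congʳ (+-congˡ (*-congˡ ceq)) ⟩
      p * p ^ k + p * (ν (suc k) * p ^ k + q * h) + q * (z - x * c)
        ≈⟨ solve 8 (λ x e p q z c n h → p :* e :+ p :* (n :* e :+ q :* h) :+ q :* (z :- x :* c)
              := (con (+ 1) :+ n) :* (p :* e) :+ q :* (z :+ p :* h :- x :* c)) refl x (p ^ k) p q z c (ν (suc k)) h ⟩
      (1# + ν (suc k)) * (p * p ^ k) + q * (z + p * h - x * c) ∎)
      where
      n = suc k ℕ.* d
      p = fib (suc d)
      q = fib d

  -- F_(d+1) is a unit modulo F_d, so multiplying c ≡ (k+1) F_(d+1)^k by `inv d ^ k` leaves the
  -- integer k+1 in the ideal.
  fib-quotient : ∀ d k → Σ Carrier λ c → (fib (suc k ℕ.* d) ≈ fib d * c) × ⟨ c , fib d ⟩ (ν (suc k))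
  fib-quotient d k with fib-multiple d k | inv-fib-^ d k
  ... | c , eq , h , ceq | z , zeq = c , eq , w , - (n * z + w * h) , sym (begin
      w * c + - (n * z + w * h) * q
        ≈⟨ +-congʳ (*-congˡ ceq) ⟩
      w * (n * e + q * h) + - (n * z + w * h) * q
        ≈⟨ solve 6 (λ w n e q h z → w :* (n :* e :+ q :* h) :+ (:- (n :* z :+ w :* h)) :* q := n :* (w :* e) :- n :* (q :* z)) refl w n e q h z ⟩
      n * (w * e) - n * (q * z)
        ≈⟨ +-congʳ (*-congˡ zeq) ⟩
      n * (1# + q * z) - n * (q * z)
        ≈⟨ solve 3 (λ n q z → n :* (con (+ 1) :+ q :* z) :- n :* (q :* z) := n) refl n q z ⟩
      n ∎)
    where
    w = inv d ^ k
    n = ν (suc k)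
    e = fib (suc d) ^ k
    q = fib d

  fib-∣ : ∀ d k → fib d ∣ fib (k ℕ.* d)
  fib-∣ d zero    = ∣-0
  fib-∣ d (suc k) = let c , eq , _ = fib-quotient d k in divides c eq

  module _ {I : Carrier → Set} (isIdeal : IsIdeal I) where
    open IsIdeal isIdeal

    I-∣ : ∀ {a b} → a ∣ b → I a → I b
    I-∣ (divides q b≈aq) p = I-resp (sym (trans b≈aq (*-comm _ _))) (I-* q p)

    -- Modulo the ideal F_c vanishes, so F_(d+c) reduces to F_d F_(c+1), and F_(c+1) is invertible
    -- modulo F_c. This is Euclid's subtraction step on the indices.
    ideal-fib-∸ : ∀ d c → I (fib (d ℕ.+ c)) → I (fib c) → I (fib d)
    ideal-fib-∸ d c p q = I-resp
      (begin
        w * fib (d ℕ.+ c) + (- (w * (fib (suc d) - x * fib d) + fib d * s)) * fib c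
          ≈⟨ +-congʳ (*-congˡ (fib-+ d c)) ⟩
        w * (fib d * fib (suc c) + (fib (suc d) - x * fib d) * fib c) + (- (w * (fib (suc d) - x * fib d) + fib d * s)) * fib c
          ≈⟨ solve 6 (λ w d p y c s → w :* (d :* p :+ y :* c) :+ (:- (w :* y :+ d :* s)) :* c := d :* (w :* p) :- d :* (s :* c)) refl w (fib d) (fib (suc c)) (fib (suc d) - x * fib d) (fib c) s ⟩
        fib d * (w * fib (suc c)) - fib d * (s * fib c)
          ≈⟨ +-congʳ (*-congˡ (inv-fib c)) ⟩
        fib d * (1# + fib c * s) - fib d * (s * fib c)
          ≈⟨ solve 3 (λ d c s → d :* (con (+ 1) :+ c :* s) :- d :* (s :* c) := d) refl (fib d) (fib c) s ⟩
        fib d ∎)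
      (I-+ (I-* w p) (I-* _ q))
      where
      w = inv c
      s = sgn c * fib c

    ideal-fib-gcd : ∀ a b → I (fib a) → I (fib b) → I (fib (gcd a b))
    ideal-fib-gcd a b p q with Bézout.identity (gcd-GCD a b)
    ... | Bézout.+- u v eq = ideal-fib-∸ (gcd a b) (v ℕ.* b)
            (≡.subst (λ n → I (fib n)) (≡.sym eq) (I-∣ (fib-∣ a u) p)) (I-∣ (fib-∣ b v) q)
    ... | Bézout.-+ u v eq = ideal-fib-∸ (gcd a b) (u ℕ.* a)
            (≡.subst (λ n → I (fib n)) (≡.sym eq) (I-∣ (fib-∣ b v) q)) (I-∣ (fib-∣ a u) p)

  module _ (∂ : Carrier → Carrier)
           (∂-cong : ∀ {a b} → a ≈ b → ∂ a ≈ ∂ b)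
           (∂-+ : ∀ a b → ∂ (a + b) ≈ ∂ a + ∂ b)
           (∂-* : ∀ a b → ∂ (a * b) ≈ ∂ a * b + a * ∂ b)
           (∂x : ∂ x ≈ 1#) where

    ∂0 : ∂ 0# ≈ 0#
    ∂0 = begin
      ∂ 0# ≈⟨ solve 1 (λ d → d := d :+ d :- d) refl (∂ 0#) ⟩
      ∂ 0# + ∂ 0# - ∂ 0# ≈⟨ +-congʳ (∂-+ 0# 0#) ⟨
      ∂ (0# + 0#) - ∂ 0# ≈⟨ +-congʳ (∂-cong (+-identityʳ 0#)) ⟩
      ∂ 0# - ∂ 0# ≈⟨ -‿inverseʳ _ ⟩
      0# ∎

    ∂1 : ∂ 1# ≈ 0#
    ∂1 = begin
      ∂ 1# ≈⟨ solve 1 (λ d → d := d :* con (+ 1) :+ con (+ 1) :* d :- d) refl (∂ 1#) ⟩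
      ∂ 1# * 1# + 1# * ∂ 1# - ∂ 1# ≈⟨ +-congʳ (∂-* 1# 1#) ⟨
      ∂ (1# * 1#) - ∂ 1# ≈⟨ +-congʳ (∂-cong (*-identityʳ 1#)) ⟩
      ∂ 1# - ∂ 1# ≈⟨ -‿inverseʳ _ ⟩
      0# ∎

    -- Differentiating α² = x α + 1 gives (α - β) α′ = α, and likewise (α - β) β′ = -β; the formula
    -- is the derivative of (α - β) F_n = α^n - β^n, multiplied by α - β. The induction itself uses
    -- only the recurrence.
    ∂-fib : ∀ n → disc * ∂ (fib n) ≈ ν n * luc n - x * fib n
    ∂-fib zero = trans (*-congˡ ∂0)
      (solve 2 (λ d x → d :* con (+ 0) := con (+ 0) :* (con (+ 2) :* con (+ 1) :- x :* con (+ 0)) :- x :* con (+ 0)) refl disc x)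
    ∂-fib (suc zero) = trans (*-congˡ ∂1)
      (solve 2 (λ d x → d :* con (+ 0) := con (+ 1) :* (con (+ 2) :* (x :* con (+ 1) :+ con (+ 0)) :- x :* con (+ 1)) :- x :* con (+ 1)) refl disc x)
    ∂-fib (suc (suc n)) = begin
      disc * ∂ (x * p + q)
        ≈⟨ *-congˡ (trans (∂-+ (x * p) q) (+-congʳ (trans (∂-* x p) (+-congʳ (*-congʳ ∂x))))) ⟩
      disc * (1# * p + x * ∂ p + ∂ q)
        ≈⟨ solve 5 (λ d p x p′ q′ → d :* (con (+ 1) :* p :+ x :* p′ :+ q′) := d :* p :+ x :* (d :* p′) :+ d :* q′) refl disc p x (∂ p) (∂ q) ⟩
      disc * p + x * (disc * ∂ p) + disc * ∂ q
        ≈⟨ +-cong (+-congˡ (*-congˡ (trans (∂-fib (suc n)) (+-congʳ (*-congʳ (ν-suc n)))))) (∂-fib n) ⟩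
      disc * p + x * ((1# + ν n) * luc (suc n) - x * p) + (ν n * luc n - x * q)
        ≈⟨ solve 4 (λ x p q n →
             (x :* x :+ con (+ 4)) :* p :+ x :* ((con (+ 1) :+ n) :* (con (+ 2) :* (x :* p :+ q) :- x :* p) :- x :* p) :+ (n :* (con (+ 2) :* p :- x :* q) :- x :* q)
             := (con (+ 1) :+ (con (+ 1) :+ n)) :* (con (+ 2) :* (x :* (x :* p :+ q) :+ p) :- x :* (x :* p :+ q)) :- x :* (x :* p :+ q)) refl x p q (ν n) ⟩
      (1# + (1# + ν n)) * luc (suc (suc n)) - x * (x * p + q)
        ≈⟨ +-congʳ (*-congʳ (+-congˡ (ν-suc n))) ⟨
      ν (suc (suc n)) * luc (suc (suc n)) - x * (x * p + q) ∎
      where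
      p = fib (suc n)
      q = fib n

-- The Frobenius map

-- The absorption identity, by induction from Pascal's rule. With n+1 = p it exhibits p as a divisor
-- of (k+1) C(p , k+1).
C-absorb : ∀ n k → suc k ℕ.* (suc n choose suc k) ≡ suc n ℕ.* (n choose k)
C-absorb n zero = begin
  1 ℕ.* (suc n choose 1) ≡⟨ ℕₚ.*-identityˡ _ ⟩
  suc n choose 1 ≡⟨ nC1≡n (suc n) ⟩
  suc n ≡⟨ ℕₚ.*-identityʳ _ ⟨
  suc n ℕ.* 1 ≡⟨⟩
  suc n ℕ.* (n choose 0) ∎
  where open ≡.≡-Reasoning
C-absorb zero (suc k) = begin
  suc (suc k) ℕ.* (1 choose suc (suc k)) ≡⟨ ≡.cong (suc (suc k) ℕ.*_) (k>n⇒nCk≡0 {1} {suc (suc k)} (s≤s (s≤s z≤n))) ⟩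
  suc (suc k) ℕ.* 0 ≡⟨ ℕₚ.*-zeroʳ (suc (suc k)) ⟩
  0 ≡⟨ ≡.cong (1 ℕ.*_) (k>n⇒nCk≡0 {0} {suc k} (s≤s z≤n)) ⟨
  1 ℕ.* (0 choose suc k) ∎
  where open ≡.≡-Reasoning
C-absorb (suc n) (suc k) = begin
  suc (suc k) ℕ.* (suc (suc n) choose suc (suc k))
    ≡⟨ ≡.cong (suc (suc k) ℕ.*_) (nCk+nC[k+1]≡[n+1]C[k+1] (suc n) (suc k)) ⟨
  suc (suc k) ℕ.* (c ℕ.+ (suc n choose suc (suc k)))
    ≡⟨ solve 3 (λ k c d → (con 1 :+ k) :* (c :+ d) := k :* c :+ c :+ (con 1 :+ k) :* d) ≡.refl (suc k) c (suc n choose suc (suc k)) ⟩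
  suc k ℕ.* c ℕ.+ c ℕ.+ suc (suc k) ℕ.* (suc n choose suc (suc k))
    ≡⟨ ≡.cong₂ (λ u v → u ℕ.+ c ℕ.+ v) (C-absorb n k) (C-absorb n (suc k)) ⟩
  suc n ℕ.* (n choose k) ℕ.+ c ℕ.+ suc n ℕ.* (n choose suc k)
    ≡⟨ solve 4 (λ n c a b → n :* a :+ c :+ n :* b := c :+ n :* (a :+ b)) ≡.refl (suc n) c (n choose k) (n choose suc k) ⟩
  c ℕ.+ suc n ℕ.* ((n choose k) ℕ.+ (n choose suc k))
    ≡⟨ ≡.cong (λ z → c ℕ.+ suc n ℕ.* z) (nCk+nC[k+1]≡[n+1]C[k+1] n k) ⟩
  suc (suc n) ℕ.* c ∎
  where
  open ≡.≡-Reasoning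
  open Data.Nat.Solver.+-*-Solver
  c = suc n choose suc k

prime∣C : ∀ {p} → Prime p → ∀ k → suc k < p → p ∣ℕ (p choose suc k)
prime∣C {suc p} p-prime k k<p
  with euclidsLemma (suc k) (suc p choose suc k) p-prime
         (ℕ∣.divides (p choose k) (≡.trans (C-absorb p k) (ℕₚ.*-comm (suc p) (p choose k))))
... | inj₁ p∣k = ⊥-elim (ℕₚ.<⇒≱ k<p (ℕ∣.∣⇒≤ p∣k))
... | inj₂ p∣C = p∣C

module CharP (C : CommutativeRing 0ℓ 0ℓ) {p : ℕ} (p-prime : Prime p)
             (char : RingKit.Characteristic C p) where
  open RingKit C
  private
    open Algebra.Properties.CommutativeSemiring.Binomial commutativeSemiring using (theorem; binomialTerm)
    open Algebra.Properties.Semiring.Sum semiring using (sum; sum-init-last; sum-cong-≋; sum-replicate-zero)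
    open Algebra.Properties.Semiring.Mult semiring using (×-assoc-*) renaming (_×_ to _·_)

    ·-ν : ∀ n → n · 1# ≈ ν n
    ·-ν zero    = refl
    ·-ν (suc n) = trans (+-congˡ (·-ν n)) (sym (ν-suc n))

    multiple-zero : ∀ {n} → p ∣ℕ n → ∀ z → n · z ≈ 0#
    multiple-zero {n} (ℕ∣.divides q eq) z = begin
      n · z ≈⟨ Algebra.Properties.Semiring.Mult.×-congʳ semiring n (*-identityˡ z) ⟨
      n · (1# * z) ≈⟨ ×-assoc-* n 1# z ⟨
      (n · 1#) * z ≈⟨ *-congʳ (·-ν n) ⟩
      ν n * z ≡⟨ ≡.cong (λ m → ν m * z) eq ⟩
      ν (q ℕ.* p) * z ≈⟨ *-congʳ (ν-* q p) ⟩
      (ν q * ν p) * z ≈⟨ *-congʳ (*-congˡ char) ⟩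
      (ν q * 0#) * z ≈⟨ solve 2 (λ q z → q :* con (+ 0) :* z := con (+ 0)) refl (ν q) z ⟩
      0# ∎

    -- Writing p as n+2 splits the binomial sum into its two ends and n+1 middle terms, whose
    -- coefficients are multiples of p.
    frobenius-suc : ∀ n → p ≡ suc (suc n) → ∀ x y → (x + y) ^ p ≈ x ^ p + y ^ p
    frobenius-suc n ≡.refl x y = begin
      (x + y) ^ p ≈⟨ theorem p x y ⟩
      T Fin.zero + sum U ≈⟨ +-cong first (sum-init-last U) ⟩
      y ^ p + (sum M + L) ≈⟨ +-congˡ (+-cong (trans (sum-cong-≋ {suc n} middle) (sum-replicate-zero (suc n))) last) ⟩
      y ^ p + (0# + x ^ p) ≈⟨ solve 2 (λ a b → a :+ (con (+ 0) :+ b) := b :+ a) refl (y ^ p) (x ^ p) ⟩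
      x ^ p + y ^ p ∎
      where
      T : Fin (suc p) → Carrier
      T = binomialTerm x y p

      U : Fin p → Carrier
      U i = T (Fin.suc i)

      M : Fin (suc n) → Carrier
      M i = U (Fin.inject₁ i)

      L : Carrier
      L = U (Fin.fromℕ (suc n))

      term : ℕ → Carrier
      term k = (p choose k) · (x ^ k * y ^ (p ℕ.∸ k))

      first : T Fin.zero ≈ y ^ p
      first = trans (+-identityʳ _) (*-identityˡ _)

      last : L ≈ x ^ p
      last = begin
        term (suc (Fin.toℕ (Fin.fromℕ (suc n)))) ≡⟨ ≡.cong (λ k → term (suc k)) (Finₚ.toℕ-fromℕ (suc n)) ⟩
        (p choose p) · (x ^ p * y ^ (p ℕ.∸ p)) ≡⟨ ≡.cong₂ (λ c e → c · (x ^ p * y ^ e)) (nCn≡1 p) (ℕₚ.n∸n≡0 p) ⟩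
        1 · (x ^ p * 1#) ≈⟨ trans (+-identityʳ _) (*-identityʳ _) ⟩
        x ^ p ∎

      middle : ∀ i → M i ≈ 0#
      middle i = multiple-zero (prime∣C p-prime (Fin.toℕ (Fin.inject₁ i))
        (s≤s (≡.subst (ℕ._< suc n) (≡.sym (Finₚ.toℕ-inject₁ i)) (Finₚ.toℕ<n i)))) _

    prime≥2 : ∀ {p} → Prime p → Σ ℕ λ n → p ≡ suc (suc n)
    prime≥2 {zero}        pr with () ← prime⇒nonZero pr
    prime≥2 {suc zero}    pr with () ← prime⇒nonTrivial pr
    prime≥2 {suc (suc n)} pr = n , ≡.refl

  frobenius-+ : ∀ x y → (x + y) ^ p ≈ x ^ p + y ^ p
  frobenius-+ = let n , eq = prime≥2 p-prime in frobenius-suc n eq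

  0^p : 0# ^ p ≈ 0#
  0^p = let n , eq = prime≥2 p-prime in trans (^-congʳ 0# eq) (zeroˡ _)

  -- Derived from additivity at x + (-x), which spares a case distinction on the parity of p.
  frobenius-neg : ∀ x → (- x) ^ p ≈ - (x ^ p)
  frobenius-neg x = begin
    (- x) ^ p ≈⟨ solve 2 (λ a b → a := (b :+ a) :- b) refl _ (x ^ p) ⟩
    (x ^ p + (- x) ^ p) - x ^ p ≈⟨ +-congʳ (frobenius-+ x (- x)) ⟨
    (x + - x) ^ p - x ^ p ≈⟨ +-congʳ (trans (^-congˡ p (-‿inverseʳ x)) 0^p) ⟩
    0# - x ^ p ≈⟨ +-identityˡ _ ⟩
    - (x ^ p) ∎

  frobenius-sub : ∀ x y → (x - y) ^ p ≈ x ^ p - y ^ p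
  frobenius-sub x y = trans (frobenius-+ x (- y)) (+-congˡ (frobenius-neg y))

  frobenius-+-^ : ∀ d x y → (x + y) ^ (p ℕ.^ d) ≈ x ^ (p ℕ.^ d) + y ^ (p ℕ.^ d)
  frobenius-+-^ zero    x y = trans (*-identityʳ _) (+-cong (sym (*-identityʳ _)) (sym (*-identityʳ _)))
  frobenius-+-^ (suc d) x y = begin
    (x + y) ^ (p ℕ.* p ℕ.^ d) ≈⟨ ^-assocʳ (x + y) p (p ℕ.^ d) ⟨
    ((x + y) ^ p) ^ (p ℕ.^ d) ≈⟨ ^-congˡ (p ℕ.^ d) (frobenius-+ x y) ⟩
    (x ^ p + y ^ p) ^ (p ℕ.^ d) ≈⟨ frobenius-+-^ d (x ^ p) (y ^ p) ⟩
    (x ^ p) ^ (p ℕ.^ d) + (y ^ p) ^ (p ℕ.^ d) ≈⟨ +-cong (^-assocʳ x p _) (^-assocʳ y p _) ⟩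
    x ^ (p ℕ.* p ℕ.^ d) + y ^ (p ℕ.* p ℕ.^ d) ∎

  -- Fermat's little theorem, by induction on n through the additivity of the Frobenius map.
  ν^p : ∀ n → ν n ^ p ≈ ν n
  ν^p zero    = 0^p
  ν^p (suc n) = begin
    ν (suc n) ^ p ≈⟨ ^-congˡ p (ν-suc n) ⟩
    (1# + ν n) ^ p ≈⟨ frobenius-+ 1# (ν n) ⟩
    1# ^ p + ν n ^ p ≈⟨ +-cong (1^ p) (ν^p n) ⟩
    1# + ν n ≈⟨ ν-suc n ⟨
    ν (suc n) ∎
    where
    1^ : ∀ k → 1# ^ k ≈ 1#
    1^ zero    = refl
    1^ (suc k) = trans (*-identityˡ _) (1^ k)

  ν^p^ : ∀ d n → ν n ^ (p ℕ.^ d) ≈ ν n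
  ν^p^ zero    n = *-identityʳ _
  ν^p^ (suc d) n = trans (sym (^-assocʳ (ν n) p (p ℕ.^ d))) (trans (^-congˡ (p ℕ.^ d) (ν^p n)) (ν^p^ d n))

  frobenius-sub-^ : ∀ d x y → (x - y) ^ (p ℕ.^ d) ≈ x ^ (p ℕ.^ d) - y ^ (p ℕ.^ d)
  frobenius-sub-^ d x y = begin
    (x - y) ^ Q ≈⟨ solve 2 (λ a b → a := (a :+ b) :- b) refl ((x - y) ^ Q) (y ^ Q) ⟩
    ((x - y) ^ Q + y ^ Q) - y ^ Q ≈⟨ +-congʳ (frobenius-+-^ d (x - y) y) ⟨
    ((x - y) + y) ^ Q - y ^ Q ≈⟨ +-congʳ (^-congˡ Q (solve 2 (λ a b → (a :- b) :+ b := a) refl x y)) ⟩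
    x ^ Q - y ^ Q ∎
    where Q = p ℕ.^ d

-- Binet's formulas

module Binet (E : CommutativeRing 0ℓ 0ℓ) (x α β : CommutativeRing.Carrier E) (roots : RingKit.QuadraticRoots E x α β) where
  open RingKit E
  private
    α+β = proj₁ roots
    αβ  = proj₂ roots
  open Fibonacci E x

  private
    quadratic : ∀ {α β} → α + β ≈ x → α * β ≈ - 1# → ∀ n → α ^ suc (suc n) ≈ x * α ^ suc n + α ^ n
    quadratic {α} {β} s q n = begin
      α * (α * α ^ n) ≈⟨ solve 3 (λ a b e → a :* (a :* e) := (a :+ b) :* (a :* e) :- a :* b :* e) refl α β (α ^ n) ⟩
      (α + β) * (α * α ^ n) - α * β * α ^ n ≈⟨ +-cong (*-congʳ s) (-‿cong (*-congʳ q)) ⟩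
      x * (α * α ^ n) - (- 1#) * α ^ n ≈⟨ solve 2 (λ u e → u :- (:- con (+ 1)) :* e := u :+ e) refl (x * (α * α ^ n)) (α ^ n) ⟩
      x * (α * α ^ n) + α ^ n ∎

    α-rec = quadratic α+β αβ
    β-rec = quadratic (trans (+-comm β α) α+β) (trans (*-comm β α) αβ)

  binet-fib : ∀ n → (α - β) * fib n ≈ α ^ n - β ^ n
  binet-fib zero          = trans (zeroʳ _) (sym (-‿inverseʳ _))
  binet-fib (suc zero)    = solve 2 (λ a b → (a :- b) :* con (+ 1) := a :* con (+ 1) :- b :* con (+ 1)) refl α β
  binet-fib (suc (suc n)) = begin
    (α - β) * (x * fib (suc n) + fib n) ≈⟨ solve 4 (λ d x p q → d :* (x :* p :+ q) := x :* (d :* p) :+ d :* q) refl (α - β) x (fib (suc n)) (fib n) ⟩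
    x * ((α - β) * fib (suc n)) + (α - β) * fib n ≈⟨ +-cong (*-congˡ (binet-fib (suc n))) (binet-fib n) ⟩
    x * (α ^ suc n - β ^ suc n) + (α ^ n - β ^ n) ≈⟨ solve 5 (λ x a b c d → x :* (a :- b) :+ (c :- d) := (x :* a :+ c) :- (x :* b :+ d)) refl x (α ^ suc n) (β ^ suc n) (α ^ n) (β ^ n) ⟩
    (x * α ^ suc n + α ^ n) - (x * β ^ suc n + β ^ n) ≈⟨ +-cong (α-rec n) (-‿cong (β-rec n)) ⟨
    α ^ suc (suc n) - β ^ suc (suc n) ∎

  binet-luc : ∀ n → luc n ≈ α ^ n + β ^ n
  binet-luc zero = solve 1 (λ x → con (+ 2) :* con (+ 1) :- x :* con (+ 0) := con (+ 1) :+ con (+ 1)) refl x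
  binet-luc (suc zero) = trans
    (solve 1 (λ x → con (+ 2) :* (x :* con (+ 1) :+ con (+ 0)) :- x :* con (+ 1) := x) refl x)
    (trans (sym α+β) (+-cong (sym (*-identityʳ α)) (sym (*-identityʳ β))))
  binet-luc (suc (suc n)) = begin
    luc (suc (suc n))
      ≈⟨ solve 3 (λ x p q → con (+ 2) :* (x :* (x :* p :+ q) :+ p) :- x :* (x :* p :+ q)
           := x :* (con (+ 2) :* (x :* p :+ q) :- x :* p) :+ (con (+ 2) :* p :- x :* q)) refl x (fib (suc n)) (fib n) ⟩
    x * luc (suc n) + luc n ≈⟨ +-cong (*-congˡ (binet-luc (suc n))) (binet-luc n) ⟩
    x * (α ^ suc n + β ^ suc n) + (α ^ n + β ^ n) ≈⟨ solve 5 (λ x a b c d → x :* (a :+ b) :+ (c :+ d) := (x :* a :+ c) :+ (x :* b :+ d)) refl x (α ^ suc n) (β ^ suc n) (α ^ n) (β ^ n) ⟩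
    (x * α ^ suc n + α ^ n) + (x * β ^ suc n + β ^ n) ≈⟨ +-cong (α-rec n) (β-rec n) ⟨
    α ^ suc (suc n) + β ^ suc (suc n) ∎

  δ²≈disc : (α - β) * (α - β) ≈ disc
  δ²≈disc = begin
    (α - β) * (α - β) ≈⟨ solve 2 (λ a b → (a :- b) :* (a :- b) := (a :+ b) :* (a :+ b) :- con (+ 4) :* (a :* b)) refl α β ⟩
    (α + β) * (α + β) - ν 4 * (α * β) ≈⟨ +-cong (*-cong α+β α+β) (-‿cong (*-congˡ αβ)) ⟩
    x * x - ν 4 * (- 1#) ≈⟨ solve 1 (λ x → x :* x :- con (+ 4) :* (:- con (+ 1)) := x :* x :+ con (+ 4)) refl x ⟩
    disc ∎

  module _ {p : ℕ} (p-prime : Prime p) (char : ν p ≈ 0#) where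
    open CharP E p-prime char
    open Algebra.Properties.CommutativeSemiring.Exp commutativeSemiring using (^-distrib-*)

    -- α^q + β^q = (α + β)^q when q is a power of p.
    luc-frobenius : ∀ d → luc (p ℕ.^ d) ≈ x ^ (p ℕ.^ d)
    luc-frobenius d = trans (binet-luc (p ℕ.^ d)) (trans (sym (frobenius-+-^ d α β)) (^-congˡ (p ℕ.^ d) α+β))

    private
      δ-fib-p : (α - β) * fib p ≈ (α - β) ^ p
      δ-fib-p = trans (binet-fib p) (sym (frobenius-sub α β))

    -- (α - β) F_(np) = (α^n - β^n)^p = (α - β)^p F_n^p, and (α - β)^p = (α - β) F_p. A second
    -- factor α - β turns the multiplier into `disc`, which lies in the base ring.
    fib-frobenius : ∀ n → disc * fib (n ℕ.* p) ≈ disc * (fib p * fib n ^ p)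
    fib-frobenius n = begin
      disc * fib (n ℕ.* p) ≈⟨ *-congʳ δ²≈disc ⟨
      (δ * δ) * fib (n ℕ.* p) ≈⟨ *-assoc _ _ _ ⟩
      δ * (δ * fib (n ℕ.* p)) ≈⟨ *-congˡ (binet-fib (n ℕ.* p)) ⟩
      δ * (α ^ (n ℕ.* p) - β ^ (n ℕ.* p)) ≈⟨ *-congˡ (+-cong (^-assocʳ α n p) (-‿cong (^-assocʳ β n p))) ⟨
      δ * ((α ^ n) ^ p - (β ^ n) ^ p) ≈⟨ *-congˡ (frobenius-sub (α ^ n) (β ^ n)) ⟨
      δ * (α ^ n - β ^ n) ^ p ≈⟨ *-congˡ (^-congˡ p (binet-fib n)) ⟨
      δ * (δ * fib n) ^ p ≈⟨ *-congˡ (^-distrib-* δ (fib n) p) ⟩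
      δ * (δ ^ p * fib n ^ p) ≈⟨ *-congˡ (*-congʳ δ-fib-p) ⟨
      δ * ((δ * fib p) * fib n ^ p) ≈⟨ solve 3 (λ d f e → d :* (d :* f :* e) := (d :* d) :* (f :* e)) refl δ (fib p) (fib n ^ p) ⟩
      (δ * δ) * (fib p * fib n ^ p) ≈⟨ *-congʳ δ²≈disc ⟩
      disc * (fib p * fib n ^ p) ∎
      where δ = α - β

    -- Both sides are (α - β)^(p+1), since p + 1 = 2 (h + 1).
    disc-fib-p : ∀ h → p ≡ suc (2 ℕ.* h) → disc * fib p ≈ disc * disc ^ h
    disc-fib-p h p≡ = begin
      disc * fib p ≈⟨ *-congʳ δ²≈disc ⟨
      (δ * δ) * fib p ≈⟨ *-assoc _ _ _ ⟩
      δ * (δ * fib p) ≈⟨ *-congˡ δ-fib-p ⟩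
      δ * δ ^ p ≈⟨ *-congˡ (^-congʳ δ p≡) ⟩
      δ * (δ * δ ^ (2 ℕ.* h)) ≈⟨ *-assoc _ _ _ ⟨
      (δ * δ) * δ ^ (2 ℕ.* h) ≈⟨ *-congˡ (^-assocʳ δ 2 h) ⟨
      (δ * δ) * (δ ^ 2) ^ h ≈⟨ *-cong δ²≈disc (^-congˡ h (trans (*-congˡ (*-identityʳ δ)) δ²≈disc)) ⟩
      disc * disc ^ h ∎
      where δ = α - β

-- C[α] with α² = x α + 1; the pair (a , b) stands for a + b α.
module QuadraticExtension (C : CommutativeRing 0ℓ 0ℓ) (x : CommutativeRing.Carrier C) where
  private module C = RingKit C
  open C using (Carrier; _≈_; _+_; _*_; -_; 0#; 1#; solve; con; _:+_; _:*_; :-_; _:=_)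

  private
    A : Set
    A = Carrier × Carrier

    _≈A_ : A → A → Set
    (a , b) ≈A (c , d) = (a ≈ c) × (b ≈ d)

    _+A_ _*A_ : A → A → A
    (a , b) +A (c , d) = (a + c) , (b + d)
    (a , b) *A (c , d) = (a * c + b * d) , (a * d + b * c + x * (b * d))

    -A_ : A → A
    -A (a , b) = (- a) , (- b)

  extension : CommutativeRing 0ℓ 0ℓ
  extension = record
    { Carrier = A ; _≈_ = _≈A_ ; _+_ = _+A_ ; _*_ = _*A_ ; -_ = -A_ ; 0# = 0# , 0# ; 1# = 1# , 0#
    ; isCommutativeRing = record
      { isRing = record
        { +-isAbelianGroup = record
          { isGroup = record
            { isMonoid = record
              { isSemigroup = record
                { isMagma = record
                  { isEquivalence = record
                    { refl  = C.refl , C.refl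
                    ; sym   = λ { (p , q) → C.sym p , C.sym q }
                    ; trans = λ { (p , q) (r , s) → C.trans p r , C.trans q s } }
                  ; ∙-cong = λ { (p , q) (r , s) → C.+-cong p r , C.+-cong q s } }
                ; assoc = λ _ _ _ → C.+-assoc _ _ _ , C.+-assoc _ _ _ }
              ; identity = (λ _ → C.+-identityˡ _ , C.+-identityˡ _) , (λ _ → C.+-identityʳ _ , C.+-identityʳ _) }
            ; inverse = (λ _ → C.-‿inverseˡ _ , C.-‿inverseˡ _) , (λ _ → C.-‿inverseʳ _ , C.-‿inverseʳ _)
            ; ⁻¹-cong = λ { (p , q) → C.-‿cong p , C.-‿cong q } }
          ; comm = λ _ _ → C.+-comm _ _ , C.+-comm _ _ }
        ; *-cong = λ { (p , q) (r , s) → C.+-cong (C.*-cong p r) (C.*-cong q s)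
                     , C.+-cong (C.+-cong (C.*-cong p s) (C.*-cong q r)) (C.*-congˡ (C.*-cong q s)) }
        ; *-assoc = λ { (a , b) (c , d) (e , f) →
              solve 7 (λ x a b c d e f →
                (a :* c :+ b :* d) :* e :+ (a :* d :+ b :* c :+ x :* (b :* d)) :* f
                := a :* (c :* e :+ d :* f) :+ b :* (c :* f :+ d :* e :+ x :* (d :* f))) C.refl x a b c d e f
            , solve 7 (λ x a b c d e f →
                (a :* c :+ b :* d) :* f :+ (a :* d :+ b :* c :+ x :* (b :* d)) :* e :+ x :* ((a :* d :+ b :* c :+ x :* (b :* d)) :* f)
                := a :* (c :* f :+ d :* e :+ x :* (d :* f)) :+ b :* (c :* e :+ d :* f) :+ x :* (b :* (c :* f :+ d :* e :+ x :* (d :* f))))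
                C.refl x a b c d e f }
        ; *-identity = (λ { (a , b) →
              solve 3 (λ x a b → con (+ 1) :* a :+ con (+ 0) :* b := a) C.refl x a b
            , solve 3 (λ x a b → con (+ 1) :* b :+ con (+ 0) :* a :+ x :* (con (+ 0) :* b) := b) C.refl x a b })
            , (λ { (a , b) →
              solve 3 (λ x a b → a :* con (+ 1) :+ b :* con (+ 0) := a) C.refl x a b
            , solve 3 (λ x a b → a :* con (+ 0) :+ b :* con (+ 1) :+ x :* (b :* con (+ 0)) := b) C.refl x a b })
        ; distrib = (λ { (a , b) (c , d) (e , f) →
              solve 7 (λ x a b c d e f → a :* (c :+ e) :+ b :* (d :+ f) := (a :* c :+ b :* d) :+ (a :* e :+ b :* f)) C.refl x a b c d e f
            , solve 7 (λ x a b c d e f → a :* (d :+ f) :+ b :* (c :+ e) :+ x :* (b :* (d :+ f))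
                := (a :* d :+ b :* c :+ x :* (b :* d)) :+ (a :* f :+ b :* e :+ x :* (b :* f))) C.refl x a b c d e f })
            , (λ { (a , b) (c , d) (e , f) →
              solve 7 (λ x a b c d e f → (c :+ e) :* a :+ (d :+ f) :* b := (c :* a :+ d :* b) :+ (e :* a :+ f :* b)) C.refl x a b c d e f
            , solve 7 (λ x a b c d e f → (c :+ e) :* b :+ (d :+ f) :* a :+ x :* ((d :+ f) :* b)
                := (c :* b :+ d :* a :+ x :* (d :* b)) :+ (e :* b :+ f :* a :+ x :* (f :* b))) C.refl x a b c d e f }) }
      ; *-comm = λ { (a , b) (c , d) →
              solve 5 (λ x a b c d → a :* c :+ b :* d := c :* a :+ d :* b) C.refl x a b c d
            , solve 5 (λ x a b c d → a :* d :+ b :* c :+ x :* (b :* d) := c :* b :+ d :* a :+ x :* (d :* b)) C.refl x a b c d } } }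

  private module E = RingKit extension

  embed : Carrier → A
  embed a = a , 0#

  embed-+ : ∀ a b → embed (a + b) E.≈ embed a E.+ embed b
  embed-+ a b = C.refl , C.sym (C.+-identityˡ _)

  embed-* : ∀ a b → embed (a * b) E.≈ embed a E.* embed b
  embed-* a b = solve 2 (λ a b → a :* b := a :* b :+ con (+ 0) :* con (+ 0)) C.refl a b
              , solve 3 (λ x a b → con (+ 0) := a :* con (+ 0) :+ con (+ 0) :* b :+ x :* (con (+ 0) :* con (+ 0))) C.refl x a b

  embed-^ : ∀ a n → embed (a C.^ n) E.≈ embed a E.^ n
  embed-^ a zero    = E.refl
  embed-^ a (suc n) = E.trans (embed-* a (a C.^ n)) (E.*-congˡ {embed a} (embed-^ a n))

  embed-ν : ∀ n → embed (C.ν n) E.≈ E.ν n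
  embed-ν zero          = E.refl
  embed-ν (suc zero)    = E.refl
  embed-ν (suc (suc n)) = E.trans (embed-+ 1# (C.ν (suc n))) (E.+-congˡ {1# , 0#} (embed-ν (suc n)))

  private
    module FC = Fibonacci C x
    module FE = Fibonacci extension (embed x)
    -- The roots are α and x - α, with product x α - α² = -1.
    module B = Binet extension (embed x) (0# , 1#) (x , - 1#)
      ((C.+-identityˡ x , C.-‿inverseʳ 1#)
      , solve 1 (λ x → con (+ 0) :* x :+ con (+ 1) :* (:- con (+ 1)) := :- con (+ 1)) C.refl x
      , solve 1 (λ x → con (+ 0) :* (:- con (+ 1)) :+ con (+ 1) :* x :+ x :* (con (+ 1) :* (:- con (+ 1))) := :- con (+ 0)) C.refl x )

  embed-fib : ∀ n → embed (FC.fib n) E.≈ FE.fib n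
  embed-fib zero          = E.refl
  embed-fib (suc zero)    = E.refl
  embed-fib (suc (suc n)) = E.trans (embed-+ _ _) (E.+-cong {embed (x * FC.fib (suc n))}
    (E.trans (embed-* _ _) (E.*-congˡ {embed x} (embed-fib (suc n)))) (embed-fib n))

  embed-disc : embed FC.disc E.≈ FE.disc
  embed-disc = E.trans (embed-+ _ _) (E.+-cong {embed (x * x)} (embed-* _ _) (embed-ν 4))

  embed-luc : ∀ n → embed (FC.luc n) E.≈ FE.luc n
  embed-luc n = E.trans (embed-+ _ _) (E.+-cong {embed (C.ν 2 * FC.fib (suc n))}
      (E.trans (embed-* _ _) (E.*-cong {embed (C.ν 2)} (embed-ν 2) (embed-fib (suc n))))
      (E.trans (C.refl , C.sym C.-0#≈0#) (E.-‿cong {embed (x * FC.fib n)} (E.trans (embed-* _ _) (E.*-congˡ {embed x} (embed-fib n))))))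

  module _ {p : ℕ} (p-prime : Prime p) (char : C.ν p ≈ 0#) where
    private
      char-E : E.ν p E.≈ E.0#
      char-E = E.trans (E.sym (embed-ν p)) (char , C.refl)

    -- Proved in the extension and read off in the first coordinate, which recovers an element from
    -- its image under `embed`.
    luc-frobenius : ∀ d → FC.luc (p ℕ.^ d) ≈ x C.^ (p ℕ.^ d)
    luc-frobenius d = proj₁ (E.trans (embed-luc (p ℕ.^ d))
      (E.trans (B.luc-frobenius p-prime char-E d) (E.sym (embed-^ x (p ℕ.^ d)))))

    fib-frobenius : ∀ n → FC.disc * FC.fib (n ℕ.* p) ≈ FC.disc * (FC.fib p * FC.fib n C.^ p)
    fib-frobenius n = proj₁ (E.trans
      (E.trans (embed-* _ _) (E.*-cong {embed FC.disc} embed-disc (embed-fib (n ℕ.* p))))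
      (E.trans (B.fib-frobenius p-prime char-E n)
        (E.sym (E.trans (embed-* _ _) (E.*-cong {embed FC.disc} embed-disc
          (E.trans (embed-* _ _) (E.*-cong {embed (FC.fib p)} (embed-fib p)
            (E.trans (embed-^ _ p) (E.^-congˡ p {embed (FC.fib n)} (embed-fib n))))))))))

    disc-fib-p : ∀ h → p ≡ suc (2 ℕ.* h) → FC.disc * FC.fib p ≈ FC.disc * FC.disc C.^ h
    disc-fib-p h p≡ = proj₁ (E.trans
      (E.trans (embed-* _ _) (E.*-cong {embed FC.disc} embed-disc (embed-fib p)))
      (E.trans (B.disc-fib-p p-prime char-E h p≡)
        (E.sym (E.trans (embed-* _ _) (E.*-cong {embed FC.disc} embed-disc
          (E.trans (embed-^ _ h) (E.^-congˡ h {embed FC.disc} embed-disc)))))))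

-- Degrees and division by monic polynomials

module PolyDegree (R : CommutativeRing 0ℓ 0ℓ) where
  private module R = RingKit R
  open R using (_≈_; 0#; 1#)
  open PolyRing R public
  private module P = RingKit polyRing
  open Divisibility polyRing public

  const : R.Carrier → Pol
  const c = c ∷ []

  const-* : ∀ c f → const c *P f ≋ map (c R.*_) f
  const-* c f = ≋-trans (+P-cong {g = 0# ∷ []} ≋-refl 0∷[]≋[]) (+P-identityʳ _)

  X-* : ∀ f → X *P f ≋ 0# ∷ f
  X-* f = ≋-trans (0∷-*P oneP f) (∷-cong R.refl (*P-identityˡ f))

  const-cong : ∀ {a b} → a ≈ b → const a ≋ const b
  const-cong p = ∷-cong p ≋-refl

  const-homo-* : ∀ a b → const (a R.* b) ≋ const a *P const b
  const-homo-* a b = ≋-sym (const-* a (const b))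

  const-0 : const 0# ≋ []
  const-0 = 0∷[]≋[]

  const-ν : ∀ n → const (R.ν n) ≋ P.ν n
  const-ν zero          = 0∷[]≋[]
  const-ν (suc zero)    = ≋-refl
  const-ν (suc (suc n)) = +P-cong {const 1#} {const 1#} ≋-refl (const-ν (suc n))

  ∷-decompose : ∀ a f → a ∷ f ≋ const a +P X *P f
  ∷-decompose a f = ≋-trans (∷-cong (R.sym (R.+-identityʳ a)) ≋-refl)
    (+P-cong {const a} ≋-refl (≋-sym (X-* f)))

  -- Lists may carry trailing zeros, so degrees are bounded rather than read off from the length;
  -- `DegLT f 0` covers the zero polynomial.
  record DegLT (f : Pol) (n : ℕ) : Set where
    constructor degLT
    field above : ∀ i → n ≤ i → coeff f i ≈ 0#
  open DegLT public

  MonicDeg : Pol → ℕ → Set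
  MonicDeg f d = (coeff f d ≈ 1#) × DegLT f (suc d)

  Degree : Pol → ℕ → Set
  Degree f d = ¬ (coeff f d ≈ 0#) × DegLT f (suc d)

  degLT-resp : ∀ {f g n} → f ≋ g → DegLT f n → DegLT g n
  above (degLT-resp p l) i n≤i = R.trans (R.sym (coeff-≈ p i)) (above l i n≤i)

  degLT-mono : ∀ {f m n} → m ≤ n → DegLT f m → DegLT f n
  above (degLT-mono m≤n l) i n≤i = above l i (ℕₚ.≤-trans m≤n n≤i)

  degLT-[] : ∀ {n} → DegLT [] n
  above degLT-[] i _ = R.refl

  degLT-zero : ∀ {f} → DegLT f 0 → f ≋ []
  degLT-zero l = coeffwise λ i → above l i z≤n

  degLT-+ : ∀ {f g n} → DegLT f n → DegLT g n → DegLT (f +P g) n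
  above (degLT-+ {f} {g} l m) i n≤i =
    R.trans (coeff-+P f g i) (R.trans (R.+-cong (above l i n≤i) (above m i n≤i)) (R.+-identityˡ _))

  degLT-neg : ∀ {f n} → DegLT f n → DegLT (negP f) n
  above (degLT-neg {f} l) i n≤i = R.trans (coeff-neg f i) (R.trans (R.-‿cong (above l i n≤i)) R.-0#≈0#)

  degLT-∷ : ∀ {a f n} → DegLT f n → DegLT (a ∷ f) (suc n)
  above (degLT-∷ l) (suc i) (s≤s n≤i) = above l i n≤i

  degLT-tail : ∀ {a f n} → DegLT (a ∷ f) (suc n) → DegLT f n
  above (degLT-tail l) i n≤i = above l (suc i) (s≤s n≤i)

  degLT-length : ∀ f → DegLT f (length f)
  above (degLT-length []) i _         = R.refl
  above (degLT-length (a ∷ f)) (suc i) (s≤s n≤i) = above (degLT-length f) i n≤i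

  degLT-pred : ∀ {f n} → DegLT f (suc n) → coeff f n ≈ 0# → DegLT f n
  above (degLT-pred {f} {n} l z) i n≤i with ℕₚ.m≤n⇒m<n∨m≡n n≤i
  ... | inj₁ n<i    = above l i n<i
  ... | inj₂ ≡.refl = z

  degLT-1 : ∀ {f} → DegLT f 1 → f ≋ const (coeff f 0)
  degLT-1 l = coeffwise λ where
    zero    → R.refl
    (suc i) → above l (suc i) (s≤s z≤n)

  coeff-*-suc : ∀ a f g i → coeff ((a ∷ f) *P g) (suc i) ≈ a R.* coeff g (suc i) R.+ coeff (f *P g) i
  coeff-*-suc a f g i = R.trans (coeff-+P (map (a R.*_) g) (0# ∷ (f *P g)) (suc i)) (R.+-congʳ (coeff-scale a g (suc i)))

  private
    scalar-* : ∀ {a f} g → f ≋ [] → (a ∷ f) *P g ≋ map (a R.*_) g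
    scalar-* {a} g f≋[] = ≋-trans (*P-congʳ g (∷-cong R.refl f≋[])) (const-* a g)

  degLT-* : ∀ f g {d e} → DegLT f (suc d) → DegLT g (suc e) → DegLT (f *P g) (suc (d ℕ.+ e))
  above (degLT-* []      g {d}     {e} l m) i n≤i = R.refl
  above (degLT-* (a ∷ f) g {zero}  {e} l m) i n≤i = R.trans (coeff-≈ (scalar-* g (degLT-zero (degLT-tail {a} {f} l))) i)
    (R.trans (coeff-scale a g i) (R.trans (R.*-congˡ (above m i n≤i)) (R.zeroʳ a)))
  above (degLT-* (a ∷ f) g {suc d} {e} l m) (suc i) (s≤s n≤i) = R.trans (coeff-*-suc a f g i)
    (R.trans (R.+-cong (R.*-congˡ (above m (suc i) (s≤s (ℕₚ.≤-trans (ℕₚ.m≤n+m e (suc d)) n≤i))))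
                       (above (degLT-* f g {d} {e} (degLT-tail {a} {f} l) m) i n≤i))
      (R.trans (R.+-identityʳ _) (R.zeroʳ a)))

  lead-* : ∀ f g {d e} → DegLT f (suc d) → DegLT g (suc e) →
           coeff (f *P g) (d ℕ.+ e) ≈ coeff f d R.* coeff g e
  lead-* []      g {d}     {e} l m = R.sym (R.zeroˡ _)
  lead-* (a ∷ f) g {zero}  {e} l m = R.trans (coeff-≈ (scalar-* g (degLT-zero (degLT-tail {a} {f} l))) e) (coeff-scale a g e)
  lead-* (a ∷ f) g {suc d} {e} l m = R.trans (coeff-*-suc a f g (d ℕ.+ e))
    (R.trans (R.+-cong (R.trans (R.*-congˡ (above m (suc (d ℕ.+ e)) (s≤s (ℕₚ.m≤n+m e d)))) (R.zeroʳ a))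
                       (lead-* f g {d} {e} (degLT-tail {a} {f} l) m))
      (R.+-identityˡ _))

  monic-resp : ∀ {f g d} → f ≋ g → MonicDeg f d → MonicDeg g d
  monic-resp p (c , l) = R.trans (R.sym (coeff-≈ p _)) c , degLT-resp p l

  monic-one : MonicDeg oneP 0
  monic-one = R.refl , degLT-length oneP

  monic-X : MonicDeg X 1
  monic-X = R.refl , degLT-length X

  monic-* : ∀ {f g d e} → MonicDeg f d → MonicDeg g e → MonicDeg (f *P g) (d ℕ.+ e)
  monic-* {f} {g} (cf , lf) (cg , lg) =
    R.trans (lead-* f g lf lg) (R.trans (R.*-cong cf cg) (R.*-identityˡ _)) , degLT-* f g lf lg

  monic-^ : ∀ {f d} → MonicDeg f d → ∀ n → MonicDeg (f P.^ n) (n ℕ.* d)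
  monic-^ m zero    = monic-one
  monic-^ m (suc n) = monic-* m (monic-^ m n)

  monic-0⇒one : ∀ {f} → MonicDeg f 0 → f ≋ oneP
  monic-0⇒one (c , l) = ≋-trans (degLT-1 l) (const-cong c)

  monic-+ : ∀ {f g d} → MonicDeg f d → DegLT g d → MonicDeg (f +P g) d
  monic-+ {f} {g} {d} (c , l) m =
    R.trans (coeff-+P f g d) (R.trans (R.+-cong c (above m d ℕₚ.≤-refl)) (R.+-identityʳ _)) ,
    degLT-+ l (degLT-mono (ℕₚ.n≤1+n d) m)

  -- Recursion in the style of Horner: if f = g q + r, then a + x f leaves a + x r, of degree at
  -- most d, and subtracting t g removes its coefficient t at d.
  division : ∀ {g d} → MonicDeg g d → ∀ f → Σ Pol λ q → Σ Pol λ r → (f ≋ g *P q +P r) × DegLT r d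
  division {g} {d} (c , l) [] = [] , [] , ≋-sym (≋-trans (+P-identityʳ _) (*P-zeroʳ g)) , degLT-[]
  division {g} {d} (c , l) (a ∷ f) =
    let q , r , f≋ , r< = division (c , l) f
        t = coeff (a ∷ r) d
        r′ = (a ∷ r) +P negP (const t *P g)
    in  (t ∷ q) , r′ , (begin
          a ∷ f ≈⟨ ∷-cong R.refl f≋ ⟩
          a ∷ (g *P q +P r) ≈⟨ ∷-decompose a _ ⟩
          const a +P X *P (g *P q +P r) ≈⟨ P.solve 6 (λ a x g q r t → a P.:+ x P.:* (g P.:* q P.:+ r)
                                                              P.:= g P.:* (t P.:+ x P.:* q) P.:+ ((a P.:+ x P.:* r) P.:- t P.:* g))
                                                              ≋-refl (const a) X g q r (const t) ⟩
          g *P (const t +P X *P q) +P ((const a +P X *P r) +P negP (const t *P g))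
            ≈⟨ +P-cong (*P-congˡ g (∷-decompose t q)) (+P-cong {g = negP (const t *P g)} (∷-decompose a r) ≋-refl) ⟨
          g *P (t ∷ q) +P r′ ∎)
        , degLT-pred (degLT-+ (degLT-∷ r<) (degLT-neg (degLT-resp (≋-sym (const-* t g)) (scaled t))))
            (R.trans (coeff-+P (a ∷ r) (negP (const t *P g)) d)
              (R.trans (R.+-congˡ (R.trans (coeff-neg (const t *P g) d) (R.-‿cong
                (R.trans (coeff-≈ (const-* t g) d) (R.trans (coeff-scale t g d) (R.trans (R.*-congˡ c) (R.*-identityʳ t)))))))
                (R.-‿inverseʳ t)))
    where
    open P using (begin_; step-≈-⟩; step-≈-⟨; _∎)
    scaled : ∀ t → DegLT (map (t R.*_) g) (suc d)
    above (scaled t) i n≤i = R.trans (coeff-scale t g i) (R.trans (R.*-congˡ (above l i n≤i)) (R.zeroʳ t))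

  -- Because g is monic, the top coefficient of g h is that of h, and it sits at a degree where g h
  -- vanishes. Descending from the length of h kills one coefficient after another.
  monic-small-multiple : ∀ {g d} → MonicDeg g d → ∀ h → DegLT (g *P h) d → h ≋ []
  monic-small-multiple {g} {d} (c , l) h gh< = degLT-zero (descend (length h) (degLT-length h))
    where
    descend : ∀ n → DegLT h n → DegLT h 0
    descend zero    h< = h<
    descend (suc n) h< = descend n (degLT-pred h< (begin
      coeff h n ≈⟨ R.*-identityˡ _ ⟨
      1# R.* coeff h n ≈⟨ R.*-congʳ c ⟨
      coeff g d R.* coeff h n ≈⟨ lead-* g h l h< ⟨
      coeff (g *P h) (d ℕ.+ n) ≈⟨ above gh< (d ℕ.+ n) (ℕₚ.m≤m+n d n) ⟩
      0# ∎))
      where open R using (begin_; step-≈-⟩; step-≈-⟨; _∎)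

  ≋-from-0 : ∀ {f g} → f +P negP g ≋ [] → f ≋ g
  ≋-from-0 {f} {g} p = begin
    f ≈⟨ P.solve 2 (λ f g → f P.:= (f P.:- g) P.:+ g) ≋-refl f g ⟩
    (f +P negP g) +P g ≈⟨ +P-cong {g = g} p ≋-refl ⟩
    g ∎
    where open P using (begin_; step-≈-⟩; _∎)

  -- Holds over every coefficient ring, because a leading coefficient 1 annihilates nothing.
  monic-cancel : ∀ {g d} → MonicDeg g d → ∀ {h k} → g *P h ≋ g *P k → h ≋ k
  monic-cancel {g} {d} m {h} {k} p = ≋-from-0 (monic-small-multiple m (h +P negP k)
    (degLT-resp {[]} (≋-sym (begin
      g *P (h +P negP k) ≈⟨ P.solve 3 (λ g h k → g P.:* (h P.:- k) P.:= g P.:* h P.:- g P.:* k) ≋-refl g h k ⟩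
      g *P h +P negP (g *P k) ≈⟨ +P-cong {g = negP (g *P k)} p ≋-refl ⟩
      g *P k +P negP (g *P k) ≈⟨ +P-inverseʳ (g *P k) ⟩
      [] ∎)) degLT-[]))
    where open P using (begin_; step-≈-⟩; _∎)

  monic-∣-small : ∀ {g d f} → MonicDeg g d → g ∣ f → DegLT f d → f ≋ []
  monic-∣-small {g} m (divides h f≋gh) f< =
    ≋-trans f≋gh (≋-trans (*P-congˡ g (monic-small-multiple m h (degLT-resp f≋gh f<))) (*P-zeroʳ g))

  module Decidable (zero? : ∀ a → Dec (a ≈ 0#)) where

    isZero? : ∀ f → Dec (f ≋ [])
    isZero? [] = yes ≋-refl
    isZero? (a ∷ f) with zero? a | isZero? f
    ... | yes p | yes q = yes (≋-trans (∷-cong p q) 0∷[]≋[])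
    ... | no ¬p | _     = no λ e → ¬p (coeff-≈ e 0)
    ... | yes _ | no ¬q = no λ e → ¬q (tail-≋[] e)

    monic-∣? : ∀ {g d} → MonicDeg g d → ∀ f → Dec (g ∣ f)
    monic-∣? {g} m f = decide (division m f)
      where
      decide : (Σ Pol λ q → Σ Pol λ r → (f ≋ g *P q +P r) × DegLT r _) → Dec (g ∣ f)
      decide (q , r , f≋ , r<) with isZero? r
      ... | yes r≋0 = yes (divides q (≋-trans f≋ (≋-trans (+P-cong {g *P q} ≋-refl r≋0) (+P-identityʳ _))))
      ... | no  r≉0 = no λ g∣f → r≉0 (monic-∣-small m
              (∣-cancel-+ʳ (∣-resp (≋-trans f≋ (+P-comm (g *P q) r)) g∣f) (divides q ≋-refl)) r<)

    degree : ∀ f → (f ≋ []) ⊎ Σ ℕ (Degree f)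
    degree f = search (length f) (degLT-length f)
      where
      search : ∀ n → DegLT f n → (f ≋ []) ⊎ Σ ℕ (Degree f)
      search zero    l = inj₁ (degLT-zero l)
      search (suc n) l with zero? (coeff f n)
      ... | yes z = search n (degLT-pred l z)
      ... | no ¬z = inj₂ (n , ¬z , l)

  module Domain (zero? : ∀ a → Dec (a ≈ 0#)) (1≉0 : ¬ (1# ≈ 0#))
                (no-zero-divisors : ∀ a b → a R.* b ≈ 0# → (a ≈ 0#) ⊎ (b ≈ 0#)) where
    open Decidable zero? public

    degree-* : ∀ {f g d e} → Degree f d → Degree g e → Degree (f *P g) (d ℕ.+ e)
    degree-* {f} {g} {d} {e} (cf , lf) (cg , lg) = nonzero , degLT-* f g lf lg
      where
      nonzero : ¬ (coeff (f *P g) (d ℕ.+ e) ≈ 0#)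
      nonzero z with no-zero-divisors (coeff f d) (coeff g e) (R.trans (R.sym (lead-* f g lf lg)) z)
      ... | inj₁ p = cf p
      ... | inj₂ p = cg p

    degree⇒nonzero : ∀ {f d} → Degree f d → ¬ (f ≋ [])
    degree⇒nonzero {d = d} (c , _) p = c (coeff-≈ p d)

    degree-<-degLT : ∀ {f d n} → Degree f d → DegLT f n → d < n
    degree-<-degLT {f} {d} {n} (c , _) l with ℕₚ.<-cmp d n
    ... | tri< d<n _ _ = d<n
    ... | tri≈ _ ≡.refl _ = ⊥-elim (c (above l d ℕₚ.≤-refl))
    ... | tri> _ _ n<d = ⊥-elim (c (above l d (ℕₚ.<⇒≤ n<d)))

    degree-unique : ∀ {f d e} → Degree f d → Degree f e → d ≡ e
    degree-unique p q = ℕₚ.≤-antisym (ℕₚ.≤-pred (degree-<-degLT p (proj₂ q))) (ℕₚ.≤-pred (degree-<-degLT q (proj₂ p)))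

    monic⇒degree : ∀ {f d} → MonicDeg f d → Degree f d
    monic⇒degree (c , l) = (λ z → 1≉0 (R.trans (R.sym c) z)) , l

    monic⇒nonzero : ∀ {f d} → MonicDeg f d → ¬ (f ≋ [])
    monic⇒nonzero m = degree⇒nonzero (monic⇒degree m)

    monic-unique : ∀ {f d e} → MonicDeg f d → MonicDeg f e → d ≡ e
    monic-unique p q = degree-unique (monic⇒degree p) (monic⇒degree q)

    poly-no-zero-divisors : ∀ f g → f *P g ≋ [] → (f ≋ []) ⊎ (g ≋ [])
    poly-no-zero-divisors f g fg≋0 with degree f | degree g
    ... | inj₁ p       | _            = inj₁ p
    ... | inj₂ _       | inj₁ q       = inj₂ q
    ... | inj₂ (d , p) | inj₂ (e , q) = ⊥-elim (degree⇒nonzero (degree-* p q) fg≋0)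

    factor-degrees : ∀ f g {n} → Degree (f *P g) n → Σ ℕ λ d → Σ ℕ λ e → Degree f d × Degree g e × (n ≡ d ℕ.+ e)
    factor-degrees f g h with degree f | degree g
    ... | inj₁ p       | _            = ⊥-elim (degree⇒nonzero h (*P-zeroˡ g p))
    ... | inj₂ _       | inj₁ q       = ⊥-elim (degree⇒nonzero h (≋-trans (*P-congˡ f q) (*P-zeroʳ f)))
    ... | inj₂ (d , p) | inj₂ (e , q) = d , e , p , q , degree-unique h (degree-* p q)

    monic-cofactor : ∀ {g d} → MonicDeg g d → ∀ h {n} → MonicDeg (g *P h) n → Σ ℕ λ e → MonicDeg h e × (n ≡ d ℕ.+ e)
    monic-cofactor {g} {d} m h {n} gh-monic =
      let d′ , e , gd , hd , n≡ = factor-degrees g h (monic⇒degree gh-monic)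
          d′≡d = degree-unique gd (monic⇒degree m)
          n≡d+e = ≡.trans n≡ (≡.cong (ℕ._+ e) d′≡d)
      in  e , (R.trans (R.sym (R.*-identityˡ _)) (R.trans (R.*-congʳ (R.sym (proj₁ m)))
                (R.trans (R.sym (lead-* g h (proj₂ m) (proj₂ hd)))
                  (≡.subst (λ k → coeff (g *P h) k ≈ 1#) n≡d+e (proj₁ gh-monic)))) , proj₂ hd) , n≡d+e

-- Irreducible polynomials

record IntegralDomain : Set₁ where
  field ring : CommutativeRing 0ℓ 0ℓ
  open RingKit ring using (_≈_; 0#; 1#; NoZeroDivisors)
  field
    zero?            : ∀ a → Dec (a ≈ 0#)
    1≉0              : ¬ (1# ≈ 0#)
    no-zero-divisors : NoZeroDivisors

module Factorization (𝔻 : IntegralDomain) where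
  open IntegralDomain 𝔻 renaming (ring to R)
  private module R = RingKit R
  open R using (0#; 1#; _≈_)
  open PolyDegree R public
  open Domain zero? 1≉0 no-zero-divisors public
  private module P = RingKit polyRing
  open P using (solve; _:=_; _:+_; _:*_; _:-_; begin_; step-≈-⟩; step-≈-⟨; _∎)

  *-nonzero : ∀ {a b} → ¬ (a ≈ 0#) → ¬ (b ≈ 0#) → ¬ (a R.* b ≈ 0#)
  *-nonzero ¬a ¬b z with no-zero-divisors _ _ z
  ... | inj₁ p = ¬a p
  ... | inj₂ p = ¬b p

  const-cancel : ∀ {c f} → ¬ (c ≈ 0#) → const c *P f ≋ [] → f ≋ []
  const-cancel {c} {f} ¬c z with poly-no-zero-divisors (const c) f z
  ... | inj₁ p = ⊥-elim (¬c (coeff-≈ p 0))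
  ... | inj₂ p = p

  -- Divide f by g with remainder r. Then g divides c r, whose degree is too small, so c r and hence
  -- r vanish.
  monic-∣-cancel-const : ∀ {g d c f} → MonicDeg g d → ¬ (c ≈ 0#) → g ∣ const c *P f → g ∣ f
  monic-∣-cancel-const {g} {d} {c} {f} m ¬c g∣cf =
    let q , r , f≋ , r< = division m f
        cr≋0 = monic-∣-small m
          (∣-cancel-+ʳ (∣-resp (begin
              const c *P f ≈⟨ *P-congˡ (const c) f≋ ⟩
              const c *P (g *P q +P r) ≈⟨ solve 4 (λ c g q r → c :* (g :* q :+ r) := c :* r :+ g :* (c :* q)) ≋-refl (const c) g q r ⟩
              const c *P r +P g *P (const c *P q) ∎) g∣cf) (divides (const c *P q) ≋-refl))
          (scaled r r<)
    in  divides q (≋-trans f≋ (≋-trans (+P-cong {g *P q} ≋-refl (const-cancel ¬c cr≋0)) (+P-identityʳ _)))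
    where
    scaled : ∀ r → DegLT r d → DegLT (const c *P r) d
    above (scaled r r<) i d≤i = R.trans (coeff-≈ (const-* c r) i)
      (R.trans (coeff-scale c r i) (R.trans (R.*-congˡ (above r< i d≤i)) (R.zeroʳ c)))

  Unit : Pol → Set
  Unit f = f ∣ oneP

  record Irr (g : Pol) : Set where
    field
      nonzero : ¬ (g ≋ [])
      nonunit : ¬ Unit g
      split   : ∀ a b → g ≋ a *P b → Unit a ⊎ Unit b
  open Irr public

  monic-unit : ∀ {g d} → MonicDeg g d → Unit g → d ≡ 0
  monic-unit {g} {d} m (divides v 1≋gv) =
    let e , _ , 0≡ = monic-cofactor m v (monic-resp 1≋gv monic-one) in ℕₚ.m+n≡0⇒m≡0 d (≡.sym 0≡)

  irr-degree : ∀ {g d} → MonicDeg g d → Irr g → 1 ≤ d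
  irr-degree {d = zero}  m i = ⊥-elim (nonunit i (divides oneP (≋-sym (≋-trans (*P-congʳ oneP (monic-0⇒one m)) (*P-identityˡ oneP)))))
  irr-degree {d = suc _} m i = s≤s z≤n

  irr-∣-irr : ∀ {g h d e} → MonicDeg g d → MonicDeg h e → Irr g → Irr h → g ∣ h → g ≋ h
  irr-∣-irr {g} mg mh ig ih (divides k h≋gk) with split ih g k h≋gk
  ... | inj₁ u = ⊥-elim (nonunit ig u)
  ... | inj₂ u = let e , mk , _ = monic-cofactor mg k (monic-resp h≋gk mh)
                     k≋1 = monic-0⇒one (≡.subst (MonicDeg k) (monic-unit mk u) mk)
                 in  ≋-sym (≋-trans h≋gk (≋-trans (*P-congˡ g k≋1) (P.*-identityʳ g)))

  -- Scaling by the leading coefficient of the other factor makes both factors of a monic polynomial monic.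
  irreducible-if-no-monic-split : ∀ {g n} → MonicDeg g n → 1 ≤ n →
    (∀ {a b i j} → MonicDeg a i → MonicDeg b j → g ≋ a *P b → (i ≡ 0) ⊎ (j ≡ 0)) → Irr g
  irreducible-if-no-monic-split {g} {n} m 1≤n no-split = record
    { nonzero = monic⇒nonzero m
    ; nonunit = λ u → ℕₚ.<⇒≢ 1≤n (≡.sym (monic-unit m u))
    ; split   = splits }
    where
    scale-monic : ∀ {f d l} → DegLT f (suc d) → l R.* coeff f d ≈ 1# → MonicDeg (const l *P f) d
    scale-monic {f} {d} {l} f< eq =
      R.trans (coeff-≈ (const-* l f) d) (R.trans (coeff-scale l f d) eq) , degLT-* (const l) f (degLT-length (const l)) f<

    unit : ∀ {f l d} → d ≡ 0 → MonicDeg (const l *P f) d → Unit f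
    unit {f} {l} ≡.refl ml = divides (const l) (≋-trans (≋-sym (monic-0⇒one ml)) (*P-comm (const l) f))

    splits : ∀ a b → g ≋ a *P b → Unit a ⊎ Unit b
    splits a b g≋ab = conclude (factor-degrees a b (monic⇒degree (monic-resp g≋ab m)))
      where
      conclude : (Σ ℕ λ d → Σ ℕ λ e → Degree a d × Degree b e × (n ≡ d ℕ.+ e)) → Unit a ⊎ Unit b
      conclude (d , e , (_ , a<) , (_ , b<) , ≡.refl) = Data.Sum.map (λ i≡0 → unit i≡0 ma) (λ j≡0 → unit j≡0 mb)
        (no-split ma mb (begin
          g ≈⟨ g≋ab ⟩
          a *P b ≈⟨ *P-identityˡ (a *P b) ⟨
          const 1# *P (a *P b) ≈⟨ *P-congʳ (a *P b) (const-cong la*lb) ⟨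
          const (la R.* lb) *P (a *P b) ≈⟨ *P-congʳ (a *P b) (const-homo-* la lb) ⟩
          (const la *P const lb) *P (a *P b) ≈⟨ solve 4 (λ x y a b → (x :* y) :* (a :* b) := (y :* a) :* (x :* b)) ≋-refl (const la) (const lb) a b ⟩
          (const lb *P a) *P (const la *P b) ∎))
        where
        la = coeff a d
        lb = coeff b e
        la*lb : la R.* lb ≈ 1#
        la*lb = R.trans (R.sym (lead-* a b a< b<)) (proj₁ (monic-resp g≋ab m))
        ma = scale-monic {a} {d} {lb} a< (R.trans (R.*-comm lb la) la*lb)
        mb = scale-monic {b} {e} {la} b< la*lb

  -- A greatest common divisor over the field of fractions with cleared denominators: `D` is a
  -- combination of `A` and `B` and divides nonzero constant multiples of both.
  record PseudoGcd (A B : Pol) : Set where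
    field
      D u v E E′ : Pol
      c c′ : R.Carrier
      D≋   : D ≋ u *P A +P v *P B
      c≉0  : ¬ (c ≈ 0#)
      c′≉0 : ¬ (c′ ≈ 0#)
      cA   : const c *P A ≋ D *P E
      c′B  : const c′ *P B ≋ D *P E′

  private
    pg-sym : ∀ {A B} → PseudoGcd A B → PseudoGcd B A
    pg-sym {A} {B} g = record
      { D = D ; u = v ; v = u ; E = E′ ; E′ = E ; c = c′ ; c′ = c
      ; D≋ = ≋-trans D≋ (+P-comm (u *P A) (v *P B)) ; c≉0 = c′≉0 ; c′≉0 = c≉0 ; cA = c′B ; c′B = cA }
      where open PseudoGcd g

    pg-zero : ∀ {A} B → A ≋ [] → PseudoGcd A B
    pg-zero {A} B A≋0 = record
      { D = B ; u = [] ; v = oneP ; E = [] ; E′ = oneP ; c = 1# ; c′ = 1#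
      ; D≋ = ≋-sym (*P-identityˡ B) ; c≉0 = 1≉0 ; c′≉0 = 1≉0
      ; cA = ≋-trans (*P-congˡ oneP A≋0) (≋-trans (*P-zeroʳ oneP) (≋-sym (*P-zeroʳ B)))
      ; c′B = *P-comm oneP B }

    -- A step of pseudo-division: `A` is scaled by `β` first, so that no coefficient has to be
    -- inverted, and the scalars accumulate in `c`.
    pg-reduce : ∀ {A B} α β s → ¬ (β ≈ 0#) →
      PseudoGcd (const β *P A +P negP (const α *P (s *P B))) B → PseudoGcd A B
    pg-reduce {A} {B} α β s β≉0 g = record
      { D = D ; u = u *P const β ; v = v +P negP (u *P (const α *P s))
      ; E = const c′ *P E +P const c *P (const α *P (s *P E′)) ; E′ = E′
      ; c = (c R.* c′) R.* β ; c′ = c′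
      ; D≋ = ≋-trans D≋ (solve 7 (λ u b A a s B v →
               u :* (b :* A :- a :* (s :* B)) :+ v :* B := (u :* b) :* A :+ (v :- u :* (a :* s)) :* B)
               ≋-refl u (const β) A (const α) s B v)
      ; c≉0 = *-nonzero (*-nonzero c≉0 c′≉0) β≉0 ; c′≉0 = c′≉0
      ; cA = begin
          const ((c R.* c′) R.* β) *P A
            ≈⟨ *P-congʳ A (≋-trans (const-homo-* (c R.* c′) β) (*P-congʳ (const β) (const-homo-* c c′))) ⟩
          ((const c *P const c′) *P const β) *P A
            ≈⟨ solve 7 (λ c c′ b A a s B → c :* c′ :* b :* A
                 := c′ :* (c :* (b :* A :- a :* (s :* B))) :+ c :* (a :* (s :* (c′ :* B))))
                 ≋-refl (const c) (const c′) (const β) A (const α) s B ⟩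
          const c′ *P (const c *P (const β *P A +P negP (const α *P (s *P B)))) +P const c *P (const α *P (s *P (const c′ *P B)))
            ≈⟨ +P-cong (*P-congˡ (const c′) cA) (*P-congˡ (const c) (*P-congˡ (const α) (*P-congˡ s c′B))) ⟩
          const c′ *P (D *P E) +P const c *P (const α *P (s *P (D *P E′)))
            ≈⟨ solve 7 (λ c c′ D E E′ a s → c′ :* (D :* E) :+ c :* (a :* (s :* (D :* E′))) := D :* (c′ :* E :+ c :* (a :* (s :* E′))))
                 ≋-refl (const c) (const c′) D E E′ (const α) s ⟩
          D *P (const c′ *P E +P const c *P (const α *P (s *P E′))) ∎
      ; c′B = c′B }
      where open PseudoGcd g

    cancel-lead : ∀ A B k b → DegLT A (suc (k ℕ.+ b)) → DegLT B (suc b) →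
      DegLT (const (coeff B b) *P A +P negP (const (coeff A (k ℕ.+ b)) *P ((X P.^ k) *P B))) (k ℕ.+ b)
    cancel-lead A B k b A< B< = degLT-pred
      (degLT-+ (degLT-* (const β) A (degLT-length (const β)) A<)
               (degLT-neg (degLT-* (const α) (X^k *P B) (degLT-length (const α)) (degLT-* X^k B (proj₂ mX) B<))))
      (R.trans (coeff-+P (const β *P A) _ a)
        (R.trans (R.+-cong (R.trans (coeff-≈ (const-* β A) a) (coeff-scale β A a))
          (R.trans (coeff-neg (const α *P (X^k *P B)) a) (R.-‿cong
            (R.trans (coeff-≈ (const-* α (X^k *P B)) a) (R.trans (coeff-scale α (X^k *P B) a)
              (R.*-congˡ (R.trans (lead-* X^k B (proj₂ mX) B<) (R.trans (R.*-congʳ (proj₁ mX)) (R.*-identityˡ β)))))))))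
          (R.trans (R.+-congʳ (R.*-comm β α)) (R.-‿inverseʳ _))))
      where
      a = k ℕ.+ b
      α = coeff A a
      β = coeff B b
      X^k = X P.^ k
      mX : MonicDeg X^k k
      mX = ≡.subst (MonicDeg X^k) (ℕₚ.*-identityʳ k) (monic-^ monic-X k)

  -- Euclid's algorithm. In `go` the numbers `a` and `b` bound the degrees strictly; each call
  -- lowers one of them, either because the presumed leading coefficient is zero or by cancelling it
  -- against the other polynomial. `N` bounds their sum.
  pseudo-gcd : ∀ A B → PseudoGcd A B
  pseudo-gcd A B = go (length A ℕ.+ length B) (length A) (length B) A B ℕₚ.≤-refl (degLT-length A) (degLT-length B)
    where
    go : ∀ N a b A B → a ℕ.+ b ≤ N → DegLT A a → DegLT B b → PseudoGcd A B
    go N       zero    b       A B _ A< B< = pg-zero B (degLT-zero A<)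
    go N       (suc a) zero    A B _ A< B< = pg-sym (pg-zero A (degLT-zero B<))
    go (suc N) (suc a) (suc b) A B (s≤s ab≤N) A< B< with zero? (coeff A a) | zero? (coeff B b)
    ... | yes z | _     = go N a (suc b) A B ab≤N (degLT-pred A< z) B<
    ... | no _  | yes z = go N (suc a) b A B (≡.subst (_≤ N) (ℕₚ.+-suc a b) ab≤N) A< (degLT-pred B< z)
    ... | no ¬α | no ¬β with ℕₚ.≤-total b a
    ...   | inj₁ b≤a = pg-reduce (coeff A a) (coeff B b) (X P.^ (a ℕ.∸ b)) ¬β
            (go N a (suc b) _ B ab≤N
              (≡.subst (λ m → DegLT (const (coeff B b) *P A +P negP (const (coeff A m) *P ((X P.^ (a ℕ.∸ b)) *P B))) m) (ℕₚ.m∸n+n≡m b≤a)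
                (cancel-lead A B (a ℕ.∸ b) b (≡.subst (λ m → DegLT A (suc m)) (≡.sym (ℕₚ.m∸n+n≡m b≤a)) A<) B<)) B<)
    ...   | inj₂ a≤b = pg-sym (pg-reduce (coeff B b) (coeff A a) (X P.^ (b ℕ.∸ a)) ¬α
            (pg-sym (go N (suc a) b A _ (≡.subst (_≤ N) (ℕₚ.+-suc a b) ab≤N) A<
              (≡.subst (λ m → DegLT (const (coeff A a) *P B +P negP (const (coeff B m) *P ((X P.^ (b ℕ.∸ a)) *P A))) m) (ℕₚ.m∸n+n≡m a≤b)
                (cancel-lead B A (b ℕ.∸ a) a (≡.subst (λ m → DegLT B (suc m)) (≡.sym (ℕₚ.m∸n+n≡m a≤b)) B<) A<)))))

  -- Gauss's lemma, in the form needed below: it is trivial over a field and holds over ℤ.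
  GaussProperty : Set
  GaussProperty = ∀ {c A n} B C → ¬ (c ≈ 0#) → MonicDeg A n → const c *P A ≋ B *P C →
    Σ Pol λ B₀ → Σ Pol λ C₀ → Σ R.Carrier λ r → (A ≋ B₀ *P C₀) × (B ≋ const r *P B₀)

  module Gauss (gauss : GaussProperty) where

    -- For a pseudo-gcd `D` of g and A, Gauss's lemma turns c g = D E into g = D₀ E₀ with D = r D₀.
    -- If D₀ is a unit, the combination defining `D` expresses r B through g and A B. If E₀ is a
    -- unit, D₀ is g up to a unit and divides c′ A.
    irr-prime : ∀ {g d} → MonicDeg g d → Irr g → ∀ A B → g ∣ A *P B → (g ∣ A) ⊎ (g ∣ B)
    irr-prime {g} {d} m irr A B g∣AB = conclude (gauss D E c≉0 m cA)
      where
      open PseudoGcd (pseudo-gcd g A)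
      conclude : (Σ Pol λ D₀ → Σ Pol λ E₀ → Σ R.Carrier λ r → (g ≋ D₀ *P E₀) × (D ≋ const r *P D₀)) → (g ∣ A) ⊎ (g ∣ B)
      conclude (D₀ , E₀ , r , g≋ , D≋rD₀) with split irr D₀ E₀ g≋
      ... | inj₁ (divides w 1≋D₀w) = inj₂ (monic-∣-cancel-const m r≉0 (∣-resp rB≋ (∣-+ (divides (u *P (w *P B)) ≋-refl) (∣-*ˡ (v *P w) g∣AB))))
        where
        rB≋ : g *P (u *P (w *P B)) +P (v *P w) *P (A *P B) ≋ const r *P B
        rB≋ = begin
          g *P (u *P (w *P B)) +P (v *P w) *P (A *P B)
            ≈⟨ solve 6 (λ g u w B v A → g :* (u :* (w :* B)) :+ (v :* w) :* (A :* B) := (u :* g :+ v :* A) :* (w :* B)) ≋-refl g u w B v A ⟩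
          (u *P g +P v *P A) *P (w *P B) ≈⟨ *P-congʳ (w *P B) D≋ ⟨
          D *P (w *P B) ≈⟨ *P-congʳ (w *P B) D≋rD₀ ⟩
          (const r *P D₀) *P (w *P B) ≈⟨ solve 4 (λ r d w B → (r :* d) :* (w :* B) := (r :* B) :* (d :* w)) ≋-refl (const r) D₀ w B ⟩
          (const r *P B) *P (D₀ *P w) ≈⟨ *P-congˡ (const r *P B) 1≋D₀w ⟨
          (const r *P B) *P oneP ≈⟨ P.*-identityʳ _ ⟩
          const r *P B ∎
        r≉0 : ¬ (r ≈ 0#)
        r≉0 r≈0 = monic⇒nonzero m (const-cancel c≉0 (≋-trans cA (*P-zeroˡ E (≋-trans D≋rD₀
          (*P-zeroˡ D₀ (≋-trans (const-cong r≈0) const-0))))))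
      ... | inj₂ (divides w 1≋E₀w) = inj₁ (monic-∣-cancel-const m c′≉0 (divides (const r *P (w *P E′)) (begin
          const c′ *P A ≈⟨ c′B ⟩
          D *P E′ ≈⟨ *P-congʳ E′ D≋rD₀ ⟩
          (const r *P D₀) *P E′ ≈⟨ P.*-identityʳ _ ⟨
          ((const r *P D₀) *P E′) *P oneP ≈⟨ *P-congˡ ((const r *P D₀) *P E′) 1≋E₀w ⟩
          ((const r *P D₀) *P E′) *P (E₀ *P w) ≈⟨ solve 5 (λ r d e f w → ((r :* d) :* e) :* (f :* w) := (d :* f) :* (r :* (w :* e))) ≋-refl (const r) D₀ E′ E₀ w ⟩
          (D₀ *P E₀) *P (const r *P (w *P E′)) ≈⟨ *P-congʳ (const r *P (w *P E′)) g≋ ⟨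
          g *P (const r *P (w *P E′)) ∎)))

    irr-∤-^ : ∀ {g d} → MonicDeg g d → Irr g → ∀ {A} → ¬ (g ∣ A) → ∀ n → ¬ (g ∣ (A P.^ n))
    irr-∤-^ m irr g∤A zero    g∣1 = nonunit irr g∣1
    irr-∤-^ m irr {A} g∤A (suc n) g∣A^n with irr-prime m irr A (A P.^ n) g∣A^n
    ... | inj₁ g∣A = g∤A g∣A
    ... | inj₂ g∣  = irr-∤-^ m irr g∤A n g∣

    -- A prime g that does not divide S takes all its multiplicity in f S from f; one factor g is
    -- split off at a time and cancelled from both sides.
    ^-∣-cancelʳ : ∀ {g d} → MonicDeg g d → Irr g → ∀ {S} → ¬ (g ∣ S) → ∀ e f → (g P.^ e) ∣ f *P S → (g P.^ e) ∣ f
    ^-∣-cancelʳ m irr g∤S zero f _ = divides f (≋-sym (*P-identityˡ f))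
    ^-∣-cancelʳ {g} m irr {S} g∤S (suc e) f (divides q fS≋)
      with irr-prime m irr f S (divides ((g P.^ e) *P q) (≋-trans fS≋ (*P-assoc g (g P.^ e) q)))
    ... | inj₂ g∣S = ⊥-elim (g∤S g∣S)
    ... | inj₁ (divides f′ f≋gf′) = ∣-resp (≋-sym f≋gf′) (∣-*-cong (∣-refl {g}) (^-∣-cancelʳ m irr g∤S e f′ (divides q
            (monic-cancel m (begin
              g *P (f′ *P S) ≈⟨ *P-assoc g f′ S ⟨
              (g *P f′) *P S ≈⟨ *P-congʳ S f≋gf′ ⟨
              f *P S ≈⟨ fS≋ ⟩
              (g *P (g P.^ e)) *P q ≈⟨ *P-assoc g (g P.^ e) q ⟩
              g *P ((g P.^ e) *P q) ∎)))))

-- Primitive parts of the Fibonacci polynomials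

-- Stated for a commutative monoid, since it serves both for products of polynomials and for sums of
-- totients.
module BigOp (M : CommutativeMonoid 0ℓ 0ℓ) where
  open CommutativeMonoid M
  open import Relation.Binary.Reasoning.Setoid setoid
  open Algebra.Properties.CommutativeSemigroup commutativeSemigroup using (interchange)

  -- The index runs over 1, …, n.
  ⨁ : ℕ → (ℕ → Carrier) → Carrier
  ⨁ zero    f = ε
  ⨁ (suc n) f = f (suc n) ∙ ⨁ n f

  ⨁-cong : ∀ n {f g} → (∀ i → 1 ≤ i → i ≤ n → f i ≈ g i) → ⨁ n f ≈ ⨁ n g
  ⨁-cong zero    p = refl
  ⨁-cong (suc n) p = ∙-cong (p (suc n) (s≤s z≤n) ℕₚ.≤-refl) (⨁-cong n λ i 1≤i i≤n → p i 1≤i (ℕₚ.m≤n⇒m≤1+n i≤n))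

  ⨁-∙ : ∀ n f g → ⨁ n (λ i → f i ∙ g i) ≈ ⨁ n f ∙ ⨁ n g
  ⨁-∙ zero    f g = sym (identityˡ ε)
  ⨁-∙ (suc n) f g = trans (∙-congˡ (⨁-∙ n f g)) (interchange _ _ _ _)

  ⨁-ε : ∀ n → ⨁ n (λ _ → ε) ≈ ε
  ⨁-ε zero    = refl
  ⨁-ε (suc n) = trans (identityˡ _) (⨁-ε n)

  ⨁-swap : ∀ m n (f : ℕ → ℕ → Carrier) → ⨁ m (λ i → ⨁ n (f i)) ≈ ⨁ n (λ j → ⨁ m (λ i → f i j))
  ⨁-swap zero    n f = sym (⨁-ε n)
  ⨁-swap (suc m) n f = trans (∙-congˡ (⨁-swap m n f)) (sym (⨁-∙ n (f (suc m)) _))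

  ⨁-extend : ∀ k m f → (∀ i → m < i → i ≤ k ℕ.+ m → f i ≈ ε) → ⨁ (k ℕ.+ m) f ≈ ⨁ m f
  ⨁-extend zero    m f p = refl
  ⨁-extend (suc k) m f p = trans (∙-cong (p (suc (k ℕ.+ m)) (s≤s (ℕₚ.m≤n+m m k)) ℕₚ.≤-refl)
    (⨁-extend k m f λ i m<i i≤ → p i m<i (ℕₚ.m≤n⇒m≤1+n i≤))) (identityˡ _)

  ⨁-extend-≤ : ∀ {m n} f → m ≤ n → (∀ i → m < i → i ≤ n → f i ≈ ε) → ⨁ n f ≈ ⨁ m f
  ⨁-extend-≤ {m} {n} f m≤n p = ≡.subst (λ n → (∀ i → m < i → i ≤ n → f i ≈ ε) → ⨁ n f ≈ ⨁ m f)
    (ℕₚ.m∸n+n≡m m≤n) (⨁-extend (n ℕ.∸ m) m f) p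

  ⨁-single : ∀ n k f → 1 ≤ k → k ≤ n → (∀ i → i ≢ k → f i ≈ ε) → ⨁ n f ≈ f k
  ⨁-single zero    k f 1≤k k≤0 p with () ← ℕₚ.≤-trans 1≤k k≤0
  ⨁-single (suc n) k f 1≤k k≤n p with suc n ℕ.≟ k
  ... | yes ≡.refl = trans (∙-congˡ (trans (⨁-cong n λ i _ i≤n → p i (ℕₚ.<⇒≢ (s≤s i≤n))) (⨁-ε n))) (identityʳ _)
  ... | no n≢k = trans (∙-cong (p (suc n) n≢k)
          (⨁-single n k f 1≤k (ℕₚ.≤-pred (ℕₚ.≤∧≢⇒< k≤n λ e → n≢k (≡.sym e))) p)) (identityˡ _)

  ⨁-multiples : ∀ c n f → 1 ≤ c → (∀ i → ¬ (c ∣ℕ i) → f i ≈ ε) → ⨁ (n ℕ.* c) f ≈ ⨁ n (λ i → f (i ℕ.* c))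
  ⨁-multiples c zero    f 1≤c p = refl
  ⨁-multiples (suc c) (suc n) f 1≤c p = ∙-congˡ (trans
    (⨁-extend c (n ℕ.* suc c) f λ i <i i≤ → p i (between i <i i≤))
    (⨁-multiples (suc c) n f 1≤c p))
    where
    between : ∀ i → n ℕ.* suc c < i → i ≤ c ℕ.+ n ℕ.* suc c → ¬ (suc c ∣ℕ i)
    between i <i i≤ (ℕ∣.divides q ≡.refl) =
      ℕₚ.<⇒≱ (s≤s i≤) (ℕₚ.*-monoˡ-≤ (suc c) (ℕₚ.*-cancelʳ-< (suc c) n q <i))

  when : ∀ {A : Set} → Dec A → Carrier → Carrier
  when (yes _) x = x
  when (no  _) x = ε

  when-yes : ∀ {A : Set} (d : Dec A) {x} → A → when d x ≈ x
  when-yes (yes _) a = refl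
  when-yes (no ¬a) a = ⊥-elim (¬a a)

  when-no : ∀ {A : Set} (d : Dec A) {x} → ¬ A → when d x ≈ ε
  when-no (yes a) ¬a = ⊥-elim (¬a a)
  when-no (no _)  ¬a = refl

  when-cong : ∀ {A B : Set} (d : Dec A) (e : Dec B) {x y} → (A → B) → (B → A) → (A → x ≈ y) → when d x ≈ when e y
  when-cong (yes a) (yes _) f g p = p a
  when-cong (yes a) (no ¬b) f g p = ⊥-elim (¬b (f a))
  when-cong (no ¬a) (yes b) f g p = ⊥-elim (¬a (g b))
  when-cong (no _)  (no _)  f g p = refl

  unless : ∀ {A : Set} → Dec A → Carrier → Carrier
  unless (yes _) x = ε
  unless (no  _) x = x

  unless-no : ∀ {A : Set} (d : Dec A) {x} → ¬ A → unless d x ≈ x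
  unless-no (yes a) ¬a = ⊥-elim (¬a a)
  unless-no (no _)  ¬a = refl

  -- Separates, in a product over the divisors of n, those that already divide some g ∣ n from the
  -- new ones.
  when-split : ∀ {A B : Set} (d : Dec A) (e : Dec B) x → (A → B) → when e x ≈ when d x ∙ unless d (when e x)
  when-split (yes a) (yes _) x f = sym (identityʳ x)
  when-split (yes a) (no ¬b) x f = ⊥-elim (¬b (f a))
  when-split (no _)  e       x f = sym (identityˡ _)

-- The formal derivative

module Derivative (R : CommutativeRing 0ℓ 0ℓ) where
  private module R = RingKit R
  open PolyDegree R
  private module P = RingKit polyRing
  open P using (solve; _:=_; _:+_; _:*_; begin_; step-≈-⟩; _∎)

  -- The product rule for a + x f, which avoids integer multiples of the coefficients.
  ∂ : Pol → Pol
  ∂ []      = []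
  ∂ (a ∷ f) = f +P (R.0# ∷ ∂ f)

  ∂-zero : ∀ {f} → f ≋ [] → ∂ f ≋ []
  ∂-zero {[]}    p = ≋-refl
  ∂-zero {a ∷ f} p = +P-cong (tail-≋[] p) (≋-trans (∷-cong R.refl (∂-zero {f} (tail-≋[] p))) 0∷[]≋[])

  ∂-cong : ∀ {f g} → f ≋ g → ∂ f ≋ ∂ g
  ∂-cong {[]}    {g}     p = ≋-sym (∂-zero {g} (≋-sym p))
  ∂-cong {a ∷ f} {[]}    p = ∂-zero {a ∷ f} p
  ∂-cong {a ∷ f} {b ∷ g} p = +P-cong (tail-≋ p) (∷-cong R.refl (∂-cong {f} {g} (tail-≋ p)))

  ∂-+ : ∀ f g → ∂ (f +P g) ≋ ∂ f +P ∂ g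
  ∂-+ []      g       = ≋-refl
  ∂-+ (a ∷ f) []      = ≋-sym (+P-identityʳ _)
  ∂-+ (a ∷ f) (b ∷ g) = ≋-trans
    (+P-cong {f +P g} ≋-refl (≋-trans (∷-cong R.refl (∂-+ f g)) (0∷-+P (∂ f) (∂ g))))
    (+P-interchange f g _ _)

  ∂-scale : ∀ c f → ∂ (map (c R.*_) f) ≋ map (c R.*_) (∂ f)
  ∂-scale c []      = ≋-refl
  ∂-scale c (a ∷ f) = ≋-trans (+P-cong {map (c R.*_) f} ≋-refl (∷-cong (R.sym (R.zeroʳ c)) (∂-scale c f)))
    (≋-sym (scale-+P c f (R.0# ∷ ∂ f)))

  ∂-* : ∀ f g → ∂ (f *P g) ≋ ∂ f *P g +P f *P ∂ g
  ∂-* []      g = ≋-refl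
  ∂-* (a ∷ f) g = begin
    ∂ (map (a R.*_) g +P (R.0# ∷ (f *P g)))
      ≈⟨ ∂-+ (map (a R.*_) g) (R.0# ∷ (f *P g)) ⟩
    ∂ (map (a R.*_) g) +P (f *P g +P (R.0# ∷ ∂ (f *P g)))
      ≈⟨ +P-cong (≋-trans (∂-scale a g) (≋-sym (const-* a (∂ g))))
           (+P-cong {f *P g} ≋-refl (≋-trans (∷-cong R.refl (∂-* f g)) (≋-sym (X-* (∂ f *P g +P f *P ∂ g))))) ⟩
    const a *P ∂ g +P (f *P g +P X *P (∂ f *P g +P f *P ∂ g))
      ≈⟨ solve 6 (λ a f g f′ g′ x → a :* g′ :+ (f :* g :+ x :* (f′ :* g :+ f :* g′)) := (f :+ x :* f′) :* g :+ (a :+ x :* f) :* g′)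
           ≋-refl (const a) f g (∂ f) (∂ g) X ⟩
    (f +P X *P ∂ f) *P g +P (const a +P X *P f) *P ∂ g
      ≈⟨ +P-cong (*P-congʳ g (+P-cong {f} ≋-refl (X-* (∂ f)))) (*P-congʳ (∂ g) (≋-sym (∷-decompose a f))) ⟩
    (f +P (R.0# ∷ ∂ f)) *P g +P (a ∷ f) *P ∂ g ∎

  ∂-X : ∂ X ≋ oneP
  ∂-X = coeffwise λ where
    zero          → R.+-identityʳ _
    (suc zero)    → R.refl
    (suc (suc i)) → R.refl

  square-∣-∂ : ∀ {g f} → g *P g ∣ f → g ∣ ∂ f
  square-∣-∂ {g} {f} (divides h f≋) = divides ((∂ g *P h +P ∂ g *P h) +P g *P ∂ h) (begin
    ∂ f ≈⟨ ∂-cong f≋ ⟩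
    ∂ ((g *P g) *P h) ≈⟨ ∂-* (g *P g) h ⟩
    ∂ (g *P g) *P h +P (g *P g) *P ∂ h ≈⟨ +P-cong {g = (g *P g) *P ∂ h} (*P-congʳ h (∂-* g g)) ≋-refl ⟩
    (∂ g *P g +P g *P ∂ g) *P h +P (g *P g) *P ∂ h
      ≈⟨ solve 4 (λ g g′ h h′ → (g′ :* g :+ g :* g′) :* h :+ (g :* g) :* h′ := g :* ((g′ :* h :+ g′ :* h) :+ g :* h′)) ≋-refl g (∂ g) h (∂ h) ⟩
    g *P ((∂ g *P h +P ∂ g *P h) +P g *P ∂ h) ∎)

module PrimitiveParts (R : CommutativeRing 0ℓ 0ℓ) where
  private module R = RingKit R
  open PolyDegree R
  private module P = RingKit polyRing
  open P using (solve; _:=_; _:+_; _:*_; _:-_; con; begin_; step-≈-⟩; _∎)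
  open Fibonacci polyRing X public
  open BigOp P.*-commutativeMonoid public

  monic-fib : ∀ n → MonicDeg (fib (suc n)) n
  monic-fib zero          = monic-one
  monic-fib (suc zero)    = monic-resp (≋-sym (≋-trans (+P-identityʳ _) (P.*-identityʳ X))) monic-X
  monic-fib (suc (suc n)) = monic-+ (monic-* monic-X (monic-fib (suc n)))
    (degLT-mono (ℕₚ.n≤1+n (suc n)) (proj₂ (monic-fib n)))

  monic-disc : MonicDeg disc 2
  monic-disc = monic-+ (monic-* monic-X monic-X) (degLT-resp (const-ν 4) (degLT-mono (s≤s z≤n) (degLT-length (const (R.ν 4)))))

  -- Multiplying L_n² = disc F_n² + 4 (-1)^n by the sign (-1)^n isolates 4.
  luc²-∣ : ∀ {g n} → g ∣ luc n → g ∣ fib n → g ∣ P.ν 4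
  luc²-∣ {g} {n} g∣luc g∣fib = ∣-resp eq (∣-sub (∣-*ˡ (sgn n) (∣-*ˡ (luc n) g∣luc)) (∣-*ˡ (sgn n P.* disc) (∣-*ˡ (fib n) g∣fib)))
    where
    eq : sgn n P.* (luc n P.* luc n) P.- (sgn n P.* disc) P.* (fib n P.* fib n) ≋ P.ν 4
    eq = begin
      sgn n P.* (luc n P.* luc n) P.- (sgn n P.* disc) P.* (fib n P.* fib n)
        ≈⟨ P.+-congʳ (P.*-congˡ {sgn n} (luc² n)) ⟩
      sgn n P.* (disc P.* (fib n P.* fib n) P.+ P.ν 4 P.* sgn n) P.- (sgn n P.* disc) P.* (fib n P.* fib n)
        ≈⟨ solve 3 (λ s d f → s :* (d :* (f :* f) :+ con (+ 4) :* s) :- (s :* d) :* (f :* f) := con (+ 4) :* (s :* s)) ≋-refl (sgn n) disc (fib n) ⟩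
      P.ν 4 P.* (sgn n P.* sgn n)
        ≈⟨ P.*-congˡ {P.ν 4} (sgn² n) ⟩
      P.ν 4 P.* P.1#
        ≈⟨ P.*-identityʳ (P.ν 4) ⟩
      P.ν 4 ∎

  open Derivative R public

  disc-∂-fib : ∀ n → disc P.* ∂ (fib n) ≋ P.ν n P.* luc n P.- X P.* fib n
  disc-∂-fib = ∂-fib ∂ ∂-cong ∂-+ ∂-* ∂-X

  ∏∣ : ℕ → ℕ → (ℕ → Pol) → Pol
  ∏∣ n N f = ⨁ N λ d → when (d ℕ∣.∣? n) (f d)

  ∏∣-proper : ∀ {g n} f → g ∣ℕ n → 1 ≤ g → g < n → Σ Pol λ h → ∏∣ n n f ≋ ∏∣ g g f *P (f n *P h)
  ∏∣-proper {g} {suc n} f g∣n 1≤g g<n = ⨁ n rest , (begin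
    ⨁ (suc n) (λ d → when (d ℕ∣.∣? suc n) (f d))
      ≈⟨ ⨁-cong (suc n) (λ d _ _ → when-split (d ℕ∣.∣? g) (d ℕ∣.∣? suc n) (f d) λ d∣g → ℕ∣.∣-trans d∣g g∣n) ⟩
    ⨁ (suc n) (λ d → when (d ℕ∣.∣? g) (f d) P.* rest d)
      ≈⟨ ⨁-∙ (suc n) (λ d → when (d ℕ∣.∣? g) (f d)) rest ⟩
    ⨁ (suc n) (λ d → when (d ℕ∣.∣? g) (f d)) P.* ⨁ (suc n) rest
      ≈⟨ P.*-cong {⨁ (suc n) (λ d → when (d ℕ∣.∣? g) (f d))}
           (⨁-extend-≤ (λ d → when (d ℕ∣.∣? g) (f d)) (ℕₚ.<⇒≤ g<n)
             (λ i g<i _ → when-no (i ℕ∣.∣? g) λ i∣g → ℕₚ.<⇒≱ g<i (ℕ∣.∣⇒≤ {{ℕ.>-nonZero 1≤g}} i∣g)))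
           (*P-congʳ (⨁ n rest) (P.trans {rest (suc n)}
             (unless-no (suc n ℕ∣.∣? g) λ n∣g → ℕₚ.<⇒≱ g<n (ℕ∣.∣⇒≤ {{ℕ.>-nonZero 1≤g}} n∣g))
             (when-yes (suc n ℕ∣.∣? suc n) ℕ∣.∣-refl))) ⟩
    ∏∣ g g f *P (f (suc n) *P ⨁ n rest) ∎)
    where
    rest : ℕ → Pol
    rest d = unless (d ℕ∣.∣? g) (when (d ℕ∣.∣? suc n) (f d))

  ∏∣-1 : ∀ f → ∏∣ 1 1 f ≋ f 1
  ∏∣-1 f = P.*-identityʳ (f 1)

  -- The factorisation into primitive parts up to a bound: the bound lets the parts be constructed
  -- by induction, and the whole record can be reduced modulo p.
  record System (N : ℕ) : Set where
    field
      part       : ℕ → Pol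
      part-monic : ∀ d → 1 ≤ d → d ≤ N → Σ ℕ (MonicDeg (part d))
      product    : ∀ n → 1 ≤ n → n ≤ N → fib n ≋ ∏∣ n n part

  module _ {N : ℕ} (S : System N) where
    open System S

    part-1 : 1 ≤ N → part 1 ≋ oneP
    part-1 1≤N = ≋-sym (≋-trans (product 1 ℕₚ.≤-refl 1≤N) (∏∣-1 part))

    part-∣-fib : ∀ n → 1 ≤ n → n ≤ N → part n ∣ fib n
    part-∣-fib (suc n) 1≤n n≤N = ∣-resp (≋-sym (product (suc n) 1≤n n≤N))
      (∣-resp (*P-congʳ (⨁ n (λ d → when (d ℕ∣.∣? suc n) (part d))) (≋-sym (when-yes (suc n ℕ∣.∣? suc n) ℕ∣.∣-refl)))
        (∣-*ʳ (⨁ n (λ d → when (d ℕ∣.∣? suc n) (part d))) ∣-refl))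

    part-cofactor : ∀ {g n} → 1 ≤ n → n ≤ N → g ∣ℕ n → 1 ≤ g → g < n → Σ Pol λ h → fib n ≋ fib g *P (part n *P h)
    part-cofactor {g} {n} 1≤n n≤N g∣n 1≤g g<n =
      let h , eq = ∏∣-proper part g∣n 1≤g g<n
      in  h , ≋-trans (product n 1≤n n≤N) (≋-trans eq (*P-congʳ (part n *P h)
            (≋-sym (product g 1≤g (ℕₚ.≤-trans (ℕₚ.<⇒≤ g<n) n≤N)))))

    -- For g = gcd e d < e the ideal contains F_g, by the gcd property of the indices, and the
    -- quotient F_e / F_g, a multiple of `part e`. These two generate an ideal containing the
    -- integer e / g. As it divides e, it stays nonzero modulo a prime that does not divide e.
    part-fib-coprime : ∀ e d → 1 ≤ e → e ≤ N → ¬ (e ∣ℕ d) → Σ ℕ λ k → ⟨ part e , fib d ⟩ (P.ν (suc k)) × (suc k ∣ℕ e)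
    part-fib-coprime e d 1≤e e≤N e∤d = coprime (gcd e d) ≡.refl (gcd[m,n]∣m e d) (gcd[m,n]∣n e d)
      where
      coprime : ∀ g → gcd e d ≡ g → g ∣ℕ e → g ∣ℕ d → Σ ℕ λ k → ⟨ part e , fib d ⟩ (P.ν (suc k)) × (suc k ∣ℕ e)
      coprime g _ (ℕ∣.divides zero ≡.refl) _ = ⊥-elim (ℕₚ.<⇒≱ 1≤e z≤n)
      coprime zero _ (ℕ∣.divides (suc k) eq) _ = ⊥-elim (ℕₚ.<⇒≢ 1≤e (≡.sym (≡.trans eq (ℕₚ.*-zeroʳ k))))
      coprime (suc g) gcd≡ (ℕ∣.divides (suc k) e≡) g∣d = k , ν∈ , ℕ∣.divides (suc g) (≡.trans e≡ (ℕₚ.*-comm (suc k) (suc g)))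
        where
        open IsIdeal (⟨,⟩-isIdeal (part e) (fib d))
        I = ⟨ part e , fib d ⟩
        I-mult : ∀ {a b} → a ∣ b → I a → I b
        I-mult = I-∣ (⟨,⟩-isIdeal (part e) (fib d))
        g∣e : suc g ∣ℕ e
        g∣e = ℕ∣.divides (suc k) e≡
        g<e : suc g < e
        g<e = ℕₚ.≤∧≢⇒< (ℕ∣.∣⇒≤ {{ℕ.>-nonZero 1≤e}} g∣e) λ g≡e → e∤d (≡.subst (_∣ℕ d) g≡e g∣d)
        fib-e = fib-quotient (suc g) k
        c = proj₁ fib-e
        cof = part-cofactor 1≤e e≤N g∣e (s≤s z≤n) g<e
        c≋ : c ≋ part e *P proj₁ cof
        c≋ = monic-cancel (monic-fib g) (≋-trans (≋-sym (proj₁ (proj₂ fib-e)))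
               (≋-trans (P.reflexive (≡.cong fib (≡.sym e≡))) (proj₂ cof)))
        c∈ : I c
        c∈ = I-resp (≋-sym c≋) (I-mult (divides (proj₁ cof) ≋-refl) ⟨,⟩-left)
        fib-g∈ : I (fib (suc g))
        fib-g∈ = ≡.subst (λ n → I (fib n)) gcd≡ (ideal-fib-gcd (⟨,⟩-isIdeal (part e) (fib d)) e d
          (I-mult (part-∣-fib e 1≤e e≤N) ⟨,⟩-left) ⟨,⟩-right)
        ν∈ : I (P.ν (suc k))
        ν∈ = let u , v , eq = proj₂ (proj₂ fib-e) in I-resp (≋-sym eq) (I-+ (I-* u c∈) (I-* v fib-g∈))

-- Squarefreeness and existence of the primitive parts

module PrimitivePartsDomain (𝔻 : IntegralDomain) where
  open IntegralDomain 𝔻 renaming (ring to R)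
  private module R = RingKit R
  open Factorization 𝔻
  open PrimitiveParts R
  private module P = RingKit polyRing
  open P using (solve; _:=_; _:+_; _:*_; begin_; step-≈-⟩; step-≈-⟨; _∎)

  ∤-ν : ∀ {g d} n → MonicDeg g (suc d) → ¬ (R.ν n R.≈ R.0#) → ¬ (g ∣ P.ν n)
  ∤-ν n m ν≉0 g∣ν = ν≉0 (coeff-≈ (≋-trans (const-ν n)
    (monic-∣-small m g∣ν (degLT-resp (const-ν n) (degLT-mono (s≤s z≤n) (degLT-length (const (R.ν n))))))) 0)

  ∣-ν*-cancel : ∀ {g d f} n → MonicDeg g d → ¬ (R.ν n R.≈ R.0#) → g ∣ P.ν n *P f → g ∣ f
  ∣-ν*-cancel {f = f} n m ν≉0 g∣ = monic-∣-cancel-const m ν≉0 (∣-resp (*P-congʳ f (≋-sym (const-ν n))) g∣)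

  -- If g divides F_n and disc F_n′, it divides n L_n, hence L_n; a common divisor of F_n and L_n
  -- divides 4.
  ∂-fib-∣ : ∀ {g d n} → MonicDeg g d → ¬ (R.ν n R.≈ R.0#) → g ∣ fib n → g ∣ disc P.* ∂ (fib n) → g ∣ P.ν 4
  ∂-fib-∣ {g} {d} {n} m ν≉0 g∣fib g∣∂ = luc²-∣ {n = n} (∣-ν*-cancel n m ν≉0
    (∣-cancel-+ʳ (∣-resp (disc-∂-fib n) g∣∂) (∣-neg (∣-*ˡ X g∣fib)))) g∣fib

  fib-squarefree : ∀ {g d n} → MonicDeg g (suc d) → ¬ (R.ν n R.≈ R.0#) → ¬ (R.ν 4 R.≈ R.0#) → ¬ (g *P g ∣ fib n)
  fib-squarefree {g} {d} {n} m νn≉0 ν4≉0 g²∣ = ∤-ν 4 m ν4≉0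
    (∂-fib-∣ {n = n} m νn≉0 (∣-trans (divides g ≋-refl) g²∣) (∣-*ˡ disc (square-∣-∂ g²∣)))

  module Existence (char-0 : ∀ n → ¬ (R.ν (suc n) R.≈ R.0#)) where

    -- Coprimality over the field of fractions, in a form without fractions: the ideal contains a
    -- positive integer.
    Cop : Pol → Pol → Set
    Cop A B = Σ ℕ λ k → ⟨ A , B ⟩ (P.ν (suc k))

    cop-one : ∀ A → Cop A oneP
    cop-one A = 0 , [] , oneP , ≋-sym (P.*-identityʳ oneP)

    cop-* : ∀ {A} B B′ → Cop A B → Cop A B′ → Cop A (B *P B′)
    cop-* {A} B B′ (k , u , v , eq) (k′ , u′ , v′ , eq′) =
      k′ ℕ.+ k ℕ.* suc k′ , (u *P (u′ *P A) +P u *P (v′ *P B′)) +P (v *P B) *P u′ , v *P v′ , (begin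
        P.ν (suc k ℕ.* suc k′) ≈⟨ P.ν-* (suc k) (suc k′) ⟩
        P.ν (suc k) *P P.ν (suc k′) ≈⟨ *P-cong eq eq′ ⟩
        (u *P A +P v *P B) *P (u′ *P A +P v′ *P B′)
          ≈⟨ solve 7 (λ A B B′ u v u′ v′ → (u :* A :+ v :* B) :* (u′ :* A :+ v′ :* B′)
               := ((u :* (u′ :* A) :+ u :* (v′ :* B′)) :+ (v :* B) :* u′) :* A :+ (v :* v′) :* (B :* B′)) ≋-refl A B B′ u v u′ v′ ⟩
        ((u *P (u′ *P A) +P u *P (v′ *P B′)) +P (v *P B) *P u′) *P A +P (v *P v′) *P (B *P B′) ∎)

    cop-∣ : ∀ {A B C} → C ∣ B → Cop A B → Cop A C
    cop-∣ {A} {B} {C} (divides q B≋) (k , u , v , eq) = k , u , v *P q , (begin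
      P.ν (suc k) ≈⟨ eq ⟩
      u *P A +P v *P B ≈⟨ +P-cong {u *P A} ≋-refl (*P-congˡ v B≋) ⟩
      u *P A +P v *P (C *P q) ≈⟨ solve 5 (λ u A v C q → u :* A :+ v :* (C :* q) := u :* A :+ (v :* q) :* C) ≋-refl u A v C q ⟩
      u *P A +P (v *P q) *P C ∎)

    -- From k+1 = u A + v B follows (k+1) F = u A F + v B F, a multiple of A B; the integer cancels
    -- because A B is monic.
    cop-*-∣ : ∀ {A B F d} → MonicDeg (A *P B) d → Cop A B → A ∣ F → B ∣ F → A *P B ∣ F
    cop-*-∣ {A} {B} {F} m (k , u , v , eq) (divides a F≋a) (divides b F≋b) =
      ∣-ν*-cancel (suc k) m (char-0 k) (divides (u *P b +P v *P a) (begin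
        P.ν (suc k) *P F ≈⟨ *P-congʳ F eq ⟩
        (u *P A +P v *P B) *P F ≈⟨ solve 5 (λ u A v B F → (u :* A :+ v :* B) :* F := u :* (A :* F) :+ v :* (B :* F)) ≋-refl u A v B F ⟩
        u *P (A *P F) +P v *P (B *P F) ≈⟨ +P-cong (*P-congˡ u (*P-congˡ A F≋b)) (*P-congˡ v (*P-congˡ B F≋a)) ⟩
        u *P (A *P (B *P b)) +P v *P (B *P (A *P a))
          ≈⟨ solve 6 (λ u A v B a b → u :* (A :* (B :* b)) :+ v :* (B :* (A :* a)) := (A :* B) :* (u :* b :+ v :* a)) ≋-refl u A v B a b ⟩
        (A *P B) *P (u *P b +P v *P a) ∎))

    module _ {N : ℕ} (S : System N) where
      open System S

      private
        n = suc N

        factor : ℕ → Pol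
        factor d = when (d ℕ∣.∣? n) (part d)

        factor-monic : ∀ d → 1 ≤ d → d ≤ N → Σ ℕ (MonicDeg (factor d))
        factor-monic d 1≤d d≤N with d ℕ∣.∣? n
        ... | yes _ = part-monic d 1≤d d≤N
        ... | no  _ = 0 , monic-one

        product-monic : ∀ M → M ≤ N → Σ ℕ (MonicDeg (⨁ M factor))
        product-monic zero    _   = 0 , monic-one
        product-monic (suc M) M<N =
          let e , me = factor-monic (suc M) (s≤s z≤n) M<N
              k , mk = product-monic M (ℕₚ.<⇒≤ M<N)
          in  e ℕ.+ k , monic-* me mk

        -- No positive index below e is a multiple of e, so `part-fib-coprime` applies to every
        -- factor.
        factor-coprime : ∀ e M → 1 ≤ e → e ≤ N → M < e → Cop (part e) (⨁ M factor)
        factor-coprime e zero    1≤e e≤N _   = cop-one (part e)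
        factor-coprime e (suc M) 1≤e e≤N M<e = cop-* (factor (suc M)) (⨁ M factor) one-factor
          (factor-coprime e M 1≤e e≤N (ℕₚ.<⇒≤ M<e))
          where
          one-factor : Cop (part e) (factor (suc M))
          one-factor with suc M ℕ∣.∣? n
          ... | no  _ = cop-one (part e)
          ... | yes _ =
            let k , c , _ = part-fib-coprime S e (suc M) 1≤e e≤N λ e∣M → ℕₚ.<⇒≱ M<e (ℕ∣.∣⇒≤ e∣M)
            in  cop-∣ (part-∣-fib S (suc M) (s≤s z≤n) (ℕₚ.≤-trans (ℕₚ.<⇒≤ M<e) e≤N)) (k , c)

        product-∣ : ∀ M → M ≤ N → ⨁ M factor ∣ fib n
        product-∣ zero    _   = divides (fib n) (≋-sym (*P-identityˡ (fib n)))
        product-∣ (suc M) M<N = step (suc M ℕ∣.∣? n) (product-monic (suc M) M<N)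
          where
          step : (d : Dec (suc M ∣ℕ n)) → Σ ℕ (MonicDeg (when d (part (suc M)) P.* ⨁ M factor)) →
                 when d (part (suc M)) P.* ⨁ M factor ∣ fib n
          step (no _) _ = ∣-respˡ (≋-sym (*P-identityˡ (⨁ M factor))) (product-∣ M (ℕₚ.<⇒≤ M<N))
          step (yes M∣n) (_ , m) = cop-*-∣ m (factor-coprime (suc M) M (s≤s z≤n) M<N ℕₚ.≤-refl)
            (∣-trans (part-∣-fib S (suc M) (s≤s z≤n) M<N) (fib-∣-∣ M∣n)) (product-∣ M (ℕₚ.<⇒≤ M<N))
            where
            fib-∣-∣ : suc M ∣ℕ n → fib (suc M) ∣ fib n
            fib-∣-∣ (ℕ∣.divides q eq) = ∣-resp (P.reflexive (≡.cong fib (≡.sym eq))) (fib-∣ (suc M) q)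

      -- The new part is the quotient of F_(N+1) by the product of the parts at its proper divisors;
      -- that product divides because its factors are pairwise coprime up to integers.
      extend : System (suc N)
      extend = build (product-∣ N ℕₚ.≤-refl) (product-monic N ℕₚ.≤-refl)
        where
        build : ⨁ N factor ∣ fib n → Σ ℕ (MonicDeg (⨁ N factor)) → System (suc N)
        build (divides Q fib≋) (e , me) = record { part = part′ ; part-monic = monic′ ; product = product′ }
          where
          part′ : ℕ → Pol
          part′ d with d ℕ.≟ n
          ... | yes _ = Q
          ... | no  _ = part d

          part′-top : part′ n ≋ Q
          part′-top with n ℕ.≟ n
          ... | yes _ = ≋-refl
          ... | no ¬p = ⊥-elim (¬p ≡.refl)

          part′-below : ∀ d → d ≤ N → part′ d ≋ part d
          part′-below d d≤N with d ℕ.≟ n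
          ... | yes ≡.refl = ⊥-elim (ℕₚ.<⇒≱ ℕₚ.≤-refl d≤N)
          ... | no  _ = ≋-refl

          agree : ∀ k M → M ≤ N → ⨁ M (λ d → when (d ℕ∣.∣? k) (part′ d)) ≋ ⨁ M (λ d → when (d ℕ∣.∣? k) (part d))
          agree k M M≤N = ⨁-cong M λ d _ d≤M → when-cong (d ℕ∣.∣? k) (d ℕ∣.∣? k) (λ x → x) (λ x → x)
            λ _ → part′-below d (ℕₚ.≤-trans d≤M M≤N)

          monic′ : ∀ d → 1 ≤ d → d ≤ suc N → Σ ℕ (MonicDeg (part′ d))
          monic′ d 1≤d d≤n with ℕₚ.m≤n⇒m<n∨m≡n d≤n
          ... | inj₁ d<n = let k , mk = part-monic d 1≤d (ℕₚ.≤-pred d<n)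
                           in  k , monic-resp (≋-sym (part′-below d (ℕₚ.≤-pred d<n))) mk
          ... | inj₂ ≡.refl = let k , mk , _ = monic-cofactor me Q (monic-resp fib≋ (monic-fib N))
                              in  k , monic-resp (≋-sym part′-top) mk

          product′ : ∀ k → 1 ≤ k → k ≤ suc N → fib k ≋ ∏∣ k k part′
          product′ k 1≤k k≤n with ℕₚ.m≤n⇒m<n∨m≡n k≤n
          ... | inj₁ k<n = ≋-trans (product k 1≤k (ℕₚ.≤-pred k<n)) (≋-sym (agree k k (ℕₚ.≤-pred k<n)))
          ... | inj₂ ≡.refl = begin
            fib n ≈⟨ fib≋ ⟩
            ⨁ N factor *P Q ≈⟨ *P-comm (⨁ N factor) Q ⟩
            Q *P ⨁ N factor ≈⟨ *P-cong (≋-trans (when-yes (n ℕ∣.∣? n) ℕ∣.∣-refl) part′-top) (agree n N ℕₚ.≤-refl) ⟨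
            ∏∣ n n part′ ∎

    system : ∀ N → System N
    system zero    = record { part = λ _ → oneP ; part-monic = λ { (suc _) _ () } ; product = λ { (suc _) _ () } }
    system (suc N) = extend (system N)

-- Reduction modulo p

-- The quotient keeps the carrier and coarsens the equality. It serves for ℤ modulo p, for ℤ modulo
-- the modulus of an order, and for polynomials modulo an irreducible one.
module Quotient (C : CommutativeRing 0ℓ 0ℓ) (m : CommutativeRing.Carrier C) where
  open RingKit C
  open Divisibility C

  infix 4 _~_
  record _~_ (a b : Carrier) : Set where
    constructor congruent
    field difference : m ∣ a - b
  open _~_ public

  ≈⇒~ : ∀ {a b} → a ≈ b → a ~ b
  ≈⇒~ {a} {b} a≈b = congruent (∣-resp (trans (sym (-‿inverseʳ b)) (+-congʳ (sym a≈b))) ∣-0)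

  ~0⇒∣ : ∀ {a} → a ~ 0# → m ∣ a
  ~0⇒∣ {a} p = ∣-resp (solve 1 (λ a → a :- con (+ 0) := a) refl a) (difference p)

  ∣⇒~0 : ∀ {a} → m ∣ a → a ~ 0#
  ∣⇒~0 {a} p = congruent (∣-resp (solve 1 (λ a → a := a :- con (+ 0)) refl a) p)

  private
    ~-sym : ∀ {a b} → a ~ b → b ~ a
    ~-sym {a} {b} (congruent p) = congruent (∣-resp (solve 2 (λ a b → :- (a :- b) := b :- a) refl a b) (∣-neg p))

    ~-trans : ∀ {a b c} → a ~ b → b ~ c → a ~ c
    ~-trans {a} {b} {c} (congruent p) (congruent q) =
      congruent (∣-resp (solve 3 (λ a b c → (a :- b) :+ (b :- c) := a :- c) refl a b c) (∣-+ p q))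

    ~-+ : ∀ {a b c d} → a ~ b → c ~ d → a + c ~ b + d
    ~-+ {a} {b} {c} {d} (congruent p) (congruent q) =
      congruent (∣-resp (solve 4 (λ a b c d → (a :- b) :+ (c :- d) := (a :+ c) :- (b :+ d)) refl a b c d) (∣-+ p q))

    ~-* : ∀ {a b c d} → a ~ b → c ~ d → a * c ~ b * d
    ~-* {a} {b} {c} {d} (congruent p) (congruent q) =
      congruent (∣-resp (solve 4 (λ a b c d → c :* (a :- b) :+ b :* (c :- d) := a :* c :- b :* d) refl a b c d)
        (∣-+ (∣-*ˡ c p) (∣-*ˡ b q)))

    ~-neg : ∀ {a b} → a ~ b → - a ~ - b
    ~-neg {a} {b} (congruent p) = congruent (∣-resp (solve 2 (λ a b → :- (a :- b) := (:- a) :- (:- b)) refl a b) (∣-neg p))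

  quotientRing : CommutativeRing 0ℓ 0ℓ
  quotientRing = record
    { Carrier = Carrier ; _≈_ = _~_ ; _+_ = _+_ ; _*_ = _*_ ; -_ = -_ ; 0# = 0# ; 1# = 1#
    ; isCommutativeRing = record
      { isRing = record
        { +-isAbelianGroup = record
          { isGroup = record
            { isMonoid = record
              { isSemigroup = record
                { isMagma = record
                  { isEquivalence = record { refl = ≈⇒~ refl ; sym = ~-sym ; trans = ~-trans }
                  ; ∙-cong = ~-+ }
                ; assoc = λ a b c → ≈⇒~ (+-assoc a b c) }
              ; identity = (λ a → ≈⇒~ (+-identityˡ a)) , (λ a → ≈⇒~ (+-identityʳ a)) }
            ; inverse = (λ a → ≈⇒~ (-‿inverseˡ a)) , (λ a → ≈⇒~ (-‿inverseʳ a))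
            ; ⁻¹-cong = ~-neg }
          ; comm = λ a b → ≈⇒~ (+-comm a b) }
        ; *-cong = ~-*
        ; *-assoc = λ a b c → ≈⇒~ (*-assoc a b c)
        ; *-identity = (λ a → ≈⇒~ (*-identityˡ a)) , (λ a → ≈⇒~ (*-identityʳ a))
        ; distrib = (λ a b c → ≈⇒~ (distribˡ a b c)) , (λ a b c → ≈⇒~ (distribʳ a b c)) }
      ; *-comm = λ a b → ≈⇒~ (*-comm a b) } }

  private module Q = RingKit quotientRing

  ν-quotient : ∀ n → Q.ν n ≡ ν n
  ν-quotient zero          = ≡.refl
  ν-quotient (suc zero)    = ≡.refl
  ν-quotient (suc (suc n)) = ≡.cong (λ z → 1# + z) (ν-quotient (suc n))

  ^-quotient : ∀ a n → a Q.^ n ≡ a ^ n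
  ^-quotient a zero    = ≡.refl
  ^-quotient a (suc n) = ≡.cong (a *_) (^-quotient a n)

ℤ-ring : CommutativeRing 0ℓ 0ℓ
ℤ-ring = ℤₚ.+-*-commutativeRing

module ℤR = RingKit ℤ-ring
module ℤ-Div = Divisibility ℤ-ring

ν-ℤ : ∀ n → ℤR.ν n ≡ + n
ν-ℤ zero          = ≡.refl
ν-ℤ (suc zero)    = ≡.refl
ν-ℤ (suc (suc n)) = ≡.cong (ℤ._+_ (+ 1)) (ν-ℤ (suc n))

∣ᵤ⇒∣ : ∀ p a → p ∣ℕ ℤ.∣ a ∣ → + p ℤ-Div.∣ a
∣ᵤ⇒∣ p (+ n) (ℕ∣.divides q ≡.refl) = ℤ-Div.divides (+ q) (≡.trans (ℤₚ.pos-* q p) (ℤₚ.*-comm (+ q) (+ p)))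
∣ᵤ⇒∣ p -[1+ n ] (ℕ∣.divides q eq) = ℤ-Div.divides (ℤ.- (+ q)) (begin
  ℤ.- (+ suc n) ≡⟨ ≡.cong (λ k → ℤ.- (+ k)) eq ⟩
  ℤ.- (+ (q ℕ.* p)) ≡⟨ ≡.cong ℤ.-_ (≡.trans (ℤₚ.pos-* q p) (ℤₚ.*-comm (+ q) (+ p))) ⟩
  ℤ.- (+ p ℤ.* + q) ≡⟨ ℤₚ.neg-distribʳ-* (+ p) (+ q) ⟩
  + p ℤ.* (ℤ.- (+ q)) ∎)
  where open ≡.≡-Reasoning

∣⇒∣ᵤ : ∀ p a → + p ℤ-Div.∣ a → p ∣ℕ ℤ.∣ a ∣
∣⇒∣ᵤ p a (ℤ-Div.divides q ≡.refl) = ℕ∣.divides ℤ.∣ q ∣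
  (≡.trans (ℤₚ.∣i*j∣≡∣i∣*∣j∣ (+ p) q) (ℕₚ.*-comm p ℤ.∣ q ∣))

-- Reduction modulo p is the identity on coefficient lists, but Poly is instantiated at several equalities on ℤ.
withEquality : (ℤ → ℤ → Set) → RawRing 0ℓ 0ℓ
withEquality _≈_ = record
  { Carrier = ℤ ; _≈_ = _≈_ ; _+_ = ℤ._+_ ; _*_ = ℤ._*_ ; -_ = ℤ.-_ ; 0# = + 0 ; 1# = + 1 }

module ChangeEquality (E F : ℤ → ℤ → Set) where
  private
    module PE = Poly (withEquality E)
    module PF = Poly (withEquality F)

  coeff-same : ∀ f i → PE.coeff f i ≡ PF.coeff f i
  coeff-same []      i       = ≡.refl
  coeff-same (a ∷ f) zero    = ≡.refl
  coeff-same (a ∷ f) (suc i) = coeff-same f i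

  +P-same : ∀ f g → f PE.+P g ≡ f PF.+P g
  +P-same []      g       = ≡.refl
  +P-same (a ∷ f) []      = ≡.refl
  +P-same (a ∷ f) (b ∷ g) = ≡.cong (a ℤ.+ b ∷_) (+P-same f g)

  *P-same : ∀ f g → f PE.*P g ≡ f PF.*P g
  *P-same []      g = ≡.refl
  *P-same (a ∷ f) g = ≡.trans (+P-same (map (a ℤ.*_) g) (+ 0 ∷ (f PE.*P g)))
    (≡.cong (λ h → map (a ℤ.*_) g PF.+P (+ 0 ∷ h)) (*P-same f g))

  ^P-same : ∀ f n → f PE.^P n ≡ f PF.^P n
  ^P-same f zero    = ≡.refl
  ^P-same f (suc n) = ≡.trans (*P-same f (f PE.^P n)) (≡.cong (f PF.*P_) (^P-same f n))

module ModP {p : ℕ} (p-prime : Prime p) where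
  module ZQ = Quotient ℤ-ring (+ p)

  ℤ/p : CommutativeRing 0ℓ 0ℓ
  ℤ/p = ZQ.quotientRing

  module Zp = RingKit ℤ/p

  ∣⇒zero : ∀ a → p ∣ℕ ℤ.∣ a ∣ → a Zp.≈ Zp.0#
  ∣⇒zero a p∣a = ZQ.∣⇒~0 (∣ᵤ⇒∣ p a p∣a)

  zero⇒∣ : ∀ a → a Zp.≈ Zp.0# → p ∣ℕ ℤ.∣ a ∣
  zero⇒∣ a a≈0 = ∣⇒∣ᵤ p a (ZQ.~0⇒∣ a≈0)

  zero? : ∀ a → Dec (a Zp.≈ Zp.0#)
  zero? a with p ℕ∣.∣? ℤ.∣ a ∣
  ... | yes q = yes (∣⇒zero a q)
  ... | no ¬q = no λ z → ¬q (zero⇒∣ a z)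

  ν-p : ∀ n → Zp.ν n ≡ + n
  ν-p n = ≡.trans (ZQ.ν-quotient n) (ν-ℤ n)

  ν-zero : ∀ {n} → p ∣ℕ n → Zp.ν n Zp.≈ Zp.0#
  ν-zero {n} p∣n = ≡.subst (λ a → a Zp.≈ Zp.0#) (≡.sym (ν-p n)) (∣⇒zero (+ n) p∣n)

  ν-nonzero : ∀ {n} → ¬ (p ∣ℕ n) → ¬ (Zp.ν n Zp.≈ Zp.0#)
  ν-nonzero {n} p∤n z = p∤n (zero⇒∣ (+ n) (≡.subst (λ a → a Zp.≈ Zp.0#) (ν-p n) z))

  char-p : Zp.ν p Zp.≈ Zp.0#
  char-p = ν-zero ℕ∣.∣-refl

  p∤1 : ¬ (p ∣ℕ 1)
  p∤1 p∣1 = ℕ.nonTrivial⇒≢1 {{prime⇒nonTrivial p-prime}} (ℕ∣.∣1⇒≡1 p∣1)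

  1≉0 : ¬ (Zp.1# Zp.≈ Zp.0#)
  1≉0 = ν-nonzero {1} p∤1

  no-zero-divisors : ∀ a b → a Zp.* b Zp.≈ Zp.0# → (a Zp.≈ Zp.0#) ⊎ (b Zp.≈ Zp.0#)
  no-zero-divisors a b z = Data.Sum.map (∣⇒zero a) (∣⇒zero b) (euclidsLemma ℤ.∣ a ∣ ℤ.∣ b ∣ p-prime
    (≡.subst (p ∣ℕ_) (ℤₚ.∣i*j∣≡∣i∣*∣j∣ a b) (zero⇒∣ (a ℤ.* b) z)))

  private
    abs-inverse : ∀ a → ¬ (p ∣ℕ a) → Σ ℤ λ b → b Zp.* (+ a) Zp.≈ Zp.1#
    abs-inverse a p∤a = from (coprime-Bézout (coprime-to-prime p∤a))
      where
      coprime-to-prime : ¬ (p ∣ℕ a) → Coprime p a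
      coprime-to-prime p∤a {d} (d∣p , d∣a) with prime⇒irreducible p-prime d∣p
      ... | inj₁ d≡1    = d≡1
      ... | inj₂ ≡.refl = ⊥-elim (p∤a d∣a)

      from : Bézout.Identity.Identity 1 p a → Σ ℤ λ b → b Zp.* (+ a) Zp.≈ Zp.1#
      from (Bézout.+- x y eq) = ℤ.- (+ y) , ZQ.congruent (ℤ-Div.divides (ℤ.- (+ x)) (begin
        (ℤ.- (+ y)) ℤ.* + a ℤ.- + 1
          ≡⟨ ℤR.solve 2 (λ y a → (ℤR.:- y) ℤR.:* a ℤR.:- ℤR.con (+ 1) ℤR.:= ℤR.:- (ℤR.con (+ 1) ℤR.:+ y ℤR.:* a)) ≡.refl (+ y) (+ a) ⟩
        ℤ.- (+ 1 ℤ.+ + y ℤ.* + a) ≡⟨ ≡.cong (λ t → ℤ.- (+ 1 ℤ.+ t)) (ℤₚ.pos-* y a) ⟨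
        ℤ.- (+ (1 ℕ.+ y ℕ.* a)) ≡⟨ ≡.cong (λ t → ℤ.- (+ t)) eq ⟩
        ℤ.- (+ (x ℕ.* p)) ≡⟨ ≡.cong ℤ.-_ (ℤₚ.pos-* x p) ⟩
        ℤ.- (+ x ℤ.* + p) ≡⟨ ℤR.solve 2 (λ x p → ℤR.:- (x ℤR.:* p) ℤR.:= p ℤR.:* (ℤR.:- x)) ≡.refl (+ x) (+ p) ⟩
        + p ℤ.* (ℤ.- (+ x)) ∎))
        where open ≡.≡-Reasoning
      from (Bézout.-+ x y eq) = + y , ZQ.congruent (ℤ-Div.divides (+ x) (begin
        + y ℤ.* + a ℤ.- + 1 ≡⟨ ≡.cong (λ t → t ℤ.- + 1) (ℤₚ.pos-* y a) ⟨
        + (y ℕ.* a) ℤ.- + 1 ≡⟨ ≡.cong (λ t → + t ℤ.- + 1) eq ⟨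
        + (1 ℕ.+ x ℕ.* p) ℤ.- + 1 ≡⟨ ≡.cong (λ t → + 1 ℤ.+ t ℤ.- + 1) (ℤₚ.pos-* x p) ⟩
        + 1 ℤ.+ + x ℤ.* + p ℤ.- + 1 ≡⟨ ℤR.solve 2 (λ x p → ℤR.con (+ 1) ℤR.:+ x ℤR.:* p ℤR.:- ℤR.con (+ 1) ℤR.:= p ℤR.:* x) ≡.refl (+ x) (+ p) ⟩
        + p ℤ.* + x ∎))
        where open ≡.≡-Reasoning

  inverse : ∀ a → ¬ (a Zp.≈ Zp.0#) → Σ ℤ λ b → b Zp.* a Zp.≈ Zp.1#
  inverse (+ n)    a≉0 = abs-inverse n λ p∣n → a≉0 (∣⇒zero (+ n) p∣n)
  inverse -[1+ n ] a≉0 =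
    let b , eq = abs-inverse (suc n) λ p∣n → a≉0 (∣⇒zero -[1+ n ] p∣n)
    in  ℤ.- b , Zp.trans (ZQ.≈⇒~ (ℤR.solve 2 (λ b a → (ℤR.:- b) ℤR.:* (ℤR.:- a) ℤR.:= b ℤR.:* a) ≡.refl b (+ suc n))) eq

  domain : IntegralDomain
  domain = record { ring = ℤ/p ; zero? = zero? ; 1≉0 = 1≉0 ; no-zero-divisors = no-zero-divisors }

  module F = Factorization domain
  open F using (_≋_; _*P_)
  private module P = RingKit F.polyRing

  -- Over a field the constant c is divided out of B.
  gauss : F.GaussProperty
  gauss {c} {A} B C c≉0 m eq =
    let c′ , c′c≈1 = inverse c c≉0
        one-const : F.const c′ *P F.const c ≋ F.oneP
        one-const = F.≋-trans (F.≋-sym (F.const-homo-* c′ c)) (F.const-cong c′c≈1)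
        open P using (solve; _:=_; _:*_; begin_; step-≈-⟩; step-≈-⟨; _∎)
    in  F.const c′ *P B , C , c
        , (begin
          A ≈⟨ F.*P-identityˡ A ⟨
          F.oneP *P A ≈⟨ F.*P-congʳ A one-const ⟨
          (F.const c′ *P F.const c) *P A ≈⟨ F.*P-assoc (F.const c′) (F.const c) A ⟩
          F.const c′ *P (F.const c *P A) ≈⟨ F.*P-congˡ (F.const c′) eq ⟩
          F.const c′ *P (B *P C) ≈⟨ F.*P-assoc (F.const c′) B C ⟨
          (F.const c′ *P B) *P C ∎)
        , (begin
          B ≈⟨ F.*P-identityˡ B ⟨
          F.oneP *P B ≈⟨ F.*P-congʳ B one-const ⟨
          (F.const c′ *P F.const c) *P B ≈⟨ solve 3 (λ c′ c B → (c′ :* c) :* B := c :* (c′ :* B)) F.≋-refl (F.const c′) (F.const c) B ⟩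
          F.const c *P (F.const c′ *P B) ∎)

  open F.Gauss gauss public

-- Gauss's lemma over ℤ

module ℤ-Poly where
  ℤ-zero? : ∀ a → Dec (a ≡ + 0)
  ℤ-zero? a = a ℤ.≟ + 0

  ℤ-1≢0 : ¬ (+ 1 ≡ + 0)
  ℤ-1≢0 ()

  ℤ-no-zero-divisors : ∀ a b → a ℤ.* b ≡ + 0 → (a ≡ + 0) ⊎ (b ≡ + 0)
  ℤ-no-zero-divisors a b = ℤₚ.i*j≡0⇒i≡0∨j≡0 a

  ℤ-domain : IntegralDomain
  ℤ-domain = record { ring = ℤ-ring ; zero? = ℤ-zero? ; 1≉0 = ℤ-1≢0 ; no-zero-divisors = ℤ-no-zero-divisors }

  module F = Factorization ℤ-domain
  open F using (_≋_; _*P_; const; Pol)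
  private module P = RingKit F.polyRing

  char-0 : ∀ n → ¬ (ℤR.ν (suc n) ≡ + 0)
  char-0 n eq with () ← ≡.trans (≡.sym (ν-ℤ (suc n))) eq

  module Reduction {p : ℕ} (p-prime : Prime p) where
    private module M = ModP p-prime
    open ChangeEquality _≡_ M.Zp._≈_ public

    reduce : ∀ {f g} → f ≋ g → f M.F.≋ g
    reduce {f} {g} p = M.F.coeffwise λ i → M.Zp.reflexive
      (≡.trans (≡.sym (coeff-same f i)) (≡.trans (F.coeff-≈ p i) (coeff-same g i)))

    zero-mod⇒multiple : ∀ f → f M.F.≋ [] → Σ Pol λ g → f ≋ const (+ p) *P g
    zero-mod⇒multiple []      _ = [] , F.≋-sym (F.*P-zeroʳ (const (+ p)))
    zero-mod⇒multiple (a ∷ f) z =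
      let g , f≋         = zero-mod⇒multiple f (M.F.tail-≋[] z)
          ℤ-Div.divides b a≡ = ∣ᵤ⇒∣ p a (M.zero⇒∣ a (M.F.coeff-≈ z 0))
      in  b ∷ g , F.≋-trans (F.∷-cong a≡ (F.≋-trans f≋ (F.const-* (+ p) g))) (F.≋-sym (F.const-* (+ p) (b ∷ g)))

  const≢0-cancel : ∀ {c f g} → ¬ (c ≡ + 0) → const c *P f ≋ const c *P g → f ≋ g
  const≢0-cancel {c} {f} {g} c≢0 eq = F.≋-from-0 (F.const-cancel c≢0 (begin
    const c *P (f P.- g) ≈⟨ solve 3 (λ c f g → c :* (f :- g) := c :* f :- c :* g) F.≋-refl (const c) f g ⟩
    const c *P f P.- const c *P g ≈⟨ P.+-congʳ eq ⟩
    const c *P g P.- const c *P g ≈⟨ P.-‿inverseʳ (const c *P g) ⟩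
    [] ∎))
    where open P using (solve; _:=_; _:*_; _:-_; begin_; step-≈-⟩; _∎)

  Split : Pol → Pol → Set
  Split A B = Σ Pol λ B₀ → Σ Pol λ C₀ → Σ ℤ λ r → (A ≋ B₀ *P C₀) × (B ≋ const r *P B₀)

  private
    split-scale : ∀ {A B B′} c → B ≋ const c *P B′ → Split A B′ → Split A B
    split-scale {A} {B} {B′} c B≋ (B₀ , C₀ , r , A≋ , B′≋) = B₀ , C₀ , c ℤ.* r , A≋ ,
      F.≋-trans B≋ (F.≋-trans (F.*P-congˡ (const c) B′≋) (F.≋-trans (F.≋-sym (F.*P-assoc (const c) (const r) B₀))
        (F.*P-congʳ B₀ (F.≋-sym (F.const-homo-* c r)))))

    -- Induction on the prime factors of the constant. Modulo p the product B C vanishes, and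
    -- polynomials over ℤ modulo p have no zero divisors, so p can be drawn out of B or of C and
    -- cancelled.
    split-product : ∀ ps → All Prime ps → ∀ {A} B C → const (+ Data.Nat.ListAction.product ps) *P A ≋ B *P C → Split A B
    split-product [] _ {A} B C eq = B , C , + 1 , F.≋-trans (F.≋-sym (F.*P-identityˡ A)) eq , F.≋-sym (F.*P-identityˡ B)
    split-product (p ∷ ps) (p-prime ∷ primes) {A} B C eq =
      conclude (M.F.poly-no-zero-divisors B C (M.F.≋-trans (≡.subst (M.F._≋ (B *P C)) (*P-same B C) M.F.≋-refl)
        (M.F.≋-trans (reduce (F.≋-trans (F.≋-sym eq) eq-p)) (M.F.≋-trans
          (≡.subst (M.F._≋ const (+ p) M.F.*P (const N *P A)) (≡.sym (*P-same (const (+ p)) (const N *P A))) M.F.≋-refl)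
          (M.F.*P-zeroˡ (const N *P A) (M.F.≋-trans (M.F.const-cong (M.∣⇒zero (+ p) ℕ∣.∣-refl)) M.F.const-0))))))
      where
      module M = ModP p-prime
      open Reduction p-prime
      open P using (solve; _:=_; _:*_; begin_; step-≈-⟩; step-≈-⟨; _∎)
      N = + Data.Nat.ListAction.product ps
      p≢0 : ¬ (+ p ≡ + 0)
      p≢0 p≡0 = ℕ.≢-nonZero⁻¹ p {{prime⇒nonZero p-prime}} (ℤₚ.+-injective p≡0)
      eq-p : const (+ (p ℕ.* Data.Nat.ListAction.product ps)) *P A ≋ const (+ p) *P (const N *P A)
      eq-p = F.≋-trans (F.*P-congʳ A (F.≋-trans (F.const-cong (ℤₚ.pos-* p (Data.Nat.ListAction.product ps))) (F.const-homo-* (+ p) N)))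
        (F.*P-assoc (const (+ p)) (const N) A)
      conclude : (B M.F.≋ []) ⊎ (C M.F.≋ []) → Split A B
      conclude (inj₁ B≋0) =
        let B′ , B≋ = zero-mod⇒multiple B B≋0
        in  split-scale (+ p) B≋ (split-product ps primes B′ C (const≢0-cancel p≢0 (begin
              const (+ p) *P (const N *P A) ≈⟨ eq-p ⟨
              const (+ (p ℕ.* Data.Nat.ListAction.product ps)) *P A ≈⟨ eq ⟩
              B *P C ≈⟨ F.*P-congʳ C B≋ ⟩
              (const (+ p) *P B′) *P C ≈⟨ F.*P-assoc (const (+ p)) B′ C ⟩
              const (+ p) *P (B′ *P C) ∎)))
      conclude (inj₂ C≋0) =
        let C′ , C≋ = zero-mod⇒multiple C C≋0
        in  split-product ps primes B C′ (const≢0-cancel p≢0 (begin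
              const (+ p) *P (const N *P A) ≈⟨ eq-p ⟨
              const (+ (p ℕ.* Data.Nat.ListAction.product ps)) *P A ≈⟨ eq ⟩
              B *P C ≈⟨ F.*P-congˡ B C≋ ⟩
              B *P (const (+ p) *P C′) ≈⟨ solve 3 (λ B p C → B :* (p :* C) := p :* (B :* C)) F.≋-refl B (const (+ p)) C′ ⟩
              const (+ p) *P (B *P C′) ∎))

    split-abs : ∀ n → {{ℕ.NonZero n}} → ∀ {A} B C → const (+ n) *P A ≋ B *P C → Split A B
    split-abs n {A} B C eq = split-product factors factorsPrime B C
      (F.≋-trans (F.*P-congʳ A (F.const-cong (≡.cong +_ (≡.sym isFactorisation)))) eq)
      where open PrimeFactorisation (factorise n)

  gauss : F.GaussProperty
  gauss {+ zero}  B C c≢0 _ eq = ⊥-elim (c≢0 ≡.refl)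
  gauss {+ suc n} B C c≢0 _ eq = split-abs (suc n) B C eq
  gauss { -[1+ n ]} {A} B C c≢0 _ eq = split-scale (ℤ.- + 1)
    (solve 1 (λ B → B := (:- con (+ 1)) :* (:- B)) F.≋-refl B)
    (split-abs (suc n) (P.- B) C (begin
      const (+ suc n) *P A ≈⟨ solve 2 (λ c A → c :* A := :- ((:- c) :* A)) F.≋-refl (const (+ suc n)) A ⟩
      P.- (const -[1+ n ] *P A) ≈⟨ P.-‿cong eq ⟩
      P.- (B *P C) ≈⟨ P.-‿distribˡ-* B C ⟩
      (P.- B) *P C ∎))
    where open P using (solve; _:=_; _:*_; :-_; con; begin_; step-≈-⟩; step-≈-⟨; _∎)

  open F.Gauss gauss public

-- Products of irreducible polynomials

module PrimeProducts (𝔻 : IntegralDomain) (gauss : Factorization.GaussProperty 𝔻) where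
  open IntegralDomain 𝔻 renaming (ring to R)
  private module R = RingKit R
  open Factorization 𝔻
  open Gauss gauss
  private module P = RingKit polyRing
  open P using (solve; _:=_; _:*_; begin_; step-≈-⟩; _∎)

  -- A monic irreducible has positive degree; storing the predecessor `deg` makes this hold by
  -- construction.
  record MonicIrr (g : Pol) : Set where
    constructor monicIrr
    field
      {deg}       : ℕ
      monic       : MonicDeg g (suc deg)
      irreducible : Irr g
  open MonicIrr public

  monic-irr : ∀ {g} → Σ ℕ (MonicDeg g) → Irr g → MonicIrr g
  monic-irr (zero  , m) i with () ← irr-degree m i
  monic-irr (suc d , m) i = monicIrr m i

  to-∣ : ∀ {f g} → g ∣P f → g ∣ f
  to-∣ (h , p) = divides h (coeffwise p)

  from-∣ : ∀ {f g} → g ∣ f → g ∣P f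
  from-∣ (divides h p) = h , coeff-≈ p

  to-monicIrr : ∀ {g} → Monic g → Irreducible g → MonicIrr g
  to-monicIrr (d , c , l) (nz , nu , sp) = monic-irr (d , c , degLT l) (record
    { nonzero = λ p → nz (coeff-≈ p)
    ; nonunit = λ { (divides v p) → nu (v , λ i → R.sym (coeff-≈ p i)) }
    ; split   = λ a b p → Data.Sum.map to-unit to-unit (sp a b (coeff-≈ p)) })
    where
    to-unit : ∀ {f} → IsUnit f → Unit f
    to-unit (v , p) = divides v (≋-sym (coeffwise p))

  from-irr : ∀ {g} → Irr g → Irreducible g
  from-irr i = (λ p → nonzero i (coeffwise p))
    , (λ { (v , p) → nonunit i (divides v (≋-sym (coeffwise p))) })
    , λ a b p → Data.Sum.map from-unit from-unit (split i a b (coeffwise p))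
    where
    from-unit : ∀ {f} → Unit f → IsUnit f
    from-unit (divides v p) = v , λ i → R.sym (coeff-≈ p i)

  prime : ∀ {g} → MonicIrr g → ∀ A B → g ∣ A *P B → (g ∣ A) ⊎ (g ∣ B)
  prime i = irr-prime (monic i) (irreducible i)

  ∣⇒≋ : ∀ {g h} → MonicIrr g → MonicIrr h → g ∣ h → g ≋ h
  ∣⇒≋ i j = irr-∣-irr (monic i) (monic j) (irreducible i) (irreducible j)

  ∤-one : ∀ {g} → MonicIrr g → ¬ (g ∣ oneP)
  ∤-one i = nonunit (irreducible i)

  prime-∣-prodP : ∀ {g L} → MonicIrr g → All MonicIrr L → g ∣ prodP L → g ∈P L
  prime-∣-prodP i []                    g∣1 = ⊥-elim (∤-one i g∣1)
  prime-∣-prodP {L = h ∷ L} i (j ∷ js) g∣  with prime i h (prodP L) g∣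
  ... | inj₁ g∣h = inj₁ (coeff-≈ (∣⇒≋ i j g∣h))
  ... | inj₂ g∣L = inj₂ (prime-∣-prodP i js g∣L)

  ∈P⇒∣prodP : ∀ {g} L → g ∈P L → g ∣ prodP L
  ∈P⇒∣prodP (h ∷ L) (inj₁ p) = ∣-respˡ (≋-sym (coeffwise p)) (∣-*ʳ {h} (prodP L) ∣-refl)
  ∈P⇒∣prodP (h ∷ L) (inj₂ p) = ∣-*ˡ h (∈P⇒∣prodP L p)

  -- The first factor divides the cofactor of the others, because by primality it would otherwise
  -- occur among them.
  prodP-∣ : ∀ {L M} → All MonicIrr L → DistinctP L → All (_∣ M) L → prodP L ∣ M
  prodP-∣ {M = M} [] _ [] = divides M (≋-sym (*P-identityˡ M))
  prodP-∣ {g ∷ L} {M} (i ∷ is) (distinct , ds) (g∣M ∷ L∣M) with prodP-∣ is ds L∣M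
  ... | divides H M≋ with prime i (prodP L) H (∣-resp M≋ g∣M)
  ...   | inj₁ g∣L = ⊥-elim (distinct g (prime-∣-prodP i is g∣L) λ i → R.refl)
  ...   | inj₂ g∣H = ∣-resp (≋-sym M≋) (∣-resp (*P-comm H (prodP L)) (∣-*-cong g∣H ∣-refl))

  monic-prodP : ∀ {L} → All MonicIrr L → Σ ℕ (MonicDeg (prodP L))
  monic-prodP []       = 0 , monic-one
  monic-prodP (i ∷ is) = let d , m = monic-prodP is in _ , monic-* (monic i) m

  -- Reducibility of H is not decided. If H had no irreducible factor, neither would a proper monic
  -- factor of it, which the induction on n refutes; hence H would be irreducible itself.
  weak-irr-factor : ∀ n {H d} → MonicDeg H (suc d) → d < n → ¬ ¬ (Σ Pol λ g → MonicIrr g × (g ∣ H))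
  weak-irr-factor (suc n) {H} {d} m (s≤s d≤n) none =
    none (H , monicIrr m (irreducible-if-no-monic-split m (s≤s z≤n) no-split) , ∣-refl)
    where
    no-split : ∀ {a b i j} → MonicDeg a i → MonicDeg b j → H ≋ a *P b → (i ≡ 0) ⊎ (j ≡ 0)
    no-split {i = zero}              ma mb H≋ = inj₁ ≡.refl
    no-split {i = suc i} {j = zero}  ma mb H≋ = inj₂ ≡.refl
    no-split {a} {b} {suc i} {suc j} ma mb H≋ = ⊥-elim (weak-irr-factor n ma
      (ℕₚ.≤-trans (≡.subst (suc i ≤_) (≡.sym (≡.trans (ℕₚ.suc-injective (monic-unique m (monic-resp (≋-sym H≋) (monic-* ma mb)))) (ℕₚ.+-suc i j)))
        (s≤s (ℕₚ.m≤m+n i j))) d≤n)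
      λ { (g , gi , g∣a) → none (g , gi , ∣-trans g∣a (divides b H≋)) })

  -- A cofactor of `prodP L` in M of positive degree would have an irreducible factor g; by
  -- completeness g lies in L, and then g² divides M. As only a contradiction is sought,
  -- `weak-irr-factor` suffices.
  squarefree-prodP : ∀ {L M d} → MonicDeg M d → (∀ {g} → MonicIrr g → ¬ (g *P g ∣ M)) →
    All MonicIrr L → DistinctP L → All (_∣ M) L → (∀ g → MonicIrr g → g ∣ M → g ∈P L) → prodP L ≋ M
  squarefree-prodP {L} {M} m squarefree is ds L∣M complete = finish (prodP-∣ is ds L∣M) (monic-prodP is)
    where
    finish : prodP L ∣ M → Σ ℕ (MonicDeg (prodP L)) → prodP L ≋ M
    finish (divides H M≋) (k , mL) = cofactor (monic-cofactor mL H (monic-resp M≋ m))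
      where
      cofactor : (Σ ℕ λ e → MonicDeg H e × (_ ≡ k ℕ.+ e)) → prodP L ≋ M
      cofactor (zero  , mH , _) = ≋-sym (≋-trans M≋ (≋-trans (*P-congˡ (prodP L) (monic-0⇒one mH)) (P.*-identityʳ (prodP L))))
      cofactor (suc e , mH , _) = ⊥-elim (weak-irr-factor (suc e) mH ℕₚ.≤-refl λ { (g , gi , g∣H) →
        squarefree gi (∣-resp (≋-sym M≋) (∣-*-cong (∈P⇒∣prodP L (complete g gi (∣-resp (≋-sym M≋) (∣-*ˡ (prodP L) g∣H)))) g∣H)) })

  module _ (irr-factor : ∀ {H d} → MonicDeg H (suc d) → Σ Pol λ g → MonicIrr g × (g ∣ H)) where

    -- Splits off g^(e+1) completely; the cofactor is no longer divisible by g and inherits the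
    -- hypothesis on multiplicities. `n` bounds the degree.
    powers-of-irreducibles : ∀ n e f {d} → MonicDeg f d → d ≤ n →
      (∀ g → MonicIrr g → g ∣ f → (g P.^ suc e ∣ f) × ¬ (g P.^ suc (suc e) ∣ f)) →
      Σ (List Pol) λ L → All (λ g → MonicIrr g × (g ∣ f)) L × DistinctP L × (f ≋ prodP (map (λ g → g P.^ suc e) L))
    powers-of-irreducibles n e f {zero} m _ _ = [] , [] , _ , monic-0⇒one m
    powers-of-irreducibles (suc n) e f {suc d} m (s≤s d≤n) val = step (irr-factor m)
      where
      step : (Σ Pol λ g → MonicIrr g × (g ∣ f)) →
        Σ (List Pol) λ L → All (λ g → MonicIrr g × (g ∣ f)) L × DistinctP L × (f ≋ prodP (map (λ g → g P.^ suc e) L))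
      step (g , gi , g∣f) = extract (proj₁ (val g gi g∣f))
        where
        ge = g P.^ suc e
        extract : ge ∣ f → Σ (List Pol) λ L → All (λ g → MonicIrr g × (g ∣ f)) L × DistinctP L × (f ≋ prodP (map (λ g → g P.^ suc e) L))
        extract (divides h f≋) = combine (monic-cofactor (monic-^ (monic gi) (suc e)) h (monic-resp f≋ m))
          where
          h∣f : h ∣ f
          h∣f = ∣-resp (≋-sym f≋) (∣-*ˡ ge ∣-refl)

          g∤h : ¬ (g ∣ h)
          g∤h (divides k h≋) = proj₂ (val g gi g∣f) (divides k (begin
            f ≈⟨ f≋ ⟩
            ge *P h ≈⟨ *P-congˡ ge h≋ ⟩
            ge *P (g *P k) ≈⟨ solve 3 (λ a g k → a :* (g :* k) := (g :* a) :* k) ≋-refl ge g k ⟩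
            (g *P ge) *P k ∎))

          val-h : ∀ g′ → MonicIrr g′ → g′ ∣ h → (g′ P.^ suc e ∣ h) × ¬ (g′ P.^ suc (suc e) ∣ h)
          val-h g′ gi′ g′∣h = ^-∣-cancelʳ (monic gi′) (irreducible gi′) g′∤ge (suc e) h
              (∣-resp (≋-trans f≋ (*P-comm ge h)) (proj₁ (val g′ gi′ (∣-trans g′∣h h∣f))))
            , λ p → proj₂ (val g′ gi′ (∣-trans g′∣h h∣f)) (∣-trans p h∣f)
            where
            g′∤ge : ¬ (g′ ∣ ge)
            g′∤ge = irr-∤-^ (monic gi′) (irreducible gi′) (λ g′∣g → g∤h (∣-respˡ (∣⇒≋ gi′ gi g′∣g) g′∣h)) (suc e)

          combine : (Σ ℕ λ k → MonicDeg h k × (suc d ≡ suc e ℕ.* suc (deg gi) ℕ.+ k)) →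
            Σ (List Pol) λ L → All (λ g → MonicIrr g × (g ∣ f)) L × DistinctP L × (f ≋ prodP (map (λ g → g P.^ suc e) L))
          combine (k , mh , d≡) =
            let L , is , ds , h≋ = powers-of-irreducibles n e h mh (ℕₚ.≤-trans k≤d d≤n) val-h
            in  g ∷ L , (gi , g∣f) ∷ All.map (λ { (i , p) → i , ∣-trans p h∣f }) is
                , ((λ g′ g′∈L p → g∤h (∣-respˡ (≋-sym (coeffwise p)) (member-∣ is g′∈L))) , ds)
                , ≋-trans f≋ (*P-congˡ ge h≋)
            where
            k≤d : k ≤ d
            k≤d = ℕₚ.≤-pred (≡.subst (suc k ≤_) (≡.sym d≡) (s≤s (ℕₚ.m≤n+m k _)))

            member-∣ : ∀ {L g′} → All (λ g → MonicIrr g × (g ∣ h)) L → g′ ∈P L → g′ ∣ h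
            member-∣ ((_ , p) ∷ _)  (inj₁ q) = ∣-respˡ (≋-sym (coeffwise q)) p
            member-∣ (_ ∷ ps)       (inj₂ q) = member-∣ ps q

-- Prime factors of the primitive parts

module FibotomicPart (𝔻 : IntegralDomain) (gauss : Factorization.GaussProperty 𝔻) where
  open IntegralDomain 𝔻 renaming (ring to R)
  private module R = RingKit R
  open Factorization 𝔻
  open PrimeProducts 𝔻 gauss
  open PrimitiveParts R
  open PrimitivePartsDomain 𝔻
  private module P = RingKit polyRing

  module _ {N : ℕ} (S : System N) where
    open System S

    rest : ℕ → Pol
    rest n = ⨁ (ℕ.pred n) λ d → when (d ℕ∣.∣? n) (part d)

    fib≋part*rest : ∀ n → 1 ≤ n → n ≤ N → fib n ≋ part n *P rest n
    fib≋part*rest (suc n) 1≤n n≤N = ≋-trans (product (suc n) 1≤n n≤N)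
      (*P-congʳ (rest (suc n)) (when-yes (suc n ℕ∣.∣? suc n) ℕ∣.∣-refl))

    prime-∤-rest : ∀ {g n} → MonicIrr g → n ≤ N → (∀ d → 1 ≤ d → d < n → d ∣ℕ n → ¬ (g ∣ fib d)) → ¬ (g ∣ rest n)
    prime-∤-rest {g} {zero}  i _   new g∣1 = ∤-one i g∣1
    prime-∤-rest {g} {suc n} i n≤N new = none n ℕₚ.≤-refl
      where
      none : ∀ M → M ≤ n → ¬ (g ∣ ⨁ M λ d → when (d ℕ∣.∣? suc n) (part d))
      none zero    _   g∣1 = ∤-one i g∣1
      none (suc M) M<n g∣⨁ with prime i (when (suc M ℕ∣.∣? suc n) (part (suc M))) (⨁ M λ d → when (d ℕ∣.∣? suc n) (part d)) g∣⨁
      ... | inj₂ g∣M = none M (ℕₚ.<⇒≤ M<n) g∣M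
      ... | inj₁ g∣top = top (suc M ℕ∣.∣? suc n) g∣top
        where
        top : (d : Dec (suc M ∣ℕ suc n)) → ¬ (g ∣ when d (part (suc M)))
        top (no _)  g∣1    = ∤-one i g∣1
        top (yes M∣n) g∣part = new (suc M) (s≤s z≤n) (s≤s M<n) M∣n
          (∣-trans g∣part (part-∣-fib S (suc M) (s≤s z≤n) (ℕₚ.≤-trans (ℕₚ.m≤n⇒m≤1+n M<n) n≤N)))

    prime-∣-fib⇒∣-part : ∀ {g n} → MonicIrr g → 1 ≤ n → n ≤ N → g ∣ fib n →
      (∀ d → 1 ≤ d → d < n → d ∣ℕ n → ¬ (g ∣ fib d)) → g ∣ part n
    prime-∣-fib⇒∣-part {g} {n} i 1≤n n≤N g∣fib new with prime i (part n) (rest n) (∣-resp (fib≋part*rest n 1≤n n≤N) g∣fib)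
    ... | inj₁ g∣part = g∣part
    ... | inj₂ g∣rest = ⊥-elim (prime-∤-rest i n≤N new g∣rest)

    -- The rank of apparition of g is n: if n does not divide d, the ideal of `part n` and F_d
    -- contains a positive divisor of n, which is a nonzero constant and so not divisible by g.
    prime-∣-part⇒rank : ∀ {g n} → MonicIrr g → 1 ≤ n → n ≤ N → (∀ k → suc k ∣ℕ n → ¬ (R.ν (suc k) R.≈ R.0#)) →
      g ∣ part n → ∀ d → g ∣ fib d → n ∣ℕ d
    prime-∣-part⇒rank {g} {n} i 1≤n n≤N ν≉0 g∣part d g∣fib with n ℕ∣.∣? d
    ... | yes n∣d = n∣d
    ... | no  n∤d =
      let k , (u , v , eq) , k∣n = part-fib-coprime S n d 1≤n n≤N n∤d
      in  ⊥-elim (∤-ν (suc k) (monic i) (ν≉0 k k∣n) (∣-resp (≋-sym eq) (∣-+ (∣-*ˡ u g∣part) (∣-*ˡ v g∣fib))))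

open ℤ-Poly using (ℤ-domain)

module ℤ-Fibotomic where
  open PrimeProducts ℤ-domain ℤ-Poly.gauss
  open FibotomicPart ℤ-domain ℤ-Poly.gauss
  open PrimitiveParts ℤ-ring
  open PrimitivePartsDomain ℤ-domain
  open ℤ-Poly.F

  ℤ-system : ∀ N → System N
  ℤ-system = Existence.system ℤ-Poly.char-0

  Fib≡fib : ∀ n → Fib n ≡ fib n
  Fib≡fib zero          = ≡.refl
  Fib≡fib (suc zero)    = ≡.refl
  Fib≡fib (suc (suc n)) = ≡.cong₂ (λ a b → (X *P a) +P b) (Fib≡fib (suc n)) (Fib≡fib n)

  -- The listed irreducibles are exactly the prime factors of the part: a factor of F_n that divides
  -- no earlier F_d avoids the complementary product, and conversely a factor of the part divides
  -- F_k only if n ∣ k. Squarefreeness of F_n makes their product equal to the part.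
  fibotomic≋part : ∀ {n Ψ} → 1 ≤ n → IsFibotomic n Ψ → Ψ ≋ System.part (ℤ-system n) n
  fibotomic≋part {suc n} {Ψ} 1≤n (L , sound , complete , distinct , Ψ≈) =
    ≋-trans (coeffwise Ψ≈) (squarefree-prodP (proj₂ (part-monic (suc n) 1≤n ℕₚ.≤-refl)) squarefree
      (members (λ i _ _ → i) L λ g g∈L → g∈L) distinct (members new-∣ L λ g g∈L → g∈L) λ g i g∣part →
        complete g (_ , proj₁ (monic i) , above (proj₂ (monic i))) (from-irr (irreducible i))
          (from-∣ (≡.subst (g ∣_) (≡.sym (Fib≡fib (suc n))) (∣-trans g∣part (part-∣-fib S (suc n) 1≤n ℕₚ.≤-refl))))
          λ k 1≤k k<n g∣Fib → ℕₚ.<⇒≱ k<n (ℕ∣.∣⇒≤ {{ℕ.>-nonZero 1≤k}}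
            (prime-∣-part⇒rank S i 1≤n ℕₚ.≤-refl (λ k _ → ℤ-Poly.char-0 k) g∣part k (≡.subst (g ∣_) (Fib≡fib k) (to-∣ g∣Fib)))))
    where
    S = ℤ-system (suc n)
    open System S

    squarefree : ∀ {g} → MonicIrr g → ¬ (g *P g ∣ part (suc n))
    squarefree i g²∣ = fib-squarefree {n = suc n} (monic i) (ℤ-Poly.char-0 n) (ℤ-Poly.char-0 3)
      (∣-trans g²∣ (part-∣-fib S (suc n) 1≤n ℕₚ.≤-refl))

    new-∣ : ∀ {g} → MonicIrr g → g ∣ fib (suc n) → (∀ d → 1 ≤ d → d < suc n → ¬ (g ∣ fib d)) → g ∣ part (suc n)
    new-∣ i g∣fib new = prime-∣-fib⇒∣-part S i 1≤n ℕₚ.≤-refl g∣fib λ d 1≤d d<n _ → new d 1≤d d<n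

    -- The recursion runs over a sublist `L′`, while membership refers to the whole list, for which
    -- `sound` is stated.
    members : ∀ {Q : Pol → Set} →
      (∀ {g} → MonicIrr g → g ∣ fib (suc n) → (∀ d → 1 ≤ d → d < suc n → ¬ (g ∣ fib d)) → Q g) →
      ∀ L′ → (∀ g → g ∈P L′ → g ∈P L) → All Q L′
    members q [] _ = []
    members q (g ∷ L′) L′⊆L =
      let m , irr , g∣ , new = sound g (L′⊆L g (inj₁ λ i → ≡.refl))
      in  q (to-monicIrr m irr) (≡.subst (g ∣_) (Fib≡fib (suc n)) (to-∣ g∣))
            (λ d 1≤d d<n g∣fib → new d 1≤d d<n (from-∣ (≡.subst (g ∣_) (≡.sym (Fib≡fib d)) g∣fib)))
          ∷ members q L′ λ g g∈ → L′⊆L g (inj₂ g∈)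

-- The totient function

module Counting where
  open BigOp ℕₚ.+-0-commutativeMonoid public

  length-filter-range : ∀ {P : ℕ → Set} (P? : ∀ j → Dec (P j)) n →
    length (List.filter P? (map suc (List.upTo n))) ≡ ⨁ n (λ j → when (P? j) 1)
  length-filter-range P? zero    = ≡.refl
  length-filter-range P? (suc n) = begin
    length (List.filter P? (map suc (List.upTo (suc n))))
      ≡⟨ ≡.cong (λ l → length (List.filter P? (map suc l))) (Listₚ.upTo-∷ʳ n) ⟨
    length (List.filter P? (map suc (List.upTo n List.++ List.[ n ])))
      ≡⟨ ≡.cong (λ l → length (List.filter P? l)) (Listₚ.map-++ suc (List.upTo n) List.[ n ]) ⟩
    length (List.filter P? (map suc (List.upTo n) List.++ List.[ suc n ]))
      ≡⟨ ≡.cong length (Listₚ.filter-++ P? (map suc (List.upTo n)) List.[ suc n ]) ⟩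
    length (List.filter P? (map suc (List.upTo n)) List.++ List.filter P? List.[ suc n ])
      ≡⟨ Listₚ.length-++ (List.filter P? (map suc (List.upTo n))) ⟩
    length (List.filter P? (map suc (List.upTo n))) ℕ.+ length (List.filter P? List.[ suc n ])
      ≡⟨ ≡.cong₂ ℕ._+_ (length-filter-range P? n) last ⟩
    ⨁ n (λ j → when (P? j) 1) ℕ.+ when (P? (suc n)) 1
      ≡⟨ ℕₚ.+-comm _ (when (P? (suc n)) 1) ⟩
    when (P? (suc n)) 1 ℕ.+ ⨁ n (λ j → when (P? j) 1) ∎
    where
    open ≡.≡-Reasoning
    last : length (List.filter P? List.[ suc n ]) ≡ when (P? (suc n)) 1
    last with P? (suc n)
    ... | yes _ = ≡.refl
    ... | no  _ = ≡.refl

  φ≡⨁ : ∀ n → φ n ≡ ⨁ n (λ j → when (coprime? j n) 1)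
  φ≡⨁ n = length-filter-range (λ j → coprime? j n) n

  ⨁-1 : ∀ n → ⨁ n (λ _ → 1) ≡ n
  ⨁-1 zero    = ≡.refl
  ⨁-1 (suc n) = ≡.cong suc (⨁-1 n)

  -- Each j ∈ {1, …, n} has the form j = i · n/d with d ∣ n and i coprime to d for exactly one d, namely n / gcd j n.
  private
    φ-fiber : ∀ n d → 1 ≤ d → 1 ≤ n → when (d ℕ∣.∣? n) (φ d) ≡ ⨁ n (λ j → when (gcd j n ℕ.* d ℕ.≟ n) 1)
    φ-fiber n d 1≤d 1≤n with d ℕ∣.∣? n
    ... | no d∤n = ≡.sym (≡.trans (⨁-cong n λ j _ _ → when-no (gcd j n ℕ.* d ℕ.≟ n)
            λ eq → d∤n (ℕ∣.divides (gcd j n) (≡.sym eq))) (⨁-ε n))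
    ... | yes (ℕ∣.divides e ≡.refl) = ≡.trans (φ≡⨁ d) (≡.sym (begin
      ⨁ (e ℕ.* d) f ≡⟨ ≡.cong (λ N → ⨁ N f) (ℕₚ.*-comm e d) ⟩
      ⨁ (d ℕ.* e) f ≡⟨ ⨁-multiples e d f 1≤e support ⟩
      ⨁ d (λ i → f (i ℕ.* e)) ≡⟨ ⨁-cong d (λ i _ _ → when-cong (gcd (i ℕ.* e) (e ℕ.* d) ℕ.* d ℕ.≟ e ℕ.* d) (coprime? i d) (to i) (from i) λ _ → ≡.refl) ⟩
      ⨁ d (λ j → when (coprime? j d) 1) ∎))
      where
      open ≡.≡-Reasoning
      instance
        nonzero-d = ℕ.>-nonZero 1≤d
      f : ℕ → ℕ
      f j = when (gcd j (e ℕ.* d) ℕ.* d ℕ.≟ e ℕ.* d) 1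
      1≤e : 1 ≤ e
      1≤e = ℕₚ.n≢0⇒n>0 λ { ≡.refl → ℕₚ.<⇒≢ 1≤n ≡.refl }
      gcd≡e : ∀ j → gcd j (e ℕ.* d) ℕ.* d ≡ e ℕ.* d → gcd j (e ℕ.* d) ≡ e
      gcd≡e j = ℕₚ.*-cancelʳ-≡ (gcd j (e ℕ.* d)) e d
      support : ∀ j → ¬ (e ∣ℕ j) → f j ≡ 0
      support j e∤j = when-no (gcd j (e ℕ.* d) ℕ.* d ℕ.≟ e ℕ.* d) λ eq →
        e∤j (≡.subst (_∣ℕ j) (gcd≡e j eq) (gcd[m,n]∣m j (e ℕ.* d)))
      gcd-scaled : ∀ i → gcd (i ℕ.* e) (e ℕ.* d) ≡ e ℕ.* gcd i d
      gcd-scaled i = ≡.trans (≡.cong (λ t → gcd t (e ℕ.* d)) (ℕₚ.*-comm i e)) (≡.sym (GCD.c*gcd[m,n]≡gcd[cm,cn] e i d))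
      to : ∀ i → gcd (i ℕ.* e) (e ℕ.* d) ℕ.* d ≡ e ℕ.* d → Coprime i d
      to i eq = gcd≡1⇒coprime (ℕₚ.*-cancelˡ-≡ (gcd i d) 1 e {{ℕ.>-nonZero 1≤e}}
        (≡.trans (≡.sym (gcd-scaled i)) (≡.trans (gcd≡e (i ℕ.* e) eq) (≡.sym (ℕₚ.*-identityʳ e)))))
      from : ∀ i → Coprime i d → gcd (i ℕ.* e) (e ℕ.* d) ℕ.* d ≡ e ℕ.* d
      from i c = ≡.cong (ℕ._* d) (≡.trans (gcd-scaled i) (≡.trans (≡.cong (e ℕ.*_) (coprime⇒gcd≡1 c)) (ℕₚ.*-identityʳ e)))

  sum-φ : ∀ n → 1 ≤ n → ⨁ n (λ d → when (d ℕ∣.∣? n) (φ d)) ≡ n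
  sum-φ n 1≤n = begin
    ⨁ n (λ d → when (d ℕ∣.∣? n) (φ d)) ≡⟨ ⨁-cong n (λ d 1≤d _ → φ-fiber n d 1≤d 1≤n) ⟩
    ⨁ n (λ d → ⨁ n (λ j → when (gcd j n ℕ.* d ℕ.≟ n) 1)) ≡⟨ ⨁-swap n n (λ d j → when (gcd j n ℕ.* d ℕ.≟ n) 1) ⟩
    ⨁ n (λ j → ⨁ n (λ d → when (gcd j n ℕ.* d ℕ.≟ n) 1)) ≡⟨ ⨁-cong n (λ j _ _ → unique j (gcd[m,n]∣n j n)) ⟩
    ⨁ n (λ _ → 1) ≡⟨ ⨁-1 n ⟩
    n ∎
    where
    open ≡.≡-Reasoning
    unique : ∀ j → gcd j n ∣ℕ n → ⨁ n (λ d → when (gcd j n ℕ.* d ℕ.≟ n) 1) ≡ 1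
    unique j (ℕ∣.divides q eq) = ≡.trans (⨁-single n q (λ d → when (gcd j n ℕ.* d ℕ.≟ n) 1) 1≤q
        (ℕ∣.∣⇒≤ {{ℕ.>-nonZero 1≤n}} (ℕ∣.divides (gcd j n) (≡.trans eq (ℕₚ.*-comm q (gcd j n)))))
        λ d d≢q → when-no (gcd j n ℕ.* d ℕ.≟ n) λ e → d≢q (ℕₚ.*-cancelˡ-≡ d q (gcd j n) {{ℕ.≢-nonZero g≢0}} (≡.trans e gq)))
      (when-yes (gcd j n ℕ.* q ℕ.≟ n) (≡.sym gq))
      where
      gq : n ≡ gcd j n ℕ.* q
      gq = ≡.trans eq (ℕₚ.*-comm q (gcd j n))
      g≢0 : gcd j n ≢ 0
      g≢0 g≡0 = ℕₚ.<⇒≢ 1≤n (≡.sym (≡.trans gq (≡.cong (ℕ._* q) g≡0)))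
      1≤q : 1 ≤ q
      1≤q = ℕₚ.n≢0⇒n>0 λ { ≡.refl → ℕₚ.<⇒≢ 1≤n (≡.sym eq) }

-- Divisors and totients of prime powers

prime∤⇒coprime : ∀ {p j} → Prime p → ¬ (p ∣ℕ j) → Coprime j p
prime∤⇒coprime p-prime p∤j {d} (d∣j , d∣p) with prime⇒irreducible p-prime d∣p
... | inj₁ d≡1    = d≡1
... | inj₂ ≡.refl = ⊥-elim (p∤j d∣j)

full-power-or-divisor : ∀ {p} → Prime p → ∀ k d j → j ∣ℕ p ℕ.^ suc k ℕ.* d → (p ℕ.^ suc k ∣ℕ j) ⊎ (j ∣ℕ p ℕ.^ k ℕ.* d)
full-power-or-divisor {p} p-prime k d j j∣ with p ℕ∣.∣? j
... | no p∤j = inj₂ (coprime-divisor (prime∤⇒coprime p-prime p∤j) (≡.subst (j ∣ℕ_) (ℕₚ.*-assoc p (p ℕ.^ k) d) j∣))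
full-power-or-divisor {p} p-prime zero    d _ j∣ | yes p∣j = inj₁ (≡.subst (_∣ℕ _) (≡.sym (ℕₚ.*-identityʳ p)) p∣j)
full-power-or-divisor {p} p-prime (suc k) d _ j∣ | yes (ℕ∣.divides j′ ≡.refl)
  with full-power-or-divisor p-prime k d j′ (ℕ∣.*-cancelˡ-∣ p {{prime⇒nonZero p-prime}}
         (≡.subst₂ _∣ℕ_ (ℕₚ.*-comm j′ p) (ℕₚ.*-assoc p (p ℕ.^ suc k) d) j∣))
... | inj₁ q = inj₁ (≡.subst (p ℕ.^ suc (suc k) ∣ℕ_) (ℕₚ.*-comm p j′) (ℕ∣.*-monoʳ-∣ p q))
... | inj₂ q = inj₂ (≡.subst₂ _∣ℕ_ (ℕₚ.*-comm p j′) (≡.sym (ℕₚ.*-assoc p (p ℕ.^ k) d)) (ℕ∣.*-monoʳ-∣ p q))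

prime-power∤ : ∀ {p d} → Prime p → ¬ (p ∣ℕ d) → ∀ k → ¬ (p ℕ.^ suc k ∣ℕ p ℕ.^ k ℕ.* d)
prime-power∤ {p} {d} p-prime p∤d k p∣ = p∤d (ℕ∣.*-cancelˡ-∣ (p ℕ.^ k) {{ℕₚ.m^n≢0 p k {{prime⇒nonZero p-prime}}}}
  (≡.subst (_∣ℕ p ℕ.^ k ℕ.* d) (ℕₚ.*-comm p (p ℕ.^ k)) p∣))

prime-power≥1 : ∀ {p} → Prime p → ∀ k → 1 ≤ p ℕ.^ k
prime-power≥1 {p} p-prime k = ℕ.>-nonZero⁻¹ (p ℕ.^ k) {{ℕₚ.m^n≢0 p k {{prime⇒nonZero p-prime}}}}

-- The totient sums over the divisors of p^(k+1) and of p^k differ in the single term at p^(k+1).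
φ-prime-power : ∀ {p} → Prime p → ∀ k → φ (p ℕ.^ suc k) ≡ p ℕ.^ k ℕ.* ℕ.pred p
φ-prime-power {p} p-prime k = ℕₚ.+-cancelˡ-≡ (p ℕ.^ k) _ _ (begin
  p ℕ.^ k ℕ.+ φ (p ℕ.^ suc k)
    ≡⟨ ≡.cong (ℕ._+ φ P) (sum-φ (p ℕ.^ k) (prime-power≥1 p-prime k)) ⟨
  ⨁ (p ℕ.^ k) (λ d → when (d ℕ∣.∣? p ℕ.^ k) (φ d)) ℕ.+ φ P
    ≡⟨ ≡.cong₂ ℕ._+_ small large ⟨
  ⨁ P (λ d → when (d ℕ∣.∣? p ℕ.^ k) (φ d)) ℕ.+ ⨁ P rest
    ≡⟨ ⨁-∙ P (λ d → when (d ℕ∣.∣? p ℕ.^ k) (φ d)) rest ⟨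
  ⨁ P (λ d → when (d ℕ∣.∣? p ℕ.^ k) (φ d) ℕ.+ rest d)
    ≡⟨ ⨁-cong P (λ d _ _ → when-split (d ℕ∣.∣? p ℕ.^ k) (d ℕ∣.∣? P) (φ d) (λ d∣ → ℕ∣.∣-trans d∣ (ℕ∣.divides p ≡.refl))) ⟨
  ⨁ P (λ d → when (d ℕ∣.∣? P) (φ d))
    ≡⟨ sum-φ P (prime-power≥1 p-prime (suc k)) ⟩
  p ℕ.* p ℕ.^ k
    ≡⟨ ≡.cong (ℕ._* p ℕ.^ k) (ℕₚ.suc-pred p {{prime⇒nonZero p-prime}}) ⟨
  suc (ℕ.pred p) ℕ.* p ℕ.^ k
    ≡⟨ ≡.cong (p ℕ.^ k ℕ.+_) (ℕₚ.*-comm (ℕ.pred p) (p ℕ.^ k)) ⟩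
  p ℕ.^ k ℕ.+ p ℕ.^ k ℕ.* ℕ.pred p ∎)
  where
  open ≡.≡-Reasoning
  open Counting
  P = p ℕ.^ suc k
  rest : ℕ → ℕ
  rest d = unless (d ℕ∣.∣? p ℕ.^ k) (when (d ℕ∣.∣? P) (φ d))
  p^k≤P : p ℕ.^ k ≤ P
  p^k≤P = ℕₚ.m≤n*m (p ℕ.^ k) p {{prime⇒nonZero p-prime}}
  small : ⨁ P (λ d → when (d ℕ∣.∣? p ℕ.^ k) (φ d)) ≡ ⨁ (p ℕ.^ k) (λ d → when (d ℕ∣.∣? p ℕ.^ k) (φ d))
  small = ⨁-extend-≤ (λ d → when (d ℕ∣.∣? p ℕ.^ k) (φ d)) p^k≤P λ i <i _ →
    when-no (i ℕ∣.∣? p ℕ.^ k) λ i∣ → ℕₚ.<⇒≱ <i (ℕ∣.∣⇒≤ {{ℕ.>-nonZero (prime-power≥1 p-prime k)}} i∣)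
  P∤p^k : ¬ (P ∣ℕ p ℕ.^ k)
  P∤p^k P∣ = prime-power∤ {d = 1} p-prime (λ p∣1 → ℕ.nonTrivial⇒≢1 {{prime⇒nonTrivial p-prime}} (ℕ∣.∣1⇒≡1 p∣1)) k
    (≡.subst (P ∣ℕ_) (≡.sym (ℕₚ.*-identityʳ (p ℕ.^ k))) P∣)
  large : ⨁ P rest ≡ φ P
  large = ≡.trans (⨁-single P P rest (prime-power≥1 p-prime (suc k)) ℕₚ.≤-refl others)
    (≡.trans (unless-no (P ℕ∣.∣? p ℕ.^ k) P∤p^k) (when-yes (P ℕ∣.∣? P) ℕ∣.∣-refl))
    where
    others : ∀ i → i ≢ P → rest i ≡ 0
    others i i≢P with i ℕ∣.∣? p ℕ.^ k | i ℕ∣.∣? P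
    ... | yes _ | _      = ≡.refl
    ... | no _  | no _   = ≡.refl
    ... | no i∤ | yes i∣ with full-power-or-divisor p-prime k 1 i (≡.subst (i ∣ℕ_) (≡.sym (ℕₚ.*-identityʳ P)) i∣)
    ...   | inj₁ P∣i = ⊥-elim (i≢P (ℕ∣.∣-antisym i∣ P∣i))
    ...   | inj₂ i∣′ = ⊥-elim (i∤ (≡.subst (i ∣ℕ_) (ℕₚ.*-identityʳ (p ℕ.^ k)) i∣′))

-- Primitive parts in characteristic p

-- The degree of part n; it differs from φ at 1, since part 1 = 1 while φ 1 = 1.
φ₁ : ℕ → ℕ
φ₁ zero          = 0
φ₁ (suc zero)    = 0
φ₁ (suc (suc n)) = φ (suc (suc n))

-- The sum is n - 1, the degree of F_n; the correction at d = 1 accounts for the missing 1.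
sum-φ₁ : ∀ n → 1 ≤ n → suc (Counting.⨁ n (λ d → Counting.when (d ℕ∣.∣? n) (φ₁ d))) ≡ n
sum-φ₁ n 1≤n = begin
  1 ℕ.+ ⨁ n (λ d → when (d ℕ∣.∣? n) (φ₁ d))
    ≡⟨ ≡.cong (ℕ._+ ⨁ n (λ d → when (d ℕ∣.∣? n) (φ₁ d))) (⨁-single n 1 one ℕₚ.≤-refl 1≤n λ i i≢1 → when-no (i ℕ.≟ 1) i≢1) ⟨
  ⨁ n one ℕ.+ ⨁ n (λ d → when (d ℕ∣.∣? n) (φ₁ d))
    ≡⟨ ⨁-∙ n one (λ d → when (d ℕ∣.∣? n) (φ₁ d)) ⟨
  ⨁ n (λ d → one d ℕ.+ when (d ℕ∣.∣? n) (φ₁ d))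
    ≡⟨ ⨁-cong n (λ d 1≤d _ → pointwise d 1≤d) ⟩
  ⨁ n (λ d → when (d ℕ∣.∣? n) (φ d))
    ≡⟨ sum-φ n 1≤n ⟩
  n ∎
  where
  open ≡.≡-Reasoning
  open Counting
  one : ℕ → ℕ
  one d = when (d ℕ.≟ 1) 1
  pointwise : ∀ d → 1 ≤ d → one d ℕ.+ when (d ℕ∣.∣? n) (φ₁ d) ≡ when (d ℕ∣.∣? n) (φ d)
  pointwise (suc zero)    _ with 1 ℕ∣.∣? n
  ... | yes _  = ≡.refl
  ... | no 1∤n = ⊥-elim (1∤n (ℕ∣.1∣ n))
  pointwise (suc (suc d)) _ = ≡.refl

module PartDegree (𝔻 : IntegralDomain) where
  open IntegralDomain 𝔻 renaming (ring to R)
  private module R = RingKit R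
  open Factorization 𝔻
  open PrimitiveParts R

  module _ {N : ℕ} (S : System N) where
    open System S

    private
      proper-product-degree : ∀ n M → (∀ d → 1 ≤ d → d ≤ M → MonicDeg (part d) (φ₁ d)) →
        MonicDeg (⨁ M λ d → when (d ℕ∣.∣? n) (part d)) (Counting.⨁ M λ d → Counting.when (d ℕ∣.∣? n) (φ₁ d))
      proper-product-degree n zero    p = monic-one
      proper-product-degree n (suc M) p = monic-* (factor (suc M ℕ∣.∣? n))
        (proper-product-degree n M λ d 1≤d d≤M → p d 1≤d (ℕₚ.m≤n⇒m≤1+n d≤M))
        where
        factor : (d : Dec (suc M ∣ℕ n)) → MonicDeg (when d (part (suc M))) (Counting.when d (φ₁ (suc M)))
        factor (yes _) = p (suc M) (s≤s z≤n) ℕₚ.≤-refl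
        factor (no _)  = monic-one

      -- Comparing degrees in the factorisation of F_n shows that the degrees of the parts at the
      -- divisors of n add up to n - 1; by `sum-φ₁` the function `φ₁` solves the same recursion.
      part-degrees : ∀ M → M ≤ N → ∀ d → 1 ≤ d → d ≤ M → MonicDeg (part d) (φ₁ d)
      part-degrees zero    _   d 1≤d d≤0 = ⊥-elim (ℕₚ.<⇒≱ 1≤d d≤0)
      part-degrees (suc M) M<N d 1≤d d≤  with ℕₚ.m≤n⇒m<n∨m≡n d≤
      ... | inj₁ d<      = part-degrees M (ℕₚ.<⇒≤ M<N) d 1≤d (ℕₚ.≤-pred d<)
      ... | inj₂ ≡.refl = conclude (monic-cofactor rest-degree (part (suc M)) (monic-resp fib≋ (monic-fib M)))
        where
        below = λ d → when (d ℕ∣.∣? suc M) (part d)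
        rest-degree : MonicDeg (⨁ M below) (Counting.⨁ M λ d → Counting.when (d ℕ∣.∣? suc M) (φ₁ d))
        rest-degree = proper-product-degree (suc M) M (part-degrees M (ℕₚ.<⇒≤ M<N))
        fib≋ : fib (suc M) ≋ ⨁ M below *P part (suc M)
        fib≋ = ≋-trans (product (suc M) (s≤s z≤n) M<N) (≋-trans
          (*P-congʳ (⨁ M below) (when-yes (suc M ℕ∣.∣? suc M) ℕ∣.∣-refl)) (*P-comm (part (suc M)) (⨁ M below)))
        total : M ≡ φ₁ (suc M) ℕ.+ Counting.⨁ M (λ d → Counting.when (d ℕ∣.∣? suc M) (φ₁ d))
        total = ℕₚ.suc-injective (≡.trans (≡.sym (sum-φ₁ (suc M) (s≤s z≤n)))
          (≡.cong (λ t → suc (t ℕ.+ Counting.⨁ M (λ d → Counting.when (d ℕ∣.∣? suc M) (φ₁ d))))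
            (Counting.when-yes (suc M ℕ∣.∣? suc M) ℕ∣.∣-refl)))
        conclude : (Σ ℕ λ e → MonicDeg (part (suc M)) e × (M ≡ _ ℕ.+ e)) → MonicDeg (part (suc M)) (φ₁ (suc M))
        conclude (e , me , M≡) = ≡.subst (MonicDeg (part (suc M)))
          (ℕₚ.+-cancelˡ-≡ (Counting.⨁ M λ d → Counting.when (d ℕ∣.∣? suc M) (φ₁ d)) e (φ₁ (suc M))
            (≡.trans (≡.sym M≡) (≡.trans total (ℕₚ.+-comm (φ₁ (suc M)) _)))) me

    part-degree : ∀ n → 1 ≤ n → n ≤ N → MonicDeg (part n) (φ₁ n)
    part-degree n 1≤n n≤N = part-degrees N ℕₚ.≤-refl n 1≤n n≤N

module CharPSystem (𝔻 : IntegralDomain)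
  {p : ℕ} (p-prime : Prime p) (char-p : RingKit.Characteristic (IntegralDomain.ring 𝔻) p) where
  open IntegralDomain 𝔻 renaming (ring to R)
  private module R = RingKit R
  open Factorization 𝔻
  open PrimitiveParts R
  open PartDegree 𝔻
  private
    module P = RingKit polyRing
    module QE = QuadraticExtension polyRing X
  open P using (solve; _:=_; _:*_; con; begin_; step-≈-⟩; step-≈-⟨; step-≡-⟩; step-≡-⟨; _∎)

  p∤1 : ¬ (p ∣ℕ 1)
  p∤1 p∣1 = ℕ.nonTrivial⇒≢1 {{prime⇒nonTrivial p-prime}} (ℕ∣.∣1⇒≡1 p∣1)

  char-poly : P.ν p ≋ []
  char-poly = ≋-trans (≋-sym (const-ν p)) (≋-trans (const-cong char-p) const-0)

  fib-frobenius : ∀ n → fib (n ℕ.* p) ≋ fib p *P (fib n P.^ p)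
  fib-frobenius n = monic-cancel monic-disc (QE.fib-frobenius p-prime char-poly n)

  fib-p : ∀ h → p ≡ suc (2 ℕ.* h) → fib p ≋ disc P.^ h
  fib-p h p≡ = monic-cancel monic-disc (QE.disc-fib-p p-prime char-poly h p≡)

  private
    p≡ : p ≡ suc (ℕ.pred p)
    p≡ = ≡.sym (ℕₚ.suc-pred p {{prime⇒nonZero p-prime}})

  open Algebra.Properties.CommutativeSemiring.Exp P.commutativeSemiring using (^-distrib-*)

  -- The induction raises the formula for k to the p-th power and multiplies by F_p; `fib-frobenius`
  -- absorbs both operations. The last exponent is φ(p^(k+1)).
  fib-tower : ∀ k d → fib (p ℕ.^ suc k ℕ.* d) ≋ fib (p ℕ.^ k ℕ.* d) *P ((fib p P.^ (p ℕ.^ k)) *P (fib d P.^ (p ℕ.^ k ℕ.* ℕ.pred p)))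
  fib-tower zero d = begin
    fib (p ℕ.* 1 ℕ.* d) ≡⟨ ≡.cong fib (≡.trans (≡.cong (ℕ._* d) (ℕₚ.*-identityʳ p)) (ℕₚ.*-comm p d)) ⟩
    fib (d ℕ.* p) ≈⟨ fib-frobenius d ⟩
    fib p *P (fib d P.^ p) ≡⟨ ≡.cong (λ e → fib p *P (fib d P.^ e)) p≡ ⟩
    fib p *P (fib d *P (fib d P.^ ℕ.pred p)) ≈⟨ solve 3 (λ a b c → a :* (b :* c) := b :* ((a :* con (+ 1)) :* c)) ≋-refl (fib p) (fib d) (fib d P.^ ℕ.pred p) ⟩
    fib d *P ((fib p P.^ 1) *P (fib d P.^ ℕ.pred p)) ≡⟨ ≡.cong₂ (λ m e → fib m *P ((fib p P.^ 1) *P (fib d P.^ e))) (ℕₚ.*-identityˡ d) (ℕₚ.*-identityˡ (ℕ.pred p)) ⟨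
    fib (1 ℕ.* d) *P ((fib p P.^ 1) *P (fib d P.^ (1 ℕ.* ℕ.pred p))) ∎
  fib-tower (suc k) d = begin
    fib (p ℕ.* p ℕ.^ suc k ℕ.* d) ≡⟨ ≡.cong fib (swap (p ℕ.^ suc k)) ⟩
    fib (p ℕ.^ suc k ℕ.* d ℕ.* p) ≈⟨ fib-frobenius (p ℕ.^ suc k ℕ.* d) ⟩
    fib p *P (fib (p ℕ.^ suc k ℕ.* d) P.^ p) ≈⟨ *P-congˡ (fib p) (P.^-congˡ p (fib-tower k d)) ⟩
    fib p *P ((A *P (B *P C)) P.^ p) ≈⟨ *P-congˡ (fib p) (≋-trans (^-distrib-* A (B *P C) p) (*P-congˡ (A P.^ p) (^-distrib-* B C p))) ⟩
    fib p *P ((A P.^ p) *P ((B P.^ p) *P (C P.^ p))) ≈⟨ *P-assoc (fib p) (A P.^ p) ((B P.^ p) *P (C P.^ p)) ⟨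
    (fib p *P (A P.^ p)) *P ((B P.^ p) *P (C P.^ p))
      ≈⟨ *P-cong (≋-trans (≋-sym (fib-frobenius (p ℕ.^ k ℕ.* d))) (P.reflexive (≡.cong fib (≡.sym (swap (p ℕ.^ k))))))
           (*P-cong (≋-trans (P.^-assocʳ (fib p) (p ℕ.^ k) p) (P.^-congʳ (fib p) (ℕₚ.*-comm (p ℕ.^ k) p)))
             (≋-trans (P.^-assocʳ (fib d) (p ℕ.^ k ℕ.* ℕ.pred p) p) (P.^-congʳ (fib d)
               (≡.trans (ℕₚ.*-comm _ p) (≡.sym (ℕₚ.*-assoc p (p ℕ.^ k) (ℕ.pred p))))))) ⟩
    fib (p ℕ.^ suc k ℕ.* d) *P ((fib p P.^ (p ℕ.^ suc k)) *P (fib d P.^ (p ℕ.^ suc k ℕ.* ℕ.pred p))) ∎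
    where
    A = fib (p ℕ.^ k ℕ.* d)
    B = fib p P.^ (p ℕ.^ k)
    C = fib d P.^ (p ℕ.^ k ℕ.* ℕ.pred p)
    swap : ∀ q → p ℕ.* q ℕ.* d ≡ q ℕ.* d ℕ.* p
    swap q = ≡.trans (ℕₚ.*-assoc p q d) (ℕₚ.*-comm p (q ℕ.* d))

  module _ {N : ℕ} (S : System N) (k : ℕ) where
    open System S

    private
      P^ = p ℕ.^ suc k
      E = p ℕ.^ k ℕ.* ℕ.pred p

      P^≥1 : 1 ≤ P^
      P^≥1 = prime-power≥1 p-prime (suc k)

      -- The power of F_p in `fib-tower` does not depend on d, so in the product over divisors it is
      -- attributed to the divisor 1.
      base : ℕ → Pol
      base e = when (e ℕ.≟ 1) (fib p P.^ (p ℕ.^ k))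

      expected : ℕ → Pol
      expected e = base e *P (part e P.^ E)

    -- The divisors of p^(k+1) d that do not divide p^k d are the p^(k+1) e with e ∣ d; their parts
    -- multiply to F_(p^(k+1) d) / F_(p^k d), which `fib-tower` evaluates.
    new-divisors-product : ∀ d → 1 ≤ d → ¬ (p ∣ℕ d) → P^ ℕ.* d ≤ N →
      ⨁ d (λ e → when (e ℕ∣.∣? d) (part (P^ ℕ.* e))) ≋ (fib p P.^ (p ℕ.^ k)) *P (fib d P.^ E)
    new-divisors-product d 1≤d p∤d ≤N = monic-cancel old-monic (begin
      fib m *P ⨁ d (λ e → when (e ℕ∣.∣? d) (part (P^ ℕ.* e)))
        ≈⟨ *P-cong old (P.trans (⨁-multiples P^ d rest P^≥1 support) (⨁-cong d λ e 1≤e e≤d → P.trans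
             (P.reflexive (≡.cong rest (ℕₚ.*-comm e P^))) (at-multiple e))) ⟨
      ⨁ n (λ j → when (j ℕ∣.∣? m) (part j)) *P ⨁ (d ℕ.* P^) rest
        ≡⟨ ≡.cong (λ M → ⨁ n (λ j → when (j ℕ∣.∣? m) (part j)) *P ⨁ M rest) (ℕₚ.*-comm d P^) ⟩
      ⨁ n (λ j → when (j ℕ∣.∣? m) (part j)) *P ⨁ n rest
        ≈⟨ ⨁-∙ n (λ j → when (j ℕ∣.∣? m) (part j)) rest ⟨
      ⨁ n (λ j → when (j ℕ∣.∣? m) (part j) P.* rest j)
        ≈⟨ ⨁-cong n (λ j _ _ → when-split (j ℕ∣.∣? m) (j ℕ∣.∣? n) (part j) λ j∣m → ℕ∣.∣-trans j∣m m∣n) ⟨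
      ⨁ n (λ j → when (j ℕ∣.∣? n) (part j))
        ≈⟨ product n 1≤n ≤N ⟨
      fib n
        ≈⟨ fib-tower k d ⟩
      fib m *P ((fib p P.^ (p ℕ.^ k)) *P (fib d P.^ E)) ∎)
      where
      n = P^ ℕ.* d
      m = p ℕ.^ k ℕ.* d
      1≤n : 1 ≤ n
      1≤n = ℕₚ.*-mono-≤ P^≥1 1≤d
      1≤m : 1 ≤ m
      1≤m = ℕₚ.*-mono-≤ (prime-power≥1 p-prime k) 1≤d
      m∣n : m ∣ℕ n
      m∣n = ℕ∣.divides p (ℕₚ.*-assoc p (p ℕ.^ k) d)
      m≤n : m ≤ n
      m≤n = ℕ∣.∣⇒≤ {{ℕ.>-nonZero 1≤n}} m∣n
      old-monic : MonicDeg (fib m) (ℕ.pred m)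
      old-monic = ≡.subst (λ i → MonicDeg (fib i) (ℕ.pred m)) (ℕₚ.suc-pred m {{ℕ.>-nonZero 1≤m}}) (monic-fib (ℕ.pred m))
      rest : ℕ → Pol
      rest j = unless (j ℕ∣.∣? m) (when (j ℕ∣.∣? n) (part j))
      old : ⨁ n (λ j → when (j ℕ∣.∣? m) (part j)) ≋ fib m
      old = ≋-trans (⨁-extend-≤ (λ j → when (j ℕ∣.∣? m) (part j)) m≤n λ i m<i _ →
                when-no (i ℕ∣.∣? m) λ i∣m → ℕₚ.<⇒≱ m<i (ℕ∣.∣⇒≤ {{ℕ.>-nonZero 1≤m}} i∣m))
              (≋-sym (product m 1≤m (ℕₚ.≤-trans m≤n ≤N)))
      support : ∀ j → ¬ (P^ ∣ℕ j) → rest j ≋ oneP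
      support j P∤j with j ℕ∣.∣? m | j ℕ∣.∣? n
      ... | yes _  | _      = ≋-refl
      ... | no _   | no _   = ≋-refl
      ... | no j∤m | yes j∣n with full-power-or-divisor p-prime k d j j∣n
      ...   | inj₁ P∣j = ⊥-elim (P∤j P∣j)
      ...   | inj₂ j∣m = ⊥-elim (j∤m j∣m)
      at-multiple : ∀ e → rest (P^ ℕ.* e) ≋ when (e ℕ∣.∣? d) (part (P^ ℕ.* e))
      at-multiple e = P.trans
        (unless-no (P^ ℕ.* e ℕ∣.∣? m) λ ∣m → prime-power∤ p-prime p∤d k (ℕ∣.∣-trans (ℕ∣.m∣m*n e) ∣m))
        (when-cong (P^ ℕ.* e ℕ∣.∣? n) (e ℕ∣.∣? d) (ℕ∣.*-cancelˡ-∣ P^ {{ℕ.>-nonZero P^≥1}}) (ℕ∣.*-monoʳ-∣ P^) λ _ → P.refl)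

    private
      ⨁-^ : ∀ M n e (f : ℕ → Pol) → ⨁ M (λ d → when (d ℕ∣.∣? n) (f d P.^ e)) ≋ ⨁ M (λ d → when (d ℕ∣.∣? n) (f d)) P.^ e
      ⨁-^ zero n e f = ≋-sym (1^ e)
        where
        1^ : ∀ e → oneP P.^ e ≋ oneP
        1^ zero    = ≋-refl
        1^ (suc e) = ≋-trans (*P-identityˡ (oneP P.^ e)) (1^ e)
      ⨁-^ (suc M) n e f = ≋-trans (*P-cong (factor (suc M ℕ∣.∣? n)) (⨁-^ M n e f))
        (≋-sym (^-distrib-* (when (suc M ℕ∣.∣? n) (f (suc M))) (⨁ M (λ d → when (d ℕ∣.∣? n) (f d))) e))
        where
        factor : (d : Dec (suc M ∣ℕ n)) → when d (f (suc M) P.^ e) ≋ when d (f (suc M)) P.^ e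
        factor (yes _) = ≋-refl
        factor (no _)  = ⨁-^ zero n e f

      expected-product : ∀ d → 1 ≤ d → d ≤ N →
        ⨁ d (λ e → when (e ℕ∣.∣? d) (expected e)) ≋ (fib p P.^ (p ℕ.^ k)) *P (fib d P.^ E)
      expected-product d 1≤d d≤N = begin
        ⨁ d (λ e → when (e ℕ∣.∣? d) (base e *P (part e P.^ E)))
          ≈⟨ ⨁-cong d (λ e _ _ → pointwise e (e ℕ∣.∣? d)) ⟩
        ⨁ d (λ e → base e P.* when (e ℕ∣.∣? d) (part e P.^ E))
          ≈⟨ ⨁-∙ d base (λ e → when (e ℕ∣.∣? d) (part e P.^ E)) ⟩
        ⨁ d base *P ⨁ d (λ e → when (e ℕ∣.∣? d) (part e P.^ E))
          ≈⟨ *P-cong (P.trans (⨁-single d 1 base ℕₚ.≤-refl 1≤d λ i i≢1 → when-no (i ℕ.≟ 1) i≢1) (when-yes (1 ℕ.≟ 1) ≡.refl))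
               (≋-trans (⨁-^ d d E part) (P.^-congˡ E (≋-sym (product d 1≤d d≤N)))) ⟩
        (fib p P.^ (p ℕ.^ k)) *P (fib d P.^ E) ∎
        where
        pointwise : ∀ e (e∣? : Dec (e ∣ℕ d)) → when e∣? (base e *P (part e P.^ E)) ≋ base e P.* when e∣? (part e P.^ E)
        pointwise e (yes _)  = ≋-refl
        pointwise e (no e∤d) with e ℕ.≟ 1
        ... | yes ≡.refl = ⊥-elim (e∤d (ℕ∣.1∣ d))
        ... | no _       = ≋-sym (*P-identityˡ oneP)

    -- Möbius inversion without the Möbius function: both families have the same product over the
    -- divisors of each admissible d, and the terms at smaller divisors cancel by induction.
    part-prime-power-multiple : ∀ M d → 1 ≤ d → d ≤ M → ¬ (p ∣ℕ d) → P^ ℕ.* d ≤ N → part (P^ ℕ.* d) ≋ expected d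
    part-prime-power-multiple zero    d 1≤d d≤0 _ _ = ⊥-elim (ℕₚ.<⇒≱ 1≤d d≤0)
    part-prime-power-multiple (suc M) (suc d) 1≤d (s≤s d≤M) p∤d ≤N = monic-cancel rest-monic (begin
      ⨁ d new *P part (P^ ℕ.* suc d) ≈⟨ *P-comm (⨁ d new) (part (P^ ℕ.* suc d)) ⟩
      part (P^ ℕ.* suc d) *P ⨁ d new ≈⟨ *P-congʳ (⨁ d new) (when-yes (suc d ℕ∣.∣? suc d) ℕ∣.∣-refl) ⟨
      ⨁ (suc d) new ≈⟨ new-divisors-product (suc d) 1≤d p∤d ≤N ⟩
      (fib p P.^ (p ℕ.^ k)) *P (fib (suc d) P.^ E) ≈⟨ expected-product (suc d) 1≤d sd≤N ⟨
      ⨁ (suc d) old ≈⟨ *P-congʳ (⨁ d old) (when-yes (suc d ℕ∣.∣? suc d) ℕ∣.∣-refl) ⟩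
      expected (suc d) *P ⨁ d old ≈⟨ *P-comm (expected (suc d)) (⨁ d old) ⟩
      ⨁ d old *P expected (suc d) ≈⟨ *P-congʳ (expected (suc d)) agree ⟨
      ⨁ d new *P expected (suc d) ∎)
      where
      new old : ℕ → Pol
      new e = when (e ℕ∣.∣? suc d) (part (P^ ℕ.* e))
      old e = when (e ℕ∣.∣? suc d) (expected e)
      sd≤N : suc d ≤ N
      sd≤N = ℕₚ.≤-trans (ℕₚ.m≤n*m (suc d) P^ {{ℕ.>-nonZero P^≥1}}) ≤N
      smaller : ∀ e → e ≤ d → P^ ℕ.* e ≤ N
      smaller e e≤d = ℕₚ.≤-trans (ℕₚ.*-monoʳ-≤ P^ (ℕₚ.m≤n⇒m≤1+n e≤d)) ≤N
      agree : ⨁ d new ≋ ⨁ d old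
      agree = ⨁-cong d λ e 1≤e e≤d → when-cong (e ℕ∣.∣? suc d) (e ℕ∣.∣? suc d) (λ x → x) (λ x → x) λ e∣d →
        part-prime-power-multiple M e 1≤e (ℕₚ.≤-trans e≤d d≤M) (λ p∣e → p∤d (ℕ∣.∣-trans p∣e e∣d)) (smaller e e≤d)
      monic-new : ∀ M → M ≤ d → Σ ℕ (MonicDeg (⨁ M new))
      monic-new zero    _   = 0 , monic-one
      monic-new (suc M) M<d =
        let a , ma = factor (suc M ℕ∣.∣? suc d)
            b , mb = monic-new M (ℕₚ.<⇒≤ M<d)
        in  a ℕ.+ b , monic-* ma mb
        where
        factor : (x : Dec (suc M ∣ℕ suc d)) → Σ ℕ (MonicDeg (when x (part (P^ ℕ.* suc M))))
        factor (yes _) = part-monic (P^ ℕ.* suc M) (ℕₚ.*-mono-≤ P^≥1 (s≤s z≤n)) (smaller (suc M) M<d)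
        factor (no _)  = 0 , monic-one
      rest-monic : MonicDeg (⨁ d new) _
      rest-monic = proj₂ (monic-new d ℕₚ.≤-refl)

    part-prime-power : P^ ≤ N → part (P^ ℕ.* 1) ≋ fib p P.^ (p ℕ.^ k)
    part-prime-power P^≤N = begin
      part (P^ ℕ.* 1) ≈⟨ part-prime-power-multiple 1 1 ℕₚ.≤-refl ℕₚ.≤-refl p∤1 (≡.subst (_≤ N) (≡.sym (ℕₚ.*-identityʳ P^)) P^≤N) ⟩
      base 1 *P (part 1 P.^ E) ≈⟨ *P-cong {base 1} {fib p P.^ (p ℕ.^ k)} (when-yes (1 ℕ.≟ 1) ≡.refl) (P.^-congˡ E (part-1 S (ℕₚ.≤-trans P^≥1 P^≤N))) ⟩
      (fib p P.^ (p ℕ.^ k)) *P (oneP P.^ E) ≈⟨ *P-congˡ (fib p P.^ (p ℕ.^ k)) (≋-sym (⨁-^ zero 0 E part)) ⟩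
      (fib p P.^ (p ℕ.^ k)) *P oneP ≈⟨ P.*-identityʳ _ ⟩
      fib p P.^ (p ℕ.^ k) ∎

    part-prime-power-multiple-≥2 : ∀ d → 2 ≤ d → ¬ (p ∣ℕ d) → P^ ℕ.* d ≤ N → part (P^ ℕ.* d) ≋ part d P.^ E
    part-prime-power-multiple-≥2 d 2≤d p∤d ≤N =
      ≋-trans (part-prime-power-multiple d d (ℕₚ.<⇒≤ 2≤d) ℕₚ.≤-refl p∤d ≤N)
        (≋-trans (*P-congʳ (part d P.^ E) (when-no (d ℕ.≟ 1) λ d≡1 → ℕₚ.<⇒≢ 2≤d (≡.sym d≡1))) (*P-identityˡ (part d P.^ E)))

module SystemModP {p : ℕ} (p-prime : Prime p) where
  open ModP p-prime
  open ℤ-Poly.Reduction p-prime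
  open PrimitiveParts ℤ/p public
  open F
  private
    module Z = PrimitiveParts ℤ-ring

  fib-same : ∀ n → Z.fib n ≡ fib n
  fib-same zero          = ≡.refl
  fib-same (suc zero)    = ≡.refl
  fib-same (suc (suc n)) = ≡.trans (+P-same _ (Z.fib n)) (≡.cong₂ _+P_
    (≡.trans (*P-same X (Z.fib (suc n))) (≡.cong (X *P_) (fib-same (suc n)))) (fib-same n))

  when-same : ∀ {A : Set} (d : Dec A) f → Z.when d f ≡ when d f
  when-same (yes _) f = ≡.refl
  when-same (no _)  f = ≡.refl

  ⨁-same : ∀ N (f g : ℕ → List ℤ) → (∀ d → f d ≡ g d) → Z.⨁ N f ≡ ⨁ N g
  ⨁-same zero    f g f≡g = ≡.refl
  ⨁-same (suc N) f g f≡g = ≡.trans (*P-same (f (suc N)) (Z.⨁ N f)) (≡.cong₂ _*P_ (f≡g (suc N)) (⨁-same N f g f≡g))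

  ∏∣-same : ∀ n N f → Z.∏∣ n N f ≡ ∏∣ n N f
  ∏∣-same n N f = ⨁-same N (λ d → Z.when (d ℕ∣.∣? n) (f d)) (λ d → when (d ℕ∣.∣? n) (f d)) λ d → when-same (d ℕ∣.∣? n) (f d)

  reduce-monic : ∀ {f d} → ℤ-Poly.F.MonicDeg f d → MonicDeg f d
  reduce-monic {f} {d} (c , l) = Zp.reflexive (≡.trans (≡.sym (coeff-same f d)) c)
    , degLT λ i d<i → Zp.reflexive (≡.trans (≡.sym (coeff-same f i)) (ℤ-Poly.F.above l i d<i))

  reduce-system : ∀ {N} → Z.System N → System N
  reduce-system S = record
    { part = part
    ; part-monic = λ d 1≤d d≤N → proj₁ (part-monic d 1≤d d≤N) , reduce-monic (proj₂ (part-monic d 1≤d d≤N))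
    ; product = λ n 1≤n n≤N → ≡.subst₂ _≋_ (fib-same n) (∏∣-same n n part) (reduce (product n 1≤n n≤N)) }
    where open Z.System S

-- Residue fields

-- `residue` and `ν-injective` number the elements of the field by 0, ..., p-1; this makes the
-- search for factors and the count of residue classes finite.
record PrimeFieldData (p : ℕ) : Set₁ where
  field 𝔻 : IntegralDomain
  R : CommutativeRing 0ℓ 0ℓ
  R = IntegralDomain.ring 𝔻
  open RingKit R using (_≈_; 0#; ν; Characteristic)
  field
    gauss       : Factorization.GaussProperty 𝔻
    p-prime     : Prime p
    char-p      : Characteristic p
    residue     : ∀ a → Σ ℕ λ r → r < p × (a ≈ ν r)
    ν-injective : ∀ r s → r < p → s < p → ν r ≈ ν s → r ≡ s
    ν-nonzero   : ∀ {n} → ¬ (p ∣ℕ n) → ¬ (ν n ≈ 0#)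

module Roots (K : CommutativeRing 0ℓ 0ℓ) (no-zero-divisors : RingKit.NoZeroDivisors K) where
  open RingKit K

  eval : List Carrier → Carrier → Carrier
  eval []      y = 0#
  eval (c ∷ f) y = c + y * eval f y

  eval-cong : ∀ f {y z} → y ≈ z → eval f y ≈ eval f z
  eval-cong []      y≈z = refl
  eval-cong (c ∷ f) y≈z = +-congˡ (*-cong y≈z (eval-cong f y≈z))

  private
    -- synthetic division by Y - a
    divide : List Carrier → Carrier → List Carrier
    divide []          a = []
    divide (c ∷ [])    a = []
    divide (c ∷ d ∷ f) a = eval (d ∷ f) a ∷ divide (d ∷ f) a

    divide-length : ∀ c f a → length (divide (c ∷ f) a) ≡ length f
    divide-length c []      a = ≡.refl
    divide-length c (d ∷ f) a = ≡.cong suc (divide-length d f a)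

    eval-divide : ∀ f a y → eval f y ≈ eval f a + (y - a) * eval (divide f a) y
    eval-divide []          a y = solve 2 (λ y a → con (+ 0) := con (+ 0) :+ (y :- a) :* con (+ 0)) refl y a
    eval-divide (c ∷ [])    a y = solve 3 (λ c y a → c :+ y :* con (+ 0) := (c :+ a :* con (+ 0)) :+ (y :- a) :* con (+ 0)) refl c y a
    eval-divide (c ∷ d ∷ f) a y = trans (+-congˡ (*-congˡ (eval-divide (d ∷ f) a y)))
      (solve 5 (λ c y a e q → c :+ y :* (e :+ (y :- a) :* q) := (c :+ a :* e) :+ (y :- a) :* (e :+ y :* q))
        refl c y a (eval (d ∷ f) a) (eval (divide (d ∷ f) a) y))

    divide-zero : ∀ f a → eval f a ≈ 0# → All (_≈ 0#) (divide f a) → All (_≈ 0#) f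
    divide-zero []          a p qs       = []
    divide-zero (c ∷ [])    a p qs       = trans (solve 2 (λ c a → c := c :+ a :* con (+ 0)) refl c a) p ∷ []
    divide-zero (c ∷ d ∷ f) a p (q ∷ qs) =
      trans (solve 2 (λ c a → c := c :+ a :* con (+ 0)) refl c a) (trans (+-congˡ (*-congˡ (sym q))) p)
      ∷ divide-zero (d ∷ f) a q qs

  -- Counting is by list length: at most n coefficients and n distinct roots force all coefficients
  -- to vanish. Synthetic division by one root keeps the others, because K has no zero divisors.
  too-many-roots : ∀ n f → length f ≤ n → (r : ℕ → Carrier) → (∀ i → i < n → eval f (r i) ≈ 0#) →
    (∀ i j → i < j → j < n → ¬ (r i ≈ r j)) → All (_≈ 0#) f
  too-many-roots n       []      _           r root distinct = []
  too-many-roots (suc n) (c ∷ f) (s≤s f≤n) r root distinct =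
    divide-zero (c ∷ f) (r 0) (root 0 (s≤s z≤n))
      (too-many-roots n (divide (c ∷ f) (r 0)) (≡.subst (_≤ n) (≡.sym (divide-length c f (r 0))) f≤n) (λ i → r (suc i)) roots
        λ i j i<j j<n → distinct (suc i) (suc j) (s≤s i<j) (s≤s j<n))
    where
    roots : ∀ i → i < n → eval (divide (c ∷ f) (r 0)) (r (suc i)) ≈ 0#
    roots i i<n with no-zero-divisors (r (suc i) - r 0) (eval (divide (c ∷ f) (r 0)) (r (suc i))) (begin
        (r (suc i) - r 0) * eval (divide (c ∷ f) (r 0)) (r (suc i))
          ≈⟨ +-identityˡ _ ⟨
        0# + (r (suc i) - r 0) * eval (divide (c ∷ f) (r 0)) (r (suc i))
          ≈⟨ +-congʳ (root 0 (s≤s z≤n)) ⟨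
        eval (c ∷ f) (r 0) + (r (suc i) - r 0) * eval (divide (c ∷ f) (r 0)) (r (suc i))
          ≈⟨ eval-divide (c ∷ f) (r 0) (r (suc i)) ⟨
        eval (c ∷ f) (r (suc i))
          ≈⟨ root (suc i) (s≤s i<n) ⟩
        0# ∎)
    ... | inj₂ q = q
    ... | inj₁ q = ⊥-elim (distinct 0 (suc i) (s≤s z≤n) (s≤s i<n) (sym (begin
            r (suc i) ≈⟨ solve 2 (λ a b → a := (a :- b) :+ b) refl (r (suc i)) (r 0) ⟩
            (r (suc i) - r 0) + r 0 ≈⟨ +-congʳ q ⟩
            0# + r 0 ≈⟨ +-identityˡ _ ⟩
            r 0 ∎)))

  -- The coefficients of Y^(k+2) - Y.
  power-minus-id : ℕ → List Carrier
  power-minus-id k = 0# ∷ - 1# ∷ List.replicate k 0# List.++ 1# ∷ []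

  length-power-minus-id : ∀ k → length (power-minus-id k) ≡ suc (suc (suc k))
  length-power-minus-id k = ≡.cong (λ n → suc (suc n)) (≡.trans (Listₚ.length-++ (List.replicate k 0#))
    (≡.trans (≡.cong (ℕ._+ 1) (Listₚ.length-replicate k)) (ℕₚ.+-comm k 1)))

  eval-power-minus-id : ∀ k y → eval (power-minus-id k) y ≈ y ^ suc (suc k) - y
  eval-power-minus-id k y = trans (+-congˡ (*-congˡ (+-congˡ (*-congˡ (monomial k)))))
    (solve 2 (λ y e → con (+ 0) :+ y :* (:- con (+ 1) :+ y :* e) := y :* (y :* e) :- y) refl y (y ^ k))
    where
    monomial : ∀ k → eval (List.replicate k 0# List.++ 1# ∷ []) y ≈ y ^ k
    monomial zero    = trans (+-congˡ (zeroʳ y)) (+-identityʳ 1#)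
    monomial (suc k) = trans (+-identityˡ _) (*-congˡ (monomial k))

module PrimeField {p : ℕ} (𝔽 : PrimeFieldData p) where
  open PrimeFieldData 𝔽
  open IntegralDomain 𝔻 using (1≉0)
  private module R = RingKit R
  open Factorization 𝔻
  open Gauss gauss
  open PrimeProducts 𝔻 gauss
  private module P = RingKit polyRing

  -- The coefficients run through the representatives `ν r` only, so `Q` has to respect equality of
  -- polynomials.
  monic-search : ∀ e {Q : Pol → Set} → (∀ {f g} → f ≋ g → Q f → Q g) → (∀ f → MonicDeg f e → Dec (Q f)) →
    Dec (Σ Pol λ f → MonicDeg f e × Q f)
  monic-search zero resp Q? with Q? oneP monic-one
  ... | yes q = yes (oneP , monic-one , q)
  ... | no ¬q = no λ { (f , m , q) → ¬q (resp (monic-0⇒one m) q) }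
  monic-search (suc e) {Q} resp Q? with ℕₚ.anyUpTo? (λ r → monic-search e {λ f → Q (R.ν r ∷ f)}
      (λ f≋g → resp (∷-cong R.refl f≋g)) (λ f m → Q? (R.ν r ∷ f) (shift m))) p
    where
    shift : ∀ {f a} → MonicDeg f e → MonicDeg (a ∷ f) (suc e)
    shift (c , l) = c , degLT-∷ l
  ... | yes (r , _ , f , (c , l) , q) = yes (R.ν r ∷ f , (c , degLT-∷ l) , q)
  ... | no none = no λ where
    ([]    , (c , _) , _) → 1≉0 (R.sym c)
    (a ∷ f , (c , l) , q) → let r , r<p , a≈ = residue a
                            in  none (r , r<p , f , (c , degLT-tail {a} l) , resp (∷-cong a≈ ≋-refl) q)

  irr-factor : ∀ {H d} → MonicDeg H (suc d) → Σ Pol λ g → MonicIrr g × (g ∣ H)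
  irr-factor {d = d} m = search (suc d) m ℕₚ.≤-refl
    where
    search : ∀ n {H d} → MonicDeg H (suc d) → d < n → Σ Pol λ g → MonicIrr g × (g ∣ H)
    search (suc n) {H} {d} m (s≤s d≤n) with ℕₚ.anyUpTo? (λ i → monic-search (suc i) {λ a → a ∣ H} ∣-respˡ (λ a ma → monic-∣? ma H)) d
    ... | yes (i , i<d , a , ma , a∣H) =
      let g , gi , g∣a = search n ma (ℕₚ.≤-trans i<d d≤n) in g , gi , ∣-trans g∣a a∣H
    ... | no none = H , monicIrr m (irreducible-if-no-monic-split m (s≤s z≤n) no-split) , ∣-refl
      where
      no-split : ∀ {a b i j} → MonicDeg a i → MonicDeg b j → H ≋ a *P b → (i ≡ 0) ⊎ (j ≡ 0)
      no-split {i = zero}              ma mb H≋ = inj₁ ≡.refl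
      no-split {i = suc i} {j = zero}  ma mb H≋ = inj₂ ≡.refl
      no-split {a} {b} {suc i} {suc j} ma mb H≋ = ⊥-elim (none (i
        , ≡.subst (i <_) (≡.sym (≡.trans (ℕₚ.suc-injective (monic-unique m (monic-resp (≋-sym H≋) (monic-* ma mb)))) (ℕₚ.+-suc i j)))
            (s≤s (ℕₚ.m≤m+n i j))
        , a , ma , divides b H≋))

  private instance
    nonzero-p = prime⇒nonZero p-prime

  -- The base-p digits of i as coefficients: for i < p^e they give p^e distinct polynomials of
  -- degree below e.
  digits : ℕ → ℕ → Pol
  digits zero    i = []
  digits (suc e) i = R.ν (i % p) ∷ digits e (i / p)

  digits-degLT : ∀ e i → DegLT (digits e i) e
  digits-degLT zero    i = degLT-[]
  digits-degLT (suc e) i = degLT-∷ (digits-degLT e (i / p))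

  digits-injective : ∀ e i j → i < p ℕ.^ e → j < p ℕ.^ e → digits e i ≋ digits e j → i ≡ j
  digits-injective zero    zero zero (s≤s z≤n) (s≤s z≤n) _ = ≡.refl
  digits-injective (suc e) i j i< j< eq = begin
    i ≡⟨ m≡m%n+[m/n]*n i p ⟩
    i % p ℕ.+ i / p ℕ.* p ≡⟨ ≡.cong₂ (λ r q → r ℕ.+ q ℕ.* p)
                                        (ν-injective (i % p) (j % p) (m%n<n i p) (m%n<n j p) (coeff-≈ eq 0))
                                        (digits-injective e (i / p) (j / p) (quotient< i i<) (quotient< j j<) (tail-≋ eq)) ⟩
    j % p ℕ.+ j / p ℕ.* p ≡⟨ m≡m%n+[m/n]*n j p ⟨
    j ∎
    where
    open ≡.≡-Reasoning
    quotient< : ∀ i → i < p ℕ.^ suc e → i / p < p ℕ.^ e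
    quotient< i i< = m<n*o⇒m/o<n (≡.subst (i <_) (ℕₚ.*-comm p (p ℕ.^ e)) i<)

  module ResidueField {g : Pol} (gi : MonicIrr g) where
    open Quotient polyRing g public
    module K = RingKit quotientRing

    K-no-zero-divisors : ∀ a b → a K.* b K.≈ K.0# → (a K.≈ K.0#) ⊎ (b K.≈ K.0#)
    K-no-zero-divisors a b z = Data.Sum.map ∣⇒~0 ∣⇒~0 (prime gi a b (~0⇒∣ z))

    char-K : K.ν p K.≈ K.0#
    char-K = ≡.subst (λ a → a K.≈ K.0#) (≡.sym (ν-quotient p))
      (≈⇒~ (≋-trans (≋-sym (const-ν p)) (≋-trans (const-cong char-p) const-0)))

    open CharP quotientRing p-prime char-K
    open Roots quotientRing K-no-zero-divisors
    open Algebra.Properties.CommutativeSemiring.Exp K.commutativeSemiring using (^-distrib-*)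

    -- The degree of a constant is below that of g, so only zero vanishes modulo g.
    const-nonzero : ∀ {a} → const a K.≈ K.0# → a R.≈ R.0#
    const-nonzero {a} z = coeff-≈ (monic-∣-small (monic gi) (~0⇒∣ z)
      (degLT-mono (s≤s z≤n) (degLT-length (const a)))) 0

    const^p^ : ∀ d a → const a K.^ (p ℕ.^ d) K.≈ const a
    const^p^ d a = let r , _ , a≈ = residue a
                       a~ν = K.trans (≈⇒~ (≋-trans (const-cong a≈) (const-ν r))) (K.reflexive (≡.sym (ν-quotient r)))
                   in  K.trans (K.^-congˡ (p ℕ.^ d) a~ν) (K.trans (ν^p^ d r) (K.sym a~ν))

    eval-X : ∀ f → eval (map const f) X ≋ f
    eval-X []      = ≋-refl
    eval-X (a ∷ f) = ≋-trans (+P-cong {const a} ≋-refl (*P-congˡ X (eval-X f))) (≋-sym (∷-decompose a f))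

    0^p^ : ∀ d → K.0# K.^ (p ℕ.^ d) K.≈ K.0#
    0^p^ d = ν^p^ d 0

    eval-frobenius : ∀ d f y → eval (map const f) y K.^ (p ℕ.^ d) K.≈ eval (map const f) (y K.^ (p ℕ.^ d))
    eval-frobenius d []      y = 0^p^ d
    eval-frobenius d (a ∷ f) y = K.trans (frobenius-+-^ d (const a) (y K.* eval (map const f) y))
      (K.+-cong {const a K.^ (p ℕ.^ d)} (const^p^ d a)
        (K.trans (^-distrib-* y (eval (map const f) y) (p ℕ.^ d)) (K.*-congˡ {y K.^ (p ℕ.^ d)} (eval-frobenius d f y))))

    -- The Frobenius map fixes the coefficients, so raising f to a power q of p amounts to
    -- substituting x^q for x.
    frobenius-as-eval : ∀ d f → f K.^ (p ℕ.^ d) K.≈ eval (map const f) (X K.^ (p ℕ.^ d))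
    frobenius-as-eval d f = K.trans (K.^-congˡ (p ℕ.^ d) (≈⇒~ (≋-sym (eval-X f)))) (eval-frobenius d f X)

    nilpotent⇒zero : ∀ n a → a K.^ n K.≈ K.0# → a K.≈ K.0#
    nilpotent⇒zero zero    a z = ⊥-elim (∤-one gi (~0⇒∣ z))
    nilpotent⇒zero (suc n) a z with K-no-zero-divisors a (a K.^ n) z
    ... | inj₁ q = q
    ... | inj₂ q = nilpotent⇒zero n a q

    sub-zero⇒≈ : ∀ {a b} → a K.- b K.≈ K.0# → a K.≈ b
    sub-zero⇒≈ {a} {b} z = congruent (~0⇒∣ z)

    -- `too-many-roots` counts list entries, so the list is first cut or padded to the length that
    -- its degree bound prescribes.
    trim : ∀ n f → DegLT f n → Σ Pol λ f′ → length f′ ≡ n × (f ≋ f′)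
    trim zero    f       l = [] , ≡.refl , degLT-zero l
    trim (suc n) []      l = let f′ , eq , f≋ = trim n [] degLT-[] in R.0# ∷ f′ , ≡.cong suc eq ,
                             ≋-trans (≋-sym 0∷[]≋[]) (∷-cong R.refl f≋)
    trim (suc n) (a ∷ f) l = let f′ , eq , f≋ = trim n f (degLT-tail {a} l) in a ∷ f′ , ≡.cong suc eq , ∷-cong R.refl f≋

    module _ (δ : ℕ) (1≤δ : 1 ≤ δ) (fixed : X K.^ (p ℕ.^ δ) K.≈ X)
             (minimal : ∀ d → 1 ≤ d → d < δ → ¬ (X K.^ (p ℕ.^ d) K.≈ X)) where

      private
        e = suc (deg gi)

        -- Equality would give (x^(p^(j-i)) - x)^(p^i) = 0 modulo g; a domain has no nilpotents, and
        -- x^(p^(j-i)) = x contradicts the minimality of δ.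
        conjugates-distinct : ∀ i j → i < j → j < δ → ¬ (X K.^ (p ℕ.^ i) K.≈ X K.^ (p ℕ.^ j))
        conjugates-distinct i j i<j j<δ eq = minimal d (ℕₚ.m<n⇒0<n∸m i<j) (ℕₚ.≤-<-trans (ℕₚ.m∸n≤m j i) j<δ)
          (sub-zero⇒≈ (nilpotent⇒zero (p ℕ.^ i) (X K.^ (p ℕ.^ d) K.- X) (begin
            (X K.^ (p ℕ.^ d) K.- X) K.^ (p ℕ.^ i) ≈⟨ frobenius-sub-^ i (X K.^ (p ℕ.^ d)) X ⟩
            (X K.^ (p ℕ.^ d)) K.^ (p ℕ.^ i) K.- X K.^ (p ℕ.^ i) ≈⟨ K.+-congʳ {K.- (X K.^ (p ℕ.^ i))} (K.^-assocʳ X (p ℕ.^ d) (p ℕ.^ i)) ⟩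
            X K.^ (p ℕ.^ d ℕ.* p ℕ.^ i) K.- X K.^ (p ℕ.^ i) ≡⟨ ≡.cong (λ n → X K.^ n K.- X K.^ (p ℕ.^ i)) (≡.trans (≡.sym (ℕₚ.^-distribˡ-+-* p d i)) (≡.cong (p ℕ.^_) (ℕₚ.m∸n+n≡m (ℕₚ.<⇒≤ i<j)))) ⟩
            X K.^ (p ℕ.^ j) K.- X K.^ (p ℕ.^ i) ≈⟨ K.+-congʳ {K.- (X K.^ (p ℕ.^ i))} eq ⟨
            X K.^ (p ℕ.^ i) K.- X K.^ (p ℕ.^ i) ≈⟨ K.-‿inverseʳ (X K.^ (p ℕ.^ i)) ⟩
            K.0# ∎)))
          where
          d = j ℕ.∸ i
          open K using (begin_; step-≈-⟩; step-≈-⟨; step-≡-⟩; _∎)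

        all-zero⇒≋[] : ∀ f → All (K._≈ K.0#) (map const f) → f ≋ []
        all-zero⇒≋[] []      []       = ≋-refl
        all-zero⇒≋[] (a ∷ f) (z ∷ zs) = ≋-trans (∷-cong (const-nonzero z) (all-zero⇒≋[] f zs)) 0∷[]≋[]

        -- Otherwise x, x^p, ..., x^(p^e) would be e+1 distinct roots of g, whose degree is e.
        δ≤e : δ ≤ e
        δ≤e = ℕₚ.≮⇒≥ λ e<δ →
          let g′ , len , g≋ = trim (suc e) g (proj₂ (monic gi))
          in  nonzero (irreducible gi) (≋-trans g≋ (all-zero⇒≋[] g′
                (too-many-roots (suc e) (map const g′) (ℕₚ.≤-reflexive (≡.trans (Listₚ.length-map const g′) len))
                  (λ i → X K.^ (p ℕ.^ i)) (λ i _ → K.trans (K.sym (frobenius-as-eval i g′))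
                    (K.trans (K.^-congˡ (p ℕ.^ i) (∣⇒~0 (∣-resp g≋ ∣-refl))) (0^p^ i)))
                  λ i j i<j j<e → conjugates-distinct i j i<j (ℕₚ.≤-trans j<e e<δ))))

        p^δ≡ : Σ ℕ λ k → p ℕ.^ δ ≡ suc (suc k)
        p^δ≡ = p^δ-≥2 (p ℕ.^ δ) (ℕₚ.≤-trans (ℕ.nonTrivial⇒n>1 p {{prime⇒nonTrivial p-prime}})
          (≡.subst (_≤ p ℕ.^ δ) (ℕₚ.*-identityʳ p) (ℕₚ.^-monoʳ-≤ p 1≤δ)))
          where
          p^δ-≥2 : ∀ q → 2 ≤ q → Σ ℕ λ k → q ≡ suc (suc k)
          p^δ-≥2 (suc zero)    (s≤s ())
          p^δ-≥2 (suc (suc k)) _ = k , ≡.refl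

        all-fixed : ∀ f → f K.^ (p ℕ.^ δ) K.≈ f
        all-fixed f = K.trans (frobenius-as-eval δ f) (K.trans (eval-cong (map const f) fixed) (≈⇒~ (eval-X f)))

        -- Every residue class satisfies Y^q = Y for q = p^δ, since x does. Were δ < e, the p^e
        -- classes of degree below e would supply more than q roots.
        e≤δ : e ≤ δ
        e≤δ = ℕₚ.≮⇒≥ λ δ<e →
          let k , Q≡ = p^δ≡
              Q<p^e : suc (p ℕ.^ δ) ≤ p ℕ.^ e
              Q<p^e = ℕₚ.^-monoʳ-< p (ℕ.nonTrivial⇒n>1 p {{prime⇒nonTrivial p-prime}}) δ<e
              root : ∀ i → eval (power-minus-id k) (digits e i) K.≈ K.0#
              root i = K.trans (eval-power-minus-id k (digits e i)) (K.trans
                (K.+-congʳ {K.- digits e i} (≡.subst (λ q → digits e i K.^ q K.≈ digits e i) Q≡ (all-fixed (digits e i))))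
                (K.-‿inverseʳ (digits e i)))
          in  contradiction-from (too-many-roots (suc (p ℕ.^ δ)) (power-minus-id k)
                (ℕₚ.≤-reflexive (≡.trans (length-power-minus-id k) (≡.cong suc (≡.sym Q≡)))) (digits e) (λ i _ → root i)
                λ i j i<j j< eq → ℕₚ.<⇒≢ i<j (digits-injective e i j (ℕₚ.≤-trans (ℕₚ.<-trans i<j j<) Q<p^e) (ℕₚ.≤-trans j< Q<p^e)
                  (≋-from-0 (monic-∣-small (monic gi) (difference eq)
                    (degLT-+ (digits-degLT e i) (degLT-neg (digits-degLT e j)))))))
          where
          contradiction-from : ∀ {k} → All (K._≈ K.0#) (power-minus-id k) → ⊥
          -- The coefficient of Y in Y^q - Y is -1, which g does not divide.
          contradiction-from (_ ∷ z ∷ _) = ∤-one gi (∣-resp (P.-‿involutive oneP) (∣-neg (~0⇒∣ z)))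

      residue-degree : e ≡ δ
      residue-degree = ℕₚ.≤-antisym e≤δ δ≤e

-- Irreducible factors modulo p

data Parity : ℕ → Set where
  even : ∀ b → Parity (b ℕ.+ b)
  odd  : ∀ b → Parity (suc (b ℕ.+ b))

parity : ∀ n → Parity n
parity zero = even 0
parity (suc n) with parity n
... | even b = odd b
... | odd b  = ≡.subst Parity (≡.cong suc (ℕₚ.+-suc b b)) (even (suc b))

Even Odd : ℕ → Set
Even a = Σ ℕ λ b → a ≡ b ℕ.+ b
Odd a  = Σ ℕ λ b → a ≡ suc (b ℕ.+ b)

-- Equivalent to 2 b ≡ m modulo 2 m: b is an odd multiple of m/2. For odd p and a prime factor g of
-- `part m` it means that g divides L_b.
Half : ℕ → ℕ → Set
Half m b = (m ∣ℕ b ℕ.+ b) × ¬ (m ∣ℕ b)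

-- For q = 2a + 1 a power of p, this says that X^q ≡ X modulo the irreducible factors of part m.
FixCondition : ℕ → ℕ → Set
FixCondition m a = (Even a × ((m ∣ℕ a) ⊎ (m ∣ℕ suc a))) ⊎ (Odd a × (Half m a ⊎ Half m (suc a)))

module FactorDegrees {p : ℕ} (𝔽 : PrimeFieldData p)
  {N : ℕ} (S : PrimitiveParts.System (PrimeFieldData.R 𝔽) N) (m : ℕ) (3≤m : 3 ≤ m) (m≤N : m ≤ N) (p∤m : ¬ (p ∣ℕ m)) where
  open PrimeFieldData 𝔽
  private module R = RingKit R
  open Factorization 𝔻
  open Gauss gauss
  open PrimeProducts 𝔻 gauss
  open PrimitiveParts R
  open PrimitivePartsDomain 𝔻
  open FibotomicPart 𝔻 gauss
  private module P = RingKit polyRing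
  open P using (_^_; solve; _:=_; _:+_; _:*_; _:-_; :-_; con; begin_; step-≈-⟩; step-≈-⟨; step-≡-⟩; step-≡-⟨; _∎)
  open System S

  private
    1≤m : 1 ≤ m
    1≤m = ℕₚ.≤-trans (s≤s z≤n) 3≤m

    luc-frobenius : ∀ d → luc (p ℕ.^ d) ≋ X ^ (p ℕ.^ d)
    luc-frobenius = QuadraticExtension.luc-frobenius polyRing X p-prime
      (≋-trans (≋-sym (const-ν p)) (≋-trans (const-cong char-p) const-0))

  Fixed : Pol → ℕ → Set
  Fixed g d = g ∣ (X ^ (p ℕ.^ d)) P.- X

  module _ {g : Pol} (gi : MonicIrr g) (g∣part : g ∣ part m) where

    g∣fib-m : g ∣ fib m
    g∣fib-m = ∣-trans g∣part (part-∣-fib S m 1≤m m≤N)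

    rank⇒ : ∀ d → g ∣ fib d → m ∣ℕ d
    rank⇒ = prime-∣-part⇒rank S gi 1≤m m≤N (λ k k∣m → ν-nonzero λ p∣k → p∤m (ℕ∣.∣-trans p∣k k∣m)) g∣part

    ⇒rank : ∀ d → m ∣ℕ d → g ∣ fib d
    ⇒rank d (ℕ∣.divides q eq) = ≡.subst (λ n → g ∣ fib n) (≡.sym eq) (∣-trans g∣fib-m (fib-∣ m q))

    g∤rest : ¬ (g ∣ rest S m)
    g∤rest = prime-∤-rest S gi m≤N λ d 1≤d d<m _ g∣fib → ℕₚ.<⇒≱ d<m (ℕ∣.∣⇒≤ {{ℕ.>-nonZero 1≤d}} (rank⇒ d g∣fib))

  -- For odd p, where p^d = 2a + 1, the polynomial X^(p^d) - X = L_(p^d) - X factors as disc F_a F_(a+1) or L_a L_(a+1).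
  module OddPrime (p∤4 : ¬ (p ∣ℕ 4)) where

    private
      sgn-even : ∀ b → sgn (b ℕ.+ b) ≋ oneP
      sgn-even zero    = ≋-refl
      sgn-even (suc b) = ≋-trans (P.reflexive (≡.cong (λ n → P.- sgn n) (ℕₚ.+-suc b b)))
        (≋-trans (P.-‿involutive (sgn (b ℕ.+ b))) (sgn-even b))

      frobenius-even : ∀ d b → p ℕ.^ d ≡ suc ((b ℕ.+ b) ℕ.+ (b ℕ.+ b)) →
        disc P.* (fib (b ℕ.+ b) P.* fib (suc (b ℕ.+ b))) ≋ (X ^ (p ℕ.^ d)) P.- X
      frobenius-even d b eq = begin
        disc P.* (fib (b ℕ.+ b) P.* fib (suc (b ℕ.+ b))) ≈⟨ disc-fib-fib (b ℕ.+ b) ⟩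
        luc (suc ((b ℕ.+ b) ℕ.+ (b ℕ.+ b))) P.- sgn (b ℕ.+ b) P.* X
          ≈⟨ P.+-cong {luc (suc ((b ℕ.+ b) ℕ.+ (b ℕ.+ b)))} (≋-trans (P.reflexive (≡.cong luc (≡.sym eq))) (luc-frobenius d))
               (P.-‿cong (≋-trans (*P-congʳ X (sgn-even b)) (*P-identityˡ X))) ⟩
        (X ^ (p ℕ.^ d)) P.- X ∎

      frobenius-odd : ∀ d b → p ℕ.^ d ≡ suc (suc (b ℕ.+ b) ℕ.+ suc (b ℕ.+ b)) →
        luc (suc (b ℕ.+ b)) P.* luc (suc (suc (b ℕ.+ b))) ≋ (X ^ (p ℕ.^ d)) P.- X
      frobenius-odd d b eq = begin
        luc (suc (b ℕ.+ b)) P.* luc (suc (suc (b ℕ.+ b))) ≈⟨ luc-luc (suc (b ℕ.+ b)) ⟩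
        luc (suc (suc (b ℕ.+ b) ℕ.+ suc (b ℕ.+ b))) P.+ (P.- sgn (b ℕ.+ b)) P.* X
          ≈⟨ P.+-cong {luc (suc (suc (b ℕ.+ b) ℕ.+ suc (b ℕ.+ b)))} (≋-trans (P.reflexive (≡.cong luc (≡.sym eq))) (luc-frobenius d))
               (≋-trans (≋-sym (P.-‿distribˡ-* (sgn (b ℕ.+ b)) X)) (P.-‿cong (≋-trans (*P-congʳ X (sgn-even b)) (*P-identityˡ X)))) ⟩
        (X ^ (p ℕ.^ d)) P.- X ∎

    module _ {g : Pol} (gi : MonicIrr g) (g∣part : g ∣ part m) where
      private
        g∤4 : ¬ (g ∣ P.ν 4)
        g∤4 = ∤-ν 4 (monic gi) (ν-nonzero p∤4)

        -- By the formula for disc F_m′, a common prime factor of disc and F_m divides m L_m, hence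
        -- 4.
        g∤disc : ¬ (g ∣ disc)
        g∤disc g∣disc = g∤4 (∂-fib-∣ {n = m} (monic gi) (ν-nonzero p∤m) (g∣fib-m gi g∣part) (∣-*ʳ (∂ (fib m)) g∣disc))

        -- F_(2b) = F_b L_b, and a common prime factor of F_b and L_b divides 4.
        luc⇒half : ∀ b → g ∣ luc b → Half m b
        luc⇒half b g∣luc = rank⇒ gi g∣part (b ℕ.+ b) (∣-resp (≋-sym (fib-double b)) (∣-*ˡ (fib b) g∣luc))
          , λ m∣b → g∤4 (luc²-∣ {n = b} g∣luc (⇒rank gi g∣part b m∣b))

        half⇒luc : ∀ b → Half m b → g ∣ luc b
        half⇒luc b (m∣2b , m∤b) = Data.Sum.[ (λ g∣fib → ⊥-elim (m∤b (rank⇒ gi g∣part b g∣fib))) , (λ g∣luc → g∣luc) ]′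
          (prime gi (fib b) (luc b) (∣-resp (fib-double b) (⇒rank gi g∣part (b ℕ.+ b) m∣2b)))

      fixed⇒cond : ∀ d a → p ℕ.^ d ≡ suc (a ℕ.+ a) → Fixed g d → FixCondition m a
      fixed⇒cond d a eq fx = by-parity (parity a) eq
        where
        by-parity : ∀ {a} → Parity a → p ℕ.^ d ≡ suc (a ℕ.+ a) → FixCondition m a
        by-parity {a} (even b) eq = inj₁ ((b , ≡.refl) , Data.Sum.[ (λ g∣disc → ⊥-elim (g∤disc g∣disc))
          , (λ g∣ → Data.Sum.map (rank⇒ gi g∣part a) (rank⇒ gi g∣part (suc a)) (prime gi (fib a) (fib (suc a)) g∣)) ]′
          (prime gi disc (fib a P.* fib (suc a)) (∣-resp (≋-sym (frobenius-even d b eq)) fx)))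
        by-parity {a} (odd b) eq = inj₂ ((b , ≡.refl) , Data.Sum.map (luc⇒half a) (luc⇒half (suc a))
          (prime gi (luc a) (luc (suc a)) (∣-resp (≋-sym (frobenius-odd d b eq)) fx)))

      cond⇒fixed : ∀ d a → p ℕ.^ d ≡ suc (a ℕ.+ a) → FixCondition m a → Fixed g d
      cond⇒fixed d a eq (inj₁ ((b , ≡.refl) , inj₁ m∣a))  = ∣-resp (frobenius-even d b eq) (∣-*ˡ disc (∣-*ʳ (fib (suc a)) (⇒rank gi g∣part a m∣a)))
      cond⇒fixed d a eq (inj₁ ((b , ≡.refl) , inj₂ m∣sa)) = ∣-resp (frobenius-even d b eq) (∣-*ˡ disc (∣-*ˡ (fib a) (⇒rank gi g∣part (suc a) m∣sa)))
      cond⇒fixed d a eq (inj₂ ((b , ≡.refl) , inj₁ ha))   = ∣-resp (frobenius-odd d b eq) (∣-*ʳ (luc (suc a)) (half⇒luc a ha))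
      cond⇒fixed d a eq (inj₂ ((b , ≡.refl) , inj₂ hsa))  = ∣-resp (frobenius-odd d b eq) (∣-*ˡ (luc a) (half⇒luc (suc a) hsa))

      multiplicity-one : (g ^ 1 ∣ part m) × ¬ (g ^ 2 ∣ part m)
      multiplicity-one = ∣-respˡ (≋-sym (P.*-identityʳ g)) g∣part
        , λ g²∣ → fib-squarefree {n = m} (monic gi) (ν-nonzero p∤m) (ν-nonzero p∤4)
            (∣-respˡ (*P-congˡ g (P.*-identityʳ g)) (∣-trans g²∣ (part-∣-fib S m 1≤m m≤N)))

  -- In characteristic 2, F_n F_(n+2) = (X^n - 1)² when n + 1 is a power of 2, and F_(2c+1) = (F_c + F_(c+1))²;
  -- the second identity is the source of the multiplicity 2.
  module EvenPrime (p≡2 : p ≡ 2) (c : ℕ) (m≡ : m ≡ suc (c ℕ.+ c)) where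
    private
      2≋0 : P.ν 2 ≋ []
      2≋0 = ≋-trans (≋-sym (const-ν 2)) (≋-trans (const-cong (≡.subst (λ q → R.ν q R.≈ R.0#) p≡2 char-p)) const-0)

      -- Lets the ring solver prove an identity in characteristic 2: the two sides differ by 2 k,
      -- and `k` is supplied by hand.
      ≋+2 : ∀ {f h} k → f ≋ h P.+ P.ν 2 P.* k → f ≋ h
      ≋+2 {f} {h} k eq = ≋-trans eq (≋-trans (+P-cong {h} ≋-refl (*P-zeroˡ k 2≋0)) (+P-identityʳ h))

      sgn≋1 : ∀ n → sgn n ≋ oneP
      sgn≋1 zero    = ≋-refl
      sgn≋1 (suc n) = ≋-trans (P.-‿cong (sgn≋1 n)) (≋+2 (P.- oneP) (solve 0 (:- con (+ 1) := con (+ 1) :+ con (+ 2) :* (:- con (+ 1))) ≋-refl))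

      luc≋ : ∀ n → luc n ≋ X P.* fib n
      luc≋ n = ≋+2 (fib (suc n) P.- X P.* fib n)
        (solve 3 (λ x f f′ → con (+ 2) :* f′ :- x :* f := x :* f :+ con (+ 2) :* (f′ :- x :* f)) ≋-refl X (fib n) (fib (suc n)))

      -- In characteristic 2, L_q = x F_q, while L_q = x^q for a power q of 2; the factor x cancels.
      fib-2^ : ∀ d n → 2 ℕ.^ d ≡ suc n → fib (suc n) ≋ X ^ n
      fib-2^ d n eq = monic-cancel monic-X (begin
        X P.* fib (suc n) ≈⟨ luc≋ (suc n) ⟨
        luc (suc n) ≡⟨ ≡.cong luc (≡.trans (≡.sym eq) (≡.cong (ℕ._^ d) (≡.sym p≡2))) ⟩
        luc (p ℕ.^ d) ≈⟨ luc-frobenius d ⟩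
        X ^ (p ℕ.^ d) ≡⟨ ≡.cong (X ^_) (≡.trans (≡.cong (ℕ._^ d) p≡2) eq) ⟩
        X P.* (X ^ n) ∎)

      -- Cassini's identity with F_(n+1) = x^n gives x^(2n) - 1, a square in characteristic 2.
      fib-fib : ∀ d n → 2 ℕ.^ d ≡ suc n → fib n P.* fib (suc (suc n)) ≋ ((X ^ n) P.- oneP) P.* ((X ^ n) P.- oneP)
      fib-fib d n eq = begin
        fib n P.* fib (suc (suc n))
          ≈⟨ solve 3 (λ x f f′ → f :* (x :* f′ :+ f) := f′ :* f′ :- (f′ :* f′ :- x :* (f′ :* f) :- f :* f)) ≋-refl X (fib n) (fib (suc n)) ⟩
        fib (suc n) P.* fib (suc n) P.- (fib (suc n) P.* fib (suc n) P.- X P.* (fib (suc n) P.* fib n) P.- fib n P.* fib n)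
          ≈⟨ P.+-cong (*P-cong (fib-2^ d n eq) (fib-2^ d n eq)) (P.-‿cong (≋-trans (cassini n) (sgn≋1 n))) ⟩
        (X ^ n) P.* (X ^ n) P.- oneP
          ≈⟨ ≋+2 ((X ^ n) P.- oneP) (solve 1 (λ t → t :* t :- con (+ 1) := (t :- con (+ 1)) :* (t :- con (+ 1)) :+ con (+ 2) :* (t :- con (+ 1))) ≋-refl (X ^ n)) ⟩
        ((X ^ n) P.- oneP) P.* ((X ^ n) P.- oneP) ∎

      X^-X : ∀ d n → 2 ℕ.^ d ≡ suc n → X P.* ((X ^ n) P.- oneP) ≋ (X ^ (p ℕ.^ d)) P.- X
      X^-X d n eq = begin
        X P.* ((X ^ n) P.- oneP) ≈⟨ solve 2 (λ x t → x :* (t :- con (+ 1)) := x :* t :- x) ≋-refl X (X ^ n) ⟩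
        (X ^ suc n) P.- X ≡⟨ ≡.cong (λ k → (X ^ k) P.- X) (≡.trans (≡.cong (ℕ._^ d) p≡2) eq) ⟨
        (X ^ (p ℕ.^ d)) P.- X ∎

      -- Serves to exclude g = x: m is odd, so F_m has constant term 1.
      fib-odd-mod-X : ∀ b → Σ Pol λ h → fib (suc (b ℕ.+ b)) ≋ oneP P.+ X P.* h
      fib-odd-mod-X zero    = [] , solve 1 (λ x → con (+ 1) := con (+ 1) :+ x :* con (+ 0)) ≋-refl X
      fib-odd-mod-X (suc b) = let h , eq = fib-odd-mod-X b in fib (suc (suc (b ℕ.+ b))) P.+ h , (begin
        fib (suc (suc b ℕ.+ suc b)) ≡⟨ ≡.cong (λ n → fib (suc (suc n))) (ℕₚ.+-suc b b) ⟩
        X P.* fib (suc (suc (b ℕ.+ b))) P.+ fib (suc (b ℕ.+ b)) ≈⟨ +P-cong {X P.* fib (suc (suc (b ℕ.+ b)))} ≋-refl eq ⟩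
        X P.* fib (suc (suc (b ℕ.+ b))) P.+ (oneP P.+ X P.* h)
          ≈⟨ solve 3 (λ x f h → x :* f :+ (con (+ 1) :+ x :* h) := con (+ 1) :+ x :* (f :+ h)) ≋-refl X (fib (suc (suc (b ℕ.+ b)))) h ⟩
        oneP P.+ X P.* (fib (suc (suc (b ℕ.+ b))) P.+ h) ∎)

      root : Pol
      root = fib c P.+ fib (suc c)

      fib-m-square : fib m ≋ root P.* root
      fib-m-square = begin
        fib m ≡⟨ ≡.cong fib m≡ ⟩
        fib (suc (c ℕ.+ c)) ≈⟨ fib-+-suc c c ⟩
        fib (suc c) P.* fib (suc c) P.+ fib c P.* fib c
          ≈⟨ ≋+2 (P.- (fib c P.* fib (suc c))) (solve 2 (λ a b → b :* b :+ a :* a := (a :+ b) :* (a :+ b) :+ con (+ 2) :* (:- (a :* b))) ≋-refl (fib c) (fib (suc c))) ⟩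
        root P.* root ∎

    module _ {g : Pol} (gi : MonicIrr g) (g∣part : g ∣ part m) where
      private
        g∤X : ¬ (g ∣ X)
        g∤X g∣X = let h , eq = fib-odd-mod-X c in ∤-one gi (∣-cancel-+ʳ
          (∣-resp (≋-trans (P.reflexive (≡.cong fib m≡)) eq) (g∣fib-m gi g∣part)) (∣-*ʳ h g∣X))

        g∤fib : ∀ n → 1 ≤ n → n < m → ¬ (g ∣ fib n)
        g∤fib n 1≤n n<m g∣fib = ℕₚ.<⇒≱ n<m (ℕ∣.∣⇒≤ {{ℕ.>-nonZero 1≤n}} (rank⇒ gi g∣part n g∣fib))

      fixed⇒rank : ∀ d n → 2 ℕ.^ d ≡ suc n → Fixed g d → (m ∣ℕ n) ⊎ (m ∣ℕ suc (suc n))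
      fixed⇒rank d n eq fx = Data.Sum.[ (λ g∣X → ⊥-elim (g∤X g∣X))
        , (λ g∣ → Data.Sum.map (rank⇒ gi g∣part n) (rank⇒ gi g∣part (suc (suc n)))
              (prime gi (fib n) (fib (suc (suc n))) (∣-resp (≋-sym (fib-fib d n eq)) (∣-*ʳ ((X ^ n) P.- oneP) g∣)))) ]′
        (prime gi X ((X ^ n) P.- oneP) (∣-resp (≋-sym (X^-X d n eq)) fx))

      rank⇒fixed : ∀ d n → 2 ℕ.^ d ≡ suc n → (m ∣ℕ n) ⊎ (m ∣ℕ suc (suc n)) → Fixed g d
      rank⇒fixed d n eq r = ∣-resp (X^-X d n eq) (∣-*ˡ X (Data.Sum.[ (λ x → x) , (λ x → x) ]′
        (prime gi ((X ^ n) P.- oneP) ((X ^ n) P.- oneP) (∣-resp (fib-fib d n eq) (divides-product r)))))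
        where
        divides-product : (m ∣ℕ n) ⊎ (m ∣ℕ suc (suc n)) → g ∣ fib n P.* fib (suc (suc n))
        divides-product (inj₁ m∣n) = ∣-*ʳ (fib (suc (suc n))) (⇒rank gi g∣part n m∣n)
        divides-product (inj₂ m∣n) = ∣-*ˡ (fib n) (⇒rank gi g∣part (suc (suc n)) m∣n)

      private
        g∣root : g ∣ root
        g∣root = Data.Sum.[ (λ x → x) , (λ x → x) ]′ (prime gi root root (∣-resp fib-m-square (g∣fib-m gi g∣part)))

        disc-∂-root : disc P.* ∂ root ≋ (P.ν c P.* (X P.* fib c) P.+ P.ν (suc c) P.* (X P.* fib (suc c))) P.- X P.* root
        disc-∂-root = begin
          disc P.* ∂ root
            ≈⟨ *P-congˡ disc (∂-+ (fib c) (fib (suc c))) ⟩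
          disc P.* (∂ (fib c) P.+ ∂ (fib (suc c)))
            ≈⟨ P.distribˡ disc (∂ (fib c)) (∂ (fib (suc c))) ⟩
          disc P.* ∂ (fib c) P.+ disc P.* ∂ (fib (suc c))
            ≈⟨ P.+-cong (disc-∂-fib c) (disc-∂-fib (suc c)) ⟩
          (P.ν c P.* luc c P.- X P.* fib c) P.+ (P.ν (suc c) P.* luc (suc c) P.- X P.* fib (suc c))
            ≈⟨ P.+-cong (P.+-congʳ {P.- (X P.* fib c)} (*P-congˡ (P.ν c) (luc≋ c))) (P.+-congʳ {P.- (X P.* fib (suc c))} (*P-congˡ (P.ν (suc c)) (luc≋ (suc c)))) ⟩
          (P.ν c P.* (X P.* fib c) P.- X P.* fib c) P.+ (P.ν (suc c) P.* (X P.* fib (suc c)) P.- X P.* fib (suc c))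
            ≈⟨ solve 5 (λ u v x a b → (u :* (x :* a) :- x :* a) :+ (v :* (x :* b) :- x :* b) := (u :* (x :* a) :+ v :* (x :* b)) :- x :* (a :+ b))
                 ≋-refl (P.ν c) (P.ν (suc c)) X (fib c) (fib (suc c)) ⟩
          (P.ν c P.* (X P.* fib c) P.+ P.ν (suc c) P.* (X P.* fib (suc c))) P.- X P.* root ∎

        ν-even : ∀ b → P.ν (b ℕ.+ b) ≋ []
        ν-even b = ≋-trans (P.ν-+ b b) (≋-trans (solve 1 (λ b → b :+ b := con (+ 2) :* b) ≋-refl (P.ν b)) (*P-zeroˡ (P.ν b) 2≋0))

        ν-odd : ∀ b → P.ν (suc (b ℕ.+ b)) ≋ oneP
        ν-odd b = ≋-trans (P.ν-suc (b ℕ.+ b)) (≋-trans (+P-cong {oneP} ≋-refl (ν-even b)) (+P-identityʳ oneP))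

        one-term : ∀ {u v a b} → u ≋ [] → v ≋ oneP → g ∣ u P.* (X P.* a) P.+ v P.* (X P.* b) → g ∣ b
        one-term {u} {v} {a} {b} u≋0 v≋1 g∣ = Data.Sum.[ (λ g∣X → ⊥-elim (g∤X g∣X)) , (λ g∣b → g∣b) ]′
          (prime gi X b (∣-resp (+P-cong (*P-zeroˡ (X P.* a) u≋0) (≋-trans (*P-congʳ (X P.* b) v≋1) (*P-identityˡ (X P.* b)))) g∣))

        1≤c : 1 ≤ c
        1≤c = ℕₚ.n≢0⇒n>0 λ c≡0 → ℕₚ.<⇒≱ {1} {m} (ℕₚ.≤-trans (s≤s (s≤s z≤n)) 3≤m)
          (ℕₚ.≤-reflexive (≡.trans m≡ (≡.cong (λ n → suc (n ℕ.+ n)) c≡0)))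

        c<m : suc c < m
        c<m = ≡.subst (suc c <_) (≡.sym m≡) (s≤s (ℕₚ.+-monoˡ-≤ c 1≤c))

        -- A double factor g would divide disc times the derivative of `root`. One of c and c+1 is
        -- even, so a single term x F_c or x F_(c+1) survives, and both indices lie below the rank m
        -- of g.
        root-squarefree : ¬ (g P.* g ∣ root)
        root-squarefree g²∣root = absurd (parity c) (∣-cancel-+ʳ (∣-resp disc-∂-root (∣-*ˡ disc (square-∣-∂ g²∣root))) (∣-neg (∣-*ˡ X g∣root)))
          where
          absurd : Parity c → ¬ (g ∣ P.ν c P.* (X P.* fib c) P.+ P.ν (suc c) P.* (X P.* fib (suc c)))
          absurd (even b) g∣ = g∤fib (suc c) (s≤s z≤n) c<m (one-term (ν-even b) (ν-odd b) g∣)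
          absurd (odd b)  g∣ = g∤fib c 1≤c (ℕₚ.<-trans ℕₚ.≤-refl c<m)
            (one-term (≋-trans (P.reflexive (≡.cong (λ n → P.ν (suc n)) (≡.sym (ℕₚ.+-suc b b)))) (ν-even (suc b))) (ν-odd b)
              (∣-resp (P.+-comm (P.ν c P.* (X P.* fib c)) (P.ν (suc c) P.* (X P.* fib (suc c)))) g∣))

      -- F_m is the square of `root`, which contains g exactly once, and the complementary parts of
      -- F_m do not contain g.
      multiplicity-two : (g ^ 2 ∣ part m) × ¬ (g ^ 3 ∣ part m)
      multiplicity-two = ^-∣-cancelʳ (monic gi) (irreducible gi) (g∤rest gi g∣part) 2 (part m)
            (∣-resp (≋-trans (≋-sym fib-m-square) (fib≋part*rest S m 1≤m m≤N))
              (∣-respˡ (*P-congˡ g (≋-sym (P.*-identityʳ g))) (∣-*-cong g∣root g∣root)))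
        , λ g³∣ → cubed g∣root (∣-resp fib-m-square (∣-trans g³∣ (part-∣-fib S m 1≤m m≤N)))
        where
        cubed : g ∣ root → ¬ (g ^ 3 ∣ root P.* root)
        cubed (divides s root≋) (divides q eq) = root-squarefree (∣-resp (≋-sym root≋) (∣-*-cong (∣-refl {g})
          (Data.Sum.[ (λ x → x) , (λ x → x) ]′ (prime gi s s (divides q (monic-cancel (monic gi) (monic-cancel (monic gi) (begin
            g P.* (g P.* (s P.* s)) ≈⟨ solve 2 (λ g s → g :* (g :* (s :* s)) := (g :* s) :* (g :* s)) ≋-refl g s ⟩
            (g P.* s) P.* (g P.* s) ≈⟨ *P-cong root≋ root≋ ⟨
            root P.* root ≈⟨ eq ⟩
            (g ^ 3) P.* q ≈⟨ solve 2 (λ g q → (g :* (g :* (g :* con (+ 1)))) :* q := g :* (g :* (g :* q))) ≋-refl g q ⟩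
            g P.* (g P.* (g P.* q)) ∎))))))))

-- The orders defining δ

even-or-odd : ∀ n → Even n ⊎ Odd n
even-or-odd n with parity n
... | even b = inj₁ (b , ≡.refl)
... | odd b  = inj₂ (b , ≡.refl)

even-odd-⊥ : ∀ {n} → Even n → Odd n → ⊥
even-odd-⊥ {n} (b , n≡) (c , n≡′) = ℕₚ.1+n≢0 {0} (begin
  1 ≡⟨ [m+kn]%n≡m%n 1 c 2 ⟨
  (1 ℕ.+ c ℕ.* 2) % 2 ≡⟨ ≡.cong (_% 2) (≡.trans (≡.cong suc (twice c)) (≡.trans (≡.sym n≡′) (≡.trans n≡ (≡.sym (twice b))))) ⟩
  (b ℕ.* 2) % 2 ≡⟨ [m+kn]%n≡m%n 0 b 2 ⟩
  0 ∎)
  where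
  open ≡.≡-Reasoning
  twice : ∀ b → b ℕ.* 2 ≡ b ℕ.+ b
  twice b = ≡.trans (ℕₚ.*-comm b 2) (≡.cong (b ℕ.+_) (ℕₚ.+-identityʳ b))

module Congruence (M : ℕ) (1<M : 1 < M) where
  open Quotient ℤ-ring (+ M) public
  private module T = RingKit quotientRing
  open T public using () renaming (refl to ~-refl; sym to ~-sym; trans to ~-trans; *-cong to ~-*; +-cong to ~-+; reflexive to ≡⇒~; ^-cong to ~-^)

  by : ∀ {a b} q → a ℤ.- b ≡ + M ℤ.* q → a ~ b
  by q eq = congruent (ℤ-Div.divides q eq)

  ~⇒≡ : ∀ {a b} → a < M → b < M → + a ~ + b → a ≡ b
  ~⇒≡ {a} {b} a<M b<M a~b = ℤₚ.+-injective (ℤₚ.i-j≡0⇒i≡j (+ a) (+ b) (ℤₚ.∣i∣≡0⇒i≡0 (small ℤ.∣ + a ℤ.- + b ∣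
    (ℕₚ.≤-<-trans (≡.subst (λ z → ℤ.∣ z ∣ ≤ a ℕ.⊔ b) (≡.sym (ℤₚ.m-n≡m⊖n a b)) (ℤₚ.∣m⊝n∣≤m⊔n a b)) (ℕₚ.⊔-lub a<M b<M))
    (∣⇒∣ᵤ M (+ a ℤ.- + b) (difference a~b)))))
    where
    small : ∀ n → n < M → M ∣ℕ n → n ≡ 0
    small zero    _   _   = ≡.refl
    small (suc n) n<M M∣n = ⊥-elim (ℕₚ.<⇒≱ n<M (ℕ∣.∣⇒≤ M∣n))

  mod<M : ∀ x → x mod M < M
  -- `_mod_` computes only once its modulus is a successor; `go` generalises the modulus so that it
  -- can be split.
  mod<M x = go M 1<M
    where
    go : ∀ M → 1 < M → x mod M < M
    go (suc M′) _ = m%n<n x (suc M′)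

  mod-~ : ∀ x → + x ~ + (x mod M)
  mod-~ x = go M 1<M
    where
    go : ∀ M → 1 < M → Quotient._~_ ℤ-ring (+ M) (+ x) (+ (x mod M))
    go (suc M′) _ = Quotient.congruent (ℤ-Div.divides (+ (x / suc M′)) (begin
      + x ℤ.- + (x % suc M′)
        ≡⟨ ≡.cong (λ z → z ℤ.- + (x % suc M′)) (≡.trans (≡.cong (λ z → + z) (m≡m%n+[m/n]*n x (suc M′))) (≡.trans (ℤₚ.pos-+ (x % suc M′) _) (≡.cong (λ z → + (x % suc M′) ℤ.+ z) (ℤₚ.pos-* (x / suc M′) (suc M′))))) ⟩
      (+ (x % suc M′) ℤ.+ + (x / suc M′) ℤ.* + suc M′) ℤ.- + (x % suc M′)
        ≡⟨ ℤR.solve 3 (λ r q m → (r ℤR.:+ q ℤR.:* m) ℤR.:- r ℤR.:= m ℤR.:* q) ≡.refl (+ (x % suc M′)) (+ (x / suc M′)) (+ suc M′) ⟩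
      + suc M′ ℤ.* + (x / suc M′) ∎))
      where open ≡.≡-Reasoning

  mod≡⇒~ : ∀ {x y} → x mod M ≡ y → + x ~ + y
  mod≡⇒~ {x} ≡.refl = mod-~ x

  ~⇒mod≡ : ∀ {x y} → y < M → + x ~ + y → x mod M ≡ y
  ~⇒mod≡ {x} y<M x~y = ~⇒≡ (mod<M x) y<M (~-trans (~-sym (mod-~ x)) x~y)

  pred~-1 : ∀ {x} → + x ~ + (M ℕ.∸ 1) → + x ~ ℤ.- + 1
  pred~-1 x~ = ~-trans x~ (by (+ 1) (go M 1<M))
    where
    go : ∀ M → 1 < M → + (M ℕ.∸ 1) ℤ.- (ℤ.- + 1) ≡ + M ℤ.* + 1
    go (suc M′) _ = ≡.trans (≡.cong +_ (ℕₚ.+-comm M′ 1)) (≡.sym (ℤₚ.*-identityʳ (+ suc M′)))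

  -1~pred : ∀ {x} → + x ~ ℤ.- + 1 → + x ~ + (M ℕ.∸ 1)
  -1~pred x~ = ~-trans x~ (~-sym (pred~-1 ~-refl))

  pred<M : M ℕ.∸ 1 < M
  pred<M = ℕₚ.∸-monoʳ-< {M} (s≤s z≤n) (ℕₚ.<⇒≤ 1<M)

  module Order {p u : ℕ} (order : IsOrder p M u) where
    1≤u : 1 ≤ u
    1≤u = proj₁ order

    pow : ℕ → ℤ
    pow d = + (p ℕ.^ d)

    pow-+ : ∀ d e → pow (d ℕ.+ e) ≡ pow d ℤ.* pow e
    pow-+ d e = ≡.trans (≡.cong +_ (ℕₚ.^-distribˡ-+-* p d e)) (ℤₚ.pos-* (p ℕ.^ d) (p ℕ.^ e))

    pow-u : pow u ~ + 1
    pow-u = ~-trans (mod≡⇒~ (proj₁ (proj₂ order))) (~-sym (mod-~ 1))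

    pow-multiple : ∀ q → pow (q ℕ.* u) ~ + 1
    pow-multiple zero    = ~-refl
    pow-multiple (suc q) = ~-trans (≡⇒~ (pow-+ u (q ℕ.* u))) (~-* pow-u (pow-multiple q))

    order-∣ : ∀ v → pow v ~ + 1 → u ∣ℕ v
    order-∣ v v~1 = remainder (v % u) ≡.refl
      where
      instance nonzero-u = ℕ.>-nonZero 1≤u
      remainder~1 : pow (v % u) ~ + 1
      remainder~1 = ~-trans (~-trans (≡⇒~ (≡.sym (ℤₚ.*-identityʳ (pow (v % u)))))
        (~-trans (~-* {pow (v % u)} ~-refl (~-sym (pow-multiple (v / u))))
          (≡⇒~ (≡.trans (≡.sym (pow-+ (v % u) (v / u ℕ.* u))) (≡.cong pow (≡.sym (m≡m%n+[m/n]*n v u))))))) v~1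
      remainder : ∀ r → v % u ≡ r → u ∣ℕ v
      remainder zero    eq = ℕ∣.divides (v / u) (≡.trans (m≡m%n+[m/n]*n v u) (≡.cong (ℕ._+ v / u ℕ.* u) eq))
      remainder (suc r) eq = ⊥-elim (proj₂ (proj₂ order) (suc r) (s≤s z≤n) (≡.subst (_< u) eq (m%n<n v u))
        (≡.trans (~⇒mod≡ 1<M (≡.subst (λ r → pow r ~ + 1) eq remainder~1)) (≡.sym (~⇒mod≡ 1<M ~-refl))))

    square⇒∣ : ∀ {s} d → pow d ~ s → s ℤ.* s ~ + 1 → u ∣ℕ d ℕ.+ d
    square⇒∣ d d~s s²~1 = order-∣ (d ℕ.+ d) (~-trans (≡⇒~ (pow-+ d d)) (~-trans (~-* d~s d~s) s²~1))

    ∣double⇒half : ∀ {d} → 1 ≤ d → d < u → u ∣ℕ d ℕ.+ d → d ℕ.+ d ≡ u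
    ∣double⇒half {suc d} 1≤d d<u (ℕ∣.divides zero ())
    ∣double⇒half {d} 1≤d d<u (ℕ∣.divides (suc zero) eq) = ≡.trans eq (ℕₚ.+-identityʳ u)
    ∣double⇒half {d} 1≤d d<u (ℕ∣.divides (suc (suc q)) eq) = ⊥-elim (ℕₚ.<⇒≱ (ℕₚ.+-mono-< d<u d<u)
      (ℕₚ.≤-trans (ℕₚ.+-monoʳ-≤ u (ℕₚ.m≤m+n u (q ℕ.* u))) (ℕₚ.≤-reflexive (≡.sym eq))))

    below-half : ∀ {d h} → u ≡ h ℕ.+ h → 1 ≤ d → d < h → ¬ (u ∣ℕ d ℕ.+ d)
    below-half {suc d} {h} u≡ 1≤d d<h u∣ = ℕₚ.<⇒≱ (ℕₚ.+-mono-< d<h d<h) (≡.subst (_≤ suc d ℕ.+ suc d) u≡ (ℕ∣.∣⇒≤ u∣))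

    ±1 : ℕ → Set
    ±1 d = (pow d ~ + 1) ⊎ (pow d ~ ℤ.- + 1)

    ±1⇒∣ : ∀ d → ±1 d → u ∣ℕ d ℕ.+ d
    ±1⇒∣ d (inj₁ d~1)  = square⇒∣ d d~1 ~-refl
    ±1⇒∣ d (inj₂ d~-1) = square⇒∣ d d~-1 ~-refl

    not-1-below : ∀ {d} → 1 ≤ d → d < u → ¬ (pow d ~ + 1)
    not-1-below {d} 1≤d d<u d~1 = ℕₚ.<⇒≱ d<u (ℕ∣.∣⇒≤ {{ℕ.>-nonZero 1≤d}} (order-∣ d d~1))

    -- p^d ≡ ±1 forces u ∣ 2 d, so nothing below u/2 qualifies.
    half-exponent : ∀ {h} → u ≡ h ℕ.+ h → pow h ~ ℤ.- + 1 → 1 ≤ h × ±1 h × (∀ d → 1 ≤ d → d < h → ¬ ±1 d)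
    half-exponent {h} u≡ h~-1 = 1≤half u≡ , inj₂ h~-1 , λ d 1≤d d<h c → below-half u≡ 1≤d d<h (±1⇒∣ d c)
      where
      1≤half : ∀ {h} → u ≡ h ℕ.+ h → 1 ≤ h
      1≤half {zero}  u≡0 = ⊥-elim (ℕₚ.<⇒≢ 1≤u (≡.sym u≡0))
      1≤half {suc h} _   = s≤s z≤n

    -- Below u the value 1 is excluded by the order, and the value -1 forces 2 d = u.
    full-exponent : (∀ h → u ≡ h ℕ.+ h → ¬ (pow h ~ ℤ.- + 1)) → 1 ≤ u × ±1 u × (∀ d → 1 ≤ d → d < u → ¬ ±1 d)
    full-exponent no-half = 1≤u , inj₁ pow-u , minimal
      where
      minimal : ∀ d → 1 ≤ d → d < u → ¬ ±1 d
      minimal d 1≤d d<u (inj₁ d~1)  = not-1-below 1≤d d<u d~1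
      minimal d 1≤d d<u (inj₂ d~-1) = no-half d (≡.sym (∣double⇒half 1≤d d<u (±1⇒∣ d (inj₂ d~-1)))) d~-1

≡ᵇ-true : ∀ {a b} → a ≡ b → (a ℕ.≡ᵇ b) ≡ true
≡ᵇ-true {zero}  ≡.refl = ≡.refl
≡ᵇ-true {suc a} ≡.refl = ≡ᵇ-true {a} ≡.refl

≡ᵇ-false : ∀ {a b} → a ≢ b → (a ℕ.≡ᵇ b) ≡ false
≡ᵇ-false {zero}  {zero}  a≢b = ⊥-elim (a≢b ≡.refl)
≡ᵇ-false {zero}  {suc b} a≢b = ≡.refl
≡ᵇ-false {suc a} {zero}  a≢b = ≡.refl
≡ᵇ-false {suc a} {suc b} a≢b = ≡ᵇ-false {a} λ a≡b → a≢b (≡.cong suc a≡b)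

half/2 : ∀ {u} h → u ≡ h ℕ.+ h → u / 2 ≡ h
half/2 {u} h u≡ = ≡.trans (≡.cong (_/ 2) (≡.trans u≡ (≡.sym (≡.trans (ℕₚ.*-comm h 2) (≡.cong (h ℕ.+_) (ℕₚ.+-identityʳ h))))))
  (m*n/n≡m h 2)

rem-multiple : ∀ {u} r k n .{{_ : ℕ.NonZero n}} → u ≡ r ℕ.+ k ℕ.* n → r < n → u % n ≡ r
rem-multiple r k n ≡.refl r<n = ≡.trans ([m+kn]%n≡m%n r k n) (m<n⇒m%n≡m r<n)

even⇒%2 : ∀ {u} → Even u → u % 2 ≡ 0
even⇒%2 (h , u≡) = rem-multiple 0 h 2 (≡.trans u≡ (≡.sym (≡.trans (ℕₚ.*-comm h 2) (≡.cong (h ℕ.+_) (ℕₚ.+-identityʳ h))))) (s≤s z≤n)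

odd⇒%2 : ∀ {u} → Odd u → u % 2 ≡ 1
odd⇒%2 (h , u≡) = rem-multiple 1 h 2 (≡.trans u≡ (≡.cong suc (≡.sym (≡.trans (ℕₚ.*-comm h 2) (≡.cong (h ℕ.+_) (ℕₚ.+-identityʳ h)))))) (s≤s (s≤s z≤n))

-- `C d` stands for x^(2^d) ≡ x modulo an irreducible factor. Keeping it abstract leaves pure
-- arithmetic: with 2^d = n+1, m ∣ n or m ∣ n+2 means that 2^d is 1 or -1 modulo m.
δ-iv-degree : ∀ m u → 3 ≤ m → IsOrder 2 m u →
  1 ≤ δ-iv m u × (∀ {C : ℕ → Set} → (∀ d n → 2 ℕ.^ d ≡ suc n → C d → (m ∣ℕ n) ⊎ (m ∣ℕ suc (suc n))) →
    (∀ d n → 2 ℕ.^ d ≡ suc n → (m ∣ℕ n) ⊎ (m ∣ℕ suc (suc n)) → C d) →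
    C (δ-iv m u) × (∀ d → 1 ≤ d → d < δ-iv m u → ¬ C d))
δ-iv-degree m u 3≤m order = transfer (even-or-odd u)
  where
  1<m : 1 < m
  1<m = ℕₚ.≤-trans (s≤s (s≤s z≤n)) 3≤m
  open Congruence m 1<m
  open Order order

  predecessor : ∀ d → Σ ℕ λ n → 2 ℕ.^ d ≡ suc n
  predecessor d = ℕ.pred (2 ℕ.^ d) , ≡.sym (ℕₚ.suc-pred (2 ℕ.^ d) {{ℕₚ.m^n≢0 2 d}})

  to-±1 : ∀ d n → 2 ℕ.^ d ≡ suc n → (m ∣ℕ n) ⊎ (m ∣ℕ suc (suc n)) → ±1 d
  to-±1 d n eq (inj₁ (ℕ∣.divides q n≡)) = inj₁ (~-trans (≡⇒~ (≡.cong +_ eq)) (by (+ q)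
    (≡.trans (≡.cong +_ n≡) (≡.trans (ℤₚ.pos-* q m) (ℤₚ.*-comm (+ q) (+ m))))))
  to-±1 d n eq (inj₂ (ℕ∣.divides q n≡)) = inj₂ (~-trans (≡⇒~ (≡.cong +_ eq)) (by (+ q)
    (≡.trans (≡.cong +_ (≡.trans (ℕₚ.+-comm (suc n) 1) n≡)) (≡.trans (ℤₚ.pos-* q m) (ℤₚ.*-comm (+ q) (+ m))))))

  from-±1 : ∀ d n → 2 ℕ.^ d ≡ suc n → ±1 d → (m ∣ℕ n) ⊎ (m ∣ℕ suc (suc n))
  from-±1 d n eq (inj₁ d~1) = inj₁ (∣⇒∣ᵤ m (+ n) (≡.subst (λ x → + m ℤ-Div.∣ + x ℤ.- + 1) eq (difference d~1)))
  from-±1 d n eq (inj₂ d~-1) = inj₂ (≡.subst (m ∣ℕ_) (ℕₚ.+-comm (suc n) 1)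
    (∣⇒∣ᵤ m (+ (suc n ℕ.+ 1)) (≡.subst (λ x → + m ℤ-Div.∣ + x ℤ.- (ℤ.- + 1)) eq (difference d~-1))))

  Exponent : ℕ → Set
  Exponent δ = 1 ≤ δ × ±1 δ × (∀ d → 1 ≤ d → d < δ → ¬ ±1 d)

  -- The case distinction of `δ-iv` with its two tests as arguments, so that each can be replaced by
  -- its value.
  pick : Bool → Bool → ℕ
  pick e r = if e ∧ r then u / 2 else u

  no-half-if : (∀ h → u ≡ h ℕ.+ h → (2 ℕ.^ (u / 2)) mod m ≢ m ℕ.∸ 1) → ∀ h → u ≡ h ℕ.+ h → ¬ (pow h ~ ℤ.- + 1)
  no-half-if ≢ h u≡ h~-1 = ≢ h u≡ (~⇒mod≡ pred<M (≡.subst (λ h → pow h ~ + (m ℕ.∸ 1)) (≡.sym (half/2 h u≡)) (-1~pred h~-1)))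

  exponent : Even u ⊎ Odd u → Exponent (pick (u % 2 ℕ.≡ᵇ 0) ((2 ℕ.^ (u / 2)) mod m ℕ.≡ᵇ m ℕ.∸ 1))
  exponent (inj₂ u-odd) rewrite odd⇒%2 u-odd = full-exponent λ h u≡ _ → even-odd-⊥ (h , u≡) u-odd
  exponent (inj₁ (h , u≡)) rewrite even⇒%2 (h , u≡) = by-residue ((2 ℕ.^ (u / 2)) mod m ℕ.≟ m ℕ.∸ 1)
    where
    by-residue : Dec ((2 ℕ.^ (u / 2)) mod m ≡ m ℕ.∸ 1) → Exponent (pick true ((2 ℕ.^ (u / 2)) mod m ℕ.≡ᵇ m ℕ.∸ 1))
    by-residue (yes r≡) = ≡.subst Exponent (≡.cong (pick true) (≡.sym (≡ᵇ-true r≡)))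
      (half-exponent {u / 2} (≡.trans u≡ (≡.cong (λ x → x ℕ.+ x) (≡.sym (half/2 h u≡)))) (pred~-1 (mod≡⇒~ r≡)))
    by-residue (no r≢) = ≡.subst Exponent (≡.cong (pick true) (≡.sym (≡ᵇ-false r≢))) (full-exponent (no-half-if λ _ _ → r≢))

  transfer : Even u ⊎ Odd u → 1 ≤ δ-iv m u × (∀ {C : ℕ → Set} → (∀ d n → 2 ℕ.^ d ≡ suc n → C d → (m ∣ℕ n) ⊎ (m ∣ℕ suc (suc n))) →
    (∀ d n → 2 ℕ.^ d ≡ suc n → (m ∣ℕ n) ⊎ (m ∣ℕ suc (suc n)) → C d) →
    C (δ-iv m u) × (∀ d → 1 ≤ d → d < δ-iv m u → ¬ C d))
  transfer parity-u =
    let 1≤δ , δ±1 , minimal = exponent parity-u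
    in  1≤δ , λ to from →
          (let n , eq = predecessor (δ-iv m u) in from (δ-iv m u) n eq (from-±1 (δ-iv m u) n eq δ±1))
        , λ d 1≤d d<δ c → let n , eq = predecessor d in minimal d 1≤d d<δ (to-±1 d n eq (to d n eq c))

-- Parities and residues modulo 2m

double : ∀ b → b ℕ.* 2 ≡ b ℕ.+ b
double b = ≡.trans (ℕₚ.*-comm b 2) (≡.cong (b ℕ.+_) (ℕₚ.+-identityʳ b))

double-injective : ∀ a b → a ℕ.+ a ≡ b ℕ.+ b → a ≡ b
double-injective a b eq = ℕₚ.*-cancelʳ-≡ a b 2 (≡.trans (double a) (≡.trans eq (≡.sym (double b))))

even+even : ∀ {a b} → Even a → Even b → Even (a ℕ.+ b)
even+even (a , ≡.refl) (b , ≡.refl) = a ℕ.+ b , solve 2 (λ a b → (a :+ a) :+ (b :+ b) := (a :+ b) :+ (a :+ b)) ≡.refl a b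
  where open Data.Nat.Solver.+-*-Solver

odd+even : ∀ {a b} → Odd a → Even b → Odd (a ℕ.+ b)
odd+even o e = let c , eq = even+even (proj₁ o , ≡.refl) e in c , ≡.trans (≡.cong (ℕ._+ _) (proj₂ o)) (≡.cong suc eq)

odd+odd : ∀ {a b} → Odd a → Odd b → Even (a ℕ.+ b)
odd+odd (a , ≡.refl) (b , ≡.refl) = suc (a ℕ.+ b) , solve 2 (λ a b → (con 1 :+ (a :+ a)) :+ (con 1 :+ (b :+ b)) := (con 1 :+ (a :+ b)) :+ (con 1 :+ (a :+ b))) ≡.refl a b
  where open Data.Nat.Solver.+-*-Solver

odd*odd : ∀ {a b} → Odd a → Odd b → Odd (a ℕ.* b)
odd*odd (a , ≡.refl) (b , ≡.refl) = a ℕ.+ b ℕ.+ (a ℕ.* b ℕ.+ a ℕ.* b) , solve 2 (λ a b →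
    (con 1 :+ (a :+ a)) :* (con 1 :+ (b :+ b)) := con 1 :+ ((a :+ b :+ (a :* b :+ a :* b)) :+ (a :+ b :+ (a :* b :+ a :* b)))) ≡.refl a b
  where open Data.Nat.Solver.+-*-Solver

odd-∣-double : ∀ {u} d → Odd u → u ∣ℕ d ℕ.+ d → u ∣ℕ d
odd-∣-double {u} d u-odd (ℕ∣.divides q eq) with even-or-odd q
... | inj₂ q-odd        = ⊥-elim (even-odd-⊥ (d , ≡.sym eq) (odd*odd q-odd u-odd))
... | inj₁ (j , ≡.refl) = ℕ∣.divides j (double-injective d (j ℕ.* u) (≡.trans eq (ℕₚ.*-distribʳ-+ u j j)))

half⇒even : ∀ {m b} → Half m b → Even m
half⇒even {m} {b} (m∣2b , m∤b) with even-or-odd m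
... | inj₁ e = e
... | inj₂ o = ⊥-elim (m∤b (odd-∣-double b o m∣2b))

module OddPower {h : ℕ} where
  private p = suc (h ℕ.+ h)

  -- The parity of a encodes p^d modulo 4: for even h, p and all its powers are 1 modulo 4; for odd
  -- h, p is 3 modulo 4 and the residue of p^d alternates with d.
  half-power : ∀ d → Σ ℕ λ a → (p ℕ.^ d ≡ suc (a ℕ.+ a)) × (Even h → Even a) × (Odd h → (Even d → Even a) × (Odd d → Odd a))
  half-power zero = 0 , ≡.refl , (λ _ → 0 , ≡.refl) , λ _ → (λ _ → 0 , ≡.refl) , λ d-odd → ⊥-elim (even-odd-⊥ (0 , ≡.refl) d-odd)
  half-power (suc d) =
    let a , eq , when-even , when-odd = half-power d
        z-even = a ℕ.* h , ≡.refl
    in  (h ℕ.+ a) ℕ.+ (a ℕ.* h ℕ.+ a ℕ.* h)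
      , ≡.trans (≡.cong (p ℕ.*_) eq) (solve 2 (λ h a → (con 1 :+ (h :+ h)) :* (con 1 :+ (a :+ a))
          := con 1 :+ (((h :+ a) :+ (a :* h :+ a :* h)) :+ ((h :+ a) :+ (a :* h :+ a :* h)))) ≡.refl h a)
      , (λ h-even → even+even (even+even h-even (when-even h-even)) z-even)
      , λ h-odd → (λ d-even → even+even (odd+odd h-odd (proj₂ (when-odd h-odd) (pred-odd d-even))) z-even)
                , (λ d-odd → odd+even (odd+even h-odd (proj₁ (when-odd h-odd) (pred-even d-odd))) z-even)
    where
    open Data.Nat.Solver.+-*-Solver
    pred-even : ∀ {d} → Odd (suc d) → Even d
    pred-even (b , eq) = b , ℕₚ.suc-injective eq
    pred-odd : ∀ {d} → Even (suc d) → Odd d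
    pred-odd (suc b , eq) = b , ≡.trans (ℕₚ.suc-injective eq) (ℕₚ.+-suc b b)

module ModTwiceM (m : ℕ) (3≤m : 3 ≤ m) where
  M : ℕ
  M = 2 ℕ.* m

  m<M : m < M
  m<M = ≡.subst (m <_) (≡.cong (m ℕ.+_) (≡.sym (ℕₚ.+-identityʳ m))) (ℕₚ.m<m+n m (ℕₚ.≤-trans (s≤s z≤n) 3≤m))

  open Congruence M (ℕₚ.≤-trans (ℕₚ.≤-trans (s≤s (s≤s z≤n)) 3≤m) (ℕₚ.<⇒≤ m<M)) public
  open Data.Nat.Solver.+-*-Solver

  remainder-~ : ∀ {x r} q → x ≡ r ℕ.+ q ℕ.* M → + x ~ + r
  remainder-~ {x} {r} q ≡.refl = by (+ q) (≡.trans
    (≡.cong (λ z → z ℤ.- + r) (≡.trans (ℤₚ.pos-+ r (q ℕ.* M)) (≡.cong (λ z → + r ℤ.+ z) (ℤₚ.pos-* q M))))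
    (ℤR.solve 3 (λ r q M → (r ℤR.:+ q ℤR.:* M) ℤR.:- r ℤR.:= M ℤR.:* q) ≡.refl (+ r) (+ q) (+ M)))

  shift : ∀ {a b} c → c ℤ.+ a ~ c ℤ.+ b → a ~ b
  shift {a} {b} c eq = congruent (ℤ-Div.∣-resp
    (ℤR.solve 3 (λ a b c → (c ℤR.:+ a) ℤR.:- (c ℤR.:+ b) ℤR.:= a ℤR.:- b) ≡.refl a b c) (difference eq))

  ∣⇒double~0 : ∀ b → m ∣ℕ b → + (b ℕ.+ b) ~ + 0
  ∣⇒double~0 b (ℕ∣.divides q ≡.refl) = remainder-~ q
    (solve 2 (λ q m → q :* m :+ q :* m := q :* (con 2 :* m)) ≡.refl q m)

  double~0⇒∣ : ∀ b → + (b ℕ.+ b) ~ + 0 → m ∣ℕ b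
  double~0⇒∣ b eq = ℕ∣.*-cancelˡ-∣ 2 (≡.subst (M ∣ℕ_) (≡.cong (b ℕ.+_) (≡.sym (ℕₚ.+-identityʳ b)))
    (∣⇒∣ᵤ M (+ (b ℕ.+ b)) (~0⇒∣ eq)))

  half⇒double~m : ∀ b → Half m b → + (b ℕ.+ b) ~ + m
  half⇒double~m b (ℕ∣.divides q eq , m∤b) with even-or-odd q
  ... | inj₁ (j , ≡.refl) = ⊥-elim (m∤b (ℕ∣.divides j (double-injective b (j ℕ.* m) (≡.trans eq (ℕₚ.*-distribʳ-+ m j j)))))
  ... | inj₂ (j , ≡.refl) = remainder-~ j (≡.trans eq (solve 2 (λ j m → (con 1 :+ (j :+ j)) :* m := m :+ j :* (con 2 :* m)) ≡.refl j m))

  double~m⇒half : ∀ b → + (b ℕ.+ b) ~ + m → Half m b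
  double~m⇒half b eq = m∣2b (difference eq) , λ m∣b →
    ℕₚ.<⇒≢ {0} (ℕₚ.≤-trans (s≤s z≤n) 3≤m) (≡.sym (~⇒≡ m<M (ℕₚ.≤-trans (s≤s z≤n) m<M) (~-trans (~-sym eq) (∣⇒double~0 b m∣b))))
    where
    m∣2b : + M ℤ-Div.∣ + (b ℕ.+ b) ℤ.- + m → m ∣ℕ b ℕ.+ b
    m∣2b (ℤ-Div.divides q eq) = ∣⇒∣ᵤ m (+ (b ℕ.+ b)) (ℤ-Div.divides (+ 1 ℤ.+ + 2 ℤ.* q) (begin
      + (b ℕ.+ b) ≡⟨ ℤR.solve 2 (λ x m → x ℤR.:= (x ℤR.:- m) ℤR.:+ m) ≡.refl (+ (b ℕ.+ b)) (+ m) ⟩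
      (+ (b ℕ.+ b) ℤ.- + m) ℤ.+ + m ≡⟨ ≡.cong (λ z → z ℤ.+ + m) (≡.trans eq (≡.cong (λ z → z ℤ.* q) (ℤₚ.pos-* 2 m))) ⟩
      (+ 2 ℤ.* + m) ℤ.* q ℤ.+ + m ≡⟨ ℤR.solve 2 (λ m q → (ℤR.con (+ 2) ℤR.:* m) ℤR.:* q ℤR.:+ m ℤR.:= m ℤR.:* (ℤR.con (+ 1) ℤR.:+ ℤR.con (+ 2) ℤR.:* q)) ≡.refl (+ m) q ⟩
      + m ℤ.* (+ 1 ℤ.+ + 2 ℤ.* q) ∎))
      where open ≡.≡-Reasoning

  private
    suc-double : ∀ a → suc a ℕ.+ suc a ≡ suc (suc (a ℕ.+ a))
    suc-double a = ≡.cong suc (ℕₚ.+-suc a a)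

    1+pred : suc (m ℕ.∸ 1) ≡ m
    1+pred = ℕₚ.m+[n∸m]≡n (ℕₚ.≤-trans (s≤s z≤n) 3≤m)

  -- With q = 2 a + 1, this and the next three lemmas turn the index conditions into congruences
  -- modulo 2 m: m ∣ a and m ∣ a+1 become q ≡ 1 and q ≡ -1, the two half conditions q ≡ m+1 and q ≡
  -- m-1.
  m∣a⇔ : ∀ a → ((m ∣ℕ a) → + suc (a ℕ.+ a) ~ + 1) × (+ suc (a ℕ.+ a) ~ + 1 → m ∣ℕ a)
  m∣a⇔ a = (λ m∣a → ~-+ {+ 1} ~-refl (∣⇒double~0 a m∣a)) , λ eq → double~0⇒∣ a (shift (+ 1) eq)

  m∣suc-a⇔ : ∀ a → ((m ∣ℕ suc a) → + suc (a ℕ.+ a) ~ ℤ.- + 1) × (+ suc (a ℕ.+ a) ~ ℤ.- + 1 → m ∣ℕ suc a)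
  m∣suc-a⇔ a = (λ m∣ → shift (+ 1) (≡.subst (λ x → + x ~ + 0) (suc-double a) (∣⇒double~0 (suc a) m∣)))
    , λ eq → double~0⇒∣ (suc a) (≡.subst (λ x → + x ~ + 0) (≡.sym (suc-double a)) (~-+ {+ 1} ~-refl eq))

  half-a⇔ : ∀ a → (Half m a → + suc (a ℕ.+ a) ~ + (m ℕ.+ 1)) × (+ suc (a ℕ.+ a) ~ + (m ℕ.+ 1) → Half m a)
  half-a⇔ a = (λ ha → ≡.subst (λ x → + suc (a ℕ.+ a) ~ + x) (ℕₚ.+-comm 1 m) (~-+ {+ 1} ~-refl (half⇒double~m a ha)))
    , λ eq → double~m⇒half a (shift (+ 1) (≡.subst (λ x → + suc (a ℕ.+ a) ~ + x) (ℕₚ.+-comm m 1) eq))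

  half-suc-a⇔ : ∀ a → (Half m (suc a) → + suc (a ℕ.+ a) ~ + (m ℕ.∸ 1)) × (+ suc (a ℕ.+ a) ~ + (m ℕ.∸ 1) → Half m (suc a))
  half-suc-a⇔ a = (λ h → shift (+ 1) (≡.subst₂ (λ x y → + x ~ + y) (suc-double a) (≡.sym 1+pred) (half⇒double~m (suc a) h)))
    , λ eq → double~m⇒half (suc a) (≡.subst₂ (λ x y → + x ~ + y) (≡.sym (suc-double a)) 1+pred (~-+ {+ 1} ~-refl eq))

  m+1<M : m ℕ.+ 1 < M
  m+1<M = ≡.subst (m ℕ.+ 1 <_) (≡.cong (m ℕ.+_) (≡.sym (ℕₚ.+-identityʳ m))) (ℕₚ.+-monoʳ-< m (ℕₚ.≤-trans (s≤s (s≤s z≤n)) 3≤m))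

  m∸1<M : m ℕ.∸ 1 < M
  m∸1<M = ℕₚ.≤-<-trans (ℕₚ.m∸n≤m m 1) m<M

  1<M : 1 < M
  1<M = ℕₚ.≤-trans (s≤s (s≤s z≤n)) (ℕₚ.≤-trans (ℕₚ.<⇒≤ 3≤m) (ℕₚ.<⇒≤ m<M))

  -- For m = 2 c one has (m + 1)² = 1 + (c + 1) (2 m), as 2 m divides m².
  square-m+1 : Even m → + (m ℕ.+ 1) ℤ.* + (m ℕ.+ 1) ~ + 1
  square-m+1 (c , m≡) = ~-trans (≡⇒~ (≡.sym (ℤₚ.pos-* (m ℕ.+ 1) (m ℕ.+ 1)))) (remainder-~ (suc c)
    (≡.subst (λ m → (m ℕ.+ 1) ℕ.* (m ℕ.+ 1) ≡ 1 ℕ.+ suc c ℕ.* (2 ℕ.* m)) (≡.sym m≡)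
      (solve 1 (λ c → (c :+ c :+ con 1) :* (c :+ c :+ con 1) := con 1 :+ (con 1 :+ c) :* (con 2 :* (c :+ c))) ≡.refl c)))

  square-m∸1 : Even m → + (m ℕ.∸ 1) ℤ.* + (m ℕ.∸ 1) ~ + 1
  square-m∸1 (zero  , m≡) = ⊥-elim (ℕₚ.<⇒≢ {0} (ℕₚ.≤-trans (s≤s z≤n) 3≤m) (≡.sym m≡))
  square-m∸1 (suc c , m≡) = ~-trans (≡⇒~ (≡.sym (ℤₚ.pos-* (m ℕ.∸ 1) (m ℕ.∸ 1)))) (remainder-~ c
    (≡.subst (λ m → (m ℕ.∸ 1) ℕ.* (m ℕ.∸ 1) ≡ 1 ℕ.+ c ℕ.* (2 ℕ.* m)) (≡.sym m≡)
      (solve 1 (λ c → (c :+ (con 1 :+ c)) :* (c :+ (con 1 :+ c)) := con 1 :+ c :* (con 2 :* ((con 1 :+ c) :+ (con 1 :+ c)))) ≡.refl c)))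

record Tests : Set where
  field p≡1 p≡3 u2≡0 u4≡0 u4≡2 u2≡1 r≡-1 r≡m+1 r≡m-1 : Bool
open Tests

-- The exponent δ for odd p

module DegreeIII (m u h : ℕ) (3≤m : 3 ≤ m) (order : IsOrder (suc (h ℕ.+ h)) (2 ℕ.* m) u) where
  open ModTwiceM m 3≤m
  open Order order
  open OddPower {h}
  private
    p = suc (h ℕ.+ h)
    r = (p ℕ.^ (u / 2)) mod M

    m±1 : ℕ → Set
    m±1 d = (pow d ~ + (m ℕ.+ 1)) ⊎ (pow d ~ + (m ℕ.∸ 1))

    -- p^d ≡ m ± 1 is a half condition on the index, and those hold only for even m; evenness in
    -- turn makes the squares of m ± 1 congruent to 1.
    even-m : ∀ d → m±1 d → Even m
    even-m d c = let a , eq , _ = half-power d in Data.Sum.[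
        (λ d~ → half⇒even {b = a} (proj₂ (half-a⇔ a) (≡.subst (λ x → + x ~ + (m ℕ.+ 1)) eq d~)))
      , (λ d~ → half⇒even {b = suc a} (proj₂ (half-suc-a⇔ a) (≡.subst (λ x → + x ~ + (m ℕ.∸ 1)) eq d~))) ]′ c

    m±1⇒∣ : ∀ d → m±1 d → u ∣ℕ d ℕ.+ d
    m±1⇒∣ d c@(inj₁ d~) = square⇒∣ d d~ (square-m+1 (even-m d c))
    m±1⇒∣ d c@(inj₂ d~) = square⇒∣ d d~ (square-m∸1 (even-m d c))

    ±1⇔ : ∀ d a → p ℕ.^ d ≡ suc (a ℕ.+ a) → (((m ∣ℕ a) ⊎ (m ∣ℕ suc a)) → ±1 d) × (±1 d → (m ∣ℕ a) ⊎ (m ∣ℕ suc a))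
    ±1⇔ d a eq = (λ c → Data.Sum.map (λ x → back (proj₁ (m∣a⇔ a) x)) (λ x → back (proj₁ (m∣suc-a⇔ a) x)) c)
               , (λ c → Data.Sum.map (λ x → proj₂ (m∣a⇔ a) (forth x)) (λ x → proj₂ (m∣suc-a⇔ a) (forth x)) c)
      where
      back : ∀ {y} → + suc (a ℕ.+ a) ~ y → pow d ~ y
      back {y} = ≡.subst (λ x → + x ~ y) (≡.sym eq)
      forth : ∀ {y} → pow d ~ y → + suc (a ℕ.+ a) ~ y
      forth {y} = ≡.subst (λ x → + x ~ y) eq

    m±1⇔ : ∀ d a → p ℕ.^ d ≡ suc (a ℕ.+ a) → ((Half m a ⊎ Half m (suc a)) → m±1 d) × (m±1 d → Half m a ⊎ Half m (suc a))
    m±1⇔ d a eq = (λ c → Data.Sum.map (λ x → back (proj₁ (half-a⇔ a) x)) (λ x → back (proj₁ (half-suc-a⇔ a) x)) c)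
                , (λ c → Data.Sum.map (λ x → proj₂ (half-a⇔ a) (forth x)) (λ x → proj₂ (half-suc-a⇔ a) (forth x)) c)
      where
      back : ∀ {y} → + suc (a ℕ.+ a) ~ y → pow d ~ y
      back {y} = ≡.subst (λ x → + x ~ y) (≡.sym eq)
      forth : ∀ {y} → pow d ~ y → + suc (a ℕ.+ a) ~ y
      forth {y} = ≡.subst (λ x → + x ~ y) eq

  Fix : ℕ → Set
  Fix d = FixCondition m (proj₁ (half-power d))

  Exponent : ℕ → Set
  Exponent δ = 1 ≤ δ × Fix δ × (∀ d → 1 ≤ d → d < δ → ¬ Fix d)

  private
    -- The case distinction of δ-iii with its tests abstracted.
    δ-of : Tests → ℕ
    δ-of t = if p≡1 t ∧ u2≡0 t ∧ r≡-1 t ∨ p≡3 t ∧ u4≡0 t ∧ r≡-1 t ∨ p≡3 t ∧ u4≡2 t ∧ (r≡m+1 t ∨ r≡m-1 t)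
      then u / 2 else (if p≡3 t ∧ u2≡1 t then 2 ℕ.* u else u)

    tests : Tests
    tests = record
      { p≡1 = p % 4 ℕ.≡ᵇ 1 ; p≡3 = p % 4 ℕ.≡ᵇ 3 ; u2≡0 = u % 2 ℕ.≡ᵇ 0 ; u4≡0 = u % 4 ℕ.≡ᵇ 0 ; u4≡2 = u % 4 ℕ.≡ᵇ 2
      ; u2≡1 = u % 2 ℕ.≡ᵇ 1 ; r≡-1 = r ℕ.≡ᵇ M ℕ.∸ 1 ; r≡m+1 = r ℕ.≡ᵇ m ℕ.+ 1 ; r≡m-1 = r ℕ.≡ᵇ m ℕ.∸ 1 }

    δ≡ : δ-iii p m u ≡ δ-of tests
    δ≡ = ≡.refl

    resolve : ∀ {δ} → δ-of tests ≡ δ → Exponent δ → Exponent (δ-iii p m u)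
    resolve eq = ≡.subst Exponent (≡.trans (≡.sym eq) (≡.sym δ≡))

    r≡⇒~ : ∀ k {y} → u ≡ k ℕ.+ k → r ≡ y → pow k ~ + y
    r≡⇒~ k {y} eq r≡ = ≡.subst (λ d → pow d ~ + y) (half/2 k eq) (mod≡⇒~ r≡)

    ~⇒r≡ : ∀ k {y} → u ≡ k ℕ.+ k → y < M → pow k ~ + y → r ≡ y
    ~⇒r≡ k {y} eq y<M k~ = ~⇒mod≡ y<M (≡.subst (λ d → pow d ~ + y) (≡.sym (half/2 k eq)) k~)

    no-half : (∀ k → u ≡ k ℕ.+ k → r ≢ M ℕ.∸ 1) → ∀ k → u ≡ k ℕ.+ k → ¬ (pow k ~ ℤ.- + 1)
    no-half r≢ k eq k~ = r≢ k eq (~⇒r≡ k eq pred<M (-1~pred k~))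

  -- The case p ≡ 1 modulo 4: a is always even, so only p^d ≡ ±1 counts.
  module One (h-even : Even h) where
    private
      even-a : ∀ d → Even (proj₁ (half-power d))
      even-a d = proj₁ (proj₂ (proj₂ (half-power d))) h-even

      to : ∀ d → Fix d → ±1 d
      to d (inj₁ (_ , c)) = proj₁ (±1⇔ d _ (proj₁ (proj₂ (half-power d)))) c
      to d (inj₂ (o , _)) = ⊥-elim (even-odd-⊥ (even-a d) o)

      from : ∀ d → ±1 d → Fix d
      from d c = inj₁ (even-a d , proj₂ (±1⇔ d _ (proj₁ (proj₂ (half-power d)))) c)

      transfer : ∀ {δ} → 1 ≤ δ × ±1 δ × (∀ d → 1 ≤ d → d < δ → ¬ ±1 d) → Exponent δ
      transfer {δ} (1≤δ , c , minimal) = 1≤δ , from δ c , λ d 1≤d d<δ f → minimal d 1≤d d<δ (to d f)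

      p%4 : p % 4 ≡ 1
      p%4 = let k , h≡ = h-even in rem-multiple 1 k 4 (≡.trans (≡.cong (λ h → suc (h ℕ.+ h)) h≡)
        (solve 1 (λ k → con 1 :+ ((k :+ k) :+ (k :+ k)) := con 1 :+ k :* con 4) ≡.refl k)) (s≤s (s≤s z≤n))
        where open Data.Nat.Solver.+-*-Solver

      pick-half : ∀ t → p≡1 t ≡ true → u2≡0 t ≡ true → r≡-1 t ≡ true → δ-of t ≡ u / 2
      pick-half t a b c rewrite a | b | c = ≡.refl

      pick-full : ∀ t → p≡1 t ≡ true → p≡3 t ≡ false → (u2≡0 t ≡ false) ⊎ (r≡-1 t ≡ false) → δ-of t ≡ u
      pick-full t a b (inj₁ c) rewrite a | b | c = ≡.refl
      pick-full t a b (inj₂ c) rewrite a | b | c with u2≡0 t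
      ... | true  = ≡.refl
      ... | false = ≡.refl

      p≢3 : (p % 4 ℕ.≡ᵇ 3) ≡ false
      p≢3 = ≡.cong (ℕ._≡ᵇ 3) p%4

    exponent : Exponent (δ-iii p m u)
    exponent = by-parity (even-or-odd u)
      where
      by-residue : ∀ k → u ≡ k ℕ.+ k → Dec (r ≡ M ℕ.∸ 1) → Exponent (δ-iii p m u)
      by-residue k eq (yes r≡) = resolve (≡.trans (pick-half tests (≡ᵇ-true p%4) (≡ᵇ-true {u % 2} (even⇒%2 (k , eq))) (≡ᵇ-true r≡)) (half/2 k eq))
        (transfer (half-exponent eq (pred~-1 (r≡⇒~ k eq r≡))))
      by-residue k eq (no r≢) = resolve (pick-full tests (≡ᵇ-true p%4) p≢3 (inj₂ (≡ᵇ-false r≢)))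
        (transfer (full-exponent (no-half λ _ _ → r≢)))
      by-parity : Even u ⊎ Odd u → Exponent (δ-iii p m u)
      by-parity (inj₁ (k , eq)) = by-residue k eq (r ℕ.≟ M ℕ.∸ 1)
      by-parity (inj₂ u-odd) = resolve (pick-full tests (≡ᵇ-true p%4) p≢3 (inj₁ (≡.cong (ℕ._≡ᵇ 0) (odd⇒%2 u-odd))))
        (transfer (full-exponent λ k eq _ → even-odd-⊥ (k , eq) u-odd))

  -- The case p ≡ 3 modulo 4: a has the parity of d, so an even d must satisfy p^d ≡ ±1 and an odd d
  -- must satisfy p^d ≡ m ± 1.
  module Three (h-odd : Odd h) where
    private
      Fix′ : ℕ → Set
      Fix′ d = (Even d × ±1 d) ⊎ (Odd d × m±1 d)

      parity-a : ∀ d → (Even d → Even (proj₁ (half-power d))) × (Odd d → Odd (proj₁ (half-power d)))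
      parity-a d = proj₂ (proj₂ (proj₂ (half-power d))) h-odd

      to : ∀ d → Fix d → Fix′ d
      to d f = by-parity (even-or-odd d) f
        where
        by-parity : Even d ⊎ Odd d → Fix d → Fix′ d
        by-parity (inj₁ e) (inj₁ (_ , c)) = inj₁ (e , proj₁ (±1⇔ d _ (proj₁ (proj₂ (half-power d)))) c)
        by-parity (inj₁ e) (inj₂ (o , _)) = ⊥-elim (even-odd-⊥ (proj₁ (parity-a d) e) o)
        by-parity (inj₂ o) (inj₁ (e , _)) = ⊥-elim (even-odd-⊥ e (proj₂ (parity-a d) o))
        by-parity (inj₂ o) (inj₂ (_ , c)) = inj₂ (o , proj₁ (m±1⇔ d _ (proj₁ (proj₂ (half-power d)))) c)

      from : ∀ d → Fix′ d → Fix d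
      from d (inj₁ (e , c)) = inj₁ (proj₁ (parity-a d) e , proj₂ (±1⇔ d _ (proj₁ (proj₂ (half-power d)))) c)
      from d (inj₂ (o , c)) = inj₂ (proj₂ (parity-a d) o , proj₂ (m±1⇔ d _ (proj₁ (proj₂ (half-power d)))) c)

      Fix′⇒∣ : ∀ d → Fix′ d → u ∣ℕ d ℕ.+ d
      Fix′⇒∣ d (inj₁ (_ , c)) = ±1⇒∣ d c
      Fix′⇒∣ d (inj₂ (_ , c)) = m±1⇒∣ d c

      transfer : ∀ {δ} → 1 ≤ δ → Fix′ δ → (∀ d → 1 ≤ d → d < δ → ¬ Fix′ d) → Exponent δ
      transfer {δ} 1≤δ f minimal = 1≤δ , from δ f , λ d 1≤d d<δ g → minimal d 1≤d d<δ (to d g)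

      half-case : ∀ {k} → u ≡ k ℕ.+ k → Fix′ k → Exponent k
      half-case {zero}  eq f = ⊥-elim (ℕₚ.<⇒≢ 1≤u (≡.sym eq))
      half-case {suc k} eq f = transfer (s≤s z≤n) f λ d 1≤d d<k g → below-half eq 1≤d d<k (Fix′⇒∣ d g)

      full-case : ∀ {k} → u ≡ k ℕ.+ k → ¬ Fix′ k → Exponent u
      full-case {k} eq ¬fix = transfer 1≤u (inj₁ ((k , eq) , inj₁ pow-u)) λ d 1≤d d<u f →
        ¬fix (≡.subst Fix′ (double-injective d k (≡.trans (∣double⇒half 1≤d d<u (Fix′⇒∣ d f)) eq)) f)

      -- Since m ≥ 3, both m - 1 and m + 1 lie strictly between 1 and 2 m, whereas p^u ≡ 1.
      1≁m±1 : ¬ m±1 u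
      1≁m±1 (inj₁ u~) = ℕₚ.<⇒≢ (ℕₚ.m<n+m 1 (ℕₚ.≤-trans (s≤s z≤n) 3≤m)) (~⇒≡ 1<M m+1<M (~-trans (~-sym pow-u) u~))
      1≁m±1 (inj₂ u~) = ℕₚ.<⇒≢ (ℕₚ.∸-monoˡ-≤ 1 3≤m) (~⇒≡ 1<M m∸1<M (~-trans (~-sym pow-u) u~))

      -- An admissible d has u ∣ 2 d, hence u ∣ d, which leaves only d = u below 2 u. But u is odd,
      -- and p^u ≡ 1 differs from m ± 1.
      odd-case : Odd u → Exponent (2 ℕ.* u)
      odd-case u-odd = transfer (ℕₚ.≤-trans 1≤u (ℕₚ.m≤m+n u (u ℕ.+ 0))) (inj₁ ((u , ≡.cong (u ℕ.+_) (ℕₚ.+-identityʳ u)) , inj₁ (pow-multiple 2)))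
        λ d 1≤d d<2u f → minimal d 1≤d d<2u f (odd-∣-double d u-odd (Fix′⇒∣ d f))
        where
        minimal : ∀ d → 1 ≤ d → d < 2 ℕ.* u → Fix′ d → ¬ (u ∣ℕ d)
        minimal d 1≤d d<2u f (ℕ∣.divides zero eq) = ℕₚ.<⇒≢ 1≤d (≡.sym eq)
        minimal d 1≤d d<2u (inj₁ (e , _)) (ℕ∣.divides (suc zero) eq) =
          even-odd-⊥ e (≡.subst Odd (≡.sym (≡.trans eq (ℕₚ.+-identityʳ u))) u-odd)
        minimal d 1≤d d<2u (inj₂ (_ , c)) (ℕ∣.divides (suc zero) eq) = 1≁m±1 (≡.subst m±1 (≡.trans eq (ℕₚ.+-identityʳ u)) c)
        minimal d 1≤d d<2u f (ℕ∣.divides (suc (suc q)) eq) = ℕₚ.<⇒≱ d<2u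
          (≡.subst (2 ℕ.* u ≤_) (≡.sym eq) (ℕₚ.*-monoˡ-≤ u {2} {suc (suc q)} (s≤s (s≤s z≤n))))

      p%4 : p % 4 ≡ 3
      p%4 = let k , h≡ = h-odd in rem-multiple 3 k 4 (≡.trans (≡.cong (λ h → suc (h ℕ.+ h)) h≡)
        (solve 1 (λ k → con 1 :+ ((con 1 :+ (k :+ k)) :+ (con 1 :+ (k :+ k))) := con 3 :+ k :* con 4) ≡.refl k)) ℕₚ.≤-refl
        where open Data.Nat.Solver.+-*-Solver

      p≢1 : (p % 4 ℕ.≡ᵇ 1) ≡ false
      p≢1 = ≡.cong (ℕ._≡ᵇ 1) p%4

      p≡3′ : (p % 4 ℕ.≡ᵇ 3) ≡ true
      p≡3′ = ≡.cong (ℕ._≡ᵇ 3) p%4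

      pick-0 : ∀ t → p≡1 t ≡ false → p≡3 t ≡ true → u4≡0 t ≡ true → r≡-1 t ≡ true → δ-of t ≡ u / 2
      pick-0 t a b c d rewrite a | b | c | d = ≡.refl

      pick-0-full : ∀ t → p≡1 t ≡ false → p≡3 t ≡ true → u4≡0 t ≡ true → u4≡2 t ≡ false → u2≡1 t ≡ false → r≡-1 t ≡ false → δ-of t ≡ u
      pick-0-full t a b c d e f rewrite a | b | c | d | e | f = ≡.refl

      pick-2 : ∀ t → p≡1 t ≡ false → p≡3 t ≡ true → u4≡0 t ≡ false → u4≡2 t ≡ true → (r≡m+1 t ≡ true) ⊎ (r≡m-1 t ≡ true) → δ-of t ≡ u / 2
      pick-2 t a b c d (inj₁ e) rewrite a | b | c | d | e = ≡.refl
      pick-2 t a b c d (inj₂ e) rewrite a | b | c | d | e with r≡m+1 t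
      ... | true  = ≡.refl
      ... | false = ≡.refl

      pick-2-full : ∀ t → p≡1 t ≡ false → p≡3 t ≡ true → u4≡0 t ≡ false → u4≡2 t ≡ true → u2≡1 t ≡ false → r≡m+1 t ≡ false → r≡m-1 t ≡ false → δ-of t ≡ u
      pick-2-full t a b c d e f g rewrite a | b | c | d | e | f | g = ≡.refl

      pick-odd : ∀ t → p≡1 t ≡ false → p≡3 t ≡ true → u4≡0 t ≡ false → u4≡2 t ≡ false → u2≡1 t ≡ true → δ-of t ≡ 2 ℕ.* u
      pick-odd t a b c d e rewrite a | b | c | d | e = ≡.refl

    exponent : Exponent (δ-iii p m u)
    exponent = by-parity (even-or-odd u)
      where
      open Data.Nat.Solver.+-*-Solver

      zero-mod-4 : ∀ j → u ≡ (j ℕ.+ j) ℕ.+ (j ℕ.+ j) → u % 4 ≡ 0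
      zero-mod-4 j eq = rem-multiple 0 j 4 (≡.trans eq (solve 1 (λ j → (j :+ j) :+ (j :+ j) := j :* con 4) ≡.refl j)) (s≤s z≤n)

      two-mod-4 : ∀ j → u ≡ suc (j ℕ.+ j) ℕ.+ suc (j ℕ.+ j) → u % 4 ≡ 2
      two-mod-4 j eq = rem-multiple 2 j 4 (≡.trans eq (solve 1 (λ j → (con 1 :+ (j :+ j)) :+ (con 1 :+ (j :+ j)) := con 2 :+ j :* con 4) ≡.refl j)) (s≤s (s≤s (s≤s z≤n)))

      not-1-mod-2 : Even u → (u % 2 ℕ.≡ᵇ 1) ≡ false
      not-1-mod-2 e = ≡.cong (ℕ._≡ᵇ 1) (even⇒%2 e)

      multiple-of-4 : ∀ k → u ≡ k ℕ.+ k → Even k → Dec (r ≡ M ℕ.∸ 1) → Exponent (δ-iii p m u)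
      multiple-of-4 k eq (j , k≡) (yes r≡) = resolve (≡.trans (pick-0 tests p≢1 p≡3′ (≡.cong (ℕ._≡ᵇ 0) (zero-mod-4 j (≡.trans eq (≡.cong (λ k → k ℕ.+ k) k≡)))) (≡ᵇ-true r≡)) (half/2 k eq))
        (half-case eq (inj₁ ((j , k≡) , inj₂ (pred~-1 (r≡⇒~ k eq r≡)))))
      multiple-of-4 k eq (j , k≡) (no r≢) = resolve
          (pick-0-full tests p≢1 p≡3′ (≡.cong (ℕ._≡ᵇ 0) u%4) (≡.cong (ℕ._≡ᵇ 2) u%4) (not-1-mod-2 (k , eq)) (≡ᵇ-false r≢))
        (full-case eq not-fixed)
        where
        u%4 : u % 4 ≡ 0
        u%4 = zero-mod-4 j (≡.trans eq (≡.cong (λ k → k ℕ.+ k) k≡))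
        not-fixed : ¬ Fix′ k
        not-fixed (inj₁ (_ , inj₁ k~1))  = not-1-below (1≤k k eq) (k<u k eq) k~1
          where
          1≤k : ∀ k → u ≡ k ℕ.+ k → 1 ≤ k
          1≤k zero    eq = ⊥-elim (ℕₚ.<⇒≢ 1≤u (≡.sym eq))
          1≤k (suc k) eq = s≤s z≤n
          k<u : ∀ k → u ≡ k ℕ.+ k → k < u
          k<u k eq = ≡.subst (k <_) (≡.sym eq) (ℕₚ.m<m+n k (1≤k k eq))
        not-fixed (inj₁ (_ , inj₂ k~-1)) = no-half (λ _ _ → r≢) k eq k~-1
        not-fixed (inj₂ (o , _))         = even-odd-⊥ (j , k≡) o

      twice-odd : ∀ k → u ≡ k ℕ.+ k → Odd k → Dec (r ≡ m ℕ.+ 1) → Dec (r ≡ m ℕ.∸ 1) → Exponent (δ-iii p m u)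
      twice-odd k eq (j , k≡) d₁ d₂ = by-residue d₁ d₂
        where
        u%4 : u % 4 ≡ 2
        u%4 = two-mod-4 j (≡.trans eq (≡.cong (λ k → k ℕ.+ k) k≡))
        half : (r ℕ.≡ᵇ m ℕ.+ 1) ≡ true ⊎ (r ℕ.≡ᵇ m ℕ.∸ 1) ≡ true → m±1 k → Exponent (δ-iii p m u)
        half s c = resolve (≡.trans (pick-2 tests p≢1 p≡3′ (≡.cong (ℕ._≡ᵇ 0) u%4) (≡.cong (ℕ._≡ᵇ 2) u%4) s) (half/2 k eq))
          (half-case eq (inj₂ ((j , k≡) , c)))
        by-residue : Dec (r ≡ m ℕ.+ 1) → Dec (r ≡ m ℕ.∸ 1) → Exponent (δ-iii p m u)
        by-residue (yes r≡) _        = half (inj₁ (≡ᵇ-true r≡)) (inj₁ (r≡⇒~ k eq r≡))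
        by-residue (no _)   (yes r≡) = half (inj₂ (≡ᵇ-true r≡)) (inj₂ (r≡⇒~ k eq r≡))
        by-residue (no r≢₁) (no r≢₂) = resolve
            (pick-2-full tests p≢1 p≡3′ (≡.cong (ℕ._≡ᵇ 0) u%4) (≡.cong (ℕ._≡ᵇ 2) u%4) (not-1-mod-2 (k , eq)) (≡ᵇ-false r≢₁) (≡ᵇ-false r≢₂))
          (full-case eq not-fixed)
          where
          not-fixed : ¬ Fix′ k
          not-fixed (inj₁ (e , _))       = even-odd-⊥ e (j , k≡)
          not-fixed (inj₂ (_ , inj₁ k~)) = r≢₁ (~⇒r≡ k eq m+1<M k~)
          not-fixed (inj₂ (_ , inj₂ k~)) = r≢₂ (~⇒r≡ k eq m∸1<M k~)

      not-even-mod-4 : Odd u → (u % 4 ≡ 1) ⊎ (u % 4 ≡ 3)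
      not-even-mod-4 (k , eq) = Data.Sum.map
        (λ { (j , k≡) → rem-multiple 1 j 4 (≡.trans eq (≡.trans (≡.cong (λ k → suc (k ℕ.+ k)) k≡) (solve 1 (λ j → con 1 :+ ((j :+ j) :+ (j :+ j)) := con 1 :+ j :* con 4) ≡.refl j))) (s≤s (s≤s z≤n)) })
        (λ { (j , k≡) → rem-multiple 3 j 4 (≡.trans eq (≡.trans (≡.cong (λ k → suc (k ℕ.+ k)) k≡) (solve 1 (λ j → con 1 :+ ((con 1 :+ (j :+ j)) :+ (con 1 :+ (j :+ j))) := con 3 :+ j :* con 4) ≡.refl j))) ℕₚ.≤-refl })
        (even-or-odd k)

      by-parity : Even u ⊎ Odd u → Exponent (δ-iii p m u)
      by-parity (inj₁ (k , eq)) = Data.Sum.[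
          (λ k-even → multiple-of-4 k eq k-even (r ℕ.≟ M ℕ.∸ 1))
        , (λ k-odd → twice-odd k eq k-odd (r ℕ.≟ m ℕ.+ 1) (r ℕ.≟ m ℕ.∸ 1)) ]′ (even-or-odd k)
      by-parity (inj₂ u-odd) = resolve
          (pick-odd tests p≢1 p≡3′
            (Data.Sum.[ (λ q → ≡.cong (ℕ._≡ᵇ 0) q) , (λ q → ≡.cong (ℕ._≡ᵇ 0) q) ]′ (not-even-mod-4 u-odd))
            (Data.Sum.[ (λ q → ≡.cong (ℕ._≡ᵇ 2) q) , (λ q → ≡.cong (ℕ._≡ᵇ 2) q) ]′ (not-even-mod-4 u-odd))
            (≡.cong (ℕ._≡ᵇ 1) (odd⇒%2 u-odd)))
        (odd-case u-odd)

  δ-iii-exponent : Exponent (δ-iii p m u)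
  δ-iii-exponent = Data.Sum.[ One.exponent , Three.exponent ]′ (even-or-odd h)

-- The theorem

module Assembly {p : ℕ} (𝔽 : PrimeFieldData p) where
  open PrimeFieldData 𝔽
  private module R = RingKit R
  open Factorization 𝔻
  open PrimeProducts 𝔻 gauss
  open PrimitiveParts R
  open PrimeField 𝔽
  open PartDegree 𝔻
  open CharPSystem 𝔻 p-prime char-p
  private module P = RingKit polyRing
  open P using (_^_; solve; _:=_; _:*_; con; begin_; step-≈-⟩; step-≈-⟨; step-≡-⟩; step-≡-⟨; _∎)
  open Algebra.Properties.CommutativeSemiring.Exp P.commutativeSemiring using (^-distrib-*)

  ^P≡^ : ∀ f n → f ^P n ≡ f ^ n
  ^P≡^ f zero    = ≡.refl
  ^P≡^ f (suc n) = ≡.cong (f *P_) (^P≡^ f n)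

  factor-degree : ∀ {g} (gi : MonicIrr g) δ → 1 ≤ δ → g ∣ (X ^ (p ℕ.^ δ)) P.- X →
    (∀ d → 1 ≤ d → d < δ → ¬ (g ∣ (X ^ (p ℕ.^ d)) P.- X)) → suc (deg gi) ≡ δ
  factor-degree {g} gi δ 1≤δ fixed minimal = residue-degree δ 1≤δ
      (≡.subst (_~ X) (≡.sym (^-quotient X (p ℕ.^ δ))) (congruent fixed))
      λ d 1≤d d<δ fx → minimal d 1≤d d<δ (difference (≡.subst (_~ X) (^-quotient X (p ℕ.^ d)) fx))
    where open ResidueField gi

  private
    one^ : ∀ n → oneP ^ n ≋ oneP
    one^ zero    = ≋-refl
    one^ (suc n) = ≋-trans (*P-identityˡ (oneP ^ n)) (one^ n)

  prodP-^ : ∀ k E L → prodP (map (_^ k) L) ^ E ≋ prodP (map (λ g → g ^P (k ℕ.* E)) L)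
  prodP-^ k E []      = one^ E
  prodP-^ k E (g ∷ L) = ≋-trans (^-distrib-* (g ^ k) (prodP (map (_^ k) L)) E)
    (*P-cong (≋-trans (P.^-assocʳ g k E) (P.reflexive (≡.sym (^P≡^ g (k ℕ.* E))))) (prodP-^ k E L))

  prodP-degree : ∀ k δ L → All (λ g → MonicDeg g δ × Irr g) L → MonicDeg (prodP (map (_^ k) L)) (length L ℕ.* (k ℕ.* δ))
  prodP-degree k δ []      []             = monic-one
  prodP-degree k δ (g ∷ L) ((m , _) ∷ ms) = monic-* (monic-^ m k) (prodP-degree k δ L ms)

  φ₁≡φ : ∀ n → 2 ≤ n → φ₁ n ≡ φ n
  φ₁≡φ (suc zero)    (s≤s ())
  φ₁≡φ (suc (suc n)) _ = ≡.refl

  module _ {N : ℕ} (S : System N) where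
    open System S

    -- The number of factors comes from comparing degrees: each contributes (e+1) δ to the degree
    -- φ(m) of `part m`.
    factorization : ∀ {m} → 2 ≤ m → m ≤ N → ∀ e δ E →
      (∀ g → MonicIrr g → g ∣ part m → (g ^ suc e ∣ part m) × ¬ (g ^ suc (suc e) ∣ part m)) →
      (∀ g (gi : MonicIrr g) → g ∣ part m → suc (deg gi) ≡ δ) →
      Σ (List Pol) λ L → (length L ℕ.* (suc e ℕ.* δ) ≡ φ m) × All (λ g → MonicDeg g δ × Irr g) L × DistinctP L ×
        (part m ^ E ≋ prodP (map (λ g → g ^P (suc e ℕ.* E)) L))
    factorization {m} 2≤m m≤N e δ E multiplicity degrees =
      let part-deg = part-degree S m (ℕₚ.<⇒≤ 2≤m) m≤N
          L , factors , distinct , part≋ = powers-of-irreducibles irr-factor _ e (part m) part-deg ℕₚ.≤-refl multiplicity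
          irreducibles = All.map (λ {g} (gi , g∣) → ≡.subst (MonicDeg g) (degrees g gi g∣) (monic gi) , irreducible gi) factors
      in  L , ≡.trans (monic-unique (monic-resp (≋-sym part≋) (prodP-degree (suc e) δ L irreducibles)) part-deg) (φ₁≡φ m 2≤m)
            , irreducibles , distinct , ≋-trans (P.^-congˡ E part≋) (prodP-^ (suc e) E L)

    part-reduction : ∀ k {m} → 2 ≤ m → ¬ (p ∣ℕ m) → p ℕ.^ k ℕ.* m ≤ N → part (p ℕ.^ k ℕ.* m) ≋ part m ^ φ (p ℕ.^ k)
    -- The exponent φ(p^0) computes to 1.
    part-reduction zero    {m} 2≤m p∤m ≤N = ≋-trans (P.reflexive (≡.cong part (ℕₚ.*-identityˡ m))) (≋-sym (P.*-identityʳ (part m)))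
    part-reduction (suc k) {m} 2≤m p∤m ≤N = ≋-trans (part-prime-power-multiple-≥2 S k m 2≤m p∤m ≤N)
      (P.^-congʳ (part m) (≡.sym (φ-prime-power p-prime k)))

    fib-2≋X : fib 2 ≋ X
    fib-2≋X = ≋-trans (+P-identityʳ (X *P oneP)) (P.*-identityʳ X)

    part-2≋X : 2 ≤ N → part 2 ≋ X
    part-2≋X 2≤N = begin
      part 2 ≈⟨ P.*-identityʳ (part 2) ⟨
      part 2 *P oneP ≈⟨ *P-congˡ (part 2) (≋-trans (P.*-identityʳ (part 1)) (part-1 S (ℕₚ.<⇒≤ 2≤N))) ⟨
      part 2 *P (part 1 *P oneP) ≈⟨ product 2 (s≤s z≤n) 2≤N ⟨
      fib 2 ≈⟨ fib-2≋X ⟩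
      X ∎

    part-prime-power-odd : ∀ k h → p ≡ suc (2 ℕ.* h) → p ℕ.^ suc k ≤ N →
      part (p ℕ.^ suc k ℕ.* 1) ≋ disc ^ (φ (p ℕ.^ suc k) / 2)
    part-prime-power-odd k h p≡ ≤N = begin
      part (p ℕ.^ suc k ℕ.* 1) ≈⟨ part-prime-power S k ≤N ⟩
      fib p ^ (p ℕ.^ k) ≈⟨ P.^-congˡ (p ℕ.^ k) (fib-p h p≡) ⟩
      (disc ^ h) ^ (p ℕ.^ k) ≈⟨ P.^-assocʳ disc h (p ℕ.^ k) ⟩
      disc ^ (h ℕ.* p ℕ.^ k) ≡⟨ ≡.cong (disc ^_) (≡.trans (≡.cong (_/ 2) φ≡) (m*n/n≡m (h ℕ.* p ℕ.^ k) 2)) ⟨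
      disc ^ (φ (p ℕ.^ suc k) / 2) ∎
      where
      open Data.Nat.Solver.+-*-Solver using () renaming (solve to ℕ-solve; _:*_ to _⊗_; _:=_ to _⊜_; con to num)
      φ≡ : φ (p ℕ.^ suc k) ≡ h ℕ.* p ℕ.^ k ℕ.* 2
      φ≡ = ≡.trans (φ-prime-power p-prime k) (≡.trans (≡.cong (λ q → p ℕ.^ k ℕ.* ℕ.pred q) p≡)
        (ℕ-solve 2 (λ q h → q ⊗ (num 2 ⊗ h) ⊜ h ⊗ q ⊗ num 2) ≡.refl (p ℕ.^ k) h))

    disc≋X² : p ≡ 2 → disc ≋ X *P X
    disc≋X² ≡.refl = ≋-trans (+P-cong {X *P X} ≋-refl (≋-trans (solve 0 (con (+ 4) := con (+ 2) :* con (+ 2)) ≋-refl)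
      (*P-zeroˡ (P.ν 2) (≋-trans (≋-sym (const-ν 2)) (≋-trans (const-cong char-p) const-0))))) (+P-identityʳ (X *P X))

    part-power-of-2 : ∀ k → p ≡ 2 → p ℕ.^ suc k ≤ N → part (p ℕ.^ suc k ℕ.* 1) ≋ X ^ (2 ℕ.^ k)
    part-power-of-2 k ≡.refl ≤N = ≋-trans (part-prime-power S k ≤N) (P.^-congˡ (2 ℕ.^ k) fib-2≋X)

    -- In characteristic 2, x² + 4 = x², and F_2 = x supplies x^(2^(k+1)) = (x²)^(2^k).
    part-power-of-2-disc : ∀ k → p ≡ 2 → p ℕ.^ suc (suc k) ≤ N →
      part (p ℕ.^ suc (suc k) ℕ.* 1) ≋ disc ^ (φ (p ℕ.^ suc (suc k)) / 2)
    part-power-of-2-disc k p≡2@≡.refl ≤N = begin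
      part (p ℕ.^ suc (suc k) ℕ.* 1) ≈⟨ part-power-of-2 (suc k) p≡2 ≤N ⟩
      X ^ (2 ℕ.* 2 ℕ.^ k) ≈⟨ P.^-assocʳ X 2 (2 ℕ.^ k) ⟨
      (X ^ 2) ^ (2 ℕ.^ k) ≈⟨ P.^-congˡ (2 ℕ.^ k) (≋-trans (*P-congˡ X (P.*-identityʳ X)) (≋-sym (disc≋X² p≡2))) ⟩
      disc ^ (2 ℕ.^ k) ≡⟨ ≡.cong (disc ^_) (≡.trans (≡.cong (_/ 2) φ≡) (m*n/n≡m (2 ℕ.^ k) 2)) ⟨
      disc ^ (φ (p ℕ.^ suc (suc k)) / 2) ∎
      where
      φ≡ : φ (2 ℕ.^ suc (suc k)) ≡ 2 ℕ.^ k ℕ.* 2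
      φ≡ = ≡.trans (φ-prime-power p-prime (suc k)) (≡.trans (ℕₚ.*-identityʳ (2 ℕ.^ suc k)) (ℕₚ.*-comm 2 (2 ℕ.^ k)))

    module _ {m : ℕ} (3≤m : 3 ≤ m) (m≤N : m ≤ N) (p∤m : ¬ (p ∣ℕ m)) where
      open FactorDegrees 𝔽 S m 3≤m m≤N p∤m

      factorization-odd : ∀ h u → p ≡ suc (h ℕ.+ h) → ¬ (p ∣ℕ 4) → IsOrder p (2 ℕ.* m) u → ∀ E →
        Σ (List Pol) λ L → (length L ℕ.* (1 ℕ.* δ-iii p m u) ≡ φ m) × All (λ g → MonicDeg g (δ-iii p m u) × Irr g) L ×
          DistinctP L × (part m ^ E ≋ prodP (map (λ g → g ^P (1 ℕ.* E)) L))
      factorization-odd h u ≡.refl p∤4 order E = factorization (ℕₚ.<⇒≤ 3≤m) m≤N 0 (δ-iii p m u) E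
          (λ g gi g∣ → multiplicity-one gi g∣) degrees
        where
        open OddPrime p∤4
        open DegreeIII m u h 3≤m order
        open OddPower {h}
        degrees : ∀ g (gi : MonicIrr g) → g ∣ part m → suc (deg gi) ≡ δ-iii p m u
        degrees g gi g∣ =
          let 1≤δ , fix , minimal = δ-iii-exponent
              power = λ d → proj₁ (proj₂ (half-power d))
          in  factor-degree gi (δ-iii p m u) 1≤δ (cond⇒fixed gi g∣ (δ-iii p m u) _ (power (δ-iii p m u)) fix)
                λ d 1≤d d<δ fx → minimal d 1≤d d<δ (fixed⇒cond gi g∣ d _ (power d) fx)

      factorization-2 : ∀ c u → p ≡ 2 → m ≡ suc (c ℕ.+ c) → IsOrder 2 m u → ∀ E →
        Σ (List Pol) λ L → (length L ℕ.* (2 ℕ.* δ-iv m u) ≡ φ m) × All (λ g → MonicDeg g (δ-iv m u) × Irr g) L ×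
          DistinctP L × (part m ^ E ≋ prodP (map (λ g → g ^P (2 ℕ.* E)) L))
      factorization-2 c u p≡2@≡.refl m≡ order E = factorization (ℕₚ.<⇒≤ 3≤m) m≤N 1 (δ-iv m u) E
          (λ g gi g∣ → multiplicity-two gi g∣) degrees
        where
        open EvenPrime p≡2 c m≡
        degrees : ∀ g (gi : MonicIrr g) → g ∣ part m → suc (deg gi) ≡ δ-iv m u
        degrees g gi g∣ =
          let 1≤δ , transfer = δ-iv-degree m u 3≤m order
              fixed , minimal = transfer {Fixed g} (fixed⇒rank gi g∣) (rank⇒fixed gi g∣)
          in  factor-degree gi (δ-iv m u) 1≤δ fixed minimal

div-unique : ∀ {q d n} → q ℕ.* d ≡ n → 1 ≤ d → n div d ≡ q
div-unique {q} {suc d} ≡.refl _ = m*n/n≡m q (suc d)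

coprime⇒prime∤ : ∀ {p m} → Prime p → Coprime p m → ¬ (p ∣ℕ m)
coprime⇒prime∤ p-prime c p∣m = ℕ.nonTrivial⇒≢1 {{prime⇒nonTrivial p-prime}} (c (ℕ∣.∣-refl , p∣m))

odd-prime : ∀ {p} → Prime p → p ≢ 2 → Odd p
odd-prime {p} p-prime p≢2 with even-or-odd p
... | inj₂ o          = o
... | inj₁ (b , p≡) with prime⇒irreducible p-prime (ℕ∣.divides b (≡.trans p≡ (≡.sym (double b))))
...   | inj₂ 2≡p = ⊥-elim (p≢2 (≡.sym 2≡p))

odd-prime∤4 : ∀ {p} → Prime p → 3 ≤ p → ¬ (p ∣ℕ 4)
odd-prime∤4 p-prime 3≤p p∣4 = Data.Sum.[ too-large , too-large ]′ (euclidsLemma 2 2 p-prime p∣4)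
  where
  too-large : ¬ (_ ∣ℕ 2)
  too-large p∣2 = ℕₚ.<⇒≱ 3≤p (ℕ∣.∣⇒≤ p∣2)

coprime-2⇒odd : ∀ {m} → Coprime 2 m → Odd m
coprime-2⇒odd {m} c with even-or-odd m
... | inj₂ o        = o
... | inj₁ (b , m≡) with () ← c {2} (ℕ∣.∣-refl , ℕ∣.divides b (≡.trans m≡ (≡.sym (double b))))

-- `Frozen` names the polynomials of the statement, whose equality is divisibility of integers by p,
-- while the proof works over the quotient ring. Both use the same coefficient lists, so the
-- conversions only exchange the equalities.
module ReductionModP {p : ℕ} (p-prime : Prime p) where
  open ModP p-prime
  open F
  private
    module Frozen = PZp p
    module Same = ChangeEquality (λ a b → (+ p) ℤ∣.∣ (a ℤ.- b)) Zp._≈_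
    module SP = SystemModP p-prime
    module P = RingKit polyRing

  ≈-to-frozen : ∀ {a b} → a Zp.≈ b → (+ p) ℤ∣.∣ (a ℤ.- b)
  ≈-to-frozen {a} {b} eq = ∣⇒∣ᵤ p (a ℤ.- b) (ZQ.difference eq)

  ≈-from-frozen : ∀ {a b} → (+ p) ℤ∣.∣ (a ℤ.- b) → a Zp.≈ b
  ≈-from-frozen {a} {b} p∣ = ZQ.congruent (∣ᵤ⇒∣ p (a ℤ.- b) p∣)

  to-frozen : ∀ {f g} → f ≋ g → f Frozen.≈P g
  to-frozen {f} {g} eq i = ≈-to-frozen (≡.subst₂ Zp._≈_ (≡.sym (Same.coeff-same f i)) (≡.sym (Same.coeff-same g i)) (coeff-≈ eq i))

  from-frozen : ∀ {f g} → f Frozen.≈P g → f ≋ g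
  from-frozen {f} {g} eq = coeffwise λ i → ≡.subst₂ Zp._≈_ (Same.coeff-same f i) (Same.coeff-same g i) (≈-from-frozen (eq i))

  degLT-to-frozen : ∀ {f d} → DegLT f (suc d) → ∀ i → d < i → (+ p) ℤ∣.∣ (Frozen.coeff f i ℤ.- + 0)
  degLT-to-frozen {f} l i d<i = ≈-to-frozen (≡.subst (Zp._≈ + 0) (≡.sym (Same.coeff-same f i)) (above l i d<i))

  monic-to-frozen : ∀ {f d} → MonicDeg f d → Frozen.Monic f × Frozen.HasDegree f d
  monic-to-frozen {f} {d} (c , l) =
      (d , lead , degLT-to-frozen l)
    , (λ z → 1≉0 (Zp.trans (Zp.sym c) (≡.subst (Zp._≈ + 0) (Same.coeff-same f d) (≈-from-frozen {Frozen.coeff f d} {+ 0} z)))) , degLT-to-frozen l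
    where
    lead : (+ p) ℤ∣.∣ (Frozen.coeff f d ℤ.- + 1)
    lead = ≈-to-frozen (≡.subst (Zp._≈ + 1) (≡.sym (Same.coeff-same f d)) c)

  unit-to-frozen : ∀ {f} → Unit f → Frozen.IsUnit f
  unit-to-frozen {f} (Divisibility.divides v eq) = v , to-frozen (≡.subst (_≋ oneP) (≡.sym (Same.*P-same f v)) (≋-sym eq))

  unit-from-frozen : ∀ {f} → Frozen.IsUnit f → Unit f
  unit-from-frozen {f} (v , eq) = Divisibility.divides v (≋-sym (≡.subst (_≋ oneP) (Same.*P-same f v) (from-frozen eq)))

  irr-to-frozen : ∀ {g} → Irr g → Frozen.Irreducible g
  irr-to-frozen {g} i = (λ z → nonzero i (from-frozen z)) , (λ u → nonunit i (unit-from-frozen u))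
    , λ a b g≈ → Data.Sum.map unit-to-frozen unit-to-frozen
        (split i a b (≡.subst (g ≋_) (Same.*P-same a b) (from-frozen g≈)))

  ∈P-from-frozen : ∀ {g} L → g Frozen.∈P L → g ∈P L
  ∈P-from-frozen {g} (h ∷ L) (inj₁ eq) = inj₁ (coeff-≈ (from-frozen {g} {h} eq))
  ∈P-from-frozen {g} (h ∷ L) (inj₂ g∈) = inj₂ (∈P-from-frozen L g∈)

  distinct-to-frozen : ∀ L → DistinctP L → Frozen.DistinctP L
  distinct-to-frozen []      _        = _
  distinct-to-frozen (h ∷ L) (d , ds) = (λ g g∈ eq → d g (∈P-from-frozen L g∈) (coeff-≈ (from-frozen {h} {g} eq))) , distinct-to-frozen L ds

  product-to-frozen : ∀ e L → prodP (map (λ g → g ^P e) L) ≡ Frozen.prodP (map (λ g → g Frozen.^P e) L)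
  product-to-frozen e []      = ≡.refl
  product-to-frozen e (g ∷ L) = ≡.trans (≡.sym (Same.*P-same (g ^P e) _))
    (≡.cong₂ Frozen._*P_ (≡.sym (Same.^P-same g e)) (product-to-frozen e L))

  ^-to-frozen : ∀ Ψ f n → Ψ ≋ f P.^ n → Ψ Frozen.≈P (f Frozen.^P n)
  ^-to-frozen Ψ f n eq = to-frozen (≡.subst (Ψ ≋_) (≡.trans (power n) (≡.sym (Same.^P-same f n))) eq)
    where
    power : ∀ n → f P.^ n ≡ f ^P n
    power zero    = ≡.refl
    power (suc n) = ≡.cong (f *P_) (power n)

  factors-to-frozen : ∀ Ψ f c d E e → Ψ ≋ f P.^ E →
    (Σ (List Pol) λ L → (length L ≡ c) × All (λ g → MonicDeg g d × Irr g) L × DistinctP L × (f P.^ E ≋ prodP (map (λ g → g ^P e) L))) →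
    FactorsModAs p Ψ c d e
  factors-to-frozen Ψ f c d E e Ψ≋ (L , len , irrs , distinct , f≋) = L , len
    , All.map (λ { (m , i) → proj₁ (monic-to-frozen m) , irr-to-frozen i , proj₂ (monic-to-frozen m) }) irrs
    , distinct-to-frozen L distinct
    , to-frozen (≡.subst (Ψ ≋_) (product-to-frozen e L) (≋-trans Ψ≋ f≋))

  residue : ∀ a → Σ ℕ λ r → r < p × (a Zp.≈ Zp.ν r)
  residue a = a ℤ÷.%ℕ p , ℤ÷.n%ℕd<d a p , ≡.subst (a Zp.≈_) (≡.sym (ν-p _)) (ZQ.congruent (ℤ-Div.divides (a ℤ÷./ℕ p) (begin
    a ℤ.- + (a ℤ÷.%ℕ p)
      ≡⟨ ≡.cong (λ z → z ℤ.- + (a ℤ÷.%ℕ p)) (ℤ÷.a≡a%ℕn+[a/ℕn]*n a p) ⟩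
    (+ (a ℤ÷.%ℕ p) ℤ.+ (a ℤ÷./ℕ p) ℤ.* + p) ℤ.- + (a ℤ÷.%ℕ p)
      ≡⟨ ℤR.solve 3 (λ r q p → (r ℤR.:+ q ℤR.:* p) ℤR.:- r ℤR.:= p ℤR.:* q) ≡.refl (+ (a ℤ÷.%ℕ p)) (a ℤ÷./ℕ p) (+ p) ⟩
    + p ℤ.* (a ℤ÷./ℕ p) ∎)))
    where
    open ≡.≡-Reasoning
    instance nonzero-p = prime⇒nonZero p-prime

  ν-injective : ∀ r s → r < p → s < p → Zp.ν r Zp.≈ Zp.ν s → r ≡ s
  ν-injective r s r<p s<p eq = Congruence.~⇒≡ p (ℕ.nonTrivial⇒n>1 p {{prime⇒nonTrivial p-prime}}) r<p s<p
    (≡.subst₂ Zp._≈_ (ν-p r) (ν-p s) eq)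

  primeField : PrimeFieldData p
  primeField = record
    { 𝔻 = domain ; gauss = gauss ; p-prime = p-prime ; char-p = char-p
    ; residue = residue ; ν-injective = ν-injective ; ν-nonzero = λ {n} → ν-nonzero {n} }

  open Assembly primeField public

  module _ {n : ℕ} (Ψ : ZPol) (1≤n : 1 ≤ n) (fibotomic : IsFibotomic n Ψ) where
    system : PrimitiveParts.System ℤ/p n
    system = SP.reduce-system (ℤ-Fibotomic.ℤ-system n)

    Ψ≋part : Ψ ≋ PrimitiveParts.System.part system n
    Ψ≋part = ℤ-Poly.Reduction.reduce p-prime (ℤ-Fibotomic.fibotomic≋part {n} {Ψ} 1≤n fibotomic)

module _ {p : ℕ} (p-prime : Prime p) (k : ℕ) {m : ℕ} (1≤m : 1 ≤ m) (Ψ : ZPol) (fibotomic : IsFibotomic (p ℕ.^ k ℕ.* m) Ψ) where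
  open ReductionModP p-prime
  open ModP p-prime using (module F; ℤ/p)
  open F using (_≋_; ≋-trans)
  private
    module P = RingKit F.polyRing

    1≤n : 1 ≤ p ℕ.^ k ℕ.* m
    1≤n = ℕₚ.*-mono-≤ (prime-power≥1 p-prime k) 1≤m

    m≤n : m ≤ p ℕ.^ k ℕ.* m
    m≤n = ℕₚ.m≤n*m m (p ℕ.^ k) {{ℕ.>-nonZero (prime-power≥1 p-prime k)}}

    S : PrimitiveParts.System ℤ/p (p ℕ.^ k ℕ.* m)
    S = system Ψ 1≤n fibotomic

    open PrimitiveParts.System S using (part)

    Ψ≋part^φ : 2 ≤ m → Coprime p m → Ψ ≋ part m P.^ φ (p ℕ.^ k)
    Ψ≋part^φ 2≤m c = ≋-trans (Ψ≋part Ψ 1≤n fibotomic) (part-reduction S k 2≤m (coprime⇒prime∤ p-prime c) ℕₚ.≤-refl)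

    disc≋ : PrimitiveParts.disc ℤ/p ≋ (+ 4 ∷ + 0 ∷ + 1 ∷ [])
    disc≋ = F.coeffwise λ where
      zero                → ModP.Zp.refl p-prime
      (suc zero)          → ModP.Zp.refl p-prime
      (suc (suc zero))    → ModP.Zp.refl p-prime
      (suc (suc (suc i))) → ModP.Zp.refl p-prime

  m≡1-odd : ∀ k′ → k ≡ suc k′ → m ≡ 1 → p ≢ 2 → PZp._≈P_ p Ψ (PZp._^P_ p (+ 4 ∷ + 0 ∷ + 1 ∷ []) (φ (p ℕ.^ k) / 2))
  m≡1-odd k′ ≡.refl ≡.refl p≢2 =
    let h , p≡ = odd-prime p-prime p≢2
    in  ^-to-frozen Ψ (+ 4 ∷ + 0 ∷ + 1 ∷ []) (φ (p ℕ.^ k) / 2) (≋-trans (Ψ≋part Ψ 1≤n fibotomic) (≋-trans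
          (part-prime-power-odd S k′ h (≡.trans p≡ (≡.cong (λ x → suc (h ℕ.+ x)) (≡.sym (ℕₚ.+-identityʳ h)))) (ℕₚ.≤-reflexive (≡.sym (ℕₚ.*-identityʳ _))))
          (P.^-congˡ (φ (p ℕ.^ k) / 2) disc≋)))

  m≡1-two : ∀ k′ → k ≡ suc (suc k′) → m ≡ 1 → p ≡ 2 → PZp._≈P_ p Ψ (PZp._^P_ p (+ 4 ∷ + 0 ∷ + 1 ∷ []) (φ (p ℕ.^ k) / 2))
  m≡1-two k′ ≡.refl ≡.refl p≡2 = ^-to-frozen Ψ (+ 4 ∷ + 0 ∷ + 1 ∷ []) (φ (p ℕ.^ k) / 2) (≋-trans (Ψ≋part Ψ 1≤n fibotomic) (≋-trans
    (part-power-of-2-disc S k′ p≡2 (ℕₚ.≤-reflexive (≡.sym (ℕₚ.*-identityʳ _))))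
    (P.^-congˡ (φ (p ℕ.^ k) / 2) disc≋)))

  m≡1-k≡1 : m ≡ 1 → p ≡ 2 → k ≡ 1 → PZp._≈P_ p Ψ (PZp.X p)
  m≡1-k≡1 ≡.refl p≡2 ≡.refl = to-frozen {Ψ} {F.X} (≋-trans (Ψ≋part Ψ 1≤n fibotomic) (≋-trans
    (part-power-of-2 S 0 p≡2 (ℕₚ.≤-reflexive (≡.sym (ℕₚ.*-identityʳ _)))) (P.*-identityʳ F.X)))

  m≡2 : m ≡ 2 → Coprime p m → PZp._≈P_ p Ψ (PZp._^P_ p (PZp.X p) (φ (p ℕ.^ k)))
  m≡2 ≡.refl c = ^-to-frozen Ψ F.X (φ (p ℕ.^ k)) (≋-trans (Ψ≋part^φ ℕₚ.≤-refl c) (P.^-congˡ (φ (p ℕ.^ k)) (part-2≋X S m≤n)))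

  m≥3-odd : Coprime p m → 3 ≤ m → 3 ≤ p → ∀ u → IsOrder p (2 ℕ.* m) u →
    FactorsModAs p Ψ (φ m div δ-iii p m u) (δ-iii p m u) (φ (p ℕ.^ k))
  m≥3-odd c 3≤m 3≤p u order =
    let h , p≡ = odd-prime p-prime (λ p≡2 → ℕₚ.<⇒≢ 3≤p (≡.sym p≡2))
        L , count , factors , distinct , part≋ =
          factorization-odd S 3≤m m≤n (coprime⇒prime∤ p-prime c) h u p≡ (odd-prime∤4 p-prime 3≤p) order (φ (p ℕ.^ k))
    in  factors-to-frozen Ψ (part m) (φ m div δ-iii p m u) (δ-iii p m u) (φ (p ℕ.^ k)) (φ (p ℕ.^ k)) (Ψ≋part^φ (ℕₚ.<⇒≤ 3≤m) c)
          ( L , ≡.sym (div-unique (≡.trans (≡.cong (length L ℕ.*_) (≡.sym (ℕₚ.*-identityˡ _))) count) (1≤δ h p≡ order))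
          , factors , distinct
          , ≡.subst (λ e → part m P.^ φ (p ℕ.^ k) ≋ F.prodP (map (λ g → g F.^P e) L)) (ℕₚ.*-identityˡ (φ (p ℕ.^ k))) part≋ )
    where
    1≤δ : ∀ {p} h → p ≡ suc (h ℕ.+ h) → IsOrder p (2 ℕ.* m) u → 1 ≤ δ-iii p m u
    1≤δ h ≡.refl order = proj₁ (DegreeIII.δ-iii-exponent m u h 3≤m order)

m≥3-two : (p-prime : Prime 2) → ∀ k {m} Ψ → IsFibotomic (2 ℕ.^ k ℕ.* m) Ψ → Coprime 2 m → 3 ≤ m → ∀ u → IsOrder 2 m u →
  FactorsModAs 2 Ψ (φ m div (2 ℕ.* δ-iv m u)) (δ-iv m u) (2 ℕ.* φ (2 ℕ.^ k))
m≥3-two p-prime k {m} Ψ fibotomic c 3≤m u order =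
  let b , m≡ = coprime-2⇒odd c
      L , count , factors , distinct , part≋ =
        factorization-2 S 3≤m m≤n (coprime⇒prime∤ p-prime c) b u ≡.refl m≡ order (φ (2 ℕ.^ k))
  in  factors-to-frozen Ψ (PrimitiveParts.System.part S m) (φ m div (2 ℕ.* δ-iv m u)) (δ-iv m u) (φ (2 ℕ.^ k)) (2 ℕ.* φ (2 ℕ.^ k)) (≋-trans (Ψ≋part Ψ 1≤n fibotomic) (part-reduction S k (ℕₚ.<⇒≤ 3≤m) (coprime⇒prime∤ p-prime c) ℕₚ.≤-refl))
        ( L , ≡.sym (div-unique count (ℕₚ.≤-trans (proj₁ (δ-iv-degree m u 3≤m order)) (ℕₚ.m≤m+n _ _)))
        , factors , distinct , part≋ )
  where
  open ReductionModP p-prime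
  open ModP.F p-prime using (≋-trans)
  1≤n : 1 ≤ 2 ℕ.^ k ℕ.* m
  1≤n = ℕₚ.*-mono-≤ (prime-power≥1 p-prime k) (ℕₚ.≤-trans (s≤s z≤n) 3≤m)
  m≤n : m ≤ 2 ℕ.^ k ℕ.* m
  m≤n = ℕₚ.m≤n*m m (2 ℕ.^ k) {{ℕ.>-nonZero (prime-power≥1 p-prime k)}}
  S = system Ψ 1≤n fibotomic

open import Data.Nat using (_*_; _^_)

theorem5p8 : (p m k : ℕ) → Prime p → 1 ≤ m → Coprime p m →
    (Ψ : ZPol) → IsFibotomic (p ^ k * m) Ψ →
    -- (i) m = 1, k ≥ 1 (p odd or k ≥ 2, so that φ(p^k) is even)
      (m ≡ 1 → 1 ≤ k → (¬ p ≡ 2 ⊎ 2 ≤ k) →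
        PZp._≈P_ p Ψ (PZp._^P_ p (+ 4 ∷ + 0 ∷ + 1 ∷ []) (φ (p ^ k) / 2)))
    -- (i) m = 1, p = 2, k = 1: (x^2+4)^(1/2) ≡ (x^2)^(1/2) = x in ℤ_2[x]
    × (m ≡ 1 → p ≡ 2 → k ≡ 1 → PZp._≈P_ p Ψ (PZp.X p))
    -- (ii) m = 2
    × (m ≡ 2 → PZp._≈P_ p Ψ (PZp._^P_ p (PZp.X p) (φ (p ^ k))))
    -- (iii) m ≥ 3, p > 2, u = order of p modulo 2m
    × (3 ≤ m → 3 ≤ p → (u : ℕ) → IsOrder p (2 * m) u →
        FactorsModAs p Ψ (φ m div δ-iii p m u) (δ-iii p m u) (φ (p ^ k)))
    -- (iv) m ≥ 3, p = 2, u' = order of 2 modulo m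
    × (3 ≤ m → p ≡ 2 → (u' : ℕ) → IsOrder 2 m u' →
        FactorsModAs 2 Ψ (φ m div (2 * δ-iv m u')) (δ-iv m u') (2 * φ (2 ^ k)))
theorem5p8 p m k p-prime 1≤m c Ψ fibotomic =
    part-i k ≡.refl (p ℕ.≟ 2)
  , m≡1-k≡1 p-prime k 1≤m Ψ fibotomic
  , (λ m≡ → m≡2 p-prime k 1≤m Ψ fibotomic m≡ c)
  , m≥3-odd p-prime k 1≤m Ψ fibotomic c
  , (λ { 3≤m ≡.refl → m≥3-two p-prime k Ψ fibotomic c 3≤m })
  where
  -- The exponent `k` stays a variable with an equation to its shape `k′`, because the type of
  -- `fibotomic` mentions it.
  part-i : ∀ k′ → k ≡ k′ → Dec (p ≡ 2) → m ≡ 1 → 1 ≤ k → (¬ p ≡ 2 ⊎ 2 ≤ k) →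
    PZp._≈P_ p Ψ (PZp._^P_ p (+ 4 ∷ + 0 ∷ + 1 ∷ []) (φ (p ^ k) / 2))
  part-i zero           k≡ _         _  1≤k _          = ⊥-elim (ℕₚ.<⇒≢ 1≤k (≡.sym k≡))
  part-i (suc k′)       k≡ (no p≢2)  m≡ _   _          = m≡1-odd p-prime k 1≤m Ψ fibotomic k′ k≡ m≡ p≢2
  part-i (suc zero)     k≡ (yes p≡2) _  _   (inj₁ p≢2) = ⊥-elim (p≢2 p≡2)
  part-i (suc zero)     k≡ (yes p≡2) _  _   (inj₂ 2≤k) = ⊥-elim (ℕₚ.<⇒≢ 2≤k (≡.sym k≡))
  part-i (suc (suc k′)) k≡ (yes p≡2) m≡ _   _          = m≡1-two p-prime k 1≤m Ψ fibotomic k′ k≡ m≡ p≡2
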